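{- Let $p>3$ be a prime and let $\lambda\in\mathbb{F}_p$ with $\lambda\neq 0$ and $\lambda\neq \frac{9}{4}$. Let $E^{\mathrm{DIK}}_{\lambda}: y^2=x^3+3\lambda(x+1)^2$ over $\mathbb{F}_p$ and let $a_p(E^{\mathrm{DIK}}_{\lambda})=p+1-|E^{\mathrm{DIK}}_{\lambda}(\mathbb{F}_p)|$. Then $$\frac{p^2\phi(-3\lambda)}{p-1}\sum_{r=1}^{p-2}\omega^r(6\lambda)\binom{\overline{\omega}^r}{\overline{\omega}^r\phi}\,{}_2G_2(r,1)_p=\frac{\phi(3\lambda)}{p-1}+a_p(E^{\mathrm{DIK}}_{\lambda}),$$ where for $0\le r\le p-2$ and $t\in\mathbb{F}_p$, $${}_2G_2(r,t)_p:={}_2G_2\left[\begin{array}{cc}\frac{r}{p-1} & -\frac12-\frac{r}{p-1}\\ -\frac{r}{2(p-1)} & -\frac{r}{2(p-1)}-\frac12\end{array}\Big|\, t\right]_p .$$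
   Context: Let $p$ be an odd prime. All multiplicative characters of $\mathbb{F}_p^\times$ (including the trivial one) are extended to $\mathbb{F}_p$ by setting $\chi(0)=0$. $\omega:\mathbb{F}_p^\times\to\mathbb{Z}_p^\times$ is the Teichmüller character ($\omega(a)\equiv a \pmod p$), $\overline{\omega}$ its inverse, and $\phi$ the quadratic character of $\mathbb{F}_p$. Fractions such as $\frac94$ denote elements of $\mathbb{F}_p$. For characters $A,B$ of $\mathbb{F}_p$, $J(A,B)=\sum_{x\in\mathbb{F}_p}A(x)B(1-x)$ and $\binom{A}{B}:=\frac{B(-1)}{p}J(A,\overline{B})$. $\Gamma_p$ is Morita's $p$-adic gamma function. For real $x$, $\lfloor x\rfloor$ is the floor and $\langle x\rangle=x-\lfloor x\rfloor$ the fractional part. For $n\ge1$, $a_i,b_i\in\mathbb{Q}\cap\mathbb{Z}_p$ and $t\in\mathbb{F}_p$, $${}_nG_n\left[\begin{array}{c}a_1,\dots,a_n\\ b_1,\dots,b_n\end{array}\Big|\,t\right]_p:=\frac{ -1}{p-1}\sum_{j=0}^{p-2}(-1)^{jn}\overline{\omega}^{j}(t)\prod_{i=1}^{n}(-p)^{ -\lfloor\langle a_i\rangle-\frac{j}{p-1}\rfloor-\lfloor\langle -b_i\rangle+\frac{j}{p-1}\rfloor}\frac{\Gamma_p(\langle a_i-\frac{j}{p-1}\rangle)}{\Gamma_p(\langle a_i\rangle)}\frac{\Gamma_p(\langle -b_i+\frac{j}{p-1}\rangle)}{\Gamma_p(\langle -b_i\rangle)}.$$ $|E^{\mathrm{DIK}}_{\lambda}(\mathbb{F}_p)|$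 is the number of solutions $(x,y)\in\mathbb{F}_p^2$ of the curve equation plus one (the point at infinity). -}

module Defs where

open import Data.Nat as ℕ using (ℕ; zero; suc)
open import Data.Integer as ℤ using (ℤ; +_; -[1+_])
import Data.Integer.Divisibility as ℤD
open import Data.Rational as ℚ using (ℚ; ↥_; ↧ₙ_; floor)
open import Data.List using (List; []; _∷_; map; foldr; filter; upTo; length; concatMap)
open import Data.Bool.ListAction using (any)
open import Data.Bool using (Bool; true; false; if_then_else_)
open import Data.Vec using (Vec; []; _∷_)
open import Data.Nat.Primality using (Prime)
open import Relation.Nullary using (¬_)
open import Relation.Binary.PropositionalEquality using (_≡_)

_mod'_ : ℤ → ℕ → ℕ
z mod' zero = 0
z mod' suc n = z ℤ.%ℕ suc n

-- rational z / n  (convention: 0 when n = 0; only used with n > 0)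
_//_ : ℤ → ℕ → ℚ
z // zero = ℚ.0ℚ
z // suc n = z ℚ./ suc n

⟨_⟩ : ℚ → ℚ
⟨ x ⟩ = x ℚ.- (floor x ℚ./ 1)

sgnPow : ℕ → ℤ
sgnPow n = (ℤ.- (+ 1)) ℤ.^ n

-- p-adic integers and Z_p[1/p], for a fixed modulus p.
--
-- An element x of Z_p is represented by a sequence of integer
-- approximations: x k ≡ x (mod p^k) for every k.  Two such elements are
-- equal in Z_p iff all their approximations agree modulo p^k.

Zp : Set
Zp = ℕ → ℤ

module _ (p : ℕ) where

  _≈Z_ : Zp → Zp → Set
  x ≈Z y = ∀ k → (+ (p ℕ.^ k)) ℤD.∣ (x k ℤ.- y k)

  cZ : ℤ → Zp
  cZ z _ = z

  _+Z_ : Zp → Zp → Zp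
  (x +Z y) k = x k ℤ.+ y k

  _*Z_ : Zp → Zp → Zp
  (x *Z y) k = x k ℤ.* y k

  -Z_ : Zp → Zp
  (-Z x) k = ℤ.- x k

  _^Z_ : Zp → ℕ → Zp
  (x ^Z n) k = x k ℤ.^ n

  -- inverse of a unit u of Z_p:  u^{-1} ≡ u^{p^k (p-1) - 1} (mod p^k)
  invZ : Zp → Zp
  invZ u k = u k ℤ.^ ((p ℕ.^ k) ℕ.* (p ℕ.∸ 1) ℕ.∸ 1)

  sumZ : List Zp → Zp
  sumZ = foldr _+Z_ (cZ (+ 0))

  record Qp : Set where
    constructor _/p^_
    field
      num : Zp
      den : ℕ
  open Qp

  _≈Q_ : Qp → Qp → Set
  x ≈Q y = (num x *Z cZ (+ (p ℕ.^ den y))) ≈Z (num y *Z cZ (+ (p ℕ.^ den x)))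

  ι : Zp → Qp
  ι x = x /p^ 0

  _+Q_ : Qp → Qp → Qp
  (a /p^ e) +Q (b /p^ f) =
    ((a *Z cZ (+ (p ℕ.^ f))) +Z (b *Z cZ (+ (p ℕ.^ e)))) /p^ (e ℕ.+ f)

  _*Q_ : Qp → Qp → Qp
  (a /p^ e) *Q (b /p^ f) = (a *Z b) /p^ (e ℕ.+ f)

  -Q_ : Qp → Qp
  -Q (a /p^ e) = (-Z a) /p^ e

  sumQ : List Qp → Qp
  sumQ = foldr _+Q_ (ι (cZ (+ 0)))

  prodQ : List Qp → Qp
  prodQ = foldr _*Q_ (ι (cZ (+ 1)))

  negpPow : ℤ → Qp
  negpPow (+ n) = cZ (sgnPow n ℤ.* + (p ℕ.^ n)) /p^ 0
  negpPow -[1+ n ] = cZ (sgnPow (suc n)) /p^ (suc n)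

  -- F_p is represented by ℕ (taken modulo p); characters are maps ℕ → Zp
  -- that depend only on the residue mod p and vanish at 0.

  toFp : ℤ → ℕ
  toFp z = z mod' p

  isZeroFp : ℕ → Bool
  isZeroFp x = ((+ x) mod' p) ℕ.≡ᵇ 0

  Char : Set
  Char = ℕ → Zp

  -- Teichmüller character: ω(a) ≡ a^{p^k} (mod p^k); ω(0) = 0
  ω : Char
  ω a k = + (((+ a) mod' p) ℕ.^ (p ℕ.^ k))

  -- χ^m, with the convention χ^m(0) = 0 (also for m = 0)
  charPow : Char → ℕ → Char
  charPow χ m x = if isZeroFp x then cZ (+ 0) else (χ x ^Z m)

  conj : Char → Char
  conj χ x = if isZeroFp x then cZ (+ 0) else invZ (χ x)

  charMul : Char → Char → Char
  charMul χ ψ x = χ x *Z ψ x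

  ω̄ : Char
  ω̄ = conj ω

  isSquareFp : ℕ → Bool
  isSquareFp x = any (λ y → ((+ (y ℕ.* y)) mod' p) ℕ.≡ᵇ ((+ x) mod' p)) (upTo p)

  φ : Char
  φ x = if isZeroFp x then cZ (+ 0)
        else (if isSquareFp x then cZ (+ 1) else cZ (ℤ.- (+ 1)))

  J : Char → Char → Zp
  J A B = sumZ (map (λ x → A x *Z B (toFp (+ 1 ℤ.- + x))) (upTo p))

  binom : Char → Char → Qp
  binom A B = (ι (B (toFp (ℤ.- (+ 1)))) *Q (cZ (+ 1) /p^ 1)) *Q ι (J A (conj B))

  -- Morita's p-adic gamma function.
  -- Γ_p(n) = (-1)^n ∏_{0<j<n, p∤j} j  for n ∈ ℕ, and for x ∈ ℚ ∩ Z_p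
  -- Γ_p(x) ≡ Γ_p(n) (mod p^k) whenever n ≡ x (mod p^k), n ≥ 0.

  ΓpNat : ℕ → ℤ
  ΓpNat n = sgnPow n ℤ.*
    foldr (λ j acc → + j ℤ.* acc) (+ 1)
      (filter (λ j → ¬? (((+ j) mod' p) ℕ.≟ 0)) (filter (λ j → ¬? (j ℕ.≟ 0)) (upTo n)))
    where open import Relation.Nullary.Decidable using (¬?)

  -- representative in [0,p^k) of the rational x (denominator prime to p)
  repQ : ℚ → ℕ → ℕ
  repQ x k = ((↥ x) ℤ.* ((+ (↧ₙ x)) ℤ.^ ((p ℕ.^ k) ℕ.* (p ℕ.∸ 1) ℕ.∸ 1))) mod' (p ℕ.^ k)

  Γp : ℚ → Zp
  Γp x k = ΓpNat (repQ x k)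

  Gterm : ℕ → ℚ → ℚ → Qp
  Gterm j a b =
    negpPow (ℤ.- floor (⟨ a ⟩ ℚ.- jq) ℤ.- floor (⟨ ℚ.- b ⟩ ℚ.+ jq))
      *Q ι (((Γp ⟨ a ℚ.- jq ⟩ *Z invZ (Γp ⟨ a ⟩))
             *Z Γp ⟨ ℚ.- b ℚ.+ jq ⟩) *Z invZ (Γp ⟨ ℚ.- b ⟩))
    where
    jq : ℚ
    jq = (+ j) // (p ℕ.∸ 1)

  termsList : {n : ℕ} → ℕ → Vec ℚ n → Vec ℚ n → List Qp
  termsList j [] [] = []
  termsList j (a ∷ as) (b ∷ bs) = Gterm j a b ∷ termsList j as bs

  nGn : (n : ℕ) → Vec ℚ n → Vec ℚ n → ℕ → Qp
  nGn n as bs t =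
    (-Q ι (invZ (cZ (+ (p ℕ.∸ 1)))))
    *Q sumQ (map (λ j → ι (cZ (sgnPow (j ℕ.* n)) *Z charPow ω̄ j t)
                          *Q prodQ (termsList j as bs))
                 (upTo (p ℕ.∸ 1)))

  G22 : ℕ → ℕ → Qp
  G22 r t = nGn 2
    (rq ∷ (ℚ.- ℚ.½ ℚ.- rq) ∷ [])
    ((ℚ.- r2q) ∷ (ℚ.- r2q ℚ.- ℚ.½) ∷ [])
    t
    where
    rq r2q : ℚ
    rq = (+ r) // (p ℕ.∸ 1)
    r2q = (+ r) // (2 ℕ.* (p ℕ.∸ 1))

  onCurve : ℕ → ℕ → ℕ → Bool
  onCurve l x y =
    ((+ (y ℕ.* y)) mod' p) ℕ.≡ᵇ
      ((+ (x ℕ.* x ℕ.* x ℕ.+ 3 ℕ.* l ℕ.* ((x ℕ.+ 1) ℕ.* (x ℕ.+ 1)))) mod' p)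

  numPoints : ℕ → ℕ
  numPoints l =
    suc (length (filter (λ xy → T? (onCurve l (Data.Product.proj₁ xy) (Data.Product.proj₂ xy)))
                  (concatMap (λ x → map (λ y → (x Data.Product., y)) (upTo p)) (upTo p))))
    where
    import Data.Product
    open import Data.Bool using (T?)

  ap : ℕ → ℤ
  ap l = + (p ℕ.+ 1) ℤ.- + (numPoints l)

  LHS : ℕ → Qp
  LHS l =
    ((ι (cZ (+ (p ℕ.^ 2))) *Q ι (φ (toFp (ℤ.- (+ (3 ℕ.* l))))))
      *Q ι (invZ (cZ (+ (p ℕ.∸ 1)))))
    *Q sumQ (map (λ r → (ι (charPow ω r (toFp (+ (6 ℕ.* l))))
                          *Q binom (charPow ω̄ r) (charMul (charPow ω̄ r) φ))
                         *Q G22 r 1)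
                 (map suc (upTo (p ℕ.∸ 2))))

  RHS : ℕ → Qp
  RHS l = (ι (φ (toFp (+ (3 ℕ.* l)))) *Q ι (invZ (cZ (+ (p ℕ.∸ 1)))))
          +Q ι (cZ (ap l))

{-# OPTIONS --safe #-}
-- Write n = p - 1, and let Y^n = -p. Dwork's exponential F(w) = exp(w(Y + Y^p/p)) is an additive character of 𝔽_p, and the
-- Gross–Koblitz formula, for p > 3, takes the form (1 - p) F(w) = Σ_a γ_a ω^a(w) Y^a with γ_a = Γ_p(a/n). It is obtained from
-- the recursion i c_i = w (c_{i-1} + c_{i-p}) for the coefficients of exp(wX + wX^p/p), by evaluating the Dwork-type sum
-- λ_a(N) = Σ_m N(N-1)…(N-m+1) c_{pm+a} (-p/w)^m at an integer N p-adically close to a/(1-p).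
--
-- Put α = 3λ and f(t) = α(t + 1)² + t³. The sum of φ(y) F(y f(t)) over y and t in 𝔽_p^× is, on summing over y first, a Gauss
-- sum times Σ_t φ(f(t)) = -a_p - φ(α). Factoring F(y f(t)) = F(αy) F(2αyt) F(αyt²) F(yt³) and expanding every factor by
-- Gross–Koblitz, orthogonality of characters leaves a double sum over two exponents C and D of products γ_A γ_B γ_C γ_D. Its
-- part D = 0 is the analogous sum for the quadratic α(t + 1)² and contributes the term φ(α)/(p - 1). The part D ≠ 0 is the
-- left-hand side, with D = n - r and C ≡ r - j mod n: the Jacobi sum in the binomial coefficient is a product of three values
-- of γ by the same method, and the duplication formula for Γ_p combines the arguments with denominator 2(p - 1) into γ_B.
--
-- Everything takes place modulo p^k for a fixed k. The left-hand side at level k is X p^d over p^(d+1), where X is congruent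
-- modulo p^k to p times the right-hand side; hence no precision is lost in the cross-multiplied congruence.
module Submission where

open import Algebra.Bundles using (CommutativeRing)
open import Algebra.Solver.Ring.AlmostCommutativeRing using (fromCommutativeRing; _-Raw-AlmostCommutative⟶_)
open import Data.Bool using (Bool; true; false; if_then_else_)
open import Data.Bool.ListAction using (any)
open import Data.Bool.Properties using (T-≡; T?)
open import Data.Empty using (⊥-elim; ⊥; ⊥-elim-irr)
open import Data.Integer as ℤ using (ℤ; +_; -[1+_])
open import Data.Integer.Tactic.RingSolver using (solve-∀)
open import Data.List as List using (List; []; _∷_)
open import Data.List.Membership.Propositional using (_∈_)
open import Data.List.Membership.Propositional.Properties using (∈-upTo⁺)
open import Data.List.Relation.Unary.All as ListAll using ([]; _∷_)
open import Data.List.Relation.Unary.Any using (here; there)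
open import Data.Maybe using (Maybe; just; nothing)
open import Data.Nat as ℕ using (ℕ; zero; suc; z≤n; s≤s; _<_)
open import Data.Nat.Combinatorics using (nCn≡1; nCk+nC[k+1]≡[n+1]C[k+1]) renaming (_C_ to _choose_)
open import Data.Nat.Combinatorics.Specification using (k>n⇒nCk≡0; nCk≡n!/k![n-k]!; [n∸k]!k!∣n!)
open import Data.Nat.Induction using (<-rec)
open import Data.Nat.Primality using (Prime; euclidsLemma; prime⇒irreducible)
open import Data.Product using (Σ; ∃; _×_; _,_; proj₁; proj₂)
open import Data.Rational as ℚ using (ℚ; floor; mkℚ)
open import Data.Rational.Unnormalised as ℚᵘ using (ℚᵘ; mkℚᵘ; *≡*)
open import Data.Sum using (_⊎_; inj₁; inj₂)
open import Data.Vec as Vec using (Vec; []; _∷_)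
open import Data.Vec.Relation.Unary.All as All using (All; []; _∷_)
open import Function.Bundles using (Equivalence)
open import Level using (Level; 0ℓ)
open import Relation.Binary.Definitions using (tri<; tri≈; tri>)
open import Relation.Binary.PropositionalEquality as ≡ using (_≡_; _≢_)
open import Relation.Nullary using (¬_; Dec; yes; no)
open import Relation.Nullary.Decidable using (¬?; decidable-stable)
import Algebra.Properties.AbelianGroup
import Algebra.Properties.CommutativeSemiring.Exp
import Algebra.Properties.Monoid.Mult.TCOptimised
import Algebra.Properties.Ring
import Algebra.Properties.Semiring.Mult.TCOptimised
import Algebra.Solver.Ring
import Data.Integer.DivMod as ℤDM
import Data.Integer.Divisibility as ℤDiv
import Data.Integer.Properties as ℤP
import Data.List.Properties as ListP
import Data.List.Relation.Unary.All.Properties as AllP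
import Data.Nat
import Data.Nat.DivMod as ℕDM
import Data.Nat.Divisibility as ℕD
import Data.Nat.Primality as ℕPr
import Data.Nat.Properties as ℕP
import Data.Nat.Tactic.RingSolver as ℕSolver
import Data.Rational.Properties as ℚP
import Data.Rational.Unnormalised.Properties as ℚᵘP
import Data.Sum as Sum
import Relation.Binary.Reasoning.Setoid
open import Defs

-- Sums in commutative rings

-- Additivity of F is the formal identity exp(wX + wX^p/p) exp(w'X + w'X^p/p) = exp((w + w')(X +
-- X^p/p)) for integers w and w', so no Teichmüller points enter. What is not formal is that F
-- depends on w modulo p only; this is read off from the Gross-Koblitz formula, whose right-hand
-- side is made of characters of w. The obstacle is convergence. Since Y^p/p = -Y, substituting Y
-- into the exponent first would give exp(0); the series has to be treated coefficient by
-- coefficient, and the c_i are not p-integral. For p ≥ 5 the factorial (pm + a)! with a < p has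
-- valuation at most 5m/4, and the integers i! c_i gain m/2 at i = pm + a because Fermat and Wilson
-- cancel. Hence (-p)^m c_(pm+a) has valuation at least m/4. Modulo p^k the terms beyond m = 4k
-- disappear, so finite sums over ℤ_(p)/p^k with a root Y of Y^n = -p adjoined suffice and no
-- completion is formed. The factor 1 - p stays in the formula: it is the unit -(p-1), and its
-- powers cancel against the factors p - 1 that orthogonality produces.

module RingTheory (R : CommutativeRing 0ℓ 0ℓ) where
  open CommutativeRing R public
  open Algebra.Properties.Ring ring public using (-‿distribˡ-*; -‿distribʳ-*; -0#≈0#; -‿involutive)
  open Algebra.Properties.AbelianGroup +-abelianGroup using (⁻¹-∙-comm)
  open Algebra.Properties.CommutativeSemiring.Exp commutativeSemiring public
    using (_^_; ^-congˡ; ^-homo-*; ^-assocʳ; ^-distrib-*)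
  open Algebra.Properties.Semiring.Mult.TCOptimised semiring using (×1-homo-*) renaming (_×_ to _∙_)
  open Algebra.Properties.Monoid.Mult.TCOptimised +-monoid using (×-homo-+)
  module ≈-Reasoning = Relation.Binary.Reasoning.Setoid setoid
  open ≈-Reasoning

  ≡⇒≈ : ∀ {x y} → x ≡ y → x ≈ y
  ≡⇒≈ ≡.refl = refl

  -- The image of ℤ, from which the ring solver takes its constants; identities with integer
  -- coefficients then normalise in every ring used below.
  ⌜_⌝ : ℤ → Carrier
  ⌜ + n ⌝ = n ∙ 1#
  ⌜ -[1+ n ] ⌝ = - (suc n ∙ 1#)

  cancel-shared : ∀ a x y → (a + x) - (a + y) ≈ x - y
  cancel-shared a x y = begin
    (a + x) - (a + y) ≈⟨ +-cong (+-comm a x) (sym (⁻¹-∙-comm a y)) ⟩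
    (x + a) + (- a + - y) ≈⟨ +-assoc x a _ ⟩
    x + (a + (- a + - y)) ≈⟨ +-congˡ (sym (+-assoc a _ _)) ⟩
    x + ((a + - a) + - y) ≈⟨ +-congˡ (+-congʳ (-‿inverseʳ a)) ⟩
    x + (0# + - y) ≈⟨ +-congˡ (+-identityˡ _) ⟩
    x - y ∎

  ⌜⊖⌝ : ∀ m n → ⌜ m ℤ.⊖ n ⌝ ≈ m ∙ 1# - n ∙ 1#
  ⌜⊖⌝ zero zero = sym (-‿inverseʳ 0#)
  ⌜⊖⌝ zero (suc n) = sym (+-identityˡ _)
  ⌜⊖⌝ (suc m) zero = sym (trans (+-congˡ -0#≈0#) (+-identityʳ _))
  ⌜⊖⌝ (suc m) (suc n) = begin
    ⌜ suc m ℤ.⊖ suc n ⌝ ≡⟨ ≡.cong ⌜_⌝ (ℤP.[1+m]⊖[1+n]≡m⊖n m n) ⟩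
    ⌜ m ℤ.⊖ n ⌝ ≈⟨ ⌜⊖⌝ m n ⟩
    m ∙ 1# - n ∙ 1# ≈⟨ sym (cancel-shared 1# _ _) ⟩
    (1# + m ∙ 1#) - (1# + n ∙ 1#) ≈⟨ sym (+-cong (×-homo-+ 1# 1 m) (-‿cong (×-homo-+ 1# 1 n))) ⟩
    suc m ∙ 1# - suc n ∙ 1# ∎

  ⌜⌝-+ : ∀ x y → ⌜ x ℤ.+ y ⌝ ≈ ⌜ x ⌝ + ⌜ y ⌝
  ⌜⌝-+ (+ m) (+ n) = ×-homo-+ 1# m n
  ⌜⌝-+ (+ m) -[1+ n ] = ⌜⊖⌝ m (suc n)
  ⌜⌝-+ -[1+ m ] (+ n) = trans (⌜⊖⌝ n (suc m)) (+-comm _ _)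
  ⌜⌝-+ -[1+ m ] -[1+ n ] = trans (-‿cong (trans (≡⇒≈ (≡.cong (_∙ 1#) (≡.cong suc (≡.sym (ℕP.+-suc m n)))))
    (×-homo-+ 1# (suc m) (suc n)))) (sym (⁻¹-∙-comm _ _))

  ⌜⌝-neg : ∀ x → ⌜ ℤ.- x ⌝ ≈ - ⌜ x ⌝
  ⌜⌝-neg (+ zero) = sym -0#≈0#
  ⌜⌝-neg (+ suc n) = refl
  ⌜⌝-neg -[1+ n ] = sym (-‿involutive _)

  ⌜⌝-- : ∀ x y → ⌜ x ℤ.- y ⌝ ≈ ⌜ x ⌝ - ⌜ y ⌝
  ⌜⌝-- x y = trans (⌜⌝-+ x (ℤ.- y)) (+-congˡ (⌜⌝-neg y))

  ⌜⌝-*-pos : ∀ m n → ⌜ + m ℤ.* + n ⌝ ≈ ⌜ + m ⌝ * ⌜ + n ⌝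
  ⌜⌝-*-pos m n = trans (≡⇒≈ (≡.cong ⌜_⌝ (≡.sym (ℤP.pos-* m n)))) (×1-homo-* m n)

  ⌜⌝-* : ∀ x y → ⌜ x ℤ.* y ⌝ ≈ ⌜ x ⌝ * ⌜ y ⌝
  ⌜⌝-* (+ m) (+ n) = ⌜⌝-*-pos m n
  ⌜⌝-* (+ m) -[1+ n ] = begin
    ⌜ + m ℤ.* -[1+ n ] ⌝ ≡⟨ ≡.cong ⌜_⌝ (≡.sym (ℤP.neg-distribʳ-* (+ m) (+ suc n))) ⟩
    ⌜ ℤ.- (+ m ℤ.* + suc n) ⌝ ≈⟨ ⌜⌝-neg (+ m ℤ.* + suc n) ⟩
    - ⌜ + m ℤ.* + suc n ⌝ ≈⟨ -‿cong (⌜⌝-*-pos m (suc n)) ⟩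
    - (⌜ + m ⌝ * ⌜ + suc n ⌝) ≈⟨ -‿distribʳ-* _ _ ⟩
    ⌜ + m ⌝ * ⌜ -[1+ n ] ⌝ ∎
  ⌜⌝-* -[1+ m ] (+ n) = begin
    ⌜ -[1+ m ] ℤ.* + n ⌝ ≡⟨ ≡.cong ⌜_⌝ (≡.sym (ℤP.neg-distribˡ-* (+ suc m) (+ n))) ⟩
    ⌜ ℤ.- (+ suc m ℤ.* + n) ⌝ ≈⟨ ⌜⌝-neg (+ suc m ℤ.* + n) ⟩
    - ⌜ + suc m ℤ.* + n ⌝ ≈⟨ -‿cong (⌜⌝-*-pos (suc m) n) ⟩
    - (⌜ + suc m ⌝ * ⌜ + n ⌝) ≈⟨ -‿distribˡ-* _ _ ⟩
    ⌜ -[1+ m ] ⌝ * ⌜ + n ⌝ ∎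
  ⌜⌝-* -[1+ m ] -[1+ n ] = begin
    ⌜ + suc m ℤ.* + suc n ⌝ ≈⟨ ⌜⌝-*-pos (suc m) (suc n) ⟩
    ⌜ + suc m ⌝ * ⌜ + suc n ⌝ ≈⟨ sym (-‿involutive _) ⟩
    - - (⌜ + suc m ⌝ * ⌜ + suc n ⌝) ≈⟨ -‿cong (-‿distribˡ-* _ _) ⟩
    - (⌜ -[1+ m ] ⌝ * ⌜ + suc n ⌝) ≈⟨ -‿distribʳ-* _ _ ⟩
    ⌜ -[1+ m ] ⌝ * ⌜ -[1+ n ] ⌝ ∎

  ⌜⌝-^ : ∀ x n → ⌜ x ℤ.^ n ⌝ ≈ ⌜ x ⌝ ^ n
  ⌜⌝-^ x zero = refl
  ⌜⌝-^ x (suc n) = trans (⌜⌝-* x (x ℤ.^ n)) (*-congˡ (⌜⌝-^ x n))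

  private
    morphism : ℤ.+-*-rawRing -Raw-AlmostCommutative⟶ fromCommutativeRing R
    morphism = record
      { ⟦_⟧ = ⌜_⌝ ; +-homo = ⌜⌝-+ ; *-homo = ⌜⌝-* ; -‿homo = ⌜⌝-neg ; 0-homo = refl ; 1-homo = refl }

    weak≟ : ∀ x y → Maybe (⌜ x ⌝ ≈ ⌜ y ⌝)
    weak≟ x y with x ℤ.≟ y
    ... | yes eq = just (≡⇒≈ (≡.cong ⌜_⌝ eq))
    ... | no _ = nothing

  module Solver = Algebra.Solver.Ring ℤ.+-*-rawRing (fromCommutativeRing R) morphism weak≟
  open Solver using (solve; _:+_; _:*_; _:-_; :-_; _:=_; con)

  x-y≈0⇒x≈y : ∀ {x y} → x - y ≈ 0# → x ≈ y
  x-y≈0⇒x≈y {x} {y} e = begin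
    x ≈⟨ solve 2 (λ x y → x := (x :- y) :+ y) refl x y ⟩
    (x - y) + y ≈⟨ +-congʳ e ⟩
    0# + y ≈⟨ +-identityˡ y ⟩
    y ∎

  x≈y⇒x-y≈0 : ∀ {x y} → x ≈ y → x - y ≈ 0#
  x≈y⇒x-y≈0 {x} {y} e = trans (+-congʳ e) (-‿inverseʳ y)

  unit-cancel : ∀ {u u' x y} → u' * u ≈ 1# → u * x ≈ u * y → x ≈ y
  unit-cancel {u} {u'} {x} {y} inv e = begin
    x ≈⟨ sym (*-identityˡ x) ⟩
    1# * x ≈⟨ *-congʳ (sym inv) ⟩
    (u' * u) * x ≈⟨ *-assoc u' u x ⟩
    u' * (u * x) ≈⟨ *-congˡ e ⟩
    u' * (u * y) ≈⟨ sym (*-assoc u' u y) ⟩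
    (u' * u) * y ≈⟨ *-congʳ inv ⟩
    1# * y ≈⟨ *-identityˡ y ⟩
    y ∎

  ∑ : ℕ → (ℕ → Carrier) → Carrier
  ∑ zero f = 0#
  ∑ (suc n) f = ∑ n f + f n

  ∑-cong : ∀ n {f g : ℕ → Carrier} → (∀ i → i ℕ.< n → f i ≈ g i) → ∑ n f ≈ ∑ n g
  ∑-cong zero h = refl
  ∑-cong (suc n) h = +-cong (∑-cong n (λ i i<n → h i (ℕP.m<n⇒m<1+n i<n))) (h n ℕP.≤-refl)

  ∑-cong′ : ∀ n {f g : ℕ → Carrier} → (∀ i → f i ≈ g i) → ∑ n f ≈ ∑ n g
  ∑-cong′ n h = ∑-cong n (λ i _ → h i)

  ∑-zero : ∀ n {f : ℕ → Carrier} → (∀ i → i ℕ.< n → f i ≈ 0#) → ∑ n f ≈ 0#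
  ∑-zero zero h = refl
  ∑-zero (suc n) h = trans (+-cong (∑-zero n (λ i i<n → h i (ℕP.m<n⇒m<1+n i<n))) (h n ℕP.≤-refl)) (+-identityˡ 0#)

  ∑-+ : ∀ n f g → ∑ n (λ i → f i + g i) ≈ ∑ n f + ∑ n g
  ∑-+ zero f g = sym (+-identityˡ 0#)
  ∑-+ (suc n) f g = trans (+-congʳ (∑-+ n f g))
    (solve 4 (λ a b c d → (a :+ b) :+ (c :+ d) := (a :+ c) :+ (b :+ d)) refl _ _ _ _)

  ∑-neg : ∀ n f → ∑ n (λ i → - f i) ≈ - ∑ n f
  ∑-neg zero f = sym -0#≈0#
  ∑-neg (suc n) f = trans (+-congʳ (∑-neg n f)) (⁻¹-∙-comm _ _)

  ∑-*ˡ : ∀ n a f → ∑ n (λ i → a * f i) ≈ a * ∑ n f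
  ∑-*ˡ zero a f = sym (zeroʳ a)
  ∑-*ˡ (suc n) a f = trans (+-congʳ (∑-*ˡ n a f)) (sym (distribˡ a _ _))

  ∑-*ʳ : ∀ n a f → ∑ n (λ i → f i * a) ≈ ∑ n f * a
  ∑-*ʳ n a f = trans (∑-cong′ n (λ i → *-comm (f i) a)) (trans (∑-*ˡ n a f) (*-comm a _))

  ∑-front : ∀ n f → ∑ (suc n) f ≈ f 0 + ∑ n (λ i → f (suc i))
  ∑-front zero f = +-comm 0# (f 0)
  ∑-front (suc n) f = trans (+-congʳ (∑-front n f)) (+-assoc _ _ _)

  ∑-append : ∀ m n f → ∑ (m ℕ.+ n) f ≈ ∑ m f + ∑ n (λ i → f (m ℕ.+ i))
  ∑-append m zero f = trans (≡⇒≈ (≡.cong (λ z → ∑ z f) (ℕP.+-identityʳ m))) (sym (+-identityʳ _))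
  ∑-append m (suc n) f = trans (≡⇒≈ (≡.cong (λ z → ∑ z f) (ℕP.+-suc m n)))
    (trans (+-congʳ (∑-append m n f)) (+-assoc _ _ _))

  ∑-blocks : ∀ m l f → ∑ (m ℕ.* l) f ≈ ∑ m (λ i → ∑ l (λ j → f (i ℕ.* l ℕ.+ j)))
  ∑-blocks zero l f = refl
  ∑-blocks (suc m) l f = trans (≡⇒≈ (≡.cong (λ z → ∑ z f) (ℕP.+-comm l (m ℕ.* l)))) (trans (∑-append (m ℕ.* l) l f) (+-congʳ (∑-blocks m l f)))

  ∑-extend : ∀ {m n} f → m ℕ.≤ n → (∀ i → m ℕ.≤ i → i ℕ.< n → f i ≈ 0#) → ∑ n f ≈ ∑ m f
  ∑-extend {m} {n} f m≤n h = begin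
    ∑ n f ≡⟨ ≡.cong (λ z → ∑ z f) (≡.sym (ℕP.m+[n∸m]≡n m≤n)) ⟩
    ∑ (m ℕ.+ (n ℕ.∸ m)) f ≈⟨ ∑-append m (n ℕ.∸ m) f ⟩
    ∑ m f + ∑ (n ℕ.∸ m) (λ i → f (m ℕ.+ i)) ≈⟨ +-congˡ (∑-zero (n ℕ.∸ m) (λ i i< → h (m ℕ.+ i) (ℕP.m≤m+n m i)
      (≡.subst (m ℕ.+ i ℕ.<_) (ℕP.m+[n∸m]≡n m≤n) (ℕP.+-monoʳ-< m i<)))) ⟩
    ∑ m f + 0# ≈⟨ +-identityʳ _ ⟩
    ∑ m f ∎

  ∑-swap : ∀ m n (f : ℕ → ℕ → Carrier) → ∑ m (λ i → ∑ n (f i)) ≈ ∑ n (λ j → ∑ m (λ i → f i j))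
  ∑-swap zero n f = sym (∑-zero n (λ _ _ → refl))
  ∑-swap (suc m) n f = trans (+-congʳ (∑-swap m n f)) (sym (∑-+ n _ _))

  ∑-const : ∀ n a → ∑ n (λ _ → a) ≈ ⌜ + n ⌝ * a
  ∑-const zero a = sym (zeroˡ a)
  ∑-const (suc n) a = begin
    ∑ n (λ _ → a) + a ≈⟨ +-congʳ (∑-const n a) ⟩
    ⌜ + n ⌝ * a + a ≈⟨ solve 2 (λ x a → x :* a :+ a := (con (+ 1) :+ x) :* a) refl _ _ ⟩
    (1# + ⌜ + n ⌝) * a ≈⟨ *-congʳ (sym (⌜⌝-+ (+ 1) (+ n))) ⟩
    ⌜ + suc n ⌝ * a ∎

  ∑-telescope : ∀ n (f : ℕ → Carrier) → ∑ n (λ i → f (suc i) - f i) ≈ f n - f 0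
  ∑-telescope zero f = sym (-‿inverseʳ (f 0))
  ∑-telescope (suc n) f = trans (+-congʳ (∑-telescope n f))
    (solve 3 (λ a b c → (a :- b) :+ (c :- a) := c :- b) refl _ _ _)

  δ : ℕ → ℕ → Carrier
  δ i j with i ℕ.≟ j
  ... | yes _ = 1#
  ... | no _ = 0#

  δ-refl : ∀ i → δ i i ≈ 1#
  δ-refl i with i ℕ.≟ i
  ... | yes _ = refl
  ... | no i≢i = ⊥-elim (i≢i ≡.refl)

  δ-≢ : ∀ i j → i ≢ j → δ i j ≈ 0#
  δ-≢ i j i≢j with i ℕ.≟ j
  ... | yes i≡j = ⊥-elim (i≢j i≡j)
  ... | no _ = refl

  ∑-δ : ∀ n i (f : ℕ → Carrier) → i ℕ.< n → ∑ n (λ j → δ i j * f j) ≈ f i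
  ∑-δ (suc n) i f i<1+n = split (i ℕ.≟ n)
    where
    split : Dec (i ≡ n) → ∑ (suc n) (λ j → δ i j * f j) ≈ f i
    split (yes ≡.refl) = trans (+-cong
      (∑-zero n (λ j j<n → trans (*-congʳ (δ-≢ n j (λ { ≡.refl → ℕP.<-irrefl ≡.refl j<n }))) (zeroˡ _)))
      (trans (*-congʳ (δ-refl n)) (*-identityˡ (f n)))) (+-identityˡ (f n))
    split (no i≢n) = trans (+-cong (∑-δ n i f (ℕP.≤∧≢⇒< (ℕP.≤-pred i<1+n) i≢n))
      (trans (*-congʳ (δ-≢ i n i≢n)) (zeroˡ (f n)))) (+-identityʳ _)

  -- Writing f (σ i) as a sum against `δ` reduces the reindexing to an exchange of two sums, because
  -- `δ (σ i) j` and `δ (τ j) i` agree.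
  ∑-perm : ∀ n (σ τ : ℕ → ℕ) (f : ℕ → Carrier) → (∀ i → i ℕ.< n → σ i ℕ.< n) → (∀ i → i ℕ.< n → τ i ℕ.< n) →
    (∀ i → i ℕ.< n → τ (σ i) ≡ i) → (∀ i → i ℕ.< n → σ (τ i) ≡ i) →
    ∑ n (λ i → f (σ i)) ≈ ∑ n f
  ∑-perm n σ τ f σ< τ< τσ στ = begin
    ∑ n (λ i → f (σ i)) ≈⟨ ∑-cong n (λ i i<n → sym (∑-δ n (σ i) f (σ< i i<n))) ⟩
    ∑ n (λ i → ∑ n (λ j → δ (σ i) j * f j)) ≈⟨ ∑-swap n n _ ⟩
    ∑ n (λ j → ∑ n (λ i → δ (σ i) j * f j)) ≈⟨ ∑-cong n (λ j j<n → trans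
      (∑-cong n (λ i i<n → *-congʳ (δ-match i j i<n j<n))) (∑-δ n (τ j) (λ _ → f j) (τ< j j<n))) ⟩
    ∑ n f ∎
    where
    δ-match : ∀ i j → i ℕ.< n → j ℕ.< n → δ (σ i) j ≈ δ (τ j) i
    δ-match i j i<n j<n with σ i ℕ.≟ j | τ j ℕ.≟ i
    ... | yes _ | yes _ = refl
    ... | no _ | no _ = refl
    ... | yes ≡.refl | no ne = ⊥-elim (ne (τσ i i<n))
    ... | no ne | yes ≡.refl = ⊥-elim (ne (στ j j<n))

  -- Both sequences vanish from Q on, so cutting the product series at 2Q loses nothing. The
  -- triangle is summed along its other side.
  ∑-cauchy : ∀ Q (a b : ℕ → Carrier) → (∀ i → Q ℕ.≤ i → a i ≈ 0#) → (∀ i → Q ℕ.≤ i → b i ≈ 0#) →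
    ∑ (Q ℕ.+ Q) (λ s → ∑ (suc s) (λ i → a i * b (s ℕ.∸ i))) ≈ ∑ Q a * ∑ Q b
  ∑-cauchy Q a b a0 b0 = begin
    ∑ (Q ℕ.+ Q) (λ s → ∑ (suc s) (λ i → a i * b (s ℕ.∸ i))) ≈⟨ triangle (Q ℕ.+ Q) ⟩
    ∑ (Q ℕ.+ Q) (λ i → a i * ∑ (Q ℕ.+ Q ℕ.∸ i) b) ≈⟨ ∑-extend _ (ℕP.m≤m+n Q Q) (λ i Q≤i _ → trans (*-congʳ (a0 i Q≤i)) (zeroˡ _)) ⟩
    ∑ Q (λ i → a i * ∑ (Q ℕ.+ Q ℕ.∸ i) b) ≈⟨ ∑-cong Q (λ i i<Q → *-congˡ (∑-extend b (long i i<Q) (λ j Q≤j _ → b0 j Q≤j))) ⟩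
    ∑ Q (λ i → a i * ∑ Q b) ≈⟨ ∑-*ʳ Q (∑ Q b) a ⟩
    ∑ Q a * ∑ Q b ∎
    where
    long : ∀ i → i ℕ.< Q → Q ℕ.≤ Q ℕ.+ Q ℕ.∸ i
    long i i<Q = ℕP.≤-trans (ℕP.m≤m+n Q (Q ℕ.∸ i)) (ℕP.≤-reflexive (≡.sym (ℕP.+-∸-assoc Q (ℕP.<⇒≤ i<Q))))
    triangle : ∀ m → ∑ m (λ s → ∑ (suc s) (λ i → a i * b (s ℕ.∸ i))) ≈ ∑ m (λ i → a i * ∑ (m ℕ.∸ i) b)
    triangle zero = refl
    triangle (suc m) = begin
      ∑ m (λ s → ∑ (suc s) (λ i → a i * b (s ℕ.∸ i))) + ∑ (suc m) (λ i → a i * b (m ℕ.∸ i))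
        ≈⟨ +-cong (trans (triangle m) (sym (trans (+-congˡ (trans (*-congˡ (≡⇒≈ (≡.cong (λ z → ∑ z b) (ℕP.n∸n≡0 m)))) (zeroʳ _))) (+-identityʳ _)))) refl ⟩
      ∑ (suc m) (λ i → a i * ∑ (m ℕ.∸ i) b) + ∑ (suc m) (λ i → a i * b (m ℕ.∸ i))
        ≈⟨ sym (∑-+ (suc m) _ _) ⟩
      ∑ (suc m) (λ i → a i * ∑ (m ℕ.∸ i) b + a i * b (m ℕ.∸ i))
        ≈⟨ ∑-cong (suc m) (λ i i<1+m → trans (sym (distribˡ (a i) _ _))
            (*-congˡ (≡⇒≈ (≡.cong (λ z → ∑ z b) (≡.sym (ℕP.+-∸-assoc 1 (ℕP.≤-pred i<1+m))))))) ⟩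
      ∑ (suc m) (λ i → a i * ∑ (suc m ℕ.∸ i) b) ∎

-- The series with denominators i! need only that positive integers are invertible and that ℤ
-- embeds. The concrete rationals are supplied in `rationals`.
record RationalAlgebra : Set (Level.suc 0ℓ) where
  field
    algebra : CommutativeRing 0ℓ 0ℓ
  open RingTheory algebra public
  field
    recip : ℕ → Carrier
    recip-inverse : ∀ i → recip i * ⌜ + suc i ⌝ ≈ 1#
    ⌜⌝-injective : ∀ x y → ⌜ x ⌝ ≈ ⌜ y ⌝ → x ≡ y

-- Congruences of integers

infix 4 _≅_[mod_]

record _≅_[mod_] (x y : ℤ) (q : ℕ) : Set where
  constructor by-quotient
  field
    quotient : ℤ
    equation : x ≡ y ℤ.+ quotient ℤ.* + q

-- The carrier is ℤ itself and only the equality depends on q. The same integer expression can thus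
-- be compared modulo p, modulo p^k and modulo p^(k+1) without conversion maps.
ℤ/ : ℕ → CommutativeRing 0ℓ 0ℓ
ℤ/ q = record
  { Carrier = ℤ ; _≈_ = λ x y → x ≅ y [mod q ]
  ; _+_ = ℤ._+_ ; _*_ = ℤ._*_ ; -_ = ℤ.-_ ; 0# = + 0 ; 1# = + 1
  ; isCommutativeRing = record
    { isRing = record
      { +-isAbelianGroup = record
        { isGroup = record
          { isMonoid = record
            { isSemigroup = record
              { isMagma = record
                { isEquivalence = record { refl = eq ≡.refl ; sym = sym′ ; trans = trans′ }
                ; ∙-cong = +-cong′ }
              ; assoc = λ x y z → eq (ℤP.+-assoc x y z) }
            ; identity = (λ x → eq (ℤP.+-identityˡ x)) , (λ x → eq (ℤP.+-identityʳ x)) }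
          ; inverse = (λ x → eq (ℤP.+-inverseˡ x)) , (λ x → eq (ℤP.+-inverseʳ x))
          ; ⁻¹-cong = neg-cong }
        ; comm = λ x y → eq (ℤP.+-comm x y) }
      ; *-cong = *-cong′
      ; *-assoc = λ x y z → eq (ℤP.*-assoc x y z)
      ; *-identity = (λ x → eq (ℤP.*-identityˡ x)) , (λ x → eq (ℤP.*-identityʳ x))
      ; distrib = (λ x y z → eq (ℤP.*-distribˡ-+ x y z)) , (λ x y z → eq (ℤP.*-distribʳ-+ x y z)) }
    ; *-comm = λ x y → eq (ℤP.*-comm x y) } }
  where
  eq : ∀ {x y} → x ≡ y → x ≅ y [mod q ]
  eq {x} ≡.refl = by-quotient (+ 0) (lem x (+ q))
    where
    lem : ∀ x q → x ≡ x ℤ.+ + 0 ℤ.* q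
    lem = solve-∀
  sym′ : ∀ {x y} → x ≅ y [mod q ] → y ≅ x [mod q ]
  sym′ {x} {y} (by-quotient a ≡.refl) = by-quotient (ℤ.- a) (lem y a (+ q))
    where
    lem : ∀ y a q → y ≡ (y ℤ.+ a ℤ.* q) ℤ.+ (ℤ.- a) ℤ.* q
    lem = solve-∀
  trans′ : ∀ {x y z} → x ≅ y [mod q ] → y ≅ z [mod q ] → x ≅ z [mod q ]
  trans′ {z = z} (by-quotient a ≡.refl) (by-quotient b ≡.refl) = by-quotient (b ℤ.+ a) (lem z a b (+ q))
    where
    lem : ∀ z a b q → (z ℤ.+ b ℤ.* q) ℤ.+ a ℤ.* q ≡ z ℤ.+ (b ℤ.+ a) ℤ.* q
    lem = solve-∀
  +-cong′ : ∀ {x y u v} → x ≅ y [mod q ] → u ≅ v [mod q ] → x ℤ.+ u ≅ y ℤ.+ v [mod q ]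
  +-cong′ {y = y} {v = v} (by-quotient a ≡.refl) (by-quotient b ≡.refl) = by-quotient (a ℤ.+ b) (lem y v a b (+ q))
    where
    lem : ∀ y v a b q → (y ℤ.+ a ℤ.* q) ℤ.+ (v ℤ.+ b ℤ.* q) ≡ (y ℤ.+ v) ℤ.+ (a ℤ.+ b) ℤ.* q
    lem = solve-∀
  neg-cong : ∀ {x y} → x ≅ y [mod q ] → ℤ.- x ≅ ℤ.- y [mod q ]
  neg-cong {y = y} (by-quotient a ≡.refl) = by-quotient (ℤ.- a) (lem y a (+ q))
    where
    lem : ∀ y a q → ℤ.- (y ℤ.+ a ℤ.* q) ≡ ℤ.- y ℤ.+ (ℤ.- a) ℤ.* q
    lem = solve-∀
  *-cong′ : ∀ {x y u v} → x ≅ y [mod q ] → u ≅ v [mod q ] → x ℤ.* u ≅ y ℤ.* v [mod q ]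
  *-cong′ {y = y} {v = v} (by-quotient a ≡.refl) (by-quotient b ≡.refl) =
    by-quotient (y ℤ.* b ℤ.+ a ℤ.* v ℤ.+ a ℤ.* b ℤ.* + q) (lem y v a b (+ q))
    where
    lem : ∀ y v a b q → (y ℤ.+ a ℤ.* q) ℤ.* (v ℤ.+ b ℤ.* q) ≡ y ℤ.* v ℤ.+ (y ℤ.* b ℤ.+ a ℤ.* v ℤ.+ a ℤ.* b ℤ.* q) ℤ.* q
    lem = solve-∀

pos-^ : ∀ a m → + (a ℕ.^ m) ≡ (+ a) ℤ.^ m
pos-^ a zero = ≡.refl
pos-^ a (suc m) = ≡.trans (ℤP.pos-* a (a ℕ.^ m)) (≡.cong (+ a ℤ.*_) (pos-^ a m))

module Mod (q : ℕ) where
  open RingTheory (ℤ/ q) public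
    using (∑; ∑-cong; ∑-cong′; ∑-zero; ∑-+; ∑-neg; ∑-*ˡ; ∑-*ʳ; ∑-front; ∑-perm; ∑-swap; ∑-const; refl; sym; trans; ≡⇒≈; +-cong; *-cong; -‿cong; x-y≈0⇒x≈y; x≈y⇒x-y≈0; module ≈-Reasoning)
    renaming (_≈_ to _≅_)
  private module R = RingTheory (ℤ/ q)

  *ˡ : ∀ a {x y} → x ≅ y → a ℤ.* x ≅ a ℤ.* y
  *ˡ a e = *-cong (refl {a}) e

  *ʳ : ∀ a {x y} → x ≅ y → x ℤ.* a ≅ y ℤ.* a
  *ʳ a e = *-cong e (refl {a})

  +ˡ : ∀ a {x y} → x ≅ y → a ℤ.+ x ≅ a ℤ.+ y
  +ˡ a e = +-cong (refl {a}) e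

  +ʳ : ∀ a {x y} → x ≅ y → x ℤ.+ a ≅ y ℤ.+ a
  +ʳ a e = +-cong e (refl {a})

  ^-cong : ∀ n {x y} → x ≅ y → x ℤ.^ n ≅ y ℤ.^ n
  ^-cong zero e = refl
  ^-cong (suc n) e = *-cong e (^-cong n e)

  ^-is : ∀ x n → x R.^ n ≡ x ℤ.^ n
  ^-is x zero = ≡.refl
  ^-is x (suc n) = ≡.cong (x ℤ.*_) (^-is x n)

  ⌜⌝-is : ∀ x → R.⌜ x ⌝ ≡ x
  ⌜⌝-is (+ n) = pos n
    where
    pos : ∀ n → R.⌜ + n ⌝ ≡ + n
    pos zero = ≡.refl
    pos (suc zero) = ≡.refl
    pos (suc (suc n)) = ≡.trans (≡.cong (ℤ._+ + 1) (pos (suc n))) (≡.cong (λ z → + suc z) (ℕP.+-comm n 1))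
  ⌜⌝-is -[1+ n ] = ≡.cong ℤ.-_ (⌜⌝-is (+ suc n))

  modulus : + q ≅ + 0
  modulus = by-quotient (+ 1) (≡.sym (≡.trans (ℤP.+-identityˡ _) (ℤP.*-identityˡ (+ q))))

  multiple : ∀ a → a ℤ.* + q ≅ + 0
  multiple a = by-quotient a (≡.sym (ℤP.+-identityˡ _))

  ≅⇒∣ : ∀ {x y} → x ≅ y → + q ℤDiv.∣ (x ℤ.- y)
  ≅⇒∣ {y = y} (by-quotient a ≡.refl) = ≡.subst (λ z → + q ℤDiv.∣ z) (lem y a (+ q))
    (≡.subst (q ℕD.∣_) (≡.sym (ℤP.abs-* a (+ q))) (ℕD.n∣m*n ℤ.∣ a ∣))
    where
    lem : ∀ y a q → a ℤ.* q ≡ (y ℤ.+ a ℤ.* q) ℤ.- y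
    lem = solve-∀

module _ {d e q : ℕ} where
  weaken : ∀ {x y} → d ℕ.* e ≡ q → x ≅ y [mod q ] → x ≅ y [mod e ]
  weaken {y = y} ≡.refl (by-quotient a ≡.refl) = by-quotient (a ℤ.* + d)
    (≡.cong (λ z → y ℤ.+ z) (≡.trans (≡.cong (a ℤ.*_) (ℤP.pos-* d e)) (≡.sym (ℤP.*-assoc a (+ d) (+ e)))))

∣∣-divides : ∀ {q} x → q ℕD.∣ ℤ.∣ x ∣ → x ≅ + 0 [mod q ]
∣∣-divides {q} (+ n) (ℕD.divides k n≡kq) = by-quotient (+ k) (≡.trans (≡.cong +_ n≡kq) (≡.trans (ℤP.pos-* k q) (≡.sym (ℤP.+-identityˡ _))))
∣∣-divides {q} -[1+ n ] (ℕD.divides k n≡kq) = by-quotient (ℤ.- + k) (≡.trans (≡.cong (λ z → ℤ.- (+ z)) n≡kq)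
  (≡.trans (≡.trans (≡.cong ℤ.-_ (ℤP.pos-* k q)) (ℤP.neg-distribˡ-* (+ k) (+ q))) (≡.sym (ℤP.+-identityˡ _))))

divides-∣∣ : ∀ {q} x → x ≅ + 0 [mod q ] → q ℕD.∣ ℤ.∣ x ∣
divides-∣∣ {q} x (by-quotient k e) = ℕD.divides ℤ.∣ k ∣ (≡.trans (≡.cong ℤ.∣_∣ (≡.trans e (ℤP.+-identityˡ (k ℤ.* + q)))) (ℤP.abs-* k (+ q)))

-- Binomial coefficients, Fermat's theorem and congruences modulo powers of p

module RingBinomial (R : CommutativeRing 0ℓ 0ℓ) where
  open RingTheory R
  open ≈-Reasoning
  open Solver using (solve; _:+_; _:*_; _:=_; con)

  binomial : ∀ x m → (1# + x) ^ m ≈ ∑ (suc m) (λ k → ⌜ + (m choose k) ⌝ * x ^ k)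
  binomial x zero = sym (trans (+-identityˡ _) (*-identityˡ 1#))
  binomial x (suc m) = begin
    (1# + x) * (1# + x) ^ m ≈⟨ *-congˡ (binomial x m) ⟩
    (1# + x) * S ≈⟨ solve 2 (λ x s → (con (+ 1) :+ x) :* s := s :+ x :* s) refl x S ⟩
    S + x * S ≈⟨ +-cong lower (sym (∑-*ˡ (suc m) x _)) ⟩
    (1# + ∑ (suc m) (λ k → ⌜ + (m choose suc k) ⌝ * x ^ suc k)) + ∑ (suc m) (λ k → x * (⌜ + (m choose k) ⌝ * x ^ k))
      ≈⟨ trans (+-assoc _ _ _) (+-congˡ (sym (∑-+ (suc m) _ _))) ⟩
    1# + ∑ (suc m) (λ k → ⌜ + (m choose suc k) ⌝ * x ^ suc k + x * (⌜ + (m choose k) ⌝ * x ^ k))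
      ≈⟨ +-cong (sym (*-identityˡ 1#)) (∑-cong′ (suc m) pascal) ⟩
    ⌜ + (suc m choose 0) ⌝ * 1# + ∑ (suc m) (λ k → ⌜ + (suc m choose suc k) ⌝ * x ^ suc k)
      ≈⟨ sym (∑-front (suc m) (λ k → ⌜ + (suc m choose k) ⌝ * x ^ k)) ⟩
    ∑ (suc (suc m)) (λ k → ⌜ + (suc m choose k) ⌝ * x ^ k) ∎
    where
    S : Carrier
    S = ∑ (suc m) (λ k → ⌜ + (m choose k) ⌝ * x ^ k)
    lower : S ≈ 1# + ∑ (suc m) (λ k → ⌜ + (m choose suc k) ⌝ * x ^ suc k)
    lower = begin
      S ≈⟨ sym (trans (+-congˡ (trans (*-congʳ (≡⇒≈ (≡.cong (λ z → ⌜ + z ⌝) (k>n⇒nCk≡0 (ℕP.n<1+n m))))) (zeroˡ _))) (+-identityʳ _)) ⟩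
      ∑ (suc (suc m)) (λ k → ⌜ + (m choose k) ⌝ * x ^ k) ≈⟨ ∑-front (suc m) (λ k → ⌜ + (m choose k) ⌝ * x ^ k) ⟩
      1# * 1# + ∑ (suc m) (λ k → ⌜ + (m choose suc k) ⌝ * x ^ suc k) ≈⟨ +-congʳ (*-identityˡ 1#) ⟩
      1# + ∑ (suc m) (λ k → ⌜ + (m choose suc k) ⌝ * x ^ suc k) ∎
    pascal : ∀ k → ⌜ + (m choose suc k) ⌝ * x ^ suc k + x * (⌜ + (m choose k) ⌝ * x ^ k) ≈ ⌜ + (suc m choose suc k) ⌝ * x ^ suc k
    pascal k = begin
      ⌜ + (m choose suc k) ⌝ * (x * x ^ k) + x * (⌜ + (m choose k) ⌝ * x ^ k)
        ≈⟨ solve 4 (λ a b x y → a :* (x :* y) :+ x :* (b :* y) := (b :+ a) :* (x :* y)) refl _ _ x (x ^ k) ⟩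
      (⌜ + (m choose k) ⌝ + ⌜ + (m choose suc k) ⌝) * (x * x ^ k)
        ≈⟨ *-congʳ (trans (sym (⌜⌝-+ (+ (m choose k)) (+ (m choose suc k)))) (≡⇒≈ (≡.cong (λ z → ⌜ + z ⌝) (nCk+nC[k+1]≡[n+1]C[k+1] m k)))) ⟩
      ⌜ + (suc m choose suc k) ⌝ * (x * x ^ k) ∎

!-coprime : ∀ {p} → Prime p → ∀ m → m ℕ.< p → ¬ p ℕD.∣ m ℕ.!
!-coprime {p} pp zero _ p∣1 = ℕP.<⇒≱ (ℕ.nonTrivial⇒n>1 p ⦃ ℕPr.prime⇒nonTrivial pp ⦄) (ℕD.∣⇒≤ p∣1)
!-coprime pp (suc m) m<p p∣ with euclidsLemma (suc m) (m ℕ.!) pp p∣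
... | inj₁ p∣1+m = ℕP.<⇒≱ m<p (ℕD.∣⇒≤ p∣1+m)
... | inj₂ p∣m! = !-coprime pp m (ℕP.<-trans (ℕP.n<1+n m) m<p) p∣m!

p∣pCk : ∀ {p} → Prime p → ∀ k → 0 ℕ.< k → k ℕ.< p → p ℕD.∣ p choose k
p∣pCk {p} pp k 0<k k<p with euclidsLemma (p choose k) (k ℕ.! ℕ.* (p ℕ.∸ k) ℕ.!) pp (≡.subst (p ℕD.∣_) (≡.sym whole) (p∣p! pp))
  where
  instance
    nz : ℕ.NonZero (k ℕ.! ℕ.* (p ℕ.∸ k) ℕ.!)
    nz = k ℕP.!* (p ℕ.∸ k) !≢0
  whole : (p choose k) ℕ.* (k ℕ.! ℕ.* (p ℕ.∸ k) ℕ.!) ≡ p ℕ.!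
  whole = ≡.trans (≡.cong (ℕ._* (k ℕ.! ℕ.* (p ℕ.∸ k) ℕ.!)) (nCk≡n!/k![n-k]! (ℕP.<⇒≤ k<p)))
    (ℕDM.m/n*n≡m (≡.subst (ℕD._∣ p ℕ.!) (ℕP.*-comm ((p ℕ.∸ k) ℕ.!) (k ℕ.!)) ([n∸k]!k!∣n! (ℕP.<⇒≤ k<p))))
  p∣p! : ∀ {p} → Prime p → p ℕD.∣ p ℕ.!
  p∣p! {suc p} _ = ℕD.m∣m*n (p ℕ.!)
... | inj₁ r = r
... | inj₂ r with euclidsLemma (k ℕ.!) ((p ℕ.∸ k) ℕ.!) pp r
... | inj₁ b = ⊥-elim (!-coprime pp k k<p b)
... | inj₂ b = ⊥-elim (!-coprime pp (p ℕ.∸ k) (ℕP.∸-monoʳ-< 0<k (ℕP.<⇒≤ k<p)) b)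

module PrimeMod (n : ℕ) (pp : Prime (suc n)) where
  p : ℕ
  p = suc n

  p>1 : 1 ℕ.< p
  p>1 = ℕ.nonTrivial⇒n>1 p ⦃ ℕPr.prime⇒nonTrivial pp ⦄

  open Mod p
  open ≈-Reasoning

  infix 4 p∤_
  p∤_ : ℤ → Set
  p∤ x = ¬ x ≅ + 0

  private
    module Z = RingTheory (ℤ/ p)
    module B = RingBinomial (ℤ/ p)

  binomial-vanish : ∀ k → 0 ℕ.< k → k ℕ.< p → + (p choose k) ≅ + 0
  binomial-vanish k 0<k k<p = ∣∣-divides (+ (p choose k)) (p∣pCk pp k 0<k k<p)

  frobenius : ∀ x → (+ 1 ℤ.+ x) ℤ.^ p ≅ + 1 ℤ.+ x ℤ.^ p
  frobenius x = begin
    (+ 1 ℤ.+ x) ℤ.^ p ≡⟨ ≡.sym (^-is (+ 1 ℤ.+ x) p) ⟩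
    (+ 1 ℤ.+ x) Z.^ p ≈⟨ B.binomial x p ⟩
    ∑ p term ℤ.+ term p ≈⟨ +-cong (trans (∑-front n term) (+ˡ (term 0) (∑-zero n middle))) refl ⟩
    (term 0 ℤ.+ + 0) ℤ.+ term p
      ≡⟨ ≡.cong₂ (λ a b → (a ℤ.+ + 0) ℤ.+ b) (≡.cong (ℤ._* + 1) (⌜⌝-is (+ (p choose 0))))
           (≡.cong₂ ℤ._*_ (≡.trans (⌜⌝-is (+ (p choose p))) (≡.cong +_ (nCn≡1 p))) (^-is x p)) ⟩
    + 1 ℤ.+ + 1 ℤ.* x ℤ.^ p ≡⟨ ≡.cong (λ z → + 1 ℤ.+ z) (ℤP.*-identityˡ (x ℤ.^ p)) ⟩
    + 1 ℤ.+ x ℤ.^ p ∎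
    where
    term : ℕ → ℤ
    term k = Z.⌜ + (p choose k) ⌝ ℤ.* x Z.^ k
    middle : ∀ i → i ℕ.< n → term (suc i) ≅ + 0
    middle i i<n = trans (*ʳ (x Z.^ suc i) (trans (≡⇒≈ (⌜⌝-is (+ (p choose suc i)))) (binomial-vanish (suc i) (s≤s z≤n) (s≤s i<n))))
      (≡⇒≈ (ℤP.*-zeroˡ (x Z.^ suc i)))

  fermat′ : ∀ a → (+ a) ℤ.^ p ≅ + a
  fermat′ zero = refl
  fermat′ (suc a) = trans (frobenius (+ a)) (+ˡ (+ 1) (fermat′ a))

  residue : ∀ x → x ≅ + (x ℤDM.%ℕ p)
  residue x = by-quotient (x ℤDM./ℕ p) (ℤDM.a≡a%ℕn+[a/ℕn]*n x p)

  fermat : ∀ x → x ℤ.^ p ≅ x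
  fermat x = trans (^-cong p (residue x)) (trans (fermat′ _) (sym (residue x)))

  euclid : ∀ x y → x ℤ.* y ≅ + 0 → (x ≅ + 0) ⊎ (y ≅ + 0)
  euclid x y e with euclidsLemma ℤ.∣ x ∣ ℤ.∣ y ∣ pp (≡.subst (p ℕD.∣_) (ℤP.abs-* x y) (divides-∣∣ (x ℤ.* y) e))
  ... | inj₁ d = inj₁ (∣∣-divides x d)
  ... | inj₂ d = inj₂ (∣∣-divides y d)

  ≅0? : ∀ x → Dec (x ≅ + 0)
  ≅0? x with p ℕD.∣? ℤ.∣ x ∣
  ... | yes d = yes (∣∣-divides x d)
  ... | no ¬d = no (λ e → ¬d (divides-∣∣ x e))

  ∤-* : ∀ {x y} → p∤ x → p∤ y → p∤ x ℤ.* y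
  ∤-* {x} {y} p∤x p∤y e with euclid x y e
  ... | inj₁ d = p∤x d
  ... | inj₂ d = p∤y d

  ∤-1 : p∤ + 1
  ∤-1 e = ℕP.<⇒≱ p>1 (ℕD.∣⇒≤ (divides-∣∣ (+ 1) e))

  ∤-^ : ∀ {x} k → p∤ x → p∤ x ℤ.^ k
  ∤-^ zero p∤x = ∤-1
  ∤-^ (suc k) p∤x = ∤-* p∤x (∤-^ k p∤x)

  ∤-small : ∀ {a} → 0 ℕ.< a → a ℕ.< p → p∤ + a
  ∤-small {suc a} _ a<p e = ℕP.<⇒≱ a<p (ℕD.∣⇒≤ (divides-∣∣ (+ suc a) e))

  cancel : ∀ a {x y} → p∤ a → a ℤ.* x ≅ a ℤ.* y → x ≅ y
  cancel a {x} {y} p∤a e = Sum.[ (λ d → ⊥-elim (p∤a d)) , x-y≈0⇒x≈y ]′ (euclid a (x ℤ.- y) (trans (≡⇒≈ (lem a x y)) (x≈y⇒x-y≈0 e)))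
    where
    lem : ∀ a x y → a ℤ.* (x ℤ.- y) ≡ a ℤ.* x ℤ.- a ℤ.* y
    lem = solve-∀

  fermat-little : ∀ {a} → p∤ a → a ℤ.^ n ≅ + 1
  fermat-little {a} p∤a = cancel a p∤a (trans (fermat a) (≡⇒≈ (≡.sym (ℤP.*-identityʳ a))))

  geometric : ℤ → ℤ → ℕ → ℤ
  geometric x y zero = + 0
  geometric x y (suc m) = x ℤ.^ m ℤ.+ y ℤ.* geometric x y m

  geometric-factor : ∀ x y m → x ℤ.^ m ℤ.- y ℤ.^ m ≡ (x ℤ.- y) ℤ.* geometric x y m
  geometric-factor x y zero = lem (x ℤ.- y)
    where
    lem : ∀ d → + 1 ℤ.- + 1 ≡ d ℤ.* + 0
    lem = solve-∀
  geometric-factor x y (suc m) = ≡.trans (lem x y (x ℤ.^ m) (y ℤ.^ m))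
    (≡.trans (≡.cong (λ z → (x ℤ.- y) ℤ.* x ℤ.^ m ℤ.+ y ℤ.* z) (geometric-factor x y m)) (lem₂ x y (x ℤ.^ m) (geometric x y m)))
    where
    lem : ∀ x y u v → x ℤ.* u ℤ.- y ℤ.* v ≡ (x ℤ.- y) ℤ.* u ℤ.+ y ℤ.* (u ℤ.- v)
    lem = solve-∀
    lem₂ : ∀ x y u g → (x ℤ.- y) ℤ.* u ℤ.+ y ℤ.* ((x ℤ.- y) ℤ.* g) ≡ (x ℤ.- y) ℤ.* (u ℤ.+ y ℤ.* g)
    lem₂ = solve-∀

  -- Each of the m summands of `geometric` is congruent to y^(m-1). The additional factor y avoids a
  -- truncated exponent at m = 0.
  geometric-≅ : ∀ {x y} → x ≅ y → ∀ m → y ℤ.* geometric x y m ≅ + m ℤ.* y ℤ.^ m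
  geometric-≅ {x} {y} e zero = ≡⇒≈ (ℤP.*-zeroʳ y)
  geometric-≅ {x} {y} e (suc m) = begin
    y ℤ.* (x ℤ.^ m ℤ.+ y ℤ.* geometric x y m) ≈⟨ *ˡ y (+-cong (^-cong m e) (geometric-≅ e m)) ⟩
    y ℤ.* (y ℤ.^ m ℤ.+ + m ℤ.* y ℤ.^ m) ≡⟨ lem y (+ m) (y ℤ.^ m) ⟩
    (+ 1 ℤ.+ + m) ℤ.* (y ℤ.* y ℤ.^ m) ∎
    where
    lem : ∀ y m u → y ℤ.* (u ℤ.+ m ℤ.* u) ≡ (+ 1 ℤ.+ m) ℤ.* (y ℤ.* u)
    lem = solve-∀

  geometric-p : ∀ {x y} → x ≅ y → geometric x y p ≅ + 0
  geometric-p {x} {y} e = begin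
    x ℤ.^ n ℤ.+ y ℤ.* geometric x y n ≈⟨ +-cong (^-cong n e) (geometric-≅ e n) ⟩
    y ℤ.^ n ℤ.+ + n ℤ.* y ℤ.^ n ≡⟨ lem (+ n) (y ℤ.^ n) ⟩
    + p ℤ.* y ℤ.^ n ≈⟨ *ʳ (y ℤ.^ n) modulus ⟩
    + 0 ℤ.* y ℤ.^ n ≡⟨ ℤP.*-zeroˡ (y ℤ.^ n) ⟩
    + 0 ∎
    where
    lem : ∀ m u → u ℤ.+ m ℤ.* u ≡ (+ 1 ℤ.+ m) ℤ.* u
    lem = solve-∀

  -- In x^p - y^p = (x - y) (x^(p-1) + ... + y^(p-1)) the second factor consists of p terms that
  -- agree modulo p. It is therefore divisible by p, which gains one level.
  lift-step : ∀ {x y} j → x ≅ y [mod p ℕ.^ suc j ] → x ℤ.^ p ≅ y ℤ.^ p [mod p ℕ.^ suc (suc j) ]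
  lift-step {x} {y} j e@(by-quotient a x≡) = by-quotient (a ℤ.* _≅_[mod_].quotient g) (≡.trans (lem (x ℤ.^ p) (y ℤ.^ p))
    (≡.cong (λ z → y ℤ.^ p ℤ.+ z) (≡.trans (geometric-factor x y p) (≡.trans (≡.cong₂ ℤ._*_
      (≡.trans (≡.cong (ℤ._- y) x≡) (lem₂ y a (+ (p ℕ.^ suc j)))) (≡.trans (_≅_[mod_].equation g) (ℤP.+-identityˡ _)))
      (≡.trans (lem₃ a (+ (p ℕ.^ suc j)) (_≅_[mod_].quotient g) (+ p)) (≡.cong (λ z → (a ℤ.* _≅_[mod_].quotient g) ℤ.* z) (≡.sym (ℤP.pos-* p (p ℕ.^ suc j)))))))))
    where
    g : geometric x y p ≅ + 0
    g = geometric-p (weaken {p ℕ.^ j} (ℕP.*-comm (p ℕ.^ j) p) e)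
    lem : ∀ u v → u ≡ v ℤ.+ (u ℤ.- v)
    lem = solve-∀
    lem₂ : ∀ y a q → (y ℤ.+ a ℤ.* q) ℤ.- y ≡ a ℤ.* q
    lem₂ = solve-∀
    lem₃ : ∀ a q b p → (a ℤ.* q) ℤ.* (b ℤ.* p) ≡ (a ℤ.* b) ℤ.* (p ℤ.* q)
    lem₃ = solve-∀

  lift : ∀ {x y} k → x ≅ y → x ℤ.^ (p ℕ.^ k) ≅ y ℤ.^ (p ℕ.^ k) [mod p ℕ.^ suc k ]
  lift {x} {y} zero e = ≡.subst₂ (λ a b → a ≅ b [mod p ℕ.^ 1 ]) (≡.sym (ℤP.^-identityʳ x)) (≡.sym (ℤP.^-identityʳ y))
    (≡.subst (λ q → x ≅ y [mod q ]) (≡.sym (ℕP.*-identityʳ p)) e)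
  lift {x} {y} (suc k) e = ≡.subst₂ (λ a b → a ≅ b [mod p ℕ.^ suc (suc k) ]) (power x) (power y) (lift-step k (lift k e))
    where
    power : ∀ x → (x ℤ.^ (p ℕ.^ k)) ℤ.^ p ≡ x ℤ.^ (p ℕ.^ suc k)
    power x = ≡.trans (ℤP.^-*-assoc x (p ℕ.^ k) p) (≡.cong (x ℤ.^_) (ℕP.*-comm (p ℕ.^ k) p))

  euler : ∀ k {a} → p∤ a → a ℤ.^ (n ℕ.* p ℕ.^ k) ≅ + 1 [mod p ℕ.^ suc k ]
  euler k {a} p∤a = ≡.subst₂ (λ u v → u ≅ v [mod p ℕ.^ suc k ]) (ℤP.^-*-assoc a n (p ℕ.^ k)) (ℤP.^-zeroˡ (p ℕ.^ k)) (lift k (fermat-little p∤a))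

-- Polynomials over the prime field: roots, Wilson's theorem, squares

ev : ∀ {d} → Vec ℤ d → ℤ → ℤ
ev [] x = + 0
ev (c ∷ cs) x = c ℤ.+ x ℤ.* ev cs x

ev-scale : ∀ {d} a (cs : Vec ℤ d) x → ev (Vec.map (a ℤ.*_) cs) x ≡ a ℤ.* ev cs x
ev-scale a [] x = ≡.sym (ℤP.*-zeroʳ a)
ev-scale a (c ∷ cs) x = ≡.trans (≡.cong (λ z → a ℤ.* c ℤ.+ x ℤ.* z) (ev-scale a cs x)) (lem a c x (ev cs x))
  where
  lem : ∀ a c x e → a ℤ.* c ℤ.+ x ℤ.* (a ℤ.* e) ≡ a ℤ.* (c ℤ.+ x ℤ.* e)
  lem = solve-∀

ev-add : ∀ {d} (as bs : Vec ℤ d) x → ev (Vec.zipWith ℤ._+_ as bs) x ≡ ev as x ℤ.+ ev bs x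
ev-add [] [] x = ≡.refl
ev-add (a ∷ as) (b ∷ bs) x = ≡.trans (≡.cong (λ z → a ℤ.+ b ℤ.+ x ℤ.* z) (ev-add as bs x)) (lem a b x (ev as x) (ev bs x))
  where
  lem : ∀ a b x e f → a ℤ.+ b ℤ.+ x ℤ.* (e ℤ.+ f) ≡ (a ℤ.+ x ℤ.* e) ℤ.+ (b ℤ.+ x ℤ.* f)
  lem = solve-∀

ev-∷ʳ : ∀ {d} (cs : Vec ℤ d) x → ev (cs Vec.∷ʳ + 1) x ≡ ev cs x ℤ.+ x ℤ.^ d
ev-∷ʳ [] x = ≡.cong (λ z → + 1 ℤ.+ z) (ℤP.*-zeroʳ x)
ev-∷ʳ {suc d} (c ∷ cs) x = ≡.trans (≡.cong (λ z → c ℤ.+ x ℤ.* z) (ev-∷ʳ cs x)) (lem c x (ev cs x) (x ℤ.^ d))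
  where
  lem : ∀ c x e u → c ℤ.+ x ℤ.* (e ℤ.+ u) ≡ (c ℤ.+ x ℤ.* e) ℤ.+ x ℤ.* u
  lem = solve-∀

monomial : ∀ e → Vec ℤ (suc e)
monomial zero = + 1 ∷ []
monomial (suc e) = + 0 ∷ monomial e

ev-monomial : ∀ e x → ev (monomial e) x ≡ x ℤ.^ e
ev-monomial zero x = ≡.cong (λ z → + 1 ℤ.+ z) (ℤP.*-zeroʳ x)
ev-monomial (suc e) x = ≡.trans (ℤP.+-identityˡ _) (≡.cong (x ℤ.*_) (ev-monomial e x))

rootProduct : ℕ → ℤ → ℤ
rootProduct zero x = + 1
rootProduct (suc m) x = rootProduct m x ℤ.* (x ℤ.- + suc m)

-- The coefficients below the leading one are produced as a vector, so that the comparison with x^m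
-- - 1 concerns a polynomial of degree less than m, to which `lagrange` applies.
rootProduct-monic : ∀ m → Σ (Vec ℤ m) λ cs → ∀ x → rootProduct m x ≡ x ℤ.^ m ℤ.+ ev cs x
rootProduct-monic zero = [] , λ x → ≡.refl
rootProduct-monic (suc m) with rootProduct-monic m
... | cs , h = Vec.zipWith ℤ._+_ (+ 0 ∷ cs) (Vec.map (ℤ.- + suc m ℤ.*_) (cs Vec.∷ʳ + 1)) , λ x →
  ≡.trans (≡.cong (ℤ._* (x ℤ.- + suc m)) (h x))
  (≡.trans (lem x (x ℤ.^ m) (ev cs x) (+ suc m))
  (≡.cong (λ z → x ℤ.* x ℤ.^ m ℤ.+ z) (≡.sym (≡.trans (ev-add (+ 0 ∷ cs) (Vec.map (ℤ.- + suc m ℤ.*_) (cs Vec.∷ʳ + 1)) x)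
    (≡.cong (λ z → (+ 0 ℤ.+ x ℤ.* ev cs x) ℤ.+ z) (≡.trans (ev-scale (ℤ.- + suc m) (cs Vec.∷ʳ + 1) x)
      (≡.cong (ℤ.- + suc m ℤ.*_) (ev-∷ʳ cs x))))))))
  where
  lem : ∀ x u e r → (u ℤ.+ e) ℤ.* (x ℤ.- r) ≡ x ℤ.* u ℤ.+ ((+ 0 ℤ.+ x ℤ.* e) ℤ.+ ℤ.- r ℤ.* (e ℤ.+ u))
  lem = solve-∀

rootProduct-root : ∀ m i → i ℕ.< m → rootProduct m (+ suc i) ≡ + 0
rootProduct-root (suc m) i i<1+m with i ℕ.≟ m
... | yes ≡.refl = ≡.trans (≡.cong (rootProduct m (+ suc m) ℤ.*_) (ℤP.+-inverseʳ (+ suc m))) (ℤP.*-zeroʳ (rootProduct m (+ suc m)))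
... | no i≢m = ≡.trans (≡.cong (ℤ._* (+ suc i ℤ.- + suc m)) (rootProduct-root m i (ℕP.≤∧≢⇒< (ℕP.≤-pred i<1+m) i≢m)))
  (ℤP.*-zeroˡ (+ suc i ℤ.- + suc m))

-- Synthetic division by x - r: the coefficients of the quotient are the partial Horner values at r.
quo : ∀ {d} → ℤ → Vec ℤ (suc d) → Vec ℤ d
quo {zero} r (c ∷ cs) = []
quo {suc d} r (c ∷ cs) = ev cs r ∷ quo r cs

quo-rem : ∀ {d} r (cs : Vec ℤ (suc d)) x → ev cs x ≡ (x ℤ.- r) ℤ.* ev (quo r cs) x ℤ.+ ev cs r
quo-rem {zero} r (c ∷ []) x = lem c x r
  where
  lem : ∀ c x r → c ℤ.+ x ℤ.* + 0 ≡ (x ℤ.- r) ℤ.* + 0 ℤ.+ (c ℤ.+ r ℤ.* + 0)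
  lem = solve-∀
quo-rem {suc d} r (c ∷ cs) x = ≡.trans (≡.cong (λ z → c ℤ.+ x ℤ.* z) (quo-rem r cs x)) (lem c x r (ev (quo r cs) x) (ev cs r))
  where
  lem : ∀ c x r q e → c ℤ.+ x ℤ.* ((x ℤ.- r) ℤ.* q ℤ.+ e) ≡ (x ℤ.- r) ℤ.* (e ℤ.+ x ℤ.* q) ℤ.+ (c ℤ.+ r ℤ.* e)
  lem = solve-∀

module Residue (n : ℕ) (pp : Prime (suc n)) where
  open PrimeMod n pp public
  open Mod p
  open ≈-Reasoning

  Vanishes : ∀ {d} → Vec ℤ d → Set
  Vanishes = All (_≅ + 0)

  vanishes-quo : ∀ {d} r (cs : Vec ℤ (suc d)) → ev cs r ≅ + 0 → Vanishes (quo r cs) → Vanishes cs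
  vanishes-quo {zero} r (c ∷ []) e _ = trans (≡⇒≈ (lem c r)) e ∷ []
    where
    lem : ∀ c r → c ≡ c ℤ.+ r ℤ.* + 0
    lem = solve-∀
  vanishes-quo {suc d} r (c ∷ cs) e (e′ ∷ v) = trans (trans (≡⇒≈ (≡.sym (lem c r))) (+ˡ c (*ˡ r (sym e′)))) e ∷ vanishes-quo r cs e′ v
    where
    lem : ∀ c r → c ℤ.+ r ℤ.* + 0 ≡ c
    lem = solve-∀

  -- Division by x - root d leaves a vector shorter by one. It still vanishes at the other roots,
  -- because their differences from root d can be cancelled modulo the prime.
  lagrange : ∀ d (cs : Vec ℤ d) (root : ℕ → ℤ) → (∀ i j → i ℕ.< j → j ℕ.< d → ¬ root i ≅ root j) →
    (∀ i → i ℕ.< d → ev cs (root i) ≅ + 0) → Vanishes cs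
  lagrange zero [] root distinct zeros = []
  lagrange (suc d) cs root distinct zeros = vanishes-quo (root d) cs (zeros d ℕP.≤-refl)
    (lagrange d (quo (root d) cs) root (λ i j i<j j<d → distinct i j i<j (ℕP.m<n⇒m<1+n j<d)) (λ i i<d →
      cancel (root i ℤ.- root d) (λ e → distinct i d i<d ℕP.≤-refl (x-y≈0⇒x≈y e))
        (trans (trans (≡⇒≈ (≡.sym (ℤP.+-identityʳ _)))
          (trans (+ˡ ((root i ℤ.- root d) ℤ.* ev (quo (root d) cs) (root i)) (sym (zeros d ℕP.≤-refl)))
          (trans (≡⇒≈ (≡.sym (quo-rem (root d) cs (root i)))) (zeros i (ℕP.m<n⇒m<1+n i<d)))))
          (≡⇒≈ (≡.sym (ℤP.*-zeroʳ (root i ℤ.- root d)))))))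

  ∤-difference : ∀ {i j} → i ℕ.< j → j ℕ.< p → ¬ + i ≅ + j
  ∤-difference {i} {j} i<j j<p e = ∤-small (ℕP.m<n⇒0<n∸m i<j) (ℕP.≤-<-trans (ℕP.m∸n≤m j i) j<p)
    (trans (≡⇒≈ (≡.trans (≡.sym (ℤP.⊖-≥ (ℕP.<⇒≤ i<j))) (≡.sym (ℤP.m-n≡m⊖n j i)))) (x≈y⇒x-y≈0 (sym e)))

  vanishes-head : ∀ {d} {c : ℤ} {cs : Vec ℤ d} → Vanishes (c ∷ cs) → c ≅ + 0
  vanishes-head (v ∷ _) = v

  -- By Fermat, the difference between the product of the x - i and x^n - 1 vanishes at 1, ..., n.
  -- Its degree is less than n, so all its coefficients vanish modulo p, and the constant one gives
  -- the value at 0.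
  wilson-monic : ∀ m → n ≡ suc m → ∀ c (cs : Vec ℤ m) → (∀ x → rootProduct (suc m) x ≡ x ℤ.^ suc m ℤ.+ ev (c ∷ cs) x) →
    rootProduct (suc m) (+ 0) ≅ ℤ.- + 1
  wilson-monic m n≡ c cs h = begin
    rootProduct (suc m) (+ 0) ≡⟨ h (+ 0) ⟩
    + 0 ℤ.* (+ 0) ℤ.^ m ℤ.+ (c ℤ.+ + 0 ℤ.* ev cs (+ 0)) ≡⟨ lem ((+ 0) ℤ.^ m) c (ev cs (+ 0)) ⟩
    (c ℤ.+ + 1) ℤ.+ ℤ.- + 1 ≈⟨ +ʳ (ℤ.- + 1) (vanishes-head (lagrange (suc m) (c ℤ.+ + 1 ∷ cs) (λ i → + suc i)
      (λ i j i<j j<m → ∤-difference (s≤s i<j) (s≤s (≡.subst (j ℕ.<_) (≡.sym n≡) j<m))) zeros)) ⟩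
    ℤ.- + 1 ∎
    where
    lem : ∀ u c e → + 0 ℤ.* u ℤ.+ (c ℤ.+ + 0 ℤ.* e) ≡ (c ℤ.+ + 1) ℤ.+ ℤ.- + 1
    lem = solve-∀
    lem₂ : ∀ c x e → (c ℤ.+ + 1) ℤ.+ x ℤ.* e ≡ + 1 ℤ.+ (c ℤ.+ x ℤ.* e)
    lem₂ = solve-∀
    zeros : ∀ i → i ℕ.< suc m → ev (c ℤ.+ + 1 ∷ cs) (+ suc i) ≅ + 0
    zeros i i<n = begin
      (c ℤ.+ + 1) ℤ.+ + suc i ℤ.* ev cs (+ suc i)
        ≡⟨ lem₂ c (+ suc i) (ev cs (+ suc i)) ⟩
      + 1 ℤ.+ ev (c ∷ cs) (+ suc i)
        ≈⟨ +ʳ (ev (c ∷ cs) (+ suc i)) (sym (fermat-little (∤-small (s≤s z≤n) (s≤s (≡.subst (i ℕ.<_) (≡.sym n≡) i<n))))) ⟩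
      (+ suc i) ℤ.^ n ℤ.+ ev (c ∷ cs) (+ suc i)
        ≡⟨ ≡.cong (λ z → (+ suc i) ℤ.^ z ℤ.+ ev (c ∷ cs) (+ suc i)) n≡ ⟩
      (+ suc i) ℤ.^ suc m ℤ.+ ev (c ∷ cs) (+ suc i)
        ≡⟨ ≡.sym (h (+ suc i)) ⟩
      rootProduct (suc m) (+ suc i)
        ≡⟨ rootProduct-root (suc m) i i<n ⟩
      + 0 ∎

  n≢0 : n ≢ 0
  n≢0 e = ℕP.<-irrefl (≡.cong suc (≡.sym e)) p>1

  wilson : rootProduct n (+ 0) ≅ ℤ.- + 1
  wilson = go n ≡.refl (rootProduct-monic n)
    where
    go : ∀ m → n ≡ m → (Σ (Vec ℤ m) λ cs → ∀ x → rootProduct m x ≡ x ℤ.^ m ℤ.+ ev cs x) → rootProduct m (+ 0) ≅ ℤ.- + 1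
    go zero e _ = ⊥-elim (n≢0 e)
    go (suc m) e (c ∷ cs , h) = wilson-monic m e c cs h

  monomial-nonzero : ∀ e → ¬ Vanishes (monomial e)
  monomial-nonzero zero (v ∷ _) = ∤-1 v
  monomial-nonzero (suc e) (_ ∷ v) = monomial-nonzero e v

  vanishes-tail : ∀ {d} {c : ℤ} {cs : Vec ℤ d} → Vanishes (c ∷ cs) → Vanishes cs
  vanishes-tail (_ ∷ v) = v

  too-many-roots : ∀ e (root : ℕ → ℤ) → (∀ i j → i ℕ.< j → j ℕ.< suc (suc e) → ¬ root i ≅ root j) →
    (∀ i → i ℕ.< suc (suc e) → root i ℤ.^ suc e ≅ + 1) → ⊥
  too-many-roots e root distinct zeros = monomial-nonzero e (vanishes-tail (lagrange (suc (suc e)) (ℤ.- + 1 ∷ monomial e) root distinct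
    (λ i i< → trans (≡⇒≈ (≡.cong (λ z → ℤ.- + 1 ℤ.+ root i ℤ.* z) (ev-monomial e (root i)))) (+ˡ (ℤ.- + 1) (zeros i i<)))))

  search : ∀ m {P : ℕ → Set} → (∀ i → Dec (P i)) → (∃ λ i → i ℕ.< m × ¬ P i) ⊎ (∀ i → i ℕ.< m → P i)
  search zero P? = inj₂ (λ i ())
  search (suc m) P? with search m P?
  ... | inj₁ (i , i<m , ¬Pi) = inj₁ (i , ℕP.m<n⇒m<1+n i<m , ¬Pi)
  ... | inj₂ all with P? m
  ... | no ¬Pm = inj₁ (m , ℕP.≤-refl , ¬Pm)
  ... | yes Pm = inj₂ λ i i<1+m → case-< i (ℕP.m≤n⇒m<n∨m≡n (ℕP.≤-pred i<1+m))
    where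
    case-< : ∀ i → i ℕ.< m ⊎ i ≡ m → _
    case-< i (inj₁ i<m) = all i i<m
    case-< i (inj₂ ≡.refl) = Pm

  ≅? : ∀ x y → Dec (x ≅ y)
  ≅? x y with ≅0? (x ℤ.- y)
  ... | yes e = yes (x-y≈0⇒x≈y e)
  ... | no ¬e = no (λ e → ¬e (x≈y⇒x-y≈0 e))

  -- This replaces a primitive root: for orthogonality it is enough that each exponent e below n has
  -- some unit g, depending on e, with g^e different from 1.
  nontrivial-power : ∀ e → 0 ℕ.< e → e ℕ.< n → ∃ λ g → p∤ + g × ¬ (+ g) ℤ.^ e ≅ + 1
  nontrivial-power (suc e) _ e<n = conclude (search n (λ i → ≅? ((+ suc i) ℤ.^ suc e) (+ 1)))
    where
    conclude : (∃ λ i → i ℕ.< n × ¬ (+ suc i) ℤ.^ suc e ≅ + 1) ⊎ (∀ i → i ℕ.< n → (+ suc i) ℤ.^ suc e ≅ + 1) →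
      ∃ λ g → p∤ + g × ¬ (+ g) ℤ.^ suc e ≅ + 1
    conclude (inj₁ (i , i<n , ¬P)) = suc i , ∤-small (s≤s z≤n) (s≤s i<n) , ¬P
    conclude (inj₂ all) = ⊥-elim (too-many-roots e (λ i → + suc i) (λ i j i<j j< → ∤-difference (s≤s i<j) (s≤s (ℕP.<-≤-trans j< e<n)))
      (λ i i< → all i (ℕP.<-≤-trans i< e<n)))

  ^-distrib : ∀ (x y : ℤ) m → (x ℤ.* y) ℤ.^ m ≡ x ℤ.^ m ℤ.* y ℤ.^ m
  ^-distrib x y zero = ≡.refl
  ^-distrib x y (suc m) = ≡.trans (≡.cong ((x ℤ.* y) ℤ.*_) (^-distrib x y m)) (lem x y (x ℤ.^ m) (y ℤ.^ m))
    where
    lem : ∀ x y u v → (x ℤ.* y) ℤ.* (u ℤ.* v) ≡ (x ℤ.* u) ℤ.* (y ℤ.* v)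
    lem = solve-∀

  module Quadratic (h : ℕ) (n≡2h : n ≡ h ℕ.+ h) where
    square⇒ : ∀ {x} y → p∤ x → y ℤ.* y ≅ x → x ℤ.^ h ≅ + 1
    square⇒ {x} y p∤x e = begin
      x ℤ.^ h ≈⟨ ^-cong h (sym e) ⟩
      (y ℤ.* y) ℤ.^ h ≡⟨ ^-distrib y y h ⟩
      y ℤ.^ h ℤ.* y ℤ.^ h ≡⟨ ≡.sym (ℤP.^-distribˡ-+-* y h h) ⟩
      y ℤ.^ (h ℕ.+ h) ≡⟨ ≡.cong (y ℤ.^_) (≡.sym n≡2h) ⟩
      y ℤ.^ n ≈⟨ fermat-little (λ y0 → p∤x (trans (sym e) (trans (*ʳ y y0) (≡⇒≈ (ℤP.*-zeroˡ y))))) ⟩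
      + 1 ∎

    half-power : ∀ {x} → p∤ x → (x ℤ.^ h ≅ + 1) ⊎ (x ℤ.^ h ≅ ℤ.- + 1)
    half-power {x} p∤x = Sum.map x-y≈0⇒x≈y x-y≈0⇒x≈y (euclid (x ℤ.^ h ℤ.- + 1) (x ℤ.^ h ℤ.- ℤ.- + 1) (begin
        (x ℤ.^ h ℤ.- + 1) ℤ.* (x ℤ.^ h ℤ.- ℤ.- + 1) ≡⟨ lem (x ℤ.^ h) ⟩
        x ℤ.^ h ℤ.* x ℤ.^ h ℤ.- + 1 ≡⟨ ≡.cong (ℤ._- + 1) (≡.trans (≡.sym (ℤP.^-distribˡ-+-* x h h)) (≡.cong (x ℤ.^_) (≡.sym n≡2h))) ⟩
        x ℤ.^ n ℤ.- + 1 ≈⟨ x≈y⇒x-y≈0 (fermat-little p∤x) ⟩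
        + 0 ∎))
      where
      lem : ∀ u → (u ℤ.- + 1) ℤ.* (u ℤ.- ℤ.- + 1) ≡ u ℤ.* u ℤ.- + 1
      lem = solve-∀

    h≤n : h ℕ.≤ n
    h≤n = ≡.subst (h ℕ.≤_) (≡.sym n≡2h) (ℕP.m≤m+n h h)

    distinct-squares : ∀ i j → i ℕ.< j → j ℕ.< h → ¬ + suc i ℤ.* + suc i ≅ + suc j ℤ.* + suc j
    distinct-squares i j i<j j<h e = conclude (euclid (+ suc j ℤ.- + suc i) (+ suc j ℤ.+ + suc i)
      (trans (≡⇒≈ (lem (+ suc j) (+ suc i))) (x≈y⇒x-y≈0 (sym e))))
      where
      lem : ∀ a b → (a ℤ.- b) ℤ.* (a ℤ.+ b) ≡ a ℤ.* a ℤ.- b ℤ.* b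
      lem = solve-∀
      conclude : (+ suc j ℤ.- + suc i ≅ + 0) ⊎ (+ suc j ℤ.+ + suc i ≅ + 0) → ⊥
      conclude (inj₁ d) = ∤-difference (s≤s i<j) (s≤s (ℕP.≤-trans j<h h≤n)) (sym (x-y≈0⇒x≈y d))
      conclude (inj₂ d) = ∤-small {suc j ℕ.+ suc i} (s≤s z≤n)
        (s≤s (ℕP.≤-trans (ℕP.+-mono-≤ j<h (ℕP.<-trans i<j j<h)) (ℕP.≤-reflexive (≡.sym n≡2h)))) d

    if< : ∀ {m} (i : ℕ) → Dec (i ℕ.< m) → ℤ → ℤ → ℤ
    if< i (yes _) a b = a
    if< i (no _) a b = b

    -- The squares of 1, ..., h are h distinct roots of X^h - 1. If x were none of them, `root`,
    -- which lists these squares and then x, would give h + 1 roots.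
    ⇒square : ∀ {x} → p∤ x → x ℤ.^ h ≅ + 1 → ∃ λ y → y ℕ.< p × (+ y ℤ.* + y ≅ x)
    ⇒square {x} p∤x e = conclude (search h (λ i → ¬? (≅? (+ suc i ℤ.* + suc i) x)))
      where
      root : ℕ → ℤ
      root i = if< i (i ℕ.<? h) (+ suc i ℤ.* + suc i) x
      conclude : (∃ λ i → i ℕ.< h × ¬ ¬ + suc i ℤ.* + suc i ≅ x) ⊎ (∀ i → i ℕ.< h → ¬ + suc i ℤ.* + suc i ≅ x) →
        ∃ λ y → y ℕ.< p × (+ y ℤ.* + y ≅ x)
      conclude (inj₁ (i , i<h , ¬¬P)) = suc i , s≤s (ℕP.≤-trans i<h h≤n) , decidable-stable (≅? (+ suc i ℤ.* + suc i) x) ¬¬P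
      conclude (inj₂ none) = ⊥-elim (go h ≡.refl)
        where
        distinct : ∀ i j → i ℕ.< j → j ℕ.< suc h → (di : Dec (i ℕ.< h)) (dj : Dec (j ℕ.< h)) →
          ¬ if< i di (+ suc i ℤ.* + suc i) x ≅ if< j dj (+ suc j ℤ.* + suc j) x
        distinct i j i<j j< (no i≮h) _ _ = i≮h (ℕP.<-≤-trans i<j (ℕP.≤-pred j<))
        distinct i j i<j j< (yes i<h) (no _) e′ = none i i<h e′
        distinct i j i<j j< (yes i<h) (yes j<h) e′ = distinct-squares i j i<j j<h e′
        zeros : ∀ i → (di : Dec (i ℕ.< h)) → if< i di (+ suc i ℤ.* + suc i) x ℤ.^ h ≅ + 1
        zeros i (no _) = e
        zeros i (yes i<h) = square⇒ (+ suc i) (∤-* p∤i p∤i) refl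
          where
          p∤i : p∤ + suc i
          p∤i = ∤-small (s≤s z≤n) (s≤s (ℕP.≤-trans i<h h≤n))
        go : ∀ m → h ≡ m → ⊥
        go zero h≡0 = n≢0 (≡.trans n≡2h (≡.cong (λ z → z ℕ.+ z) h≡0))
        go (suc m) h≡ = too-many-roots m root
          (λ i j i<j j< → distinct i j i<j (≡.subst (λ z → j ℕ.< suc z) (≡.sym h≡) j<) (i ℕ.<? h) (j ℕ.<? h))
          (λ i _ → ≡.subst (λ z → root i ℤ.^ z ≅ + 1) h≡ (zeros i (i ℕ.<? h)))

-- Teichmüller characters

module Teichmüller (n : ℕ) (pp : Prime (suc n)) (k : ℕ) where
  open Residue n pp
  private module P = Mod p

  M : ℕ
  M = p ℕ.^ k

  open Mod M
  open ≈-Reasoning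

  M>0 : 0 ℕ.< M
  M>0 = ℕP.m^n>0 p k

  ≅-level : ∀ {x y} → x ≅ y [mod p ℕ.^ suc k ] → x ≅ y
  ≅-level = weaken {d = p} ≡.refl

  ω-cong : ∀ {x y} → x P.≅ y → x ℤ.^ M ≅ y ℤ.^ M
  ω-cong e = ≅-level (lift k e)

  ω-order : ∀ {x} → p∤ x → x ℤ.^ (n ℕ.* M) ≅ + 1
  ω-order p∤x = ≅-level (euler k p∤x)

  M*n>0 : 0 ℕ.< M ℕ.* n
  M*n>0 = ℕP.*-mono-≤ M>0 (ℕP.n≢0⇒n>0 n≢0)

  -- The exponent is the one in `invZ`, so the two inverses at level k agree by computation.
  inverse : ℤ → ℤ
  inverse x = x ℤ.^ (M ℕ.* n ℕ.∸ 1)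

  inverseʳ : ∀ {x} → p∤ x → x ℤ.* inverse x ≅ + 1
  inverseʳ {x} p∤x = trans (≡⇒≈ (≡.cong (x ℤ.^_) (≡.trans (ℕP.+-comm 1 _) (ℕP.m∸n+n≡m M*n>0))))
    (trans (≡⇒≈ (≡.cong (x ℤ.^_) (ℕP.*-comm M n))) (ω-order p∤x))

  cancelᴹ : ∀ a {x y} → p∤ a → a ℤ.* x ≅ a ℤ.* y → x ≅ y
  cancelᴹ a {x} {y} p∤a e = begin
    x ≡⟨ ≡.sym (ℤP.*-identityˡ x) ⟩
    + 1 ℤ.* x ≈⟨ *ʳ x (sym (inverseʳ p∤a)) ⟩
    (a ℤ.* inverse a) ℤ.* x ≡⟨ lem a (inverse a) x ⟩
    inverse a ℤ.* (a ℤ.* x) ≈⟨ *ˡ (inverse a) e ⟩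
    inverse a ℤ.* (a ℤ.* y) ≡⟨ ≡.sym (lem a (inverse a) y) ⟩
    (a ℤ.* inverse a) ℤ.* y ≈⟨ *ʳ y (inverseʳ p∤a) ⟩
    + 1 ℤ.* y ≡⟨ ℤP.*-identityˡ y ⟩
    y ∎
    where
    lem : ∀ a b x → (a ℤ.* b) ℤ.* x ≡ b ℤ.* (a ℤ.* x)
    lem = solve-∀

  ω-≅ : ∀ x → x ℤ.^ M P.≅ x
  ω-≅ x = go k
    where
    go : ∀ j → x ℤ.^ (p ℕ.^ j) P.≅ x
    go zero = P.≡⇒≈ (ℤP.^-identityʳ x)
    go (suc j) = P.trans (P.≡⇒≈ (≡.sym (ℤP.^-*-assoc x p (p ℕ.^ j)))) (P.trans (P.^-cong (p ℕ.^ j) (fermat x)) (go j))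

  p∣⇒ω≅0 : ∀ {x} → x P.≅ + 0 → x ℤ.^ M ≅ + 0
  p∣⇒ω≅0 {x} e = trans (ω-cong e) (≡⇒≈ (zero^ M>0))
    where
    zero^ : ∀ {m} → 0 ℕ.< m → (+ 0) ℤ.^ m ≡ + 0
    zero^ {suc m} (s≤s _) = ℤP.*-zeroˡ ((+ 0) ℤ.^ m)

  ω-power-one : ∀ {x} e → n ℕD.∣ e → p∤ x → x ℤ.^ (M ℕ.* e) ≅ + 1
  ω-power-one {x} e (ℕD.divides d e≡dn) p∤x = begin
    x ℤ.^ (M ℕ.* e) ≡⟨ ≡.cong (x ℤ.^_) (≡.trans (≡.cong (M ℕ.*_) (≡.trans e≡dn (ℕP.*-comm d n))) (≡.trans (≡.sym (ℕP.*-assoc M n d)) (≡.cong (ℕ._* d) (ℕP.*-comm M n)))) ⟩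
    x ℤ.^ (n ℕ.* M ℕ.* d) ≡⟨ ≡.sym (ℤP.^-*-assoc x (n ℕ.* M) d) ⟩
    (x ℤ.^ (n ℕ.* M)) ℤ.^ d ≈⟨ ^-cong d (ω-order p∤x) ⟩
    (+ 1) ℤ.^ d ≡⟨ ℤP.^-zeroˡ d ⟩
    + 1 ∎

  ω-power-cong : ∀ {x y} e → x P.≅ y → x ℤ.^ (M ℕ.* e) ≅ y ℤ.^ (M ℕ.* e)
  ω-power-cong {x} {y} e x≅y = trans (≡⇒≈ (≡.sym (ℤP.^-*-assoc x M e))) (trans (^-cong e (ω-cong x≅y)) (≡⇒≈ (ℤP.^-*-assoc y M e)))

  characterSum : ℕ → ℤ
  characterSum e = ∑ n (λ w → (+ suc w) ℤ.^ (M ℕ.* e))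

  characterSum-trivial : ∀ e → n ℕD.∣ e → characterSum e ≅ + n
  characterSum-trivial e n∣e = trans (∑-cong n (λ w w<n → ω-power-one e n∣e (∤-small (s≤s z≤n) (s≤s w<n))))
    (trans (∑-const n (+ 1)) (≡⇒≈ (≡.trans (ℤP.*-identityʳ _) (⌜⌝-is (+ n)))))

  -- Multiplication by g permutes the residues, whence (γ - 1) S ≡ 0 for γ = g^(Me). Modulo p this γ
  -- is g^(e mod n), which is not 1 for the chosen g, so γ - 1 can be cancelled modulo p^k.
  characterSum-nontrivial : ∀ e → ¬ n ℕD.∣ e → characterSum e ≅ + 0
  characterSum-nontrivial zero n∤0 = ⊥-elim (n∤0 (n ℕD.∣0))
  characterSum-nontrivial (suc e′) n∤e = from-generator (nontrivial-power (e ℕDM.% n) r>0 (ℕDM.m%n<n e n))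
    where
    instance
      n-nonZero : ℕ.NonZero n
      n-nonZero = ℕ.≢-nonZero n≢0
    e : ℕ
    e = suc e′
    r>0 : 0 ℕ.< e ℕDM.% n
    r>0 = ℕP.n≢0⇒n>0 (λ r≡0 → n∤e (ℕD.m%n≡0⇒n∣m e n r≡0))
    f : ℕ → ℤ
    f w = (+ w) ℤ.^ (M ℕ.* e)
    -- The residue 0 is included so that multiplication by g acts on all of 0, ..., p - 1; its term
    -- vanishes because e is positive.
    full : ∑ p f ≅ characterSum e
    full = trans (∑-front n f) (trans (+ʳ (characterSum e) (trans (≡⇒≈ (≡.sym (ℤP.^-*-assoc (+ 0) M e)))
      (trans (^-cong e (p∣⇒ω≅0 P.refl)) (≡⇒≈ (ℤP.*-zeroˡ ((+ 0) ℤ.^ e′)))))) (≡⇒≈ (ℤP.+-identityˡ (characterSum e))))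
    from-generator : (∃ λ g → p∤ + g × ¬ (+ g) ℤ.^ (e ℕDM.% n) P.≅ + 1) → characterSum e ≅ + 0
    from-generator (g , p∤g , gʳ≢1) = cancelᴹ (γ ℤ.- + 1) γ-1-unit (begin
        (γ ℤ.- + 1) ℤ.* characterSum e ≡⟨ lem γ (characterSum e) ⟩
        γ ℤ.* characterSum e ℤ.- characterSum e ≈⟨ x≈y⇒x-y≈0 scaled ⟩
        + 0 ≡⟨ ≡.sym (ℤP.*-zeroʳ (γ ℤ.- + 1)) ⟩
        (γ ℤ.- + 1) ℤ.* + 0 ∎)
      where
      lem : ∀ a s → (a ℤ.- + 1) ℤ.* s ≡ a ℤ.* s ℤ.- s
      lem = solve-∀
      γ : ℤ
      γ = (+ g) ℤ.^ (M ℕ.* e)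
      g^e : γ P.≅ (+ g) ℤ.^ (e ℕDM.% n)
      g^e = P.trans (P.≡⇒≈ (≡.sym (ℤP.^-*-assoc (+ g) M e))) (P.trans (P.^-cong e (ω-≅ (+ g)))
        (P.trans (P.≡⇒≈ (≡.trans (≡.cong ((+ g) ℤ.^_) (ℕDM.m≡m%n+[m/n]*n e n)) (ℤP.^-distribˡ-+-* (+ g) (e ℕDM.% n) (e ℕDM./ n ℕ.* n))))
        (P.trans (P.*ˡ ((+ g) ℤ.^ (e ℕDM.% n)) (P.trans (P.≡⇒≈ (≡.trans (≡.cong ((+ g) ℤ.^_) (ℕP.*-comm (e ℕDM./ n) n)) (≡.sym (ℤP.^-*-assoc (+ g) n (e ℕDM./ n)))))
          (P.trans (P.^-cong (e ℕDM./ n) (fermat-little p∤g)) (P.≡⇒≈ (ℤP.^-zeroˡ (e ℕDM./ n))))))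
        (P.≡⇒≈ (ℤP.*-identityʳ ((+ g) ℤ.^ (e ℕDM.% n)))))))
      γ-1-unit : p∤ (γ ℤ.- + 1)
      γ-1-unit d = gʳ≢1 (P.trans (P.sym g^e) (P.x-y≈0⇒x≈y d))
      mul-mod : ℕ → ℕ → ℕ
      mul-mod a w = (a ℕ.* w) ℕDM.% p
      mul-mod-≅ : ∀ a w → + mul-mod a w P.≅ + a ℤ.* + w
      mul-mod-≅ a w = P.sym (P.trans (P.≡⇒≈ (≡.sym (ℤP.pos-* a w))) (residue (+ (a ℕ.* w))))
      small-≅ : ∀ {i j} → i ℕ.< p → j ℕ.< p → + i P.≅ + j → i ≡ j
      small-≅ {i} {j} i<p j<p i≅j with ℕP.<-cmp i j
      ... | tri< i<j _ _ = ⊥-elim (∤-difference i<j j<p i≅j)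
      ... | tri≈ _ i≡j _ = i≡j
      ... | tri> _ _ j<i = ⊥-elim (∤-difference j<i i<p (P.sym i≅j))
      g′ : ℕ
      g′ = g ℕ.^ (n ℕ.∸ 1)
      gg′ : + g ℤ.* + g′ P.≅ + 1
      gg′ = P.trans (P.≡⇒≈ (≡.trans (≡.cong (+ g ℤ.*_) (pos-^ g (n ℕ.∸ 1))) (≡.cong ((+ g) ℤ.^_) (≡.trans (ℕP.+-comm 1 _) (ℕP.m∸n+n≡m (ℕP.n≢0⇒n>0 n≢0)))))) (fermat-little p∤g)
      undo : ∀ a b → + a ℤ.* + b P.≅ + 1 → ∀ i → i ℕ.< p → mul-mod a (mul-mod b i) ≡ i
      undo a b ab≅1 i i<p = small-≅ (ℕDM.m%n<n (a ℕ.* mul-mod b i) p) i<p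
        (P.trans (mul-mod-≅ a (mul-mod b i)) (P.trans (P.*ˡ (+ a) (mul-mod-≅ b i))
        (P.trans (P.≡⇒≈ (≡.sym (ℤP.*-assoc (+ a) (+ b) (+ i)))) (P.trans (P.*ʳ (+ i) ab≅1) (P.≡⇒≈ (ℤP.*-identityˡ (+ i)))))))
      scaled : γ ℤ.* characterSum e ≅ characterSum e
      scaled = begin
        γ ℤ.* characterSum e ≈⟨ *ˡ γ (sym full) ⟩
        γ ℤ.* ∑ p f ≈⟨ sym (∑-*ˡ p γ f) ⟩
        ∑ p (λ w → γ ℤ.* f w) ≈⟨ ∑-cong′ p (λ w → trans (≡⇒≈ (≡.sym (^-distrib (+ g) (+ w) (M ℕ.* e)))) (ω-power-cong e (P.sym (mul-mod-≅ g w)))) ⟩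
        ∑ p (λ w → f (mul-mod g w)) ≈⟨ ∑-perm p (mul-mod g) (mul-mod g′) f (λ i _ → ℕDM.m%n<n (g ℕ.* i) p) (λ i _ → ℕDM.m%n<n (g′ ℕ.* i) p)
                                                 (undo g′ g (P.trans (P.≡⇒≈ (ℤP.*-comm (+ g′) (+ g))) gg′)) (undo g g′ gg′) ⟩
        ∑ p f ≈⟨ full ⟩
        characterSum e ∎

-- The Dwork exponential

falling : ℤ → ℕ → ℤ
falling x zero = + 1
falling x (suc d) = falling x d ℤ.* (x ℤ.- + d)

falling-front : ∀ x d → falling x (suc d) ≡ x ℤ.* falling (x ℤ.- + 1) d
falling-front x zero = lem x
  where
  lem : ∀ x → + 1 ℤ.* (x ℤ.- + 0) ≡ x ℤ.* + 1
  lem = solve-∀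
falling-front x (suc d) = ≡.trans (≡.cong (ℤ._* (x ℤ.- + suc d)) (falling-front x d)) (lem x (falling (x ℤ.- + 1) d) (+ d))
  where
  lem : ∀ x f d → (x ℤ.* f) ℤ.* (x ℤ.- (+ 1 ℤ.+ d)) ≡ x ℤ.* (f ℤ.* ((x ℤ.- + 1) ℤ.- d))
  lem = solve-∀

falling-exhausted : ∀ N → falling (+ N) (suc N) ≡ + 0
falling-exhausted N = ≡.trans (≡.cong (falling (+ N) N ℤ.*_) (ℤP.+-inverseʳ (+ N))) (ℤP.*-zeroʳ (falling (+ N) N))

pos-∸ : ∀ {m n} → n ℕ.≤ m → + (m ℕ.∸ n) ≡ + m ℤ.- + n
pos-∸ {m} {n} n≤m = ≡.trans (≡.sym (ℤP.⊖-≥ n≤m)) (≡.sym (ℤP.m-n≡m⊖n m n))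

module SuffixProduct (n : ℕ) where
  -- For b ≤ n this is the product of the integers from 1 to pN + b that are prime to p, hence
  -- Γ_p(pN + b + 1) up to sign. Multiples of p are skipped by passing from b = n directly to the
  -- next N.
  suffixProduct : ℕ → ℕ → ℤ
  suffixProduct zero zero = + 1
  suffixProduct (suc N) zero = suffixProduct N n
  suffixProduct N (suc b) = suffixProduct N b ℤ.* + suc (suc n ℕ.* N ℕ.+ b)

  suffix-suc : ∀ N b → suffixProduct N (suc b) ≡ suffixProduct N b ℤ.* + suc (suc n ℕ.* N ℕ.+ b)
  suffix-suc zero b = ≡.refl
  suffix-suc (suc N) b = ≡.refl

module DworkSeries (K : RationalAlgebra) (n : ℕ) where
  open RationalAlgebra K
  open ≈-Reasoning
  open Solver using (solve; _:+_; _:*_; _:-_; :-_; _:=_; con)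
  open SuffixProduct n

  private
    p : ℕ
    p = suc n

  -- history w i j is the coefficient of X^(i-j) in exp(wX + wX^p/p), and 0 when i < j.
  history : ℤ → ℕ → ℕ → Carrier
  history w zero zero = 1#
  history w zero (suc j) = 0#
  history w (suc i) zero = recip i * (⌜ w ⌝ * (history w i 0 + history w i n))
  history w (suc i) (suc j) = history w i j

  c : ℤ → ℕ → Carrier
  c w i = history w i 0

  history-c : ∀ w j i → history w (j ℕ.+ i) j ≡ c w i
  history-c w zero i = ≡.refl
  history-c w (suc j) i = history-c w j i

  history-0 : ∀ w i j → i ℕ.< j → history w i j ≡ 0#
  history-0 w zero (suc j) _ = ≡.refl
  history-0 w (suc i) (suc j) (s≤s i<j) = history-0 w i j i<j

  c-suc : ∀ w i → ⌜ + suc i ⌝ * c w (suc i) ≈ ⌜ w ⌝ * (c w i + history w i n)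
  c-suc w i = begin
    ⌜ + suc i ⌝ * (recip i * s) ≈⟨ solve 3 (λ a b s → a :* (b :* s) := (b :* a) :* s) refl _ _ s ⟩
    (recip i * ⌜ + suc i ⌝) * s ≈⟨ *-congʳ (recip-inverse i) ⟩
    1# * s ≈⟨ *-identityˡ s ⟩
    s ∎
    where
    s : Carrier
    s = ⌜ w ⌝ * (c w i + history w i n)

  c-rec : ∀ w j → ⌜ + (p ℕ.+ j) ⌝ * c w (p ℕ.+ j) ≈ ⌜ w ⌝ * (c w (n ℕ.+ j) + c w j)
  c-rec w j = trans (c-suc w (n ℕ.+ j)) (*-congˡ (+-congˡ (≡⇒≈ (history-c w n j))))

  c-rec-small : ∀ w b → b ℕ.< n → ⌜ + suc b ⌝ * c w (suc b) ≈ ⌜ w ⌝ * c w b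
  c-rec-small w b b<n = trans (c-suc w b) (*-congˡ (trans (+-congˡ (≡⇒≈ (history-0 w b n b<n))) (+-identityʳ _)))

  module Twist (w : ℤ) (u : Carrier) (wu : ⌜ w ⌝ * u ≈ - ⌜ + p ⌝) where

    lam-term : ℕ → ℕ → ℕ → Carrier
    lam-term a N m = ⌜ falling (+ N) m ⌝ * c w (p ℕ.* m ℕ.+ a) * u ^ m

    lam : ℕ → ℕ → Carrier
    lam a N = ∑ (suc N) (lam-term a N)

    private
      -- The remainder that telescopes. Since wu = -p, the difference p(N - m) between pN + a and pm
      -- + a lengthens the falling factorial of the m-th term by one factor and its power of u by
      -- one.
      G : ℕ → ℕ → ℕ → Carrier
      G a N zero = 0#
      G a N (suc m) = ⌜ w ⌝ * (⌜ falling (+ N) (suc m) ⌝ * c w (p ℕ.* m ℕ.+ a) * u ^ suc m)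

      G-suc : ∀ a N m → G a N (suc m) ≈ - (⌜ + p ⌝ * ((⌜ + N ⌝ - ⌜ + m ⌝) * lam-term a N m))
      G-suc a N m = begin
        ⌜ w ⌝ * (⌜ falling (+ N) m ℤ.* (+ N ℤ.- + m) ⌝ * C * (u * u ^ m))
          ≈⟨ *-congˡ (*-congʳ (*-congʳ (trans (⌜⌝-* (falling (+ N) m) (+ N ℤ.- + m)) (*-congˡ (⌜⌝-- (+ N) (+ m)))))) ⟩
        ⌜ w ⌝ * (F * (⌜ + N ⌝ - ⌜ + m ⌝) * C * (u * u ^ m))
          ≈⟨ solve 6 (λ w f d c u um → w :* (f :* d :* c :* (u :* um)) := (w :* u) :* (d :* (f :* c :* um))) refl ⌜ w ⌝ F (⌜ + N ⌝ - ⌜ + m ⌝) C u (u ^ m) ⟩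
        (⌜ w ⌝ * u) * ((⌜ + N ⌝ - ⌜ + m ⌝) * (F * C * u ^ m))
          ≈⟨ *-congʳ wu ⟩
        - ⌜ + p ⌝ * ((⌜ + N ⌝ - ⌜ + m ⌝) * (F * C * u ^ m))
          ≈⟨ sym (-‿distribˡ-* _ _) ⟩
        - (⌜ + p ⌝ * ((⌜ + N ⌝ - ⌜ + m ⌝) * (F * C * u ^ m))) ∎
        where
        F C : Carrier
        F = ⌜ falling (+ N) m ⌝
        C = c w (p ℕ.* m ℕ.+ a)

      split : ∀ a N m → ⌜ + (p ℕ.* N ℕ.+ a) ⌝ * lam-term a N m ≈ ⌜ + (p ℕ.* m ℕ.+ a) ⌝ * lam-term a N m - G a N (suc m)
      split a N m = begin
        ⌜ + (p ℕ.* N ℕ.+ a) ⌝ * t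
          ≈⟨ *-congʳ (linear N) ⟩
        (⌜ + p ⌝ * ⌜ + N ⌝ + ⌜ + a ⌝) * t
          ≈⟨ solve 5 (λ p N a m t → (p :* N :+ a) :* t := (p :* m :+ a) :* t :- (:- (p :* ((N :- m) :* t)))) refl ⌜ + p ⌝ ⌜ + N ⌝ ⌜ + a ⌝ ⌜ + m ⌝ t ⟩
        (⌜ + p ⌝ * ⌜ + m ⌝ + ⌜ + a ⌝) * t - (- (⌜ + p ⌝ * ((⌜ + N ⌝ - ⌜ + m ⌝) * t)))
          ≈⟨ +-cong (*-congʳ (sym (linear m))) (-‿cong (sym (G-suc a N m))) ⟩
        ⌜ + (p ℕ.* m ℕ.+ a) ⌝ * t - G a N (suc m) ∎
        where
        t : Carrier
        t = lam-term a N m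
        linear : ∀ N → ⌜ + (p ℕ.* N ℕ.+ a) ⌝ ≈ ⌜ + p ⌝ * ⌜ + N ⌝ + ⌜ + a ⌝
        linear N = trans (⌜⌝-+ (+ (p ℕ.* N)) (+ a)) (+-congʳ (trans (≡⇒≈ (≡.cong ⌜_⌝ (ℤP.pos-* p N))) (⌜⌝-* (+ p) (+ N))))

      G-end : ∀ a N → G a N (suc N) ≈ 0#
      G-end a N = trans (*-congˡ (trans (*-congʳ (trans (*-congʳ (≡⇒≈ (≡.cong ⌜_⌝ (falling-exhausted N)))) (zeroˡ _))) (zeroˡ _))) (zeroʳ _)

      G-total : ∀ a N → ∑ (suc N) (λ m → G a N m - G a N (suc m)) ≈ 0#
      G-total a N = begin
        ∑ (suc N) (λ m → G a N m - G a N (suc m)) ≈⟨ ∑-cong′ (suc N) (λ m → solve 2 (λ a b → a :- b := :- (b :- a)) refl (G a N m) (G a N (suc m))) ⟩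
        ∑ (suc N) (λ m → - (G a N (suc m) - G a N m)) ≈⟨ ∑-neg (suc N) _ ⟩
        - ∑ (suc N) (λ m → G a N (suc m) - G a N m) ≈⟨ -‿cong (∑-telescope (suc N) (G a N)) ⟩
        - (G a N (suc N) - 0#) ≈⟨ -‿cong (+-congʳ (G-end a N)) ⟩
        - (0# - 0#) ≈⟨ solve 0 (:- (con (+ 0) :- con (+ 0)) := con (+ 0)) refl ⟩
        0# ∎

      pm+1+b : ∀ m b → p ℕ.* m ℕ.+ suc b ≡ suc (p ℕ.* m ℕ.+ b)
      pm+1+b m b = ℕP.+-suc (p ℕ.* m) b

      p[1+m]+a : ∀ m a → p ℕ.* suc m ℕ.+ a ≡ p ℕ.+ (p ℕ.* m ℕ.+ a)
      p[1+m]+a m a = ≡.trans (≡.cong (ℕ._+ a) (ℕP.*-suc p m)) (ℕP.+-assoc p (p ℕ.* m) a)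

    -- The recursion for c turns pm + a times the m-th term into w times the term for b plus G_m,
    -- and replacing pm + a by pN + a subtracts G_(m+1). The sum telescopes: G_0 = 0, and G_(N+1)
    -- contains N(N-1)...(N-N) = 0.
    lam-suc : ∀ b N → b ℕ.< n → ⌜ + suc (p ℕ.* N ℕ.+ b) ⌝ * lam (suc b) N ≈ ⌜ w ⌝ * lam b N
    lam-suc b N b<n = begin
      ⌜ + suc (p ℕ.* N ℕ.+ b) ⌝ * lam a N ≡⟨ ≡.cong (λ z → ⌜ + z ⌝ * lam a N) (≡.sym (pm+1+b N b)) ⟩
      ⌜ + (p ℕ.* N ℕ.+ a) ⌝ * lam a N ≈⟨ sym (∑-*ˡ (suc N) _ _) ⟩
      ∑ (suc N) (λ m → ⌜ + (p ℕ.* N ℕ.+ a) ⌝ * lam-term a N m) ≈⟨ ∑-cong′ (suc N) term ⟩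
      ∑ (suc N) (λ m → ⌜ w ⌝ * lam-term b N m + (G a N m - G a N (suc m))) ≈⟨ ∑-+ (suc N) _ _ ⟩
      ∑ (suc N) (λ m → ⌜ w ⌝ * lam-term b N m) + ∑ (suc N) (λ m → G a N m - G a N (suc m)) ≈⟨ +-cong (∑-*ˡ (suc N) _ _) (G-total a N) ⟩
      ⌜ w ⌝ * lam b N + 0# ≈⟨ +-identityʳ _ ⟩
      ⌜ w ⌝ * lam b N ∎
      where
      a : ℕ
      a = suc b
      diag : ∀ m → ⌜ + (p ℕ.* m ℕ.+ a) ⌝ * lam-term a N m ≈ ⌜ w ⌝ * lam-term b N m + G a N m
      diag zero = begin
        ⌜ + (p ℕ.* 0 ℕ.+ a) ⌝ * (1# * c w (p ℕ.* 0 ℕ.+ a) * 1#) ≡⟨ ≡.cong (λ z → ⌜ + (z ℕ.+ a) ⌝ * (1# * c w (z ℕ.+ a) * 1#)) (ℕP.*-zeroʳ p) ⟩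
        ⌜ + a ⌝ * (1# * c w a * 1#) ≈⟨ solve 2 (λ a c → a :* (con (+ 1) :* c :* con (+ 1)) := a :* c) refl ⌜ + a ⌝ (c w a) ⟩
        ⌜ + a ⌝ * c w a ≈⟨ c-rec-small w b b<n ⟩
        ⌜ w ⌝ * c w b ≈⟨ solve 2 (λ w c → w :* c := w :* (con (+ 1) :* c :* con (+ 1)) :+ con (+ 0)) refl ⌜ w ⌝ (c w b) ⟩
        ⌜ w ⌝ * (1# * c w b * 1#) + 0# ≡⟨ ≡.cong (λ z → ⌜ w ⌝ * (1# * c w (z ℕ.+ b) * 1#) + 0#) (≡.sym (ℕP.*-zeroʳ p)) ⟩
        ⌜ w ⌝ * (1# * c w (p ℕ.* 0 ℕ.+ b) * 1#) + 0# ∎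
      diag (suc m) = begin
        ⌜ + (p ℕ.* suc m ℕ.+ a) ⌝ * (F * c w (p ℕ.* suc m ℕ.+ a) * u ^ suc m)
          ≡⟨ ≡.cong (λ z → ⌜ + z ⌝ * (F * c w z * u ^ suc m)) (p[1+m]+a m a) ⟩
        ⌜ + (p ℕ.+ j) ⌝ * (F * c w (p ℕ.+ j) * u ^ suc m)
          ≈⟨ solve 4 (λ i f c u → i :* (f :* c :* u) := f :* (i :* c) :* u) refl ⌜ + (p ℕ.+ j) ⌝ F (c w (p ℕ.+ j)) (u ^ suc m) ⟩
        F * (⌜ + (p ℕ.+ j) ⌝ * c w (p ℕ.+ j)) * u ^ suc m
          ≈⟨ *-congʳ (*-congˡ (c-rec w j)) ⟩
        F * (⌜ w ⌝ * (c w (n ℕ.+ j) + c w j)) * u ^ suc m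
          ≈⟨ solve 5 (λ f w c d u → f :* (w :* (c :+ d)) :* u := w :* (f :* c :* u) :+ w :* (f :* d :* u)) refl F ⌜ w ⌝ (c w (n ℕ.+ j)) (c w j) (u ^ suc m) ⟩
        ⌜ w ⌝ * (F * c w (n ℕ.+ j) * u ^ suc m) + ⌜ w ⌝ * (F * c w j * u ^ suc m)
          ≡⟨ ≡.cong (λ z → ⌜ w ⌝ * (F * c w z * u ^ suc m) + ⌜ w ⌝ * (F * c w j * u ^ suc m)) n+j ⟩
        ⌜ w ⌝ * (F * c w (p ℕ.* suc m ℕ.+ b) * u ^ suc m) + ⌜ w ⌝ * (F * c w j * u ^ suc m) ∎
        where
        F : Carrier
        F = ⌜ falling (+ N) (suc m) ⌝
        j : ℕ
        j = p ℕ.* m ℕ.+ a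
        n+j : n ℕ.+ j ≡ p ℕ.* suc m ℕ.+ b
        n+j = ≡.trans (≡.cong (n ℕ.+_) (pm+1+b m b)) (≡.trans (ℕP.+-suc n _) (≡.sym (p[1+m]+a m b)))
      term : ∀ m → ⌜ + (p ℕ.* N ℕ.+ a) ⌝ * lam-term a N m ≈ ⌜ w ⌝ * lam-term b N m + (G a N m - G a N (suc m))
      term m = trans (split a N m) (trans (+-congʳ (diag m)) (+-assoc _ _ _))

    -- The same telescoping for a = 0. Here the recursion reaches back to index pm + n, and the
    -- falling factorial of N + 1 of length m + 1 is N + 1 times that of N, so the terms of
    -- `lam n N` appear shifted by one.
    lam-wrap : ∀ N → lam 0 (suc N) ≈ - lam n N
    -- As `recip i` inverts i + 1, the argument is p(N + 1) - 1. This division is not p-integral and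
    -- uses that the coefficients are rational.
    lam-wrap N = unit-cancel (recip-inverse (n ℕ.+ N ℕ.+ n ℕ.* N)) (trans (trans (*-congʳ (≡⇒≈ (≡.cong (λ z → ⌜ + z ⌝) unit-eq))) scaled) (*-congʳ (≡⇒≈ (≡.cong (λ z → ⌜ + z ⌝) (≡.sym unit-eq)))))
      where
      N⁺ : ℕ
      N⁺ = suc N
      unit-eq : suc (n ℕ.+ N ℕ.+ n ℕ.* N) ≡ p ℕ.* N⁺ ℕ.+ 0
      unit-eq = lem n N
        where
        lem : ∀ n N → suc (n ℕ.+ N ℕ.+ n ℕ.* N) ≡ (1 ℕ.+ n) ℕ.* (1 ℕ.+ N) ℕ.+ 0
        lem = ℕSolver.solve-∀
      H : ℕ → Carrier
      H zero = 0#
      H (suc m) = - (⌜ + (p ℕ.* N⁺ ℕ.+ 0) ⌝ * lam-term n N m)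
      diag : ∀ m → ⌜ + (p ℕ.* m ℕ.+ 0) ⌝ * lam-term 0 N⁺ m ≈ H m + G 0 N⁺ m
      diag zero = trans (*-congʳ (≡⇒≈ (≡.cong (λ z → ⌜ + (z ℕ.+ 0) ⌝) (ℕP.*-zeroʳ p)))) (trans (zeroˡ _) (sym (+-identityʳ 0#)))
      diag (suc m) = begin
        ⌜ + (p ℕ.* suc m ℕ.+ 0) ⌝ * (F * c w (p ℕ.* suc m ℕ.+ 0) * u ^ suc m)
          ≡⟨ ≡.cong (λ z → ⌜ + z ⌝ * (F * c w z * u ^ suc m)) (p[1+m]+a m 0) ⟩
        ⌜ + (p ℕ.+ j) ⌝ * (F * c w (p ℕ.+ j) * u ^ suc m)
          ≈⟨ solve 4 (λ i f c u → i :* (f :* c :* u) := f :* (i :* c) :* u) refl ⌜ + (p ℕ.+ j) ⌝ F (c w (p ℕ.+ j)) (u ^ suc m) ⟩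
        F * (⌜ + (p ℕ.+ j) ⌝ * c w (p ℕ.+ j)) * u ^ suc m
          ≈⟨ *-congʳ (*-congˡ (c-rec w j)) ⟩
        F * (⌜ w ⌝ * (c w (n ℕ.+ j) + c w j)) * u ^ suc m
          ≈⟨ solve 6 (λ f w c d u um → f :* (w :* (c :+ d)) :* (u :* um) := (w :* u) :* (f :* c :* um) :+ w :* (f :* d :* (u :* um))) refl F ⌜ w ⌝ (c w (n ℕ.+ j)) (c w j) u (u ^ m) ⟩
        (⌜ w ⌝ * u) * (F * c w (n ℕ.+ j) * u ^ m) + G 0 N⁺ (suc m)
          ≈⟨ +-congʳ (*-cong wu (*-congʳ (*-cong front (≡⇒≈ (≡.cong (c w) n+j))))) ⟩
        (- ⌜ + p ⌝) * (⌜ + N⁺ ⌝ * ⌜ falling (+ N) m ⌝ * c w (p ℕ.* m ℕ.+ n) * u ^ m) + G 0 N⁺ (suc m)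
          ≈⟨ +-congʳ (solve 5 (λ p N f c u → (:- p) :* (N :* f :* c :* u) := :- ((p :* N) :* (f :* c :* u))) refl ⌜ + p ⌝ ⌜ + N⁺ ⌝ ⌜ falling (+ N) m ⌝ (c w (p ℕ.* m ℕ.+ n)) (u ^ m)) ⟩
        - ((⌜ + p ⌝ * ⌜ + N⁺ ⌝) * lam-term n N m) + G 0 N⁺ (suc m)
          ≈⟨ +-congʳ (-‿cong (*-congʳ (trans (sym (⌜⌝-* (+ p) (+ N⁺))) (≡⇒≈ (≡.cong ⌜_⌝ (≡.trans (≡.sym (ℤP.pos-* p N⁺)) (≡.cong +_ (≡.sym (ℕP.+-identityʳ _))))))))) ⟩
        H (suc m) + G 0 N⁺ (suc m) ∎
        where
        F : Carrier
        F = ⌜ falling (+ N⁺) (suc m) ⌝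
        j : ℕ
        j = p ℕ.* m ℕ.+ 0
        front : F ≈ ⌜ + N⁺ ⌝ * ⌜ falling (+ N) m ⌝
        front = trans (≡⇒≈ (≡.cong ⌜_⌝ (falling-front (+ N⁺) m))) (⌜⌝-* (+ N⁺) (falling (+ N) m))
        n+j : n ℕ.+ j ≡ p ℕ.* m ℕ.+ n
        n+j = ≡.trans (≡.cong (n ℕ.+_) (ℕP.+-identityʳ _)) (ℕP.+-comm n _)
      scaled : ⌜ + (p ℕ.* N⁺ ℕ.+ 0) ⌝ * lam 0 N⁺ ≈ ⌜ + (p ℕ.* N⁺ ℕ.+ 0) ⌝ * - lam n N
      scaled = begin
        P * lam 0 N⁺ ≈⟨ sym (∑-*ˡ (suc N⁺) _ _) ⟩
        ∑ (suc N⁺) (λ m → P * lam-term 0 N⁺ m) ≈⟨ ∑-cong′ (suc N⁺) (λ m → trans (split 0 N⁺ m) (trans (+-congʳ (diag m)) (+-assoc _ _ _))) ⟩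
        ∑ (suc N⁺) (λ m → H m + (G 0 N⁺ m - G 0 N⁺ (suc m))) ≈⟨ ∑-+ (suc N⁺) _ _ ⟩
        ∑ (suc N⁺) H + ∑ (suc N⁺) (λ m → G 0 N⁺ m - G 0 N⁺ (suc m)) ≈⟨ +-cong (∑-front N⁺ H) (G-total 0 N⁺) ⟩
        (0# + ∑ N⁺ (λ m → - (P * lam-term n N m))) + 0# ≈⟨ solve 1 (λ x → (con (+ 0) :+ x) :+ con (+ 0) := x) refl _ ⟩
        ∑ N⁺ (λ m → - (P * lam-term n N m)) ≈⟨ trans (∑-neg N⁺ _) (-‿cong (∑-*ˡ N⁺ P (lam-term n N))) ⟩
        - (P * lam n N) ≈⟨ -‿distribʳ-* P (lam n N) ⟩
        P * - lam n N ∎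
        where
        P : Carrier
        P = ⌜ + (p ℕ.* N⁺ ℕ.+ 0) ⌝

    -- An exact identity for every N: the two relations above multiply up to the product of integers
    -- prime to p. Only the later choice of N brings in a congruence.
    lam-value : ∀ N a → a ℕ.≤ n → ⌜ suffixProduct N a ⌝ * lam a N ≈ ⌜ (ℤ.- + 1) ℤ.^ N ℤ.* w ℤ.^ (n ℕ.* N ℕ.+ a) ⌝
    lam-value zero zero _ = trans (*-identityˡ _) (trans (solve 1 (λ c → con (+ 0) :+ con (+ 1) :* c :* con (+ 1) := c) refl (c w (p ℕ.* 0 ℕ.+ 0)))
      (≡⇒≈ (≡.trans (≡.cong (λ z → c w (z ℕ.+ 0)) (ℕP.*-zeroʳ p)) (≡.cong (λ z → ⌜ + 1 ℤ.* w ℤ.^ (z ℕ.+ 0) ⌝) (≡.sym (ℕP.*-zeroʳ n))))))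
    lam-value (suc N) zero _ = begin
      ⌜ suffixProduct N n ⌝ * lam 0 (suc N) ≈⟨ *-congˡ (lam-wrap N) ⟩
      ⌜ suffixProduct N n ⌝ * - lam n N ≈⟨ sym (-‿distribʳ-* _ _) ⟩
      - (⌜ suffixProduct N n ⌝ * lam n N) ≈⟨ -‿cong (lam-value N n ℕP.≤-refl) ⟩
      - ⌜ (ℤ.- + 1) ℤ.^ N ℤ.* w ℤ.^ (n ℕ.* N ℕ.+ n) ⌝ ≈⟨ sym (⌜⌝-neg ((ℤ.- + 1) ℤ.^ N ℤ.* w ℤ.^ (n ℕ.* N ℕ.+ n))) ⟩
      ⌜ ℤ.- ((ℤ.- + 1) ℤ.^ N ℤ.* w ℤ.^ (n ℕ.* N ℕ.+ n)) ⌝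
        ≡⟨ ≡.cong ⌜_⌝ (≡.trans (lem ((ℤ.- + 1) ℤ.^ N) (w ℤ.^ (n ℕ.* N ℕ.+ n))) (≡.cong (λ z → (ℤ.- + 1) ℤ.* (ℤ.- + 1) ℤ.^ N ℤ.* w ℤ.^ z) (lem₂ n N))) ⟩
      ⌜ (ℤ.- + 1) ℤ.^ suc N ℤ.* w ℤ.^ (n ℕ.* suc N ℕ.+ 0) ⌝ ∎
      where
      lem : ∀ s w → ℤ.- (s ℤ.* w) ≡ (ℤ.- + 1) ℤ.* s ℤ.* w
      lem = solve-∀
      lem₂ : ∀ n N → n ℕ.* N ℕ.+ n ≡ n ℕ.* (1 ℕ.+ N) ℕ.+ 0
      lem₂ = ℕSolver.solve-∀
    lam-value N (suc b) b<n = begin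
      ⌜ suffixProduct N (suc b) ⌝ * lam (suc b) N ≡⟨ ≡.cong (λ z → ⌜ z ⌝ * lam (suc b) N) (suffix-suc N b) ⟩
      ⌜ suffixProduct N b ℤ.* + suc (p ℕ.* N ℕ.+ b) ⌝ * lam (suc b) N ≈⟨ trans (*-congʳ (⌜⌝-* (suffixProduct N b) (+ suc (p ℕ.* N ℕ.+ b)))) (*-assoc _ _ _) ⟩
      ⌜ suffixProduct N b ⌝ * (⌜ + suc (p ℕ.* N ℕ.+ b) ⌝ * lam (suc b) N) ≈⟨ *-congˡ (lam-suc b N b<n) ⟩
      ⌜ suffixProduct N b ⌝ * (⌜ w ⌝ * lam b N) ≈⟨ solve 3 (λ a b c → a :* (b :* c) := b :* (a :* c)) refl _ _ _ ⟩
      ⌜ w ⌝ * (⌜ suffixProduct N b ⌝ * lam b N) ≈⟨ *-congˡ (lam-value N b (ℕP.<⇒≤ b<n)) ⟩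
      ⌜ w ⌝ * ⌜ (ℤ.- + 1) ℤ.^ N ℤ.* w ℤ.^ (n ℕ.* N ℕ.+ b) ⌝ ≈⟨ sym (⌜⌝-* w _) ⟩
      ⌜ w ℤ.* ((ℤ.- + 1) ℤ.^ N ℤ.* w ℤ.^ (n ℕ.* N ℕ.+ b)) ⌝
        ≡⟨ ≡.cong ⌜_⌝ (≡.trans (lem w ((ℤ.- + 1) ℤ.^ N) (w ℤ.^ (n ℕ.* N ℕ.+ b))) (≡.cong (λ z → (ℤ.- + 1) ℤ.^ N ℤ.* w ℤ.^ z) (≡.sym (ℕP.+-suc (n ℕ.* N) b)))) ⟩
      ⌜ (ℤ.- + 1) ℤ.^ N ℤ.* w ℤ.^ (n ℕ.* N ℕ.+ suc b) ⌝ ∎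
      where
      lem : ∀ w s v → w ℤ.* (s ℤ.* v) ≡ s ℤ.* (w ℤ.* v)
      lem = solve-∀

    module Trace (a N : ℕ) where
      -- An interpolation in l. At l = 0 it gives the terms of `lam a N` without their falling
      -- factorials. At l = m it is c_(nm+a) (-p)^m, a term of the coefficient of Y^a in F w.
      e : ℕ → ℕ → Carrier
      e l m = c w (p ℕ.* m ℕ.+ a ℕ.∸ l) * ⌜ w ⌝ ^ l * u ^ m

      ε : ℤ
      ε = + (n ℕ.* N ℕ.+ a)

      -- For l ≤ m this is (N - l)(N - l - 1)...(N - m + 1): the falling factorial of the Dwork sum
      -- at l = 0, and 1 at l = m.
      weight : ℕ → ℕ → ℤ
      weight m l = falling (+ N ℤ.- + l) (m ℕ.∸ l)

      weight-self : ∀ m → weight m m ≡ + 1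
      weight-self m = ≡.cong (falling (+ N ℤ.- + m)) (ℕP.n∸n≡0 m)

      weight-front : ∀ m l → l ℕ.< m → weight m l ≡ (+ N ℤ.- + l) ℤ.* weight m (suc l)
      weight-front m l l<m = ≡.trans (≡.cong (falling (+ N ℤ.- + l)) (≡.trans (ℕP.+-∸-assoc 1 l<m) ≡.refl))
        (≡.trans (falling-front (+ N ℤ.- + l) (m ℕ.∸ suc l)) (≡.cong (λ z → (+ N ℤ.- + l) ℤ.* falling z (m ℕ.∸ suc l)) (lem (+ N) (+ l))))
        where
        lem : ∀ N l → (N ℤ.- l) ℤ.- + 1 ≡ N ℤ.- (+ 1 ℤ.+ l)
        lem = solve-∀

      weight-back : ∀ m l → l ℕ.≤ m → weight (suc m) l ≡ weight m l ℤ.* (+ N ℤ.- + m)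
      weight-back m l l≤m = ≡.trans (≡.cong (falling (+ N ℤ.- + l)) (ℕP.+-∸-assoc 1 l≤m))
        (≡.cong (weight m l ℤ.*_) (≡.trans (≡.cong (λ z → (+ N ℤ.- + l) ℤ.- z) (pos-∸ l≤m)) (lem (+ N) (+ l) (+ m))))
        where
        lem : ∀ N l m → (N ℤ.- l) ℤ.- (m ℤ.- l) ≡ N ℤ.- m
        lem = solve-∀

      weight-end : ∀ l → l ℕ.< N → weight (suc N) (suc l) ≡ + 0
      weight-end l l<N = ≡.trans (≡.cong₂ falling (≡.sym (pos-∸ l<N)) (ℕP.+-∸-assoc 1 l<N)) (falling-exhausted (N ℕ.∸ suc l))

      -- The recursion at index i = p(m+1) + a - l exchanges l for l + 1. What is left over has the
      -- coefficient i - (N - l) = ε - p(N - m - 1), in which ε is p-adically small for the intended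
      -- N.
      shift-rec : ∀ m l → l ℕ.≤ m →
        e (suc l) (suc m) - ⌜ + N ℤ.- + l ⌝ * e l (suc m) ≈
        (⌜ + p ⌝ * e l m - ⌜ + p ⌝ * (⌜ + N ℤ.- + suc m ⌝ * e l (suc m))) + ⌜ ε ⌝ * e l (suc m)
      shift-rec m l l≤m = begin
        c w (I ℕ.∸ suc l) * (⌜ w ⌝ * ⌜ w ⌝ ^ l) * u ^ suc m - ⌜ + N ℤ.- + l ⌝ * E
          ≈⟨ +-congʳ (solve 4 (λ c w wl um → c :* (w :* wl) :* um := (w :* c) :* wl :* um) refl (c w (I ℕ.∸ suc l)) ⌜ w ⌝ (⌜ w ⌝ ^ l) (u ^ suc m)) ⟩
        (⌜ w ⌝ * c w (I ℕ.∸ suc l)) * ⌜ w ⌝ ^ l * u ^ suc m - ⌜ + N ℤ.- + l ⌝ * E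
          ≈⟨ +-congʳ (*-congʳ (*-congʳ isolate)) ⟩
        (⌜ i ⌝ * c w (I ℕ.∸ l) - ⌜ w ⌝ * c w j) * ⌜ w ⌝ ^ l * (u * u ^ m) - ⌜ + N ℤ.- + l ⌝ * E
          ≈⟨ solve 8 (λ i C w cj wl u um d → (i :* C :- w :* cj) :* wl :* (u :* um) :- d :* (C :* wl :* (u :* um)) :=
               (i :- d) :* (C :* wl :* (u :* um)) :- (w :* u) :* (cj :* wl :* um)) refl ⌜ i ⌝ (c w (I ℕ.∸ l)) ⌜ w ⌝ (c w j) (⌜ w ⌝ ^ l) u (u ^ m) ⌜ + N ℤ.- + l ⌝ ⟩
        (⌜ i ⌝ - ⌜ + N ℤ.- + l ⌝) * E - (⌜ w ⌝ * u) * e l m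
          ≈⟨ +-cong (*-congʳ coefficient) (-‿cong (*-congʳ wu)) ⟩
        (⌜ ε ⌝ - ⌜ + p ⌝ * ⌜ + N ℤ.- + suc m ⌝) * E - (- ⌜ + p ⌝) * e l m
          ≈⟨ solve 5 (λ ε p d E f → (ε :- p :* d) :* E :- (:- p) :* f := (p :* f :- p :* (d :* E)) :+ ε :* E) refl ⌜ ε ⌝ ⌜ + p ⌝ ⌜ + N ℤ.- + suc m ⌝ E (e l m) ⟩
        (⌜ + p ⌝ * e l m - ⌜ + p ⌝ * (⌜ + N ℤ.- + suc m ⌝ * E)) + ⌜ ε ⌝ * E ∎
        where
        I j : ℕ
        I = p ℕ.* suc m ℕ.+ a
        j = p ℕ.* m ℕ.+ a ℕ.∸ l
        E : Carrier
        E = e l (suc m)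
        l≤ : l ℕ.≤ p ℕ.* m ℕ.+ a
        l≤ = ℕP.≤-trans l≤m (ℕP.≤-trans (ℕP.m≤n*m m p) (ℕP.m≤m+n (p ℕ.* m) a))
        I-l : I ℕ.∸ l ≡ p ℕ.+ j
        I-l = ≡.trans (≡.cong (ℕ._∸ l) (p[1+m]+a m a)) (ℕP.+-∸-assoc p l≤)
        I-1-l : I ℕ.∸ suc l ≡ n ℕ.+ j
        I-1-l = ≡.trans (≡.cong (ℕ._∸ suc l) (p[1+m]+a m a)) (ℕP.+-∸-assoc n l≤)
        i : ℤ
        i = + (p ℕ.+ j)
        isolate : ⌜ w ⌝ * c w (I ℕ.∸ suc l) ≈ ⌜ i ⌝ * c w (I ℕ.∸ l) - ⌜ w ⌝ * c w j
        isolate = begin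
          ⌜ w ⌝ * c w (I ℕ.∸ suc l) ≡⟨ ≡.cong (λ z → ⌜ w ⌝ * c w z) I-1-l ⟩
          ⌜ w ⌝ * c w (n ℕ.+ j) ≈⟨ solve 3 (λ w x y → w :* x := w :* (x :+ y) :- w :* y) refl ⌜ w ⌝ (c w (n ℕ.+ j)) (c w j) ⟩
          ⌜ w ⌝ * (c w (n ℕ.+ j) + c w j) - ⌜ w ⌝ * c w j ≈⟨ +-congʳ (sym (c-rec w j)) ⟩
          ⌜ i ⌝ * c w (p ℕ.+ j) - ⌜ w ⌝ * c w j ≡⟨ ≡.cong (λ z → ⌜ i ⌝ * c w z - ⌜ w ⌝ * c w j) (≡.sym I-l) ⟩
          ⌜ i ⌝ * c w (I ℕ.∸ l) - ⌜ w ⌝ * c w j ∎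
        i-value : i ≡ + p ℤ.* + suc m ℤ.+ + a ℤ.- + l
        i-value = ≡.trans (≡.cong +_ (≡.sym I-l)) (≡.trans (pos-∸ (ℕP.≤-trans l≤ (ℕP.+-monoˡ-≤ a (ℕP.*-monoʳ-≤ p (ℕP.n≤1+n m)))))
          (≡.cong (λ z → z ℤ.+ + a ℤ.- + l) (ℤP.pos-* p (suc m))))
        coefficient : ⌜ i ⌝ - ⌜ + N ℤ.- + l ⌝ ≈ ⌜ ε ⌝ - ⌜ + p ⌝ * ⌜ + N ℤ.- + suc m ⌝
        coefficient = begin
          ⌜ i ⌝ - ⌜ + N ℤ.- + l ⌝ ≈⟨ sym (⌜⌝-- i (+ N ℤ.- + l)) ⟩
          ⌜ i ℤ.- (+ N ℤ.- + l) ⌝ ≡⟨ ≡.cong ⌜_⌝ (≡.trans (≡.cong (ℤ._- (+ N ℤ.- + l)) i-value) (≡.trans (lem (+ n) (+ N) (+ a) (+ l) (+ m)) (≡.cong (λ z → (z ℤ.+ + a) ℤ.- + p ℤ.* (+ N ℤ.- + suc m)) (≡.sym (ℤP.pos-* n N))))) ⟩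
          ⌜ ε ℤ.- + p ℤ.* (+ N ℤ.- + suc m) ⌝ ≈⟨ trans (⌜⌝-- ε (+ p ℤ.* (+ N ℤ.- + suc m))) (+-congˡ (-‿cong (⌜⌝-* (+ p) (+ N ℤ.- + suc m)))) ⟩
          ⌜ ε ⌝ - ⌜ + p ⌝ * ⌜ + N ℤ.- + suc m ⌝ ∎
          where
          lem : ∀ n N a l m → ((+ 1 ℤ.+ n) ℤ.* (+ 1 ℤ.+ m) ℤ.+ a ℤ.- l) ℤ.- (N ℤ.- l) ≡ (n ℤ.* N ℤ.+ a) ℤ.- (+ 1 ℤ.+ n) ℤ.* (N ℤ.- (+ 1 ℤ.+ m))
          lem = solve-∀

      -- The two remainders of the telescoping in l at m: U m comes from the terms with m - 1, and Y
      -- m from those with m itself. `NY` expresses the multiple N - m of Y m through U (m+1), so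
      -- that the multiples of p telescope again in m.
      U Y : ℕ → Carrier
      U zero = 0#
      U (suc m) = ∑ (suc m) (λ l → ⌜ weight (suc m) (suc l) ⌝ * e l m)
      Y m = ∑ m (λ l → ⌜ weight m (suc l) ⌝ * e l m)

      NY : ∀ m → ⌜ + N ℤ.- + m ⌝ * Y m ≈ U (suc m) - e m m
      NY m = begin
        ⌜ + N ℤ.- + m ⌝ * Y m ≈⟨ sym (∑-*ˡ m _ _) ⟩
        ∑ m (λ l → ⌜ + N ℤ.- + m ⌝ * (⌜ weight m (suc l) ⌝ * e l m)) ≈⟨ ∑-cong m (λ l l<m → trans (solve 3 (λ a b c → a :* (b :* c) := (b :* a) :* c) refl _ _ _)
          (*-congʳ (trans (sym (⌜⌝-* (weight m (suc l)) (+ N ℤ.- + m))) (≡⇒≈ (≡.cong ⌜_⌝ (≡.sym (weight-back m (suc l) l<m))))))) ⟩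
        S ≈⟨ solve 2 (λ s e → s := (s :+ con (+ 1) :* e) :- e) refl S (e m m) ⟩
        (S + 1# * e m m) - e m m ≈⟨ +-congʳ (+-congˡ (*-congʳ (≡⇒≈ (≡.cong ⌜_⌝ (≡.sym (weight-self (suc m))))))) ⟩
        U (suc m) - e m m ∎
        where
        S : Carrier
        S = ∑ m (λ l → ⌜ weight (suc m) (suc l) ⌝ * e l m)

      -- The weighted interpolation is telescoped over l from 0 to m, with `shift-rec` evaluating
      -- each difference.
      diagonal : ∀ m → e m m - ⌜ falling (+ N) m ⌝ * e 0 m ≈ (⌜ + p ⌝ * U m - ⌜ + p ⌝ * U (suc m)) + (⌜ + p ⌝ * e m m + ⌜ ε ⌝ * Y m)
      diagonal zero = trans (solve 2 (λ p e → e :- con (+ 1) :* e := (p :* con (+ 0) :- p :* (con (+ 0) :+ con (+ 1) :* e)) :+ (p :* e :+ con (+ 0))) refl ⌜ + p ⌝ (e 0 0))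
        (+-cong refl (+-congˡ (sym (zeroʳ ⌜ ε ⌝))))
      diagonal (suc m) = begin
        e m⁺ m⁺ - ⌜ falling (+ N) m⁺ ⌝ * e 0 m⁺
          ≈⟨ +-cong (sym (trans (*-congʳ (≡⇒≈ (≡.cong ⌜_⌝ (weight-self m⁺)))) (*-identityˡ _)))
               (-‿cong (*-congʳ (≡⇒≈ (≡.cong ⌜_⌝ (≡.cong (λ z → falling z m⁺) (≡.sym (ℤP.+-identityʳ (+ N)))))))) ⟩
        A m⁺ - A 0
          ≈⟨ sym (∑-telescope m⁺ A) ⟩
        ∑ m⁺ (λ l → A (suc l) - A l)
          ≈⟨ ∑-cong m⁺ step ⟩
        ∑ m⁺ (λ l → ⌜ + p ⌝ * (⌜ weight m⁺ (suc l) ⌝ * e l m) + (⌜ ε ⌝ - ⌜ + p ⌝ * ⌜ + N ℤ.- + m⁺ ⌝) * (⌜ weight m⁺ (suc l) ⌝ * e l m⁺))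
          ≈⟨ trans (∑-+ m⁺ _ _) (+-cong (∑-*ˡ m⁺ _ _) (∑-*ˡ m⁺ _ _)) ⟩
        ⌜ + p ⌝ * U m⁺ + (⌜ ε ⌝ - ⌜ + p ⌝ * ⌜ + N ℤ.- + m⁺ ⌝) * Y m⁺
          ≈⟨ solve 5 (λ p U ε d Y → p :* U :+ (ε :- p :* d) :* Y := (p :* U :- p :* (d :* Y)) :+ ε :* Y) refl ⌜ + p ⌝ (U m⁺) ⌜ ε ⌝ ⌜ + N ℤ.- + m⁺ ⌝ (Y m⁺) ⟩
        (⌜ + p ⌝ * U m⁺ - ⌜ + p ⌝ * (⌜ + N ℤ.- + m⁺ ⌝ * Y m⁺)) + ⌜ ε ⌝ * Y m⁺
          ≈⟨ +-congʳ (+-congˡ (-‿cong (*-congˡ (NY m⁺)))) ⟩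
        (⌜ + p ⌝ * U m⁺ - ⌜ + p ⌝ * (U (suc m⁺) - e m⁺ m⁺)) + ⌜ ε ⌝ * Y m⁺
          ≈⟨ solve 5 (λ p U V e y → (p :* U :- p :* (V :- e)) :+ y := (p :* U :- p :* V) :+ (p :* e :+ y)) refl ⌜ + p ⌝ (U m⁺) (U (suc m⁺)) (e m⁺ m⁺) (⌜ ε ⌝ * Y m⁺) ⟩
        (⌜ + p ⌝ * U m⁺ - ⌜ + p ⌝ * U (suc m⁺)) + (⌜ + p ⌝ * e m⁺ m⁺ + ⌜ ε ⌝ * Y m⁺) ∎
        where
        m⁺ : ℕ
        m⁺ = suc m
        A : ℕ → Carrier
        A l = ⌜ weight m⁺ l ⌝ * e l m⁺
        step : ∀ l → l ℕ.< m⁺ → A (suc l) - A l ≈ ⌜ + p ⌝ * (⌜ weight m⁺ (suc l) ⌝ * e l m) + (⌜ ε ⌝ - ⌜ + p ⌝ * ⌜ + N ℤ.- + m⁺ ⌝) * (⌜ weight m⁺ (suc l) ⌝ * e l m⁺)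
        step l l<m⁺ = begin
          W * e (suc l) m⁺ - ⌜ weight m⁺ l ⌝ * e l m⁺
            ≈⟨ +-congˡ (-‿cong (*-congʳ (trans (≡⇒≈ (≡.cong ⌜_⌝ (weight-front m⁺ l l<m⁺))) (⌜⌝-* (+ N ℤ.- + l) (weight m⁺ (suc l)))))) ⟩
          W * e (suc l) m⁺ - (⌜ + N ℤ.- + l ⌝ * W) * e l m⁺
            ≈⟨ solve 4 (λ W x d y → W :* x :- (d :* W) :* y := W :* (x :- d :* y)) refl W (e (suc l) m⁺) ⌜ + N ℤ.- + l ⌝ (e l m⁺) ⟩
          W * (e (suc l) m⁺ - ⌜ + N ℤ.- + l ⌝ * e l m⁺)
            ≈⟨ *-congˡ (shift-rec m l (ℕP.≤-pred l<m⁺)) ⟩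
          W * ((⌜ + p ⌝ * e l m - ⌜ + p ⌝ * (⌜ + N ℤ.- + m⁺ ⌝ * e l m⁺)) + ⌜ ε ⌝ * e l m⁺)
            ≈⟨ solve 6 (λ W p f d E ε → W :* ((p :* f :- p :* (d :* E)) :+ ε :* E) := p :* (W :* f) :+ (ε :- p :* d) :* (W :* E)) refl W ⌜ + p ⌝ (e l m) ⌜ + N ℤ.- + m⁺ ⌝ (e l m⁺) ⌜ ε ⌝ ⟩
          ⌜ + p ⌝ * (W * e l m) + (⌜ ε ⌝ - ⌜ + p ⌝ * ⌜ + N ℤ.- + m⁺ ⌝) * (W * e l m⁺) ∎
          where
          W : Carrier
          W = ⌜ weight m⁺ (suc l) ⌝

      U-end : U (suc N) ≈ e N N
      U-end = trans (+-cong (∑-zero N (λ l l<N → trans (*-congʳ (≡⇒≈ (≡.cong ⌜_⌝ (weight-end l l<N)))) (zeroˡ _)))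
        (trans (*-congʳ (≡⇒≈ (≡.cong ⌜_⌝ (weight-self (suc N))))) (*-identityˡ _))) (+-identityˡ _)

      lam-e : ∑ (suc N) (λ m → ⌜ falling (+ N) m ⌝ * e 0 m) ≈ lam a N
      lam-e = ∑-cong′ (suc N) (λ m → solve 3 (λ f c u → f :* (c :* con (+ 1) :* u) := f :* c :* u) refl ⌜ falling (+ N) m ⌝ (c w (p ℕ.* m ℕ.+ a)) (u ^ m))

      -- Summation of `diagonal` over m telescopes U. The summand p (e m m) on its right-hand side,
      -- moved to the left, is the origin of the factor 1 - p in the Gross-Koblitz formula.
      trace : (1# - ⌜ + p ⌝) * ∑ (suc N) (λ m → e m m) ≈ (lam a N - ⌜ + p ⌝ * e N N) + ⌜ ε ⌝ * ∑ (suc N) Y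
      trace = begin
        (1# - P) * D ≈⟨ solve 3 (λ P D L → (con (+ 1) :- P) :* D := L :+ ((D :- L) :- P :* D)) refl P D (lam a N) ⟩
        lam a N + ((D - lam a N) - P * D) ≈⟨ +-congˡ (+-congʳ difference) ⟩
        lam a N + ((- (P * U (suc N)) + (P * D + ⌜ ε ⌝ * ∑ (suc N) Y)) - P * D)
          ≈⟨ solve 5 (λ L P V x y → L :+ ((:- (P :* V) :+ (x :+ y)) :- x) := (L :- P :* V) :+ y) refl (lam a N) P (U (suc N)) (P * D) (⌜ ε ⌝ * ∑ (suc N) Y) ⟩
        (lam a N - P * U (suc N)) + ⌜ ε ⌝ * ∑ (suc N) Y ≈⟨ +-congʳ (+-congˡ (-‿cong (*-congˡ U-end))) ⟩
        (lam a N - P * e N N) + ⌜ ε ⌝ * ∑ (suc N) Y ∎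
        where
        P D : Carrier
        P = ⌜ + p ⌝
        D = ∑ (suc N) (λ m → e m m)
        difference : D - lam a N ≈ - (P * U (suc N)) + (P * D + ⌜ ε ⌝ * ∑ (suc N) Y)
        difference = begin
          D - lam a N ≈⟨ +-congˡ (trans (-‿cong (sym lam-e)) (sym (∑-neg (suc N) _))) ⟩
          D + ∑ (suc N) (λ m → - (⌜ falling (+ N) m ⌝ * e 0 m)) ≈⟨ sym (∑-+ (suc N) _ _) ⟩
          ∑ (suc N) (λ m → e m m - ⌜ falling (+ N) m ⌝ * e 0 m) ≈⟨ ∑-cong′ (suc N) diagonal ⟩
          ∑ (suc N) (λ m → (P * U m - P * U (suc m)) + (P * e m m + ⌜ ε ⌝ * Y m)) ≈⟨ trans (∑-+ (suc N) _ _) (+-cong telescoped (trans (∑-+ (suc N) _ _) (+-cong (∑-*ˡ (suc N) _ _) (∑-*ˡ (suc N) _ _)))) ⟩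
          - (P * U (suc N)) + (P * D + ⌜ ε ⌝ * ∑ (suc N) Y) ∎
          where
          telescoped : ∑ (suc N) (λ m → P * U m - P * U (suc m)) ≈ - (P * U (suc N))
          telescoped = begin
            ∑ (suc N) (λ m → P * U m - P * U (suc m)) ≈⟨ ∑-cong′ (suc N) (λ m → solve 2 (λ a b → a :- b := :- (b :- a)) refl (P * U m) (P * U (suc m))) ⟩
            ∑ (suc N) (λ m → - (P * U (suc m) - P * U m)) ≈⟨ ∑-neg (suc N) _ ⟩
            - ∑ (suc N) (λ m → P * U (suc m) - P * U m) ≈⟨ -‿cong (∑-telescope (suc N) (λ m → P * U m)) ⟩
            - (P * U (suc N) - P * 0#) ≈⟨ solve 2 (λ P V → :- (P :* V :- P :* con (+ 0)) := :- (P :* V)) refl P (U (suc N)) ⟩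
            - (P * U (suc N)) ∎

-- The p-adic gamma function

∏ : ℕ → (ℕ → ℤ) → ℤ
∏ zero f = + 1
∏ (suc m) f = ∏ m f ℤ.* f m

module Products (q : ℕ) where
  open Mod q

  ∏-cong : ∀ m {f g : ℕ → ℤ} → (∀ i → i ℕ.< m → f i ≅ g i) → ∏ m f ≅ ∏ m g
  ∏-cong zero h = refl
  ∏-cong (suc m) h = *-cong (∏-cong m (λ i i<m → h i (ℕP.m<n⇒m<1+n i<m))) (h m ℕP.≤-refl)

∏-* : ∀ m f g → ∏ m (λ i → f i ℤ.* g i) ≡ ∏ m f ℤ.* ∏ m g
∏-* zero f g = ≡.refl
∏-* (suc m) f g = ≡.trans (≡.cong (ℤ._* (f m ℤ.* g m)) (∏-* m f g)) (lem (∏ m f) (∏ m g) (f m) (g m))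
  where
  lem : ∀ a b c d → (a ℤ.* b) ℤ.* (c ℤ.* d) ≡ (a ℤ.* c) ℤ.* (b ℤ.* d)
  lem = solve-∀

∏-one : ∀ m → ∏ m (λ _ → + 1) ≡ + 1
∏-one zero = ≡.refl
∏-one (suc m) = ≡.cong (ℤ._* + 1) (∏-one m)

∏-swap : ∀ m l (f : ℕ → ℕ → ℤ) → ∏ m (λ i → ∏ l (f i)) ≡ ∏ l (λ j → ∏ m (λ i → f i j))
∏-swap zero l f = ≡.sym (∏-one l)
∏-swap (suc m) l f = ≡.trans (≡.cong (ℤ._* ∏ l (f m)) (∏-swap m l f)) (≡.sym (∏-* l _ _))

∏-append : ∀ m l f → ∏ (m ℕ.+ l) f ≡ ∏ m f ℤ.* ∏ l (λ i → f (m ℕ.+ i))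
∏-append m zero f = ≡.trans (≡.cong (λ z → ∏ z f) (ℕP.+-identityʳ m)) (≡.sym (ℤP.*-identityʳ _))
∏-append m (suc l) f = ≡.trans (≡.cong (λ z → ∏ z f) (ℕP.+-suc m l))
  (≡.trans (≡.cong (ℤ._* f (m ℕ.+ l)) (∏-append m l f)) (ℤP.*-assoc (∏ m f) _ (f (m ℕ.+ l))))

∏-blocks : ∀ m l f → ∏ (m ℕ.* l) f ≡ ∏ m (λ i → ∏ l (λ j → f (i ℕ.* l ℕ.+ j)))
∏-blocks zero l f = ≡.refl
∏-blocks (suc m) l f = ≡.trans (≡.cong (λ z → ∏ z f) (ℕP.+-comm l (m ℕ.* l))) (≡.trans (∏-append (m ℕ.* l) l f)
  (≡.cong (ℤ._* ∏ l (λ j → f (m ℕ.* l ℕ.+ j))) (∏-blocks m l f)))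

∏-const : ∀ m a → ∏ m (λ _ → a) ≡ a ℤ.^ m
∏-const zero a = ≡.refl
∏-const (suc m) a = ≡.trans (≡.cong (ℤ._* a) (∏-const m a)) (ℤP.*-comm (a ℤ.^ m) a)

∏-^ : ∀ m f d → ∏ m (λ i → f i ℤ.^ d) ≡ ∏ m f ℤ.^ d
∏-^ m f zero = ∏-one m
∏-^ m f (suc d) = ≡.trans (∏-* m f (λ i → f i ℤ.^ d)) (≡.cong (∏ m f ℤ.*_) (∏-^ m f d))

module GammaFactors (n : ℕ) (pp : Prime (suc n)) where
  open Residue n pp
  private module P = Mod p

  -- The functional equation of Γ_p: the quotient Γ_p(j + 1)/Γ_p(j) is -j if p does not divide j,
  -- and -1 otherwise.
  factorᵈ : ∀ j → Dec (+ j P.≅ + 0) → ℤ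
  factorᵈ j (yes _) = ℤ.- + 1
  factorᵈ j (no _) = ℤ.- + j

  factor : ℕ → ℤ
  factor j = factorᵈ j (≅0? (+ j))

  factor-∣ : ∀ {j} → + j P.≅ + 0 → factor j ≡ ℤ.- + 1
  factor-∣ {j} e with ≅0? (+ j)
  ... | yes _ = ≡.refl
  ... | no ne = ⊥-elim (ne e)

  factor-∤ : ∀ {j} → p∤ + j → factor j ≡ ℤ.- + j
  factor-∤ {j} ne with ≅0? (+ j)
  ... | yes e = ⊥-elim (ne e)
  ... | no _ = ≡.refl

  private
    nonzero? : (j : ℕ) → Dec (¬ j ≡ 0)
    nonzero? j = ¬? (j ℕ.≟ 0)
    coprime? : (j : ℕ) → Dec (¬ ((+ j) mod' p) ≡ 0)
    coprime? j = ¬? (((+ j) mod' p) ℕ.≟ 0)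
    mul : ℕ → ℤ → ℤ
    mul j acc = + j ℤ.* acc
    kept : List ℕ → List ℕ
    kept xs = List.filter coprime? (List.filter nonzero? xs)

    mul-foldr : ∀ xs v → List.foldr mul v xs ≡ List.foldr mul (+ 1) xs ℤ.* v
    mul-foldr [] v = ≡.sym (ℤP.*-identityˡ v)
    mul-foldr (x ∷ xs) v = ≡.trans (≡.cong (+ x ℤ.*_) (mul-foldr xs v)) (≡.sym (ℤP.*-assoc (+ x) _ v))

    %≡0⇒ : ∀ j → (+ j) mod' p ≡ 0 → + j P.≅ + 0
    %≡0⇒ j e = P.trans (residue (+ j)) (P.≡⇒≈ (≡.cong +_ e))

    ⇒%≡0 : ∀ j → + j P.≅ + 0 → (+ j) mod' p ≡ 0
    ⇒%≡0 j e = ℕD.n∣m⇒m%n≡0 j p (divides-∣∣ (+ j) e)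

    single : ∀ j → sgnPow 1 ℤ.* List.foldr mul (+ 1) (kept (j ∷ [])) ≡ factor j
    single j = go (j ℕ.≟ 0) (((+ j) mod' p) ℕ.≟ 0)
      where
      go : Dec (j ≡ 0) → Dec ((+ j) mod' p ≡ 0) → sgnPow 1 ℤ.* List.foldr mul (+ 1) (kept (j ∷ [])) ≡ factor j
      go (yes ≡.refl) _ = ≡.sym (factor-∣ P.refl)
      go (no j≢0) (yes e) = ≡.trans (≡.cong (λ xs → sgnPow 1 ℤ.* List.foldr mul (+ 1) xs)
        (≡.trans (≡.cong (List.filter coprime?) (ListP.filter-accept nonzero? {j} {[]} j≢0)) (ListP.filter-reject coprime? {j} {[]} (λ ne → ne e))))
        (≡.sym (factor-∣ (%≡0⇒ j e)))
      go (no j≢0) (no ne) = ≡.trans (≡.cong (λ xs → sgnPow 1 ℤ.* List.foldr mul (+ 1) xs)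
        (≡.trans (≡.cong (List.filter coprime?) (ListP.filter-accept nonzero? {j} {[]} j≢0)) (ListP.filter-accept coprime? {j} {[]} ne)))
        (≡.trans (lem (+ j)) (≡.sym (factor-∤ (λ e → ne (⇒%≡0 j e)))))
        where
        lem : ∀ j → (ℤ.- + 1 ℤ.* + 1) ℤ.* (j ℤ.* + 1) ≡ ℤ.- j
        lem = solve-∀

  Γ : ℕ → ℤ
  Γ = ΓpNat p

  Γ-suc : ∀ m → Γ (suc m) ≡ Γ m ℤ.* factor m
  Γ-suc m = ≡.trans (≡.cong (λ xs → sgnPow (suc m) ℤ.* List.foldr mul (+ 1) (kept xs)) (≡.sym (ListP.upTo-∷ʳ m)))
    (≡.trans (≡.cong (λ xs → sgnPow (suc m) ℤ.* List.foldr mul (+ 1) xs)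
      (≡.trans (≡.cong (List.filter coprime?) (ListP.filter-++ nonzero? (List.upTo m) (m ∷ [])))
        (ListP.filter-++ coprime? (List.filter nonzero? (List.upTo m)) (List.filter nonzero? (m ∷ [])))))
    (≡.trans (≡.cong (sgnPow (suc m) ℤ.*_) (≡.trans (ListP.foldr-++ mul (+ 1) (kept (List.upTo m)) (kept (m ∷ []))) (mul-foldr (kept (List.upTo m)) _)))
    (≡.trans (lem (sgnPow m) (List.foldr mul (+ 1) (kept (List.upTo m))) (List.foldr mul (+ 1) (kept (m ∷ []))))
      (≡.cong (Γ m ℤ.*_) (single m)))))
    where
    lem : ∀ s a b → ((ℤ.- + 1) ℤ.* s) ℤ.* (a ℤ.* b) ≡ (s ℤ.* a) ℤ.* ((ℤ.- + 1 ℤ.* + 1) ℤ.* b)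
    lem = solve-∀

  Γ-∏ : ∀ m → Γ m ≡ ∏ m factor
  Γ-∏ zero = ≡.refl
  Γ-∏ (suc m) = ≡.trans (Γ-suc m) (≡.cong (ℤ._* factor m) (Γ-∏ m))

  factor-unit : ∀ j → p∤ factor j
  factor-unit j with ≅0? (+ j)
  ... | yes _ = λ e → ∤-1 (P.trans (P.-‿cong e) P.refl)
  ... | no ne = λ e → ne (P.trans (P.≡⇒≈ (≡.sym (ℤP.neg-involutive (+ j)))) (P.-‿cong e))

  Γ-unit : ∀ m → p∤ Γ m
  Γ-unit zero = ∤-1
  Γ-unit (suc m) e = ∤-* (Γ-unit m) (factor-unit m) (P.trans (P.≡⇒≈ (≡.sym (Γ-suc m))) e)

  countᵈ : ∀ j → Dec (+ j P.≅ + 0) → ℕ → ℕ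
  countᵈ j (yes _) c = c
  countᵈ j (no _) c = suc c

  -- The number of integers below the argument that are prime to p. It is the exponent of -1 in the
  -- reflection formula and of 2 in the duplication formula.
  count : ℕ → ℕ
  count zero = 0
  count (suc j) = countᵈ j (≅0? (+ j)) (count j)

  count-∣ : ∀ {j} → + j P.≅ + 0 → count (suc j) ≡ count j
  count-∣ {j} e with ≅0? (+ j)
  ... | yes _ = ≡.refl
  ... | no ne = ⊥-elim (ne e)

  count-∤ : ∀ {j} → p∤ + j → count (suc j) ≡ suc (count j)
  count-∤ {j} ne with ≅0? (+ j)
  ... | yes e = ⊥-elim (ne e)
  ... | no _ = ≡.refl

  pm≅0 : ∀ m → + (p ℕ.* m) P.≅ + 0
  pm≅0 m = P.trans (P.≡⇒≈ (≡.trans (ℤP.pos-* p m) (ℤP.*-comm (+ p) (+ m)))) (P.multiple (+ m))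

  ∤-pm+ : ∀ m {r} → 0 ℕ.< r → r ℕ.< p → p∤ + (p ℕ.* m ℕ.+ r)
  ∤-pm+ m {r} 0<r r<p e = ∤-small 0<r r<p (P.trans (P.≡⇒≈ (≡.sym (ℤP.+-identityˡ (+ r)))) (P.trans (P.+ʳ (+ r) (P.sym (pm≅0 m))) e))

  count-+p : ∀ y m → count (y ℕ.+ p ℕ.* m) ≡ count y ℕ.+ n ℕ.* m
  count-block : ∀ m r → r ℕ.≤ n → count (p ℕ.* m ℕ.+ suc r) ≡ count (p ℕ.* m) ℕ.+ r
  count-block m zero _ = ≡.trans (≡.cong count (≡.trans (ℕP.+-suc (p ℕ.* m) 0) (≡.cong suc (ℕP.+-identityʳ (p ℕ.* m)))))
    (≡.trans (count-∣ (pm≅0 m)) (≡.sym (ℕP.+-identityʳ _)))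
  count-block m (suc r) r<n = ≡.trans (≡.cong count (ℕP.+-suc (p ℕ.* m) (suc r)))
    (≡.trans (count-∤ (∤-pm+ m (s≤s z≤n) (s≤s r<n))) (≡.trans (≡.cong suc (count-block m r (ℕP.<⇒≤ r<n))) (≡.sym (ℕP.+-suc (count (p ℕ.* m)) r))))

  count-pm : ∀ m → count (p ℕ.* m) ≡ n ℕ.* m
  count-pm zero = ≡.trans (≡.cong count (ℕP.*-zeroʳ p)) (≡.sym (ℕP.*-zeroʳ n))
  count-pm (suc m) = ≡.trans (≡.cong count (≡.trans (ℕP.*-suc p m) (ℕP.+-comm p (p ℕ.* m))))
    (≡.trans (count-block m n ℕP.≤-refl) (≡.trans (≡.cong (ℕ._+ n) (count-pm m)) (≡.trans (ℕP.+-comm (n ℕ.* m) n) (≡.sym (ℕP.*-suc n m)))))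

  count-+p zero m = count-pm m
  count-+p (suc y) m = go (≅0? (+ y))
    where
    shift : + (y ℕ.+ p ℕ.* m) P.≅ + y
    shift = P.trans (P.+ˡ (+ y) (pm≅0 m)) (P.≡⇒≈ (ℤP.+-identityʳ (+ y)))
    go : Dec (+ y P.≅ + 0) → count (suc y ℕ.+ p ℕ.* m) ≡ count (suc y) ℕ.+ n ℕ.* m
    go (yes e) = ≡.trans (count-∣ (P.trans shift e)) (≡.trans (count-+p y m) (≡.cong (ℕ._+ n ℕ.* m) (≡.sym (count-∣ e))))
    go (no ne) = ≡.trans (count-∤ (λ e → ne (P.trans (P.sym shift) e))) (≡.trans (≡.cong suc (count-+p y m)) (≡.cong (ℕ._+ n ℕ.* m) (≡.sym (count-∤ ne))))

triangle : ℕ → ℕ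
triangle zero = 0
triangle (suc m) = triangle m ℕ.+ m

triangle-double : ∀ m → triangle m ℕ.+ triangle m ℕ.+ m ≡ m ℕ.* m
triangle-double zero = ≡.refl
triangle-double (suc m) = ≡.trans (lem (triangle m) m) (≡.trans (≡.cong (ℕ._+ (1 ℕ.+ (m ℕ.+ m))) (triangle-double m)) (lem₂ m))
  where
  lem : ∀ t m → (t ℕ.+ m) ℕ.+ (t ℕ.+ m) ℕ.+ (1 ℕ.+ m) ≡ (t ℕ.+ t ℕ.+ m) ℕ.+ (1 ℕ.+ (m ℕ.+ m))
  lem = ℕSolver.solve-∀
  lem₂ : ∀ m → m ℕ.* m ℕ.+ (1 ℕ.+ (m ℕ.+ m)) ≡ (1 ℕ.+ m) ℕ.* (1 ℕ.+ m)
  lem₂ = ℕSolver.solve-∀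

≅-mod-1 : ∀ x y → x ≅ y [mod 1 ]
≅-mod-1 x y = by-quotient (x ℤ.- y) (lem x y)
  where
  lem : ∀ x y → x ≡ y ℤ.+ (x ℤ.- y) ℤ.* + 1
  lem = solve-∀

module GammaWilson (n : ℕ) (pp : Prime (suc n)) (h : ℕ) (n≡2h : n ≡ h ℕ.+ h) where
  open Residue n pp
  open GammaFactors n pp
  private module P = Mod p

  triangle-p : triangle p ≡ p ℕ.* h
  triangle-p = ℕP.*-cancelˡ-≡ (triangle p) (p ℕ.* h) 2 (ℕP.+-cancelʳ-≡ p _ _
    (≡.trans (≡.cong (λ z → triangle p ℕ.+ z ℕ.+ p) (ℕP.+-identityʳ (triangle p))) (≡.trans (triangle-double p)
      (≡.trans (≡.cong (λ z → p ℕ.* suc z) n≡2h) (lem p h)))))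
    where
    lem : ∀ p h → p ℕ.* (1 ℕ.+ (h ℕ.+ h)) ≡ 2 ℕ.* (p ℕ.* h) ℕ.+ p
    lem = ℕSolver.solve-∀

  Γ-rootProduct : ∀ m → m ℕ.≤ n → Γ (suc m) ≡ ℤ.- + 1 ℤ.* rootProduct m (+ 0)
  Γ-rootProduct zero _ = Γ-suc 0
  Γ-rootProduct (suc m) m<n = ≡.trans (Γ-suc (suc m)) (≡.trans (≡.cong₂ ℤ._*_ (Γ-rootProduct m (ℕP.<⇒≤ m<n)) (factor-∤ (∤-small (s≤s z≤n) (s≤s m<n))))
    (lem (rootProduct m (+ 0)) (+ suc m)))
    where
    lem : ∀ r m → (ℤ.- + 1 ℤ.* r) ℤ.* (ℤ.- m) ≡ ℤ.- + 1 ℤ.* (r ℤ.* (+ 0 ℤ.- m))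
    lem = solve-∀

  module Column (j : ℕ) where
    private
      q : ℕ
      q = p ℕ.^ suc j
    open Mod (p ℕ.* q)
    open ≈-Reasoning
    open Products (p ℕ.* q)
    module T = Teichmüller n pp (suc (suc j))

    q²≅0 : ∀ z → z ℤ.* (+ q ℤ.* + q) ≅ + 0
    q²≅0 z = trans (≡⇒≈ (≡.trans (≡.cong (λ x → z ℤ.* (x ℤ.* + q)) (≡.trans (ℤP.pos-* p (p ℕ.^ j)) (ℤP.*-comm (+ p) (+ (p ℕ.^ j)))))
      (≡.trans (lem z (+ (p ℕ.^ j)) (+ p) (+ q)) (≡.cong (λ x → (z ℤ.* + (p ℕ.^ j)) ℤ.* x) (≡.sym (ℤP.pos-* p q)))))) (multiple (z ℤ.* + (p ℕ.^ j)))
      where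
      lem : ∀ z r p q → z ℤ.* ((r ℤ.* p) ℤ.* q) ≡ (z ℤ.* r) ℤ.* (p ℤ.* q)
      lem = solve-∀

    -- Expansion to first order in q, as q² ≡ 0 modulo pq. The factor y on the left makes room for
    -- the correction y^(m-1) without a truncated exponent.
    shifted-product : ∀ y m → y ℤ.* ∏ m (λ i → y ℤ.- + (i ℕ.* q)) ≅ y ℤ.^ m ℤ.* (y ℤ.- + triangle m ℤ.* + q)
    shifted-product y zero = ≡⇒≈ (lem y (+ q))
      where
      lem : ∀ y q → y ℤ.* + 1 ≡ + 1 ℤ.* (y ℤ.- + 0 ℤ.* q)
      lem = solve-∀
    shifted-product y (suc m) = begin
      y ℤ.* (∏ m (λ i → y ℤ.- + (i ℕ.* q)) ℤ.* (y ℤ.- + (m ℕ.* q)))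
        ≡⟨ ≡.sym (ℤP.*-assoc y _ _) ⟩
      (y ℤ.* ∏ m (λ i → y ℤ.- + (i ℕ.* q))) ℤ.* (y ℤ.- + (m ℕ.* q))
        ≈⟨ *ʳ (y ℤ.- + (m ℕ.* q)) (shifted-product y m) ⟩
      (y ℤ.^ m ℤ.* (y ℤ.- + triangle m ℤ.* + q)) ℤ.* (y ℤ.- + (m ℕ.* q))
        ≡⟨ ≡.trans (≡.cong (λ z → (y ℤ.^ m ℤ.* (y ℤ.- + triangle m ℤ.* + q)) ℤ.* (y ℤ.- z)) (ℤP.pos-* m q)) (lem (y ℤ.^ m) y (+ triangle m) (+ m) (+ q)) ⟩
      (y ℤ.* y ℤ.^ m) ℤ.* (y ℤ.- (+ triangle m ℤ.+ + m) ℤ.* + q) ℤ.+ (y ℤ.^ m ℤ.* (+ triangle m ℤ.* + m)) ℤ.* (+ q ℤ.* + q)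
        ≈⟨ +ˡ (y ℤ.^ suc m ℤ.* (y ℤ.- + triangle (suc m) ℤ.* + q)) (q²≅0 (y ℤ.^ m ℤ.* (+ triangle m ℤ.* + m))) ⟩
      y ℤ.^ suc m ℤ.* (y ℤ.- + triangle (suc m) ℤ.* + q) ℤ.+ + 0
        ≡⟨ ℤP.+-identityʳ _ ⟩
      y ℤ.^ suc m ℤ.* (y ℤ.- + triangle (suc m) ℤ.* + q) ∎
      where
      lem : ∀ u y t m q → (u ℤ.* (y ℤ.- t ℤ.* q)) ℤ.* (y ℤ.- m ℤ.* q) ≡ (y ℤ.* u) ℤ.* (y ℤ.- (t ℤ.+ m) ℤ.* q) ℤ.+ (u ℤ.* (t ℤ.* m)) ℤ.* (q ℤ.* q)
      lem = solve-∀

    iq≅0 : ∀ i → + (i ℕ.* q) P.≅ + 0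
    iq≅0 i = P.trans (P.≡⇒≈ (≡.cong +_ (lem i p (p ℕ.^ j)))) (pm≅0 (i ℕ.* p ℕ.^ j))
      where
      lem : ∀ i p r → i ℕ.* (p ℕ.* r) ≡ p ℕ.* (i ℕ.* r)
      lem = ℕSolver.solve-∀

    shift-≅ : ∀ i x → + (i ℕ.* q ℕ.+ x) P.≅ + x
    shift-≅ i x = P.trans (P.+ʳ (+ x) (iq≅0 i)) (P.≡⇒≈ (ℤP.+-identityˡ (+ x)))

    -- The linear correction carries 0 + 1 + ... + (p-1) = ph, a multiple of p because p is odd, and
    -- so it vanishes modulo pq.
    column : ∀ x → Dec (+ x P.≅ + 0) → ∏ p (λ i → factor (i ℕ.* q ℕ.+ x)) ≅ factor x ℤ.^ p
    column x (yes e) = trans (∏-cong p (λ i _ → ≡⇒≈ (≡.trans (factor-∣ (P.trans (shift-≅ i x) e)) (≡.sym (factor-∣ e))))) (≡⇒≈ (∏-const p (factor x)))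
    column x (no ne) = T.cancelᴹ y p∤y (begin
      y ℤ.* ∏ p (λ i → factor (i ℕ.* q ℕ.+ x))
        ≈⟨ *ˡ y (∏-cong p (λ i _ → ≡⇒≈ (≡.trans (factor-∤ (λ e → ne (P.trans (P.sym (shift-≅ i x)) e)))
             (≡.trans (≡.cong ℤ.-_ (ℤP.+-comm (+ (i ℕ.* q)) (+ x))) (ℤP.neg-distrib-+ (+ x) (+ (i ℕ.* q))))))) ⟩
      y ℤ.* ∏ p (λ i → y ℤ.- + (i ℕ.* q)) ≈⟨ shifted-product y p ⟩
      y ℤ.^ p ℤ.* (y ℤ.- + triangle p ℤ.* + q) ≈⟨ *ˡ (y ℤ.^ p) (+ˡ y (-‿cong correction)) ⟩
      y ℤ.^ p ℤ.* (y ℤ.- + 0) ≡⟨ lem (y ℤ.^ p) y ⟩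
      y ℤ.* y ℤ.^ p ≡⟨ ≡.cong (λ z → y ℤ.* z ℤ.^ p) (≡.sym (factor-∤ ne)) ⟩
      y ℤ.* factor x ℤ.^ p ∎)
      where
      y : ℤ
      y = ℤ.- + x
      p∤y : p∤ y
      p∤y e = ne (P.trans (P.≡⇒≈ (≡.sym (ℤP.neg-involutive (+ x)))) (P.-‿cong e))
      lem : ∀ u y → u ℤ.* (y ℤ.- + 0) ≡ y ℤ.* u
      lem = solve-∀
      lem₂ : ∀ p h q → (p ℕ.* h) ℕ.* q ≡ h ℕ.* (p ℕ.* q)
      lem₂ = ℕSolver.solve-∀
      correction : + triangle p ℤ.* + q ≅ + 0
      correction = trans (≡⇒≈ (≡.trans (≡.sym (ℤP.pos-* (triangle p) q)) (≡.trans (≡.cong +_ (≡.trans (≡.cong (ℕ._* q) triangle-p) (lem₂ p h q)))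
        (ℤP.pos-* h (p ℕ.* q))))) (multiple (+ h))

    -- Arranging the pq factors in columns of p arguments congruent modulo q gives Γ(pq) ≡ Γ(q)^p,
    -- and taking the p-th power raises the precision of Γ(q) ≡ 1 by one.
    Γ-step : Γ q ≅ + 1 [mod q ] → Γ (p ℕ.* q) ≅ + 1
    Γ-step ih = begin
      Γ (p ℕ.* q) ≡⟨ ≡.trans (Γ-∏ (p ℕ.* q)) (∏-blocks p q factor) ⟩
      ∏ p (λ i → ∏ q (λ x → factor (i ℕ.* q ℕ.+ x))) ≡⟨ ∏-swap p q (λ i x → factor (i ℕ.* q ℕ.+ x)) ⟩
      ∏ q (λ x → ∏ p (λ i → factor (i ℕ.* q ℕ.+ x))) ≈⟨ ∏-cong q (λ x _ → column x (≅0? (+ x))) ⟩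
      ∏ q (λ x → factor x ℤ.^ p) ≡⟨ ≡.trans (∏-^ q factor p) (≡.cong (ℤ._^ p) (≡.sym (Γ-∏ q))) ⟩
      Γ q ℤ.^ p ≈⟨ lift-step j ih ⟩
      (+ 1) ℤ.^ p ≡⟨ ℤP.^-zeroˡ p ⟩
      + 1 ∎

  -- Wilson's theorem modulo p^k: the units have product -1, and the sign in Γ_p turns it into 1.
  Γ-prime-power : ∀ k → Γ (p ℕ.^ k) ≅ + 1 [mod p ℕ.^ k ]
  Γ-prime-power zero = ≅-mod-1 _ _
  Γ-prime-power (suc zero) = ≡.subst (λ q → Γ q ≅ + 1 [mod q ]) (≡.sym (ℕP.*-identityʳ p))
    (P.trans (P.≡⇒≈ (Γ-rootProduct n ℕP.≤-refl)) (P.*ˡ (ℤ.- + 1) wilson))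
  Γ-prime-power (suc (suc k)) = Column.Γ-step k (Γ-prime-power (suc k))

module GammaLevel (n : ℕ) (pp : Prime (suc n)) (h : ℕ) (n≡2h : n ≡ h ℕ.+ h) (k : ℕ) where
  open Teichmüller n pp k public
  open Residue n pp public
  open GammaFactors n pp public
  open GammaWilson n pp h n≡2h using (Γ-prime-power)
  private module P = Mod p
  open Mod M
  open ≈-Reasoning

  to-p : ∀ {j} → k ≡ suc j → ∀ {x y} → x ≅ y → x P.≅ y
  to-p {j} ≡.refl = weaken {p ℕ.^ j} (ℕP.*-comm (p ℕ.^ j) p)

  -- For k = 0 all congruences mod p^k hold trivially, so only k ≥ 1 needs an argument.
  by-level : ∀ {x y} → (∀ j → k ≡ suc j → x ≅ y) → x ≅ y
  by-level {x} {y} f = go k ≡.refl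
    where
    go : ∀ k′ → k ≡ k′ → x ≅ y
    go zero e = ≡.subst (λ k → x ≅ y [mod p ℕ.^ k ]) (≡.sym e) (≅-mod-1 x y)
    go (suc j) e = f j e

  factor-cong : ∀ {x y} → + x ≅ + y → factor x ≅ factor y
  factor-cong {x} {y} e = by-level λ j k≡ → go (to-p k≡ e) (≅0? (+ x))
    where
    go : + x P.≅ + y → Dec (+ x P.≅ + 0) → factor x ≅ factor y
    go x≅y (yes d) = ≡⇒≈ (≡.trans (factor-∣ d) (≡.sym (factor-∣ (P.trans (P.sym x≅y) d))))
    go x≅y (no nd) = trans (≡⇒≈ (factor-∤ nd)) (trans (-‿cong e) (≡⇒≈ (≡.sym (factor-∤ (λ d → nd (P.trans x≅y d))))))

  -- The p-adic continuity of Γ_p. One full period contributes Γ(p^k) ≡ 1, and the factors at x and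
  -- x + M agree modulo p^k.
  Γ-+M : ∀ x → Γ (x ℕ.+ M) ≅ Γ x
  Γ-+M zero = Γ-prime-power k
  Γ-+M (suc x) = begin
    Γ (suc (x ℕ.+ M)) ≡⟨ Γ-suc (x ℕ.+ M) ⟩
    Γ (x ℕ.+ M) ℤ.* factor (x ℕ.+ M) ≈⟨ *-cong (Γ-+M x) (factor-cong {x ℕ.+ M} {x} (trans (+ˡ (+ x) modulus) (≡⇒≈ (ℤP.+-identityʳ (+ x))))) ⟩
    Γ x ℤ.* factor x ≡⟨ ≡.sym (Γ-suc x) ⟩
    Γ (suc x) ∎

  Γ-+*M : ∀ x d → Γ (x ℕ.+ d ℕ.* M) ≅ Γ x
  Γ-+*M x zero = ≡⇒≈ (≡.cong Γ (ℕP.+-identityʳ x))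
  Γ-+*M x (suc d) = trans (≡⇒≈ (≡.cong Γ (lem x M (d ℕ.* M)))) (trans (Γ-+M (x ℕ.+ d ℕ.* M)) (Γ-+*M x d))
    where
    lem : ∀ x M y → x ℕ.+ (M ℕ.+ y) ≡ (x ℕ.+ y) ℕ.+ M
    lem = ℕSolver.solve-∀

  Γ-cong : ∀ {x y} → + x ≅ + y → Γ x ≅ Γ y
  Γ-cong {x} {y} (by-quotient (+ d) e) = trans (≡⇒≈ (≡.cong Γ (ℤP.+-injective (≡.trans e (≡.trans (≡.cong (λ z → + y ℤ.+ z) (≡.sym (ℤP.pos-* d M))) ≡.refl))))) (Γ-+*M y d)
  Γ-cong {x} {y} (by-quotient -[1+ d ] e) = sym (trans (≡⇒≈ (≡.cong Γ (ℤP.+-injective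
    (≡.trans (≡.trans (lem (+ y) -[1+ d ] (+ M)) (≡.cong (ℤ._+ + suc d ℤ.* + M) (≡.sym e))) (≡.cong (λ z → + x ℤ.+ z) (≡.sym (ℤP.pos-* (suc d) M))))))) (Γ-+*M x (suc d)))
    where
    lem : ∀ y d M → y ≡ (y ℤ.+ d ℤ.* M) ℤ.+ (ℤ.- d) ℤ.* M
    lem = solve-∀

  -- The induction moves one factor from Γ x to Γ y. Since y ≡ -x these factors agree up to a sign,
  -- which changes exactly when x is prime to p.
  Γ-reflection : ∀ x y → + (x ℕ.+ y) ≅ + 1 → Γ x ℤ.* Γ y ≅ ℤ.- (ℤ.- + 1) ℤ.^ count x
  Γ-reflection zero y e = trans (≡⇒≈ (ℤP.*-identityˡ (Γ y))) (trans (Γ-cong {y} {1} e) (≡⇒≈ (Γ-suc 0)))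
  Γ-reflection (suc x) y e = by-level λ j k≡ → go k≡ (≅0? (+ x))
    where
    ih : Γ x ℤ.* Γ (suc y) ≅ ℤ.- (ℤ.- + 1) ℤ.^ count x
    ih = Γ-reflection x (suc y) (trans (≡⇒≈ (≡.cong +_ (ℕP.+-suc x y))) e)
    x+y≅0 : + x ℤ.+ + y ≅ + 0
    x+y≅0 = trans (≡⇒≈ (lem (+ x) (+ y))) (x≈y⇒x-y≈0 e)
      where
      lem : ∀ x y → x ℤ.+ y ≡ (+ 1 ℤ.+ x ℤ.+ y) ℤ.- + 1
      lem = solve-∀
    y≅-x : + y ≅ ℤ.- + x
    y≅-x = trans (≡⇒≈ (lem (+ x) (+ y))) (trans (+ʳ (ℤ.- + x) x+y≅0) (≡⇒≈ (ℤP.+-identityˡ (ℤ.- + x))))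
      where
      lem : ∀ x y → y ≡ (x ℤ.+ y) ℤ.+ ℤ.- x
      lem = solve-∀
    go : ∀ {j} → k ≡ suc j → Dec (+ x P.≅ + 0) → Γ (suc x) ℤ.* Γ y ≅ ℤ.- (ℤ.- + 1) ℤ.^ count (suc x)
    go k≡ (yes d) = begin
      Γ (suc x) ℤ.* Γ y ≡⟨ ≡.trans (≡.cong (ℤ._* Γ y) (≡.trans (Γ-suc x) (≡.cong (Γ x ℤ.*_) (factor-∣ d)))) (lem (Γ x) (Γ y)) ⟩
      Γ x ℤ.* (Γ y ℤ.* (ℤ.- + 1)) ≡⟨ ≡.cong (Γ x ℤ.*_) (≡.sym (≡.trans (Γ-suc y) (≡.cong (Γ y ℤ.*_) (factor-∣ y≅0)))) ⟩
      Γ x ℤ.* Γ (suc y) ≈⟨ ih ⟩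
      ℤ.- (ℤ.- + 1) ℤ.^ count x ≡⟨ ≡.cong (λ z → ℤ.- (ℤ.- + 1) ℤ.^ z) (≡.sym (count-∣ d)) ⟩
      ℤ.- (ℤ.- + 1) ℤ.^ count (suc x) ∎
      where
      y≅0 : + y P.≅ + 0
      y≅0 = P.trans (to-p k≡ y≅-x) (P.-‿cong d)
      lem : ∀ a b → (a ℤ.* (ℤ.- + 1)) ℤ.* b ≡ a ℤ.* (b ℤ.* (ℤ.- + 1))
      lem = solve-∀
    go k≡ (no nd) = begin
      Γ (suc x) ℤ.* Γ y ≡⟨ ≡.trans (≡.cong (ℤ._* Γ y) (≡.trans (Γ-suc x) (≡.cong (Γ x ℤ.*_) (factor-∤ nd)))) (lem (Γ x) (+ x) (Γ y)) ⟩
      (Γ x ℤ.* Γ y) ℤ.* (ℤ.- + x) ≈⟨ *ˡ (Γ x ℤ.* Γ y) (sym y≅-x) ⟩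
      (Γ x ℤ.* Γ y) ℤ.* + y ≡⟨ lem₂ (Γ x) (Γ y) (+ y) ⟩
      ℤ.- (Γ x ℤ.* (Γ y ℤ.* (ℤ.- + y))) ≡⟨ ≡.cong (λ z → ℤ.- (Γ x ℤ.* z)) (≡.sym (≡.trans (Γ-suc y) (≡.cong (Γ y ℤ.*_) (factor-∤ p∤y)))) ⟩
      ℤ.- (Γ x ℤ.* Γ (suc y)) ≈⟨ -‿cong ih ⟩
      ℤ.- ℤ.- (ℤ.- + 1) ℤ.^ count x ≡⟨ ≡.trans (lem₃ ((ℤ.- + 1) ℤ.^ count x)) (≡.cong (λ z → ℤ.- (ℤ.- + 1) ℤ.^ z) (≡.sym (count-∤ nd))) ⟩
      ℤ.- (ℤ.- + 1) ℤ.^ count (suc x) ∎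
      where
      p∤y : p∤ + y
      p∤y d = nd (P.trans (P.≡⇒≈ (≡.sym (ℤP.neg-involutive (+ x)))) (P.-‿cong (P.trans (P.sym (to-p k≡ y≅-x)) d)))
      lem : ∀ a x b → (a ℤ.* (ℤ.- x)) ℤ.* b ≡ (a ℤ.* b) ℤ.* (ℤ.- x)
      lem = solve-∀
      lem₂ : ∀ a b y → (a ℤ.* b) ℤ.* y ≡ ℤ.- (a ℤ.* (b ℤ.* (ℤ.- y)))
      lem₂ = solve-∀
      lem₃ : ∀ s → ℤ.- (ℤ.- s) ≡ ℤ.- (ℤ.- + 1 ℤ.* s)
      lem₃ = solve-∀

  -- Passing from x to x + 1 adds the factors at 2x and at 2x + 1 ≡ 2(x + H). They are those of Γ x
  -- and Γ (x + H) up to one 2 for each argument prime to p, which is just what `count` records.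
  Γ-duplication : ∀ H → + (2 ℕ.* H) ≅ + 1 → p∤ + 2 → ∀ x →
    Γ (2 ℕ.* x) ℤ.* Γ H ≅ (+ 2) ℤ.^ count (2 ℕ.* x) ℤ.* (Γ x ℤ.* Γ (x ℕ.+ H))
  Γ-duplication H 2H≅1 p∤2 zero = ≡⇒≈ (≡.sym (ℤP.*-identityˡ _))
  Γ-duplication H 2H≅1 p∤2 (suc x) = by-level λ j k≡ → go k≡
    where
    e : ℕ
    e = 2 ℕ.* x
    2+e : 2 ℕ.* suc x ≡ suc (suc e)
    2+e = ℕP.*-suc 2 x
    halve : + 2 ℤ.* + (x ℕ.+ H) ≅ + suc e
    halve = trans (≡⇒≈ (≡.trans (≡.sym (ℤP.pos-* 2 (x ℕ.+ H))) (≡.trans (≡.cong +_ (ℕP.*-distribˡ-+ 2 x H)) ≡.refl)))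
      (trans (+ˡ (+ e) 2H≅1) (≡⇒≈ (ℤP.+-comm (+ e) (+ 1))))
    ih : Γ e ℤ.* Γ H ≅ (+ 2) ℤ.^ count e ℤ.* (Γ x ℤ.* Γ (x ℕ.+ H))
    ih = Γ-duplication H 2H≅1 p∤2 x
    even-factor : ∃ λ ε → (count (suc e) ≡ ε ℕ.+ count e) × (factor e ≡ (+ 2) ℤ.^ ε ℤ.* factor x)
    even-factor = split (≅0? (+ x))
      where
      e≡ : + e ≡ + 2 ℤ.* + x
      e≡ = ℤP.pos-* 2 x
      split : Dec (+ x P.≅ + 0) → ∃ λ ε → (count (suc e) ≡ ε ℕ.+ count e) × (factor e ≡ (+ 2) ℤ.^ ε ℤ.* factor x)
      split (yes d) = 0 , count-∣ e≅0 , ≡.trans (factor-∣ e≅0) (≡.sym (≡.trans (ℤP.*-identityˡ (factor x)) (factor-∣ d)))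
        where
        e≅0 : + e P.≅ + 0
        e≅0 = P.trans (P.≡⇒≈ e≡) (P.*ˡ (+ 2) d)
      split (no nd) = 1 , count-∤ p∤e , ≡.trans (factor-∤ p∤e) (≡.trans (≡.cong ℤ.-_ e≡) (≡.trans (lem (+ x)) (≡.cong ((+ 2) ℤ.^ 1 ℤ.*_) (≡.sym (factor-∤ nd)))))
        where
        p∤e : p∤ + e
        p∤e = λ d → ∤-* p∤2 nd (P.trans (P.≡⇒≈ (≡.sym e≡)) d)
        lem : ∀ x → ℤ.- (+ 2 ℤ.* x) ≡ (+ 2 ℤ.* + 1) ℤ.* (ℤ.- x)
        lem = solve-∀
    go : ∀ {j} → k ≡ suc j → Γ (2 ℕ.* suc x) ℤ.* Γ H ≅ (+ 2) ℤ.^ count (2 ℕ.* suc x) ℤ.* (Γ (suc x) ℤ.* Γ (suc x ℕ.+ H))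
    go k≡ = combine even-factor (odd-factor (≅0? (+ (x ℕ.+ H))))
      where
      odd-factor : Dec (+ (x ℕ.+ H) P.≅ + 0) → ∃ λ ε → (count (suc (suc e)) ≡ ε ℕ.+ count (suc e)) × (factor (suc e) ≅ (+ 2) ℤ.^ ε ℤ.* factor (x ℕ.+ H))
      odd-factor (yes d) = 0 , count-∣ e≅0 , ≡⇒≈ (≡.trans (factor-∣ e≅0) (≡.sym (≡.trans (ℤP.*-identityˡ (factor (x ℕ.+ H))) (factor-∣ d))))
        where
        e≅0 : + suc e P.≅ + 0
        e≅0 = P.trans (P.sym (to-p k≡ halve)) (P.*ˡ (+ 2) d)
      odd-factor (no nd) = 1 , count-∤ p∤e , trans (≡⇒≈ (factor-∤ p∤e)) (trans (-‿cong (sym halve)) (≡⇒≈ (≡.trans (lem (+ (x ℕ.+ H))) (≡.cong ((+ 2) ℤ.^ 1 ℤ.*_) (≡.sym (factor-∤ nd))))))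
        where
        p∤e : p∤ + suc e
        p∤e = λ d → ∤-* p∤2 nd (P.trans (to-p k≡ halve) d)
        lem : ∀ x → ℤ.- (+ 2 ℤ.* x) ≡ (+ 2 ℤ.* + 1) ℤ.* (ℤ.- x)
        lem = solve-∀
      combine : (∃ λ ε → (count (suc e) ≡ ε ℕ.+ count e) × (factor e ≡ (+ 2) ℤ.^ ε ℤ.* factor x)) →
        (∃ λ ε → (count (suc (suc e)) ≡ ε ℕ.+ count (suc e)) × (factor (suc e) ≅ (+ 2) ℤ.^ ε ℤ.* factor (x ℕ.+ H))) →
        Γ (2 ℕ.* suc x) ℤ.* Γ H ≅ (+ 2) ℤ.^ count (2 ℕ.* suc x) ℤ.* (Γ (suc x) ℤ.* Γ (suc x ℕ.+ H))
      combine (ε , c₁ , f₁) (ε′ , c₂ , f₂) = begin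
        Γ (2 ℕ.* suc x) ℤ.* Γ H
          ≡⟨ ≡.cong (ℤ._* Γ H) (≡.trans (≡.cong Γ 2+e) (≡.trans (Γ-suc (suc e)) (≡.cong (ℤ._* factor (suc e)) (Γ-suc e)))) ⟩
        ((Γ e ℤ.* factor e) ℤ.* factor (suc e)) ℤ.* Γ H
          ≡⟨ lem (Γ e) (factor e) (factor (suc e)) (Γ H) ⟩
        (Γ e ℤ.* Γ H) ℤ.* (factor e ℤ.* factor (suc e))
          ≈⟨ *-cong ih (*-cong (≡⇒≈ f₁) f₂) ⟩
        ((+ 2) ℤ.^ count e ℤ.* (Γ x ℤ.* Γ (x ℕ.+ H))) ℤ.* (((+ 2) ℤ.^ ε ℤ.* factor x) ℤ.* ((+ 2) ℤ.^ ε′ ℤ.* factor (x ℕ.+ H)))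
          ≡⟨ lem₂ ((+ 2) ℤ.^ count e) (Γ x) (Γ (x ℕ.+ H)) ((+ 2) ℤ.^ ε) (factor x) ((+ 2) ℤ.^ ε′) (factor (x ℕ.+ H)) ⟩
        ((+ 2) ℤ.^ ε′ ℤ.* ((+ 2) ℤ.^ ε ℤ.* (+ 2) ℤ.^ count e)) ℤ.* ((Γ x ℤ.* factor x) ℤ.* (Γ (x ℕ.+ H) ℤ.* factor (x ℕ.+ H)))
          ≡⟨ ≡.cong₂ ℤ._*_ power (≡.sym (≡.cong₂ ℤ._*_ (Γ-suc x) (Γ-suc (x ℕ.+ H)))) ⟩
        (+ 2) ℤ.^ count (2 ℕ.* suc x) ℤ.* (Γ (suc x) ℤ.* Γ (suc x ℕ.+ H)) ∎
        where
        lem : ∀ a b c d → ((a ℤ.* b) ℤ.* c) ℤ.* d ≡ (a ℤ.* d) ℤ.* (b ℤ.* c)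
        lem = solve-∀
        lem₂ : ∀ t a b s f s′ f′ → (t ℤ.* (a ℤ.* b)) ℤ.* ((s ℤ.* f) ℤ.* (s′ ℤ.* f′)) ≡ (s′ ℤ.* (s ℤ.* t)) ℤ.* ((a ℤ.* f) ℤ.* (b ℤ.* f′))
        lem₂ = solve-∀
        power : (+ 2) ℤ.^ ε′ ℤ.* ((+ 2) ℤ.^ ε ℤ.* (+ 2) ℤ.^ count e) ≡ (+ 2) ℤ.^ count (2 ℕ.* suc x)
        power = ≡.trans (≡.cong ((+ 2) ℤ.^ ε′ ℤ.*_) (≡.sym (ℤP.^-distribˡ-+-* (+ 2) ε (count e))))
          (≡.trans (≡.sym (ℤP.^-distribˡ-+-* (+ 2) ε′ (ε ℕ.+ count e)))
          (≡.cong ((+ 2) ℤ.^_) (≡.trans (≡.cong (ε′ ℕ.+_) (≡.sym c₁)) (≡.trans (≡.sym c₂) (≡.cong count (≡.sym 2+e))))))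

-1^double : ∀ m → (ℤ.- + 1) ℤ.^ (m ℕ.+ m) ≡ + 1
-1^double m = ≡.trans (ℤP.^-distribˡ-+-* (ℤ.- + 1) m m) (go m)
  where
  lem : ∀ s → (ℤ.- + 1 ℤ.* s) ℤ.* (ℤ.- + 1 ℤ.* s) ≡ s ℤ.* s
  lem = solve-∀
  go : ∀ m → (ℤ.- + 1) ℤ.^ m ℤ.* (ℤ.- + 1) ℤ.^ m ≡ + 1
  go zero = ≡.refl
  go (suc m) = ≡.trans (lem ((ℤ.- + 1) ℤ.^ m)) (go m)

-1^+double : ∀ a m → (ℤ.- + 1) ℤ.^ (a ℕ.+ (m ℕ.+ m)) ≡ (ℤ.- + 1) ℤ.^ a
-1^+double a m = ≡.trans (ℤP.^-distribˡ-+-* (ℤ.- + 1) a (m ℕ.+ m)) (≡.trans (≡.cong ((ℤ.- + 1) ℤ.^ a ℤ.*_) (-1^double m)) (ℤP.*-identityʳ _))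

module GammaValues (n : ℕ) (pp : Prime (suc n)) (h : ℕ) (n≡2h : n ≡ h ℕ.+ h) (k : ℕ) where
  open GammaLevel n pp h n≡2h k public
  private
    module P = Mod p
    module D = SuffixProduct n
  open Mod M
  open ≈-Reasoning

  -- 1 + p + ... + p^(j-1) = (p^j - 1)/(p - 1), which supplies integers approximating fractions with
  -- denominator p - 1.
  repunit : ℕ → ℕ
  repunit zero = 0
  repunit (suc j) = p ℕ.* repunit j ℕ.+ 1

  n*repunit : ∀ j → n ℕ.* repunit j ℕ.+ 1 ≡ p ℕ.^ j
  n*repunit zero = ≡.cong (ℕ._+ 1) (ℕP.*-zeroʳ n)
  n*repunit (suc j) = ≡.trans (lem n (repunit j)) (≡.cong (p ℕ.*_) (n*repunit j))
    where
    lem : ∀ n r → n ℕ.* ((1 ℕ.+ n) ℕ.* r ℕ.+ 1) ℕ.+ 1 ≡ (1 ℕ.+ n) ℕ.* (n ℕ.* r ℕ.+ 1)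
    lem = ℕSolver.solve-∀

  p∤n : p∤ + n
  p∤n = ∤-small (ℕP.n≢0⇒n>0 n≢0) ℕP.≤-refl

  p∤2 : p∤ + 2
  p∤2 e = p∤n (P.trans (P.≡⇒≈ (≡.trans (≡.cong +_ (≡.trans n≡2h (≡.cong (h ℕ.+_) (≡.sym (ℕP.+-identityʳ h))))) (ℤP.pos-* 2 h)))
    (P.trans (P.*ʳ (+ h) e) (P.≡⇒≈ (ℤP.*-zeroˡ (+ h)))))

  Q : ℕ
  Q = p ℕ.^ suc k

  Q≅0 : ∀ d → + (d ℕ.* Q) ≅ + 0
  Q≅0 d = trans (≡⇒≈ (≡.trans (≡.cong +_ (≡.sym (ℕP.*-assoc d p M))) (ℤP.pos-* (d ℕ.* p) M))) (multiple (+ (d ℕ.* p)))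

  -- point i ≡ i/(p-1) modulo p^(k+1).
  point : ℕ → ℕ
  point i = suc ((n ℕ.∸ i) ℕ.* repunit (suc k))

  point-value : ∀ i → i ℕ.≤ n → n ℕ.* point i ≡ (n ℕ.∸ i) ℕ.* Q ℕ.+ i
  point-value i i≤n = ≡.trans (≡.trans (ℕP.*-suc n _) (≡.cong (ℕ._+ n ℕ.* ((n ℕ.∸ i) ℕ.* r)) (≡.sym (ℕP.m∸n+n≡m i≤n))))
    (≡.trans (lem (n ℕ.∸ i) i n r) (≡.cong (λ z → (n ℕ.∸ i) ℕ.* z ℕ.+ i) (n*repunit (suc k))))
    where
    r : ℕ
    r = repunit (suc k)
    lem : ∀ d i n r → (d ℕ.+ i) ℕ.+ n ℕ.* (d ℕ.* r) ≡ d ℕ.* (n ℕ.* r ℕ.+ 1) ℕ.+ i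
    lem = ℕSolver.solve-∀

  point-≅ : ∀ i → i ℕ.≤ n → + n ℤ.* + point i ≅ + i
  point-≅ i i≤n = trans (≡⇒≈ (≡.trans (≡.sym (ℤP.pos-* n (point i))) (≡.cong +_ (point-value i i≤n))))
    (trans (+ʳ (+ i) (Q≅0 (n ℕ.∸ i))) (≡⇒≈ (ℤP.+-identityˡ (+ i))))

  γ : ℕ → ℤ
  γ i = Γ (point i)

  Γ-at : ∀ i y → i ℕ.≤ n → + n ℤ.* + y ≅ + i → Γ y ≅ γ i
  Γ-at i y i≤n e = Γ-cong {y} {point i} (cancelᴹ (+ n) p∤n (trans e (sym (point-≅ i i≤n))))

  γ-unit : ∀ i → p∤ γ i
  γ-unit i = Γ-unit (point i)

  γ-0 : γ 0 ≅ + 1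
  γ-0 = trans (Γ-cong {point 0} {0} (trans (≡⇒≈ (≡.cong +_ (≡.trans (≡.trans (≡.sym (ℕP.+-comm (n ℕ.* repunit (suc k)) 1)) (n*repunit (suc k))) (≡.sym (ℕP.*-identityˡ Q))))) (Q≅0 1)))
    refl

  -- Let d = n - i. Below `point i` there are d · `repunit k` complete blocks of length p and then d
  -- + 1 further integers, the first of them a multiple of p. The prime-to-p ones number d (n ·
  -- `repunit k` + 1) = d p^k.
  count-point : ∀ i → count (point i) ≡ (n ℕ.∸ i) ℕ.* M
  count-point i = ≡.trans (≡.cong count (lem d p (repunit k))) (≡.trans (count-block (d ℕ.* repunit k) d (ℕP.m∸n≤m n i))
    (≡.trans (≡.cong (ℕ._+ d) (count-pm (d ℕ.* repunit k))) (≡.trans (lem₂ d n (repunit k)) (≡.cong (d ℕ.*_) (n*repunit k)))))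
    where
    d : ℕ
    d = n ℕ.∸ i
    lem : ∀ d p r → 1 ℕ.+ d ℕ.* (p ℕ.* r ℕ.+ 1) ≡ p ℕ.* (d ℕ.* r) ℕ.+ (1 ℕ.+ d)
    lem = ℕSolver.solve-∀
    lem₂ : ∀ d n r → n ℕ.* (d ℕ.* r) ℕ.+ d ≡ d ℕ.* (n ℕ.* r ℕ.+ 1)
    lem₂ = ℕSolver.solve-∀

  M-odd : M ≡ 1 ℕ.+ (h ℕ.* repunit k ℕ.+ h ℕ.* repunit k)
  M-odd = ≡.trans (≡.sym (n*repunit k)) (≡.trans (ℕP.+-comm _ 1) (≡.cong suc (≡.trans (≡.cong (ℕ._* repunit k) n≡2h) (ℕP.*-distribʳ-+ (repunit k) h h))))

  -1^*M : ∀ d → (ℤ.- + 1) ℤ.^ (d ℕ.* M) ≡ (ℤ.- + 1) ℤ.^ d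
  -1^*M d = ≡.trans (≡.cong (λ z → (ℤ.- + 1) ℤ.^ (d ℕ.* z)) M-odd) (≡.trans (≡.cong ((ℤ.- + 1) ℤ.^_) (lem d (h ℕ.* repunit k))) (-1^+double d (d ℕ.* (h ℕ.* repunit k))))
    where
    lem : ∀ d m → d ℕ.* (1 ℕ.+ (m ℕ.+ m)) ≡ d ℕ.+ (d ℕ.* m ℕ.+ d ℕ.* m)
    lem = ℕSolver.solve-∀

  -1^n∸ : ∀ i → i ℕ.≤ n → (ℤ.- + 1) ℤ.^ (n ℕ.∸ i) ≡ (ℤ.- + 1) ℤ.^ i
  -1^n∸ i i≤n = ≡.trans (≡.sym (-1^+double (n ℕ.∸ i) i)) (≡.trans (≡.cong ((ℤ.- + 1) ℤ.^_)
    (≡.trans (≡.sym (ℕP.+-assoc (n ℕ.∸ i) i i)) (≡.trans (≡.cong (ℕ._+ i) (≡.trans (ℕP.m∸n+n≡m i≤n) n≡2h)) (ℕP.+-comm (h ℕ.+ h) i)))) (-1^+double i h))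

  -1^count-point : ∀ i → i ℕ.≤ n → (ℤ.- + 1) ℤ.^ count (point i) ≡ (ℤ.- + 1) ℤ.^ i
  -1^count-point i i≤n = ≡.trans (≡.cong ((ℤ.- + 1) ℤ.^_) (count-point i)) (≡.trans (-1^*M (n ℕ.∸ i)) (-1^n∸ i i≤n))

  γ-reflection : ∀ i → i ℕ.≤ n → γ i ℤ.* γ (n ℕ.∸ i) ≅ ℤ.- (ℤ.- + 1) ℤ.^ i
  γ-reflection i i≤n = trans (Γ-reflection (point i) (point (n ℕ.∸ i)) sum≅1) (≡⇒≈ (≡.cong ℤ.-_ (-1^count-point i i≤n)))
    where
    r : ℕ
    r = repunit (suc k)
    total : point i ℕ.+ point (n ℕ.∸ i) ≡ 1 ℕ.* Q ℕ.+ 1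
    total = ≡.trans (≡.cong (λ z → point i ℕ.+ suc (z ℕ.* r)) (ℕP.m∸[m∸n]≡n i≤n))
      (≡.trans (lem (n ℕ.∸ i) i r) (≡.trans (≡.cong (λ z → 1 ℕ.* (z ℕ.* r ℕ.+ 1) ℕ.+ 1) (ℕP.m∸n+n≡m i≤n)) (≡.cong (λ z → 1 ℕ.* z ℕ.+ 1) (n*repunit (suc k)))))
      where
      lem : ∀ d i r → suc (d ℕ.* r) ℕ.+ suc (i ℕ.* r) ≡ 1 ℕ.* ((d ℕ.+ i) ℕ.* r ℕ.+ 1) ℕ.+ 1
      lem = ℕSolver.solve-∀
    sum≅1 : + (point i ℕ.+ point (n ℕ.∸ i)) ≅ + 1
    sum≅1 = trans (≡⇒≈ (≡.cong +_ total)) (+ʳ (+ 1) (Q≅0 1))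

  Γ-suffixProduct : ∀ N a → a ℕ.≤ n → Γ (p ℕ.* N ℕ.+ suc a) ≡ (ℤ.- + 1) ℤ.^ (p ℕ.* N ℕ.+ suc a) ℤ.* D.suffixProduct N a
  Γ-suffixProduct zero zero _ = ≡.trans (≡.cong Γ pz) (≡.trans (Γ-suc 0) (≡.cong (λ z → (ℤ.- + 1) ℤ.^ z ℤ.* + 1) (≡.sym pz)))
    where
    pz : p ℕ.* 0 ℕ.+ 1 ≡ 1
    pz = ≡.cong (ℕ._+ 1) (ℕP.*-zeroʳ p)
  Γ-suffixProduct (suc N) zero _ = ≡.trans (≡.cong Γ (ℕP.+-comm (p ℕ.* suc N) 1)) (≡.trans (Γ-suc (p ℕ.* suc N))
    (≡.trans (≡.cong₂ ℤ._*_ (≡.trans (≡.cong Γ step) (Γ-suffixProduct N n ℕP.≤-refl)) (factor-∣ (pm≅0 (suc N))))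
    (≡.trans (lem ((ℤ.- + 1) ℤ.^ (p ℕ.* N ℕ.+ suc n)) (D.suffixProduct N n))
      (≡.cong (λ z → (ℤ.- + 1) ℤ.^ z ℤ.* D.suffixProduct N n) (≡.trans (≡.cong suc (≡.sym step)) (ℕP.+-comm 1 (p ℕ.* suc N)))))))
    where
    step : p ℕ.* suc N ≡ p ℕ.* N ℕ.+ suc n
    step = ≡.trans (ℕP.*-suc p N) (ℕP.+-comm p (p ℕ.* N))
    lem : ∀ s x → (s ℤ.* x) ℤ.* (ℤ.- + 1) ≡ (ℤ.- + 1 ℤ.* s) ℤ.* x
    lem = solve-∀
  Γ-suffixProduct N (suc b) b<n = ≡.trans (≡.cong Γ step) (≡.trans (Γ-suc (p ℕ.* N ℕ.+ suc b))
    (≡.trans (≡.cong₂ ℤ._*_ (Γ-suffixProduct N b (ℕP.<⇒≤ b<n)) (factor-∤ (∤-pm+ N (s≤s z≤n) (s≤s b<n))))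
    (≡.trans (lem ((ℤ.- + 1) ℤ.^ (p ℕ.* N ℕ.+ suc b)) (D.suffixProduct N b) (+ (p ℕ.* N ℕ.+ suc b)))
      (≡.cong₂ (λ z x → (ℤ.- + 1) ℤ.^ z ℤ.* x) (≡.sym step) (≡.sym (≡.trans (D.suffix-suc N b) (≡.cong (λ z → D.suffixProduct N b ℤ.* + z) (≡.sym (ℕP.+-suc (p ℕ.* N) b)))))))))
    where
    step : p ℕ.* N ℕ.+ suc (suc b) ≡ suc (p ℕ.* N ℕ.+ suc b)
    step = ℕP.+-suc (p ℕ.* N) (suc b)
    lem : ∀ s x j → (s ℤ.* x) ℤ.* (ℤ.- j) ≡ (ℤ.- + 1 ℤ.* s) ℤ.* (x ℤ.* j)
    lem = solve-∀

  -- (p-1) twistLength a + a = (a+p-1)p^k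
  twistLength : ℕ → ℕ
  twistLength a = (a ℕ.+ n) ℕ.* repunit k ℕ.+ 1

  -- With N ≡ -a/(p-1) the argument pN + a + 1 of the product is 1 - a/(p-1), so the reflection
  -- formula relates it to γ a.
  suffixProduct-γ : ∀ a → a ℕ.≤ n → D.suffixProduct (twistLength a) a ℤ.* γ a ≅ (ℤ.- + 1) ℤ.^ twistLength a
  suffixProduct-γ a a≤n = begin
    D.suffixProduct N a ℤ.* γ a
      ≡⟨ ≡.sym (≡.trans (≡.cong (ℤ._* (D.suffixProduct N a ℤ.* γ a)) sign²) (ℤP.*-identityˡ _)) ⟩
    (s ℤ.* s) ℤ.* (D.suffixProduct N a ℤ.* γ a)
      ≡⟨ lem s (D.suffixProduct N a) (γ a) ⟩
    s ℤ.* (γ a ℤ.* (s ℤ.* D.suffixProduct N a))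
      ≡⟨ ≡.cong (λ z → s ℤ.* (γ a ℤ.* z)) (≡.sym (Γ-suffixProduct N a a≤n)) ⟩
    s ℤ.* (γ a ℤ.* Γ y)
      ≈⟨ *ˡ s (trans (Γ-reflection (point a) y sum≅1) (≡⇒≈ (≡.cong ℤ.-_ (-1^count-point a a≤n)))) ⟩
    s ℤ.* (ℤ.- (ℤ.- + 1) ℤ.^ a)
      ≡⟨ ≡.trans (lem₂ s ((ℤ.- + 1) ℤ.^ a)) (≡.cong (ℤ.- + 1 ℤ.*_) (≡.sym (ℤP.^-distribˡ-+-* (ℤ.- + 1) y a))) ⟩
    (ℤ.- + 1) ℤ.^ suc (y ℕ.+ a)
      ≡⟨ ≡.trans (≡.cong ((ℤ.- + 1) ℤ.^_) parity) (-1^+double N (h ℕ.* N ℕ.+ suc a)) ⟩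
    (ℤ.- + 1) ℤ.^ N ∎
    where
    N y : ℕ
    N = twistLength a
    y = p ℕ.* N ℕ.+ suc a
    s : ℤ
    s = (ℤ.- + 1) ℤ.^ y
    sign² : s ℤ.* s ≡ + 1
    sign² = ≡.trans (≡.sym (ℤP.^-distribˡ-+-* (ℤ.- + 1) y y)) (-1^double y)
    lem : ∀ s x g → (s ℤ.* s) ℤ.* (x ℤ.* g) ≡ s ℤ.* (g ℤ.* (s ℤ.* x))
    lem = solve-∀
    lem₂ : ∀ s t → s ℤ.* (ℤ.- t) ≡ ℤ.- + 1 ℤ.* (s ℤ.* t)
    lem₂ = solve-∀
    parity : suc (y ℕ.+ a) ≡ N ℕ.+ ((h ℕ.* N ℕ.+ suc a) ℕ.+ (h ℕ.* N ℕ.+ suc a))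
    parity = ≡.trans (≡.cong (λ m → suc (suc m ℕ.* N ℕ.+ suc a ℕ.+ a)) n≡2h) (lem₃ h N a)
      where
      lem₃ : ∀ h N a → 1 ℕ.+ ((1 ℕ.+ (h ℕ.+ h)) ℕ.* N ℕ.+ (1 ℕ.+ a) ℕ.+ a) ≡ N ℕ.+ ((h ℕ.* N ℕ.+ (1 ℕ.+ a)) ℕ.+ (h ℕ.* N ℕ.+ (1 ℕ.+ a)))
      lem₃ = ℕSolver.solve-∀
    sum≅1 : + (point a ℕ.+ y) ≅ + 1
    sum≅1 = trans (≡⇒≈ (≡.cong +_ total)) (+ʳ (+ 1) (Q≅0 2))
      where
      r : ℕ
      r = repunit k
      total : point a ℕ.+ y ≡ 2 ℕ.* Q ℕ.+ 1
      total = ≡.trans (lem₄ (n ℕ.∸ a) p r a n) (≡.trans (≡.cong (λ z → (2 ℕ.+ (z ℕ.+ n) ℕ.* (p ℕ.* r)) ℕ.+ p ℕ.+ z) (ℕP.m∸n+n≡m a≤n))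
        (≡.trans (lem₅ n r) (≡.cong (λ z → 2 ℕ.* (p ℕ.* z) ℕ.+ 1) (n*repunit k))))
        where
        lem₄ : ∀ d p r a n → suc (d ℕ.* (p ℕ.* r ℕ.+ 1)) ℕ.+ (p ℕ.* ((a ℕ.+ n) ℕ.* r ℕ.+ 1) ℕ.+ suc a) ≡ (2 ℕ.+ ((d ℕ.+ a) ℕ.+ n) ℕ.* (p ℕ.* r)) ℕ.+ p ℕ.+ (d ℕ.+ a)
        lem₄ = ℕSolver.solve-∀
        lem₅ : ∀ n r → (2 ℕ.+ (n ℕ.+ n) ℕ.* ((1 ℕ.+ n) ℕ.* r)) ℕ.+ (1 ℕ.+ n) ℕ.+ n ≡ 2 ℕ.* ((1 ℕ.+ n) ℕ.* (n ℕ.* r ℕ.+ 1)) ℕ.+ 1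
        lem₅ = ℕSolver.solve-∀

  -- X and X′ represent b/(2(p-1)) and that number plus 1/2. The exponent of 2 is a count below a
  -- representative of b/(p-1); as 2^(nM) ≡ 1 it reduces to M(n-b), and the power of 2 becomes the
  -- value of a character.
  γ-duplication : ∀ b X X′ → b ℕ.≤ n → + (2 ℕ.* n) ℤ.* + X ≅ + b → + (2 ℕ.* n) ℤ.* + X′ ≅ + (b ℕ.+ n) →
    (+ 2) ℤ.^ (M ℕ.* (n ℕ.∸ b)) ℤ.* (Γ X ℤ.* Γ X′) ≅ γ b ℤ.* γ h
  γ-duplication b X X′ b≤n X≅ X′≅ = begin
    (+ 2) ℤ.^ (M ℕ.* (n ℕ.∸ b)) ℤ.* (Γ X ℤ.* Γ X′)
      ≈⟨ *-cong (sym power) (*-cong (Γ-cong {X} {x} (same X x (trans X≅ (sym x≅)))) (Γ-cong {X′} {x ℕ.+ H} (same X′ (x ℕ.+ H) (trans X′≅ (sym x+H≅))))) ⟩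
    (+ 2) ℤ.^ count (2 ℕ.* x) ℤ.* (Γ x ℤ.* Γ (x ℕ.+ H))
      ≈⟨ sym (Γ-duplication H 2H≅1 p∤2 x) ⟩
    Γ (2 ℕ.* x) ℤ.* Γ H
      ≈⟨ *-cong (Γ-cong {2 ℕ.* x} {point b} (trans (≡⇒≈ (≡.cong +_ 2x)) (trans (+ˡ (+ point b) (Q≅0 (point b))) (≡⇒≈ (ℤP.+-identityʳ (+ point b)))))) (≡⇒≈ (≡.cong Γ H≡)) ⟩
    γ b ℤ.* γ h ∎
    where
    r H x : ℕ
    r = repunit (suc k)
    H = suc (h ℕ.* r)
    -- H represents 1/2, so x represents b/(2(p-1)).
    x = point b ℕ.* H
    2H : 2 ℕ.* H ≡ 1 ℕ.* Q ℕ.+ 1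
    2H = ≡.trans (lem h r) (≡.cong (λ z → 1 ℕ.* z ℕ.+ 1) (≡.trans (≡.cong (λ z → z ℕ.* r ℕ.+ 1) (≡.sym n≡2h)) (n*repunit (suc k))))
      where
      lem : ∀ h r → 2 ℕ.* (1 ℕ.+ h ℕ.* r) ≡ 1 ℕ.* ((h ℕ.+ h) ℕ.* r ℕ.+ 1) ℕ.+ 1
      lem = ℕSolver.solve-∀
    2H≅1 : + (2 ℕ.* H) ≅ + 1
    2H≅1 = trans (≡⇒≈ (≡.cong +_ 2H)) (+ʳ (+ 1) (Q≅0 1))
    2x : 2 ℕ.* x ≡ point b ℕ.+ point b ℕ.* Q
    2x = ≡.trans (lem (point b) H) (≡.trans (≡.cong (point b ℕ.*_) 2H) (lem₂ (point b) Q))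
      where
      lem : ∀ a b → 2 ℕ.* (a ℕ.* b) ≡ a ℕ.* (2 ℕ.* b)
      lem = ℕSolver.solve-∀
      lem₂ : ∀ a b → a ℕ.* (1 ℕ.* b ℕ.+ 1) ≡ a ℕ.+ a ℕ.* b
      lem₂ = ℕSolver.solve-∀
    H≡ : H ≡ point h
    H≡ = ≡.cong (λ z → suc (z ℕ.* r)) (≡.sym (≡.trans (≡.cong (ℕ._∸ h) n≡2h) (ℕP.m+n∸n≡m h h)))
    p∤2n : p∤ + (2 ℕ.* n)
    p∤2n e = ∤-* p∤2 p∤n (P.trans (P.≡⇒≈ (≡.sym (ℤP.pos-* 2 n))) e)
    same : ∀ u v → + (2 ℕ.* n) ℤ.* + u ≅ + (2 ℕ.* n) ℤ.* + v → + u ≅ + v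
    same u v e = cancelᴹ (+ (2 ℕ.* n)) p∤2n e
    x≅ : + (2 ℕ.* n) ℤ.* + x ≅ + b
    x≅ = trans (≡⇒≈ (≡.trans (≡.sym (ℤP.pos-* (2 ℕ.* n) x)) (≡.trans (≡.cong +_ (≡.trans (lem n (point b) H) (≡.cong (n ℕ.* point b ℕ.*_) 2H))) (ℤP.pos-* (n ℕ.* point b) (1 ℕ.* Q ℕ.+ 1)))))
      (trans (*-cong (trans (≡⇒≈ (ℤP.pos-* n (point b))) (point-≅ b b≤n)) (+ʳ (+ 1) (Q≅0 1))) (≡⇒≈ (ℤP.*-identityʳ (+ b))))
      where
      lem : ∀ n a b → 2 ℕ.* n ℕ.* (a ℕ.* b) ≡ n ℕ.* a ℕ.* (2 ℕ.* b)
      lem = ℕSolver.solve-∀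
    x+H≅ : + (2 ℕ.* n) ℤ.* + (x ℕ.+ H) ≅ + (b ℕ.+ n)
    x+H≅ = trans (≡⇒≈ (ℤP.*-distribˡ-+ (+ (2 ℕ.* n)) (+ x) (+ H))) (+-cong x≅
      (trans (≡⇒≈ (≡.trans (≡.sym (ℤP.pos-* (2 ℕ.* n) H)) (≡.trans (≡.cong +_ (lem n H)) (ℤP.pos-* n (2 ℕ.* H))))) (trans (*ˡ (+ n) 2H≅1) (≡⇒≈ (ℤP.*-identityʳ (+ n))))))
      where
      lem : ∀ n a → 2 ℕ.* n ℕ.* a ≡ n ℕ.* (2 ℕ.* a)
      lem = ℕSolver.solve-∀
    power : (+ 2) ℤ.^ count (2 ℕ.* x) ≅ (+ 2) ℤ.^ (M ℕ.* (n ℕ.∸ b))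
    power = begin
      (+ 2) ℤ.^ count (2 ℕ.* x)
        ≡⟨ ≡.cong ((+ 2) ℤ.^_) (≡.trans (≡.cong count (≡.trans 2x (≡.cong (point b ℕ.+_) (lem (point b) p M)))) (≡.trans (count-+p (point b) (point b ℕ.* M)) (≡.cong₂ ℕ._+_ (≡.trans (count-point b) (ℕP.*-comm (n ℕ.∸ b) M)) (lem₂ n (point b) M)))) ⟩
      (+ 2) ℤ.^ (M ℕ.* (n ℕ.∸ b) ℕ.+ n ℕ.* M ℕ.* point b)
        ≡⟨ ≡.trans (ℤP.^-distribˡ-+-* (+ 2) (M ℕ.* (n ℕ.∸ b)) _) (≡.cong ((+ 2) ℤ.^ (M ℕ.* (n ℕ.∸ b)) ℤ.*_) (≡.sym (ℤP.^-*-assoc (+ 2) (n ℕ.* M) (point b)))) ⟩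
      (+ 2) ℤ.^ (M ℕ.* (n ℕ.∸ b)) ℤ.* ((+ 2) ℤ.^ (n ℕ.* M)) ℤ.^ point b
        ≈⟨ *ˡ ((+ 2) ℤ.^ (M ℕ.* (n ℕ.∸ b))) (trans (^-cong (point b) (ω-order p∤2)) (≡⇒≈ (ℤP.^-zeroˡ (point b)))) ⟩
      (+ 2) ℤ.^ (M ℕ.* (n ℕ.∸ b)) ℤ.* + 1
        ≡⟨ ℤP.*-identityʳ _ ⟩
      (+ 2) ℤ.^ (M ℕ.* (n ℕ.∸ b)) ∎
      where
      lem : ∀ a p m → a ℕ.* (p ℕ.* m) ≡ p ℕ.* (a ℕ.* m)
      lem = ℕSolver.solve-∀
      lem₂ : ∀ n a m → n ℕ.* (a ℕ.* m) ≡ n ℕ.* m ℕ.* a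
      lem₂ = ℕSolver.solve-∀

-- Valuations

≅-product : ∀ {a b x y} → x ≅ + 0 [mod a ] → y ≅ + 0 [mod b ] → x ℤ.* y ≅ + 0 [mod a ℕ.* b ]
≅-product {a} {b} (by-quotient s ≡.refl) (by-quotient t ≡.refl) = by-quotient (s ℤ.* t)
  (≡.trans (lem s t (+ a) (+ b)) (≡.cong (λ z → + 0 ℤ.+ (s ℤ.* t) ℤ.* z) (≡.sym (ℤP.pos-* a b))))
  where
  lem : ∀ s t a b → (+ 0 ℤ.+ s ℤ.* a) ℤ.* (+ 0 ℤ.+ t ℤ.* b) ≡ + 0 ℤ.+ (s ℤ.* t) ℤ.* (a ℤ.* b)
  lem = solve-∀

module Factorials (n : ℕ) (pp : Prime (suc n)) where
  open Residue n pp
  private module P = Mod p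

  weaken-^ : ∀ {d e x y} → d ℕ.≤ e → x ≅ y [mod p ℕ.^ e ] → x ≅ y [mod p ℕ.^ d ]
  weaken-^ {d} {e} d≤e = weaken {p ℕ.^ (e ℕ.∸ d)} (≡.trans (≡.sym (ℕP.^-distribˡ-+-* p (e ℕ.∸ d) d)) (≡.cong (p ℕ.^_) (ℕP.m∸n+n≡m d≤e)))

  -- (pm+a)! = unit · p^m · m!
  factorial-split : ∀ m a → a ℕ.≤ n → ∃ λ u → p∤ u × + ((p ℕ.* m ℕ.+ a) ℕ.!) ≡ u ℤ.* (+ (p ℕ.^ m) ℤ.* + (m ℕ.!))
  factorial-split zero zero _ = + 1 , ∤-1 , ≡.cong (λ z → + ((z ℕ.+ 0) ℕ.!)) (ℕP.*-zeroʳ p)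
  factorial-split (suc m) zero _ with factorial-split m n ℕP.≤-refl
  ... | u , p∤u , eq = u , p∤u , ≡.trans (≡.cong (λ z → + (z ℕ.!)) step)
    (≡.trans (ℤP.pos-* (suc (p ℕ.* m ℕ.+ n)) ((p ℕ.* m ℕ.+ n) ℕ.!)) (≡.trans (≡.cong₂ ℤ._*_ (≡.trans (≡.cong +_ step₂) (ℤP.pos-* p (suc m))) eq)
    (≡.trans (lem (+ p) (+ suc m) u (+ (p ℕ.^ m)) (+ (m ℕ.!))) (≡.cong (u ℤ.*_) (≡.cong₂ ℤ._*_ (≡.sym (ℤP.pos-* p (p ℕ.^ m))) (≡.sym (ℤP.pos-* (suc m) (m ℕ.!))))))))
    where
    step₂ : suc (p ℕ.* m ℕ.+ n) ≡ p ℕ.* suc m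
    step₂ = ≡.trans (ℕP.+-comm (suc (p ℕ.* m)) n) (≡.trans (ℕP.+-suc n (p ℕ.* m)) (≡.sym (ℕP.*-suc p m)))
    step : p ℕ.* suc m ℕ.+ 0 ≡ suc (p ℕ.* m ℕ.+ n)
    step = ≡.trans (ℕP.+-identityʳ _) (≡.sym step₂)
    lem : ∀ p s u q f → (p ℤ.* s) ℤ.* (u ℤ.* (q ℤ.* f)) ≡ u ℤ.* ((p ℤ.* q) ℤ.* (s ℤ.* f))
    lem = solve-∀
  factorial-split m (suc b) b<n with factorial-split m b (ℕP.<⇒≤ b<n)
  ... | u , p∤u , eq = + (p ℕ.* m ℕ.+ suc b) ℤ.* u , ∤-* p∤j p∤u ,
    ≡.trans (≡.cong (λ z → + (z ℕ.!)) (ℕP.+-suc (p ℕ.* m) b)) (≡.trans (ℤP.pos-* (suc (p ℕ.* m ℕ.+ b)) ((p ℕ.* m ℕ.+ b) ℕ.!))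
    (≡.trans (≡.cong₂ ℤ._*_ (≡.cong +_ (≡.sym (ℕP.+-suc (p ℕ.* m) b))) eq) (≡.sym (ℤP.*-assoc (+ (p ℕ.* m ℕ.+ suc b)) u _))))
    where
    p∤j : p∤ + (p ℕ.* m ℕ.+ suc b)
    p∤j e = ∤-small (s≤s z≤n) (s≤s b<n) (P.trans (P.≡⇒≈ (≡.sym (ℤP.+-identityˡ (+ suc b)))) (P.trans (P.+ʳ (+ suc b) (P.sym pm≅0)) e))
      where
      pm≅0 : + (p ℕ.* m) P.≅ + 0
      pm≅0 = P.trans (P.≡⇒≈ (≡.trans (ℤP.pos-* p m) (ℤP.*-comm (+ p) (+ m)))) (P.multiple (+ m))

  record FactorialForm (i : ℕ) : Set where
    constructor form
    field
      unit : ℤ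
      exponent : ℕ
      p∤unit : p∤ unit
      value : + (i ℕ.!) ≡ unit ℤ.* + (p ℕ.^ exponent)
      bound : 4 ℕ.* exponent ℕ.≤ i

  -- If m is the quotient of i by p and e the valuation of m!, then i! has valuation m + e, and 4(m
  -- + e) ≤ 5m ≤ pm ≤ i by induction. The middle step is where p ≥ 5 is used.
  factorial-form : 4 ℕ.≤ n → ∀ i → FactorialForm i
  factorial-form 4≤n = <-rec FactorialForm step
    where
    step : ∀ i → (∀ {j} → j ℕ.< i → FactorialForm j) → FactorialForm i
    step zero _ = form (+ 1) 0 ∤-1 ≡.refl z≤n
    step i@(suc _) rec = combine (rec (ℕDM.m/n<m i p (s≤s (ℕP.n≢0⇒n>0 n≢0)))) (factorial-split (i ℕDM./ p) (i ℕDM.% p) (ℕP.≤-pred (ℕDM.m%n<n i p)))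
      where
      i≡ : i ≡ p ℕ.* (i ℕDM./ p) ℕ.+ i ℕDM.% p
      i≡ = ≡.trans (ℕDM.m≡m%n+[m/n]*n i p) (≡.trans (ℕP.+-comm (i ℕDM.% p) _) (≡.cong (ℕ._+ i ℕDM.% p) (ℕP.*-comm (i ℕDM./ p) p)))
      combine : FactorialForm (i ℕDM./ p) →
        (∃ λ u → p∤ u × + ((p ℕ.* (i ℕDM./ p) ℕ.+ i ℕDM.% p) ℕ.!) ≡ u ℤ.* (+ (p ℕ.^ (i ℕDM./ p)) ℤ.* + ((i ℕDM./ p) ℕ.!))) → FactorialForm i
      combine (form u′ e p∤u′ val bnd) (u , p∤u , eq) = form (u ℤ.* u′) (i ℕDM./ p ℕ.+ e) (∤-* p∤u p∤u′)
        (≡.trans (≡.cong (λ z → + (z ℕ.!)) i≡) (≡.trans eq (≡.trans (≡.cong (λ z → u ℤ.* (+ (p ℕ.^ (i ℕDM./ p)) ℤ.* z)) val)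
          (≡.trans (lem u (+ (p ℕ.^ (i ℕDM./ p))) u′ (+ (p ℕ.^ e))) (≡.cong ((u ℤ.* u′) ℤ.*_)
            (≡.trans (≡.sym (ℤP.pos-* (p ℕ.^ (i ℕDM./ p)) (p ℕ.^ e))) (≡.cong +_ (≡.sym (ℕP.^-distribˡ-+-* p (i ℕDM./ p) e)))))))))
        bound
        where
        lem : ∀ u a v b → u ℤ.* (a ℤ.* (v ℤ.* b)) ≡ (u ℤ.* v) ℤ.* (a ℤ.* b)
        lem = solve-∀
        bound : 4 ℕ.* (i ℕDM./ p ℕ.+ e) ℕ.≤ i
        bound = begin
          4 ℕ.* (i ℕDM./ p ℕ.+ e) ≡⟨ ℕP.*-distribˡ-+ 4 (i ℕDM./ p) e ⟩
          4 ℕ.* (i ℕDM./ p) ℕ.+ 4 ℕ.* e ≤⟨ ℕP.+-monoʳ-≤ (4 ℕ.* (i ℕDM./ p)) bnd ⟩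
          4 ℕ.* (i ℕDM./ p) ℕ.+ i ℕDM./ p ≡⟨ ℕP.+-comm _ (i ℕDM./ p) ⟩
          5 ℕ.* (i ℕDM./ p) ≤⟨ ℕP.*-monoˡ-≤ (i ℕDM./ p) (s≤s 4≤n) ⟩
          p ℕ.* (i ℕDM./ p) ≤⟨ ℕP.m≤m+n _ _ ⟩
          p ℕ.* (i ℕDM./ p) ℕ.+ i ℕDM.% p ≡⟨ ≡.sym i≡ ⟩
          i ∎
          where open ℕP.≤-Reasoning

-- The integers i! c_i, where exp(wX + wX^p/p) = Σ c_i X^i, together with their history (as in DworkSeries).
module Numerators (n : ℕ) (pp : Prime (suc n)) (w : ℤ) where
  open Residue n pp
  open Factorials n pp
  private module P = Mod p

  numerator-history : ℕ → ℕ → ℤ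
  numerator-history zero zero = + 1
  numerator-history zero (suc j) = + 0
  numerator-history (suc i) zero = w ℤ.* (numerator-history i 0 ℤ.+ falling (+ i) n ℤ.* numerator-history i n)
  numerator-history (suc i) (suc j) = numerator-history i j

  numerator : ℕ → ℤ
  numerator i = numerator-history i 0

  numerator-history-value : ∀ j i → numerator-history (j ℕ.+ i) j ≡ numerator i
  numerator-history-value zero i = ≡.refl
  numerator-history-value (suc j) i = numerator-history-value j i

  numerator-history-0 : ∀ i j → i ℕ.< j → numerator-history i j ≡ + 0
  numerator-history-0 zero (suc j) _ = ≡.refl
  numerator-history-0 (suc i) (suc j) (s≤s i<j) = numerator-history-0 i j i<j

  numerator-small : ∀ a → a ℕ.≤ n → numerator a ≡ w ℤ.^ a ℤ.* numerator 0
  numerator-small zero _ = ≡.refl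
  numerator-small (suc a) a<n = ≡.trans (≡.cong (λ z → w ℤ.* (numerator a ℤ.+ falling (+ a) n ℤ.* z)) (numerator-history-0 a n a<n))
    (≡.trans (≡.cong (λ z → w ℤ.* (z ℤ.+ falling (+ a) n ℤ.* + 0)) (numerator-small a (ℕP.<⇒≤ a<n))) (lem w (w ℤ.^ a) (numerator 0) (falling (+ a) n)))
    where
    lem : ∀ w u x f → w ℤ.* (u ℤ.* x ℤ.+ f ℤ.* + 0) ≡ (w ℤ.* u) ℤ.* x
    lem = solve-∀

  falling-≅-1 : ∀ x m → x P.≅ ℤ.- + 1 → falling x m P.≅ rootProduct m (+ 0)
  falling-≅-1 x zero e = P.refl
  falling-≅-1 x (suc m) e = P.*-cong (falling-≅-1 x m e) (P.trans (P.+ʳ (ℤ.- + m) e) (P.≡⇒≈ (lem (+ m))))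
    where
    lem : ∀ m → ℤ.- + 1 ℤ.- m ≡ + 0 ℤ.- (+ 1 ℤ.+ m)
    lem = solve-∀

  falling-≅-small : ∀ x a d → x P.≅ + a → falling x (suc a ℕ.+ d) P.≅ + 0
  falling-≅-small x a zero e = P.trans (P.≡⇒≈ (≡.cong (falling x) (ℕP.+-identityʳ (suc a))))
    (P.trans (P.*ˡ (falling x a) (P.x≈y⇒x-y≈0 e)) (P.≡⇒≈ (ℤP.*-zeroʳ (falling x a))))
  falling-≅-small x a (suc d) e = P.trans (P.≡⇒≈ (≡.cong (falling x) (ℕP.+-suc (suc a) d)))
    (P.trans (P.*ʳ (x ℤ.- + (suc a ℕ.+ d)) (falling-≅-small x a d e)) (P.≡⇒≈ (ℤP.*-zeroˡ (x ℤ.- + (suc a ℕ.+ d)))))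

  pm+≅ : ∀ m x → + (p ℕ.* m ℕ.+ x) P.≅ + x
  pm+≅ m x = P.trans (P.+ʳ (+ x) (P.trans (P.≡⇒≈ (≡.trans (ℤP.pos-* p m) (ℤP.*-comm (+ p) (+ m)))) (P.multiple (+ m)))) (P.≡⇒≈ (ℤP.+-identityˡ (+ x)))

  p[1+m]+1+a : ∀ m a → p ℕ.* suc m ℕ.+ suc a ≡ suc (n ℕ.+ (p ℕ.* m ℕ.+ suc a))
  p[1+m]+1+a m a = ≡.trans (≡.cong (ℕ._+ suc a) (ℕP.*-suc p m)) (≡.cong suc (ℕP.+-assoc n (p ℕ.* m) (suc a)))

  record Divisibility (m : ℕ) : Set where
    field
      divisible : ∀ a → a ℕ.≤ n → numerator (p ℕ.* m ℕ.+ a) ≅ + 0 [mod p ℕ.^ ℕ.⌈ m /2⌉ ]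
      congruent : ∀ a → a ℕ.≤ n → numerator (p ℕ.* m ℕ.+ a) ≅ w ℤ.^ a ℤ.* numerator (p ℕ.* m) [mod p ℕ.^ ℕ.⌈ suc m /2⌉ ]

  -- The two statements support each other. Integrality of the numerators alone would bound the
  -- valuation of (-p)^m c_(pm+a) only by -m/4; the ⌈m/2⌉ obtained here makes the series converge.
  -- Between multiples of p the falling factorial contains a multiple of p, so the lagged term of
  -- the recursion gains one power of p.
  divisibility : ∀ m → Divisibility m
  divisibility zero = record
    { divisible = λ a _ → by-quotient (numerator (p ℕ.* 0 ℕ.+ a)) (≡.sym (≡.trans (ℤP.+-identityˡ _) (ℤP.*-identityʳ _)))
    ; congruent = λ a a≤n → Mod.≡⇒≈ (p ℕ.^ 1) (≡.trans (≡.cong (λ z → numerator (z ℕ.+ a)) (ℕP.*-zeroʳ p))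
        (≡.trans (numerator-small a a≤n) (≡.cong (λ z → w ℤ.^ a ℤ.* numerator z) (≡.sym (ℕP.*-zeroʳ p))))) }
  divisibility (suc m) = record { divisible = divisible′ ; congruent = congruent′ }
    where
    open Divisibility (divisibility m)
    E : ℕ
    E = ℕ.⌈ suc m /2⌉
    module C = Mod (p ℕ.^ E)
    module S = Mod (p ℕ.^ suc ℕ.⌈ m /2⌉)
    x₀ : ℤ
    x₀ = numerator (p ℕ.* m)
    x₀≅0 : x₀ ≅ + 0 [mod p ℕ.^ ℕ.⌈ m /2⌉ ]
    x₀≅0 = ≡.subst (λ z → numerator z ≅ + 0 [mod p ℕ.^ ℕ.⌈ m /2⌉ ]) (ℕP.+-identityʳ (p ℕ.* m)) (divisible 0 z≤n)
    f : ℤ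
    f = falling (+ (n ℕ.+ p ℕ.* m)) n
    -- The factors of f are congruent to -1, ..., -n, so f ≡ -1 by Wilson, while w^p ≡ w by Fermat.
    -- This cancellation is the gain at each multiple of p.
    wp+wf : w ℤ.^ p ℤ.+ w ℤ.* f P.≅ + 0
    wp+wf = P.trans (P.+-cong (fermat w) (P.*ˡ w (P.trans (falling-≅-1 (+ (n ℕ.+ p ℕ.* m)) n
        (P.trans (P.≡⇒≈ (≡.cong +_ (ℕP.+-comm n (p ℕ.* m)))) (P.trans (pm+≅ m n) (P.trans (P.≡⇒≈ (lem₂ (+ n))) (P.trans (P.+ʳ (ℤ.- + 1) P.modulus) P.refl))))) wilson)))
      (P.≡⇒≈ (lem w))
      where
      lem : ∀ w → w ℤ.+ w ℤ.* (ℤ.- + 1) ≡ + 0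
      lem = solve-∀
      lem₂ : ∀ n → n ≡ (+ 1 ℤ.+ n) ℤ.+ ℤ.- + 1
      lem₂ = solve-∀
    top : numerator (p ℕ.* suc m) C.≅ + 0
    top = C.trans (C.≡⇒≈ (≡.cong numerator (ℕP.*-suc p m))) (C.trans (C.*ˡ w (C.+-cong
        (C.trans (C.≡⇒≈ (≡.cong numerator (ℕP.+-comm n (p ℕ.* m)))) (congruent n ℕP.≤-refl))
        (C.≡⇒≈ (≡.cong (f ℤ.*_) (numerator-history-value n (p ℕ.* m))))))
      (C.trans (C.≡⇒≈ (lem w (w ℤ.^ n) f x₀)) (weaken-^ {E} (ℕP.⌈n/2⌉-mono (ℕP.n≤1+n (suc m))) (≅-product wp+wf x₀≅0))))
      where
      lem : ∀ w u f x → w ℤ.* (u ℤ.* x ℤ.+ f ℤ.* x) ≡ (w ℤ.* u ℤ.+ w ℤ.* f) ℤ.* x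
      lem = solve-∀
    congruent′ : ∀ a → a ℕ.≤ n → numerator (p ℕ.* suc m ℕ.+ a) S.≅ w ℤ.^ a ℤ.* numerator (p ℕ.* suc m)
    congruent′ zero _ = S.≡⇒≈ (≡.trans (≡.cong numerator (ℕP.+-identityʳ (p ℕ.* suc m))) (≡.sym (ℤP.*-identityˡ _)))
    congruent′ (suc a) a<n = S.trans (S.≡⇒≈ (≡.cong numerator (p[1+m]+1+a m a)))
      (S.trans (S.*ˡ w (S.+-cong (S.trans (S.≡⇒≈ (≡.cong numerator i≡)) (congruent′ a (ℕP.<⇒≤ a<n)))
          (S.trans (S.≡⇒≈ (≡.cong (g ℤ.*_) (numerator-history-value n (p ℕ.* m ℕ.+ suc a)))) (≅-product g≅0 (divisible (suc a) a<n)))))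
        (S.≡⇒≈ (lem w (w ℤ.^ a) (numerator (p ℕ.* suc m)))))
      where
      g : ℤ
      g = falling (+ (n ℕ.+ (p ℕ.* m ℕ.+ suc a))) n
      i≡ : n ℕ.+ (p ℕ.* m ℕ.+ suc a) ≡ p ℕ.* suc m ℕ.+ a
      i≡ = ℕP.suc-injective (≡.trans (≡.sym (p[1+m]+1+a m a)) (ℕP.+-suc (p ℕ.* suc m) a))
      g≅0 : g P.≅ + 0
      g≅0 = P.trans (P.≡⇒≈ (≡.cong₂ (λ x d → falling (+ x) d) i≡ (≡.sym (ℕP.m+[n∸m]≡n a<n)))) (falling-≅-small (+ (p ℕ.* suc m ℕ.+ a)) a (n ℕ.∸ suc a) (pm+≅ (suc m) a))
      lem : ∀ w u x → w ℤ.* (u ℤ.* x ℤ.+ + 0) ≡ (w ℤ.* u) ℤ.* x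
      lem = solve-∀
    divisible′ : ∀ a → a ℕ.≤ n → numerator (p ℕ.* suc m ℕ.+ a) C.≅ + 0
    divisible′ a a≤n = C.trans (weaken-^ {E} (ℕP.⌈n/2⌉-mono (ℕP.n≤1+n (suc m))) (congruent′ a a≤n)) (C.trans (C.*ˡ (w ℤ.^ a) top) (C.≡⇒≈ (ℤP.*-zeroʳ (w ℤ.^ a))))

module Valuation (K : RationalAlgebra) (n : ℕ) (pp : Prime (suc n)) where
  open RationalAlgebra K
  open ≈-Reasoning
  open Solver using (solve; _:+_; _:*_; _:-_; :-_; _:=_; con)
  open Residue n pp
  open Factorials n pp
  private module P = Mod p

  inverse-of : ∀ s → s ≢ + 0 → ∃ λ u → u * ⌜ s ⌝ ≈ 1#
  inverse-of (+ zero) s≢0 = ⊥-elim (s≢0 ≡.refl)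
  inverse-of (+ suc i) _ = recip i , recip-inverse i
  inverse-of -[1+ i ] _ = - recip i , trans (solve 2 (λ a b → (:- a) :* (:- b) := a :* b) refl (recip i) ⌜ + suc i ⌝) (recip-inverse i)

  ∤⇒≢0 : ∀ {s} → p∤ s → s ≢ + 0
  ∤⇒≢0 p∤s ≡.refl = p∤s P.refl

  -- Membership of x in p^e ℤ_(p), witnessed by a fraction; `Val 0` is p-integrality.
  record Val (e : ℕ) (x : Carrier) : Set where
    constructor val
    field
      denominator numerator : ℤ
      coprime : p∤ denominator
      clears : ⌜ denominator ⌝ * x ≈ ⌜ numerator ⌝ * ⌜ + (p ℕ.^ e) ⌝

  Val-cong : ∀ {e x y} → x ≈ y → Val e x → Val e y
  Val-cong x≈y (val s z c eq) = val s z c (trans (*-congˡ (sym x≈y)) eq)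

  Val-+ : ∀ {e x y} → Val e x → Val e y → Val e (x + y)
  Val-+ {e} {x} {y} (val s z c eq) (val s′ z′ c′ eq′) = val (s ℤ.* s′) (s′ ℤ.* z ℤ.+ s ℤ.* z′) (∤-* c c′) (begin
    ⌜ s ℤ.* s′ ⌝ * (x + y) ≈⟨ *-congʳ (⌜⌝-* s s′) ⟩
    (⌜ s ⌝ * ⌜ s′ ⌝) * (x + y) ≈⟨ solve 4 (λ s t x y → (s :* t) :* (x :+ y) := t :* (s :* x) :+ s :* (t :* y)) refl ⌜ s ⌝ ⌜ s′ ⌝ x y ⟩
    ⌜ s′ ⌝ * (⌜ s ⌝ * x) + ⌜ s ⌝ * (⌜ s′ ⌝ * y) ≈⟨ +-cong (*-congˡ eq) (*-congˡ eq′) ⟩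
    ⌜ s′ ⌝ * (⌜ z ⌝ * Q) + ⌜ s ⌝ * (⌜ z′ ⌝ * Q) ≈⟨ solve 5 (λ s t a b q → t :* (a :* q) :+ s :* (b :* q) := (t :* a :+ s :* b) :* q) refl ⌜ s ⌝ ⌜ s′ ⌝ ⌜ z ⌝ ⌜ z′ ⌝ Q ⟩
    (⌜ s′ ⌝ * ⌜ z ⌝ + ⌜ s ⌝ * ⌜ z′ ⌝) * Q ≈⟨ *-congʳ (sym (trans (⌜⌝-+ (s′ ℤ.* z) (s ℤ.* z′)) (+-cong (⌜⌝-* s′ z) (⌜⌝-* s z′)))) ⟩
    ⌜ s′ ℤ.* z ℤ.+ s ℤ.* z′ ⌝ * Q ∎)
    where
    Q : Carrier
    Q = ⌜ + (p ℕ.^ e) ⌝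

  Val-* : ∀ {e f x y} → Val e x → Val f y → Val (e ℕ.+ f) (x * y)
  Val-* {e} {f} {x} {y} (val s z c eq) (val s′ z′ c′ eq′) = val (s ℤ.* s′) (z ℤ.* z′) (∤-* c c′) (begin
    ⌜ s ℤ.* s′ ⌝ * (x * y) ≈⟨ *-congʳ (⌜⌝-* s s′) ⟩
    (⌜ s ⌝ * ⌜ s′ ⌝) * (x * y) ≈⟨ solve 4 (λ s t x y → (s :* t) :* (x :* y) := (s :* x) :* (t :* y)) refl ⌜ s ⌝ ⌜ s′ ⌝ x y ⟩
    (⌜ s ⌝ * x) * (⌜ s′ ⌝ * y) ≈⟨ *-cong eq eq′ ⟩
    (⌜ z ⌝ * ⌜ + (p ℕ.^ e) ⌝) * (⌜ z′ ⌝ * ⌜ + (p ℕ.^ f) ⌝) ≈⟨ solve 4 (λ a q b r → (a :* q) :* (b :* r) := (a :* b) :* (q :* r)) refl _ _ _ _ ⟩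
    (⌜ z ⌝ * ⌜ z′ ⌝) * (⌜ + (p ℕ.^ e) ⌝ * ⌜ + (p ℕ.^ f) ⌝) ≈⟨ *-cong (sym (⌜⌝-* z z′)) (trans (sym (⌜⌝-* (+ (p ℕ.^ e)) (+ (p ℕ.^ f))))
                                                        (≡⇒≈ (≡.cong ⌜_⌝ (≡.trans (≡.sym (ℤP.pos-* (p ℕ.^ e) (p ℕ.^ f))) (≡.cong +_ (≡.sym (ℕP.^-distribˡ-+-* p e f))))))) ⟩
    ⌜ z ℤ.* z′ ⌝ * ⌜ + (p ℕ.^ (e ℕ.+ f)) ⌝ ∎)

  Val-int : ∀ z → Val 0 ⌜ z ⌝
  Val-int z = val (+ 1) z ∤-1 (*-comm 1# ⌜ z ⌝)

  Val-≅0 : ∀ {e z} → z ≅ + 0 [mod p ℕ.^ e ] → Val e ⌜ z ⌝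
  Val-≅0 {e} {z} (by-quotient a ≡.refl) = val (+ 1) a ∤-1 (trans (*-identityˡ _) (trans (≡⇒≈ (≡.cong ⌜_⌝ (ℤP.+-identityˡ (a ℤ.* + (p ℕ.^ e))))) (⌜⌝-* a (+ (p ℕ.^ e)))))

  Val-*ʳ : ∀ {e x y} → Val e x → Val 0 y → Val e (x * y)
  Val-*ʳ {e} {x} {y} vx vy = ≡.subst (λ z → Val z (x * y)) (ℕP.+-identityʳ e) (Val-* vx vy)

  Val-*ˡ : ∀ {e x y} → Val 0 x → Val e y → Val e (x * y)
  Val-*ˡ vx vy = Val-* vx vy

  Val-neg : ∀ {e x} → Val e x → Val e (- x)
  Val-neg {e} {x} v = Val-cong (solve 1 (λ x → (:- con (+ 1)) :* x := :- x) refl x) (Val-*ˡ (Val-int (ℤ.- + 1)) v)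

  Val-- : ∀ {e x y} → Val e x → Val e y → Val e (x - y)
  Val-- vx vy = Val-+ vx (Val-neg vy)

  Val-weaken : ∀ {d e x} → d ℕ.≤ e → Val e x → Val d x
  Val-weaken {d} {e} {x} d≤e (val s z c eq) = val s (z ℤ.* + (p ℕ.^ (e ℕ.∸ d))) c (trans eq (sym (begin
    ⌜ z ℤ.* + (p ℕ.^ (e ℕ.∸ d)) ⌝ * ⌜ + (p ℕ.^ d) ⌝ ≈⟨ trans (*-congʳ (⌜⌝-* z (+ (p ℕ.^ (e ℕ.∸ d))))) (*-assoc _ _ _) ⟩
    ⌜ z ⌝ * (⌜ + (p ℕ.^ (e ℕ.∸ d)) ⌝ * ⌜ + (p ℕ.^ d) ⌝) ≈⟨ *-congˡ (trans (sym (⌜⌝-* (+ (p ℕ.^ (e ℕ.∸ d))) (+ (p ℕ.^ d)))) (≡⇒≈ (≡.cong ⌜_⌝ (≡.trans (≡.sym (ℤP.pos-* (p ℕ.^ (e ℕ.∸ d)) (p ℕ.^ d)))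
                                                                   (≡.cong +_ (≡.trans (≡.sym (ℕP.^-distribˡ-+-* p (e ℕ.∸ d) d)) (≡.cong (p ℕ.^_) (ℕP.m∸n+n≡m d≤e)))))))) ⟩
    ⌜ z ⌝ * ⌜ + (p ℕ.^ e) ⌝ ∎)))

  Val-0 : ∀ {e} → Val e 0#
  Val-0 {e} = val (+ 1) (+ 0) ∤-1 (solve 1 (λ q → con (+ 1) :* con (+ 0) := con (+ 0) :* q) refl ⌜ + (p ℕ.^ e) ⌝)

  Val-∑ : ∀ {e} m f → (∀ i → i ℕ.< m → Val e (f i)) → Val e (∑ m f)
  Val-∑ zero f h = Val-0
  Val-∑ (suc m) f h = Val-+ (Val-∑ m f (λ i i<m → h i (ℕP.m<n⇒m<1+n i<m))) (h m ℕP.≤-refl)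

  Val-^ : ∀ {x} m → Val 0 x → Val 0 (x ^ m)
  Val-^ zero v = Val-int (+ 1)
  Val-^ (suc m) v = Val-*ˡ v (Val-^ m v)

  Val-unit-cancel : ∀ {e x} s → p∤ s → Val e (⌜ s ⌝ * x) → Val e x
  Val-unit-cancel {e} {x} s p∤s (val t z c eq) = val (t ℤ.* s) z (∤-* c p∤s) (trans (*-congʳ (⌜⌝-* t s)) (trans (*-assoc _ _ x) eq))

  Val-inverse : ∀ {s u} → p∤ s → u * ⌜ s ⌝ ≈ 1# → Val 0 u
  Val-inverse {s} {u} p∤s eq = val s (+ 1) p∤s (trans (*-comm ⌜ s ⌝ u) (trans eq (sym (*-identityˡ 1#))))

  Val⇒≅0 : ∀ {k} z → Val k ⌜ z ⌝ → z ≅ + 0 [mod p ℕ.^ k ]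
  Val⇒≅0 {k} z (val s y c eq) = T.cancelᴹ s c (M.trans (by-quotient y (≡.trans (⌜⌝-injective (s ℤ.* z) (y ℤ.* + (p ℕ.^ k)) (trans (⌜⌝-* s z) (trans eq (sym (⌜⌝-* y (+ (p ℕ.^ k))))))) (≡.sym (ℤP.+-identityˡ (y ℤ.* + (p ℕ.^ k)))))) (M.≡⇒≈ (≡.sym (ℤP.*-zeroʳ s))))
    where
    module T = Teichmüller n pp k
    module M = Mod (p ℕ.^ k)

  p^≢0 : ∀ e → + (p ℕ.^ e) ≢ + 0
  p^≢0 e eq = ℕP.<⇒≢ (ℕP.m^n>0 p e) (≡.sym (ℤP.+-injective eq))

  -- Elements carry a proof of p-integrality because congruence modulo p^k is preserved by
  -- multiplication only with integral factors.
  ℤ₍ₚ₎/ : ℕ → CommutativeRing 0ℓ 0ℓ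
  ℤ₍ₚ₎/ k = record
    { Carrier = Σ Carrier (Val 0)
    ; _≈_ = λ x y → Val k (proj₁ x - proj₁ y)
    ; _+_ = λ x y → proj₁ x + proj₁ y , Val-+ (proj₂ x) (proj₂ y)
    ; _*_ = λ x y → proj₁ x * proj₁ y , Val-*ˡ (proj₂ x) (proj₂ y)
    ; -_ = λ x → - proj₁ x , Val-neg (proj₂ x)
    ; 0# = 0# , Val-int (+ 0)
    ; 1# = 1# , Val-int (+ 1)
    ; isCommutativeRing = record
      { isRing = record
        { +-isAbelianGroup = record
          { isGroup = record
            { isMonoid = record
              { isSemigroup = record
                { isMagma = record
                  { isEquivalence = record
                    { refl = eq refl
                    ; sym = λ {x} {y} v → Val-cong (solve 2 (λ x y → :- (x :- y) := y :- x) refl (proj₁ x) (proj₁ y)) (Val-neg v)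
                    ; trans = λ {x} {y} {z} v v′ → Val-cong (solve 3 (λ x y z → (x :- y) :+ (y :- z) := x :- z) refl (proj₁ x) (proj₁ y) (proj₁ z)) (Val-+ v v′) }
                  ; ∙-cong = λ {x} {y} {u} {v} a b → Val-cong (solve 4 (λ x y u v → (x :- y) :+ (u :- v) := (x :+ u) :- (y :+ v)) refl (proj₁ x) (proj₁ y) (proj₁ u) (proj₁ v)) (Val-+ a b) }
                ; assoc = λ x y z → eq (+-assoc _ _ _) }
              ; identity = (λ x → eq (+-identityˡ _)) , (λ x → eq (+-identityʳ _)) }
            ; inverse = (λ x → eq (-‿inverseˡ _)) , (λ x → eq (-‿inverseʳ _))
            ; ⁻¹-cong = λ {x} {y} v → Val-cong (solve 2 (λ x y → :- (x :- y) := (:- x) :- (:- y)) refl (proj₁ x) (proj₁ y)) (Val-neg v) }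
          ; comm = λ x y → eq (+-comm _ _) }
        ; *-cong = λ {x} {y} {u} {v} a b → Val-cong (solve 4 (λ x y u v → (x :- y) :* u :+ y :* (u :- v) := (x :* u) :- (y :* v)) refl (proj₁ x) (proj₁ y) (proj₁ u) (proj₁ v))
            (Val-+ (Val-*ʳ a (proj₂ u)) (Val-*ˡ (proj₂ y) b))
        ; *-assoc = λ x y z → eq (*-assoc _ _ _)
        ; *-identity = (λ x → eq (*-identityˡ _)) , (λ x → eq (*-identityʳ _))
        ; distrib = (λ x y z → eq (distribˡ _ _ _)) , (λ x y z → eq (distribʳ _ _ _)) }
      ; *-comm = λ x y → eq (*-comm _ _) } }
    where
    eq : ∀ {x y} → x ≈ y → Val k (x - y)
    eq {x} {y} x≈y = Val-cong (sym (trans (+-congʳ x≈y) (-‿inverseʳ y))) Val-0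

  module Coefficients (4≤n : 4 ℕ.≤ n) (w : ℤ) where
    open DworkSeries K n using (c; history; history-c; history-0; c-suc)
    open Numerators n pp w renaming (numerator to num; numerator-history to num-history)

    falling-! : ∀ i d → d ℕ.≤ i → + (i ℕ.!) ≡ falling (+ i) d ℤ.* + ((i ℕ.∸ d) ℕ.!)
    falling-! i zero _ = ≡.sym (ℤP.*-identityˡ _)
    falling-! i (suc d) d<i = ≡.trans (falling-! i d (ℕP.<⇒≤ d<i)) (≡.trans (≡.cong (λ z → falling (+ i) d ℤ.* + (z ℕ.!)) (ℕP.+-∸-assoc 1 d<i))
      (≡.trans (≡.cong (falling (+ i) d ℤ.*_) (≡.trans (ℤP.pos-* (suc (i ℕ.∸ suc d)) ((i ℕ.∸ suc d) ℕ.!)) (≡.cong (λ z → z ℤ.* + ((i ℕ.∸ suc d) ℕ.!)) (≡.trans (≡.cong +_ (≡.sym (ℕP.+-∸-assoc 1 d<i))) (pos-∸ (ℕP.<⇒≤ d<i))))))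
      (≡.sym (ℤP.*-assoc (falling (+ i) d) (+ i ℤ.- + d) _))))

    c-numerator : ∀ i → ⌜ + (i ℕ.!) ⌝ * c w i ≈ ⌜ num i ⌝
    c-numerator = <-rec _ step
      where
      step : ∀ i → (∀ {j} → j ℕ.< i → ⌜ + (j ℕ.!) ⌝ * c w j ≈ ⌜ num j ⌝) → ⌜ + (i ℕ.!) ⌝ * c w i ≈ ⌜ num i ⌝
      step zero _ = *-identityˡ 1#
      step (suc i) rec = begin
        ⌜ + (suc i ℕ.!) ⌝ * c w (suc i) ≈⟨ *-congʳ (trans (≡⇒≈ (≡.cong ⌜_⌝ (ℤP.pos-* (suc i) (i ℕ.!)))) (⌜⌝-* (+ suc i) (+ (i ℕ.!)))) ⟩
        (⌜ + suc i ⌝ * ⌜ + (i ℕ.!) ⌝) * c w (suc i) ≈⟨ solve 3 (λ a f c → (a :* f) :* c := f :* (a :* c)) refl ⌜ + suc i ⌝ ⌜ + (i ℕ.!) ⌝ (c w (suc i)) ⟩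
        ⌜ + (i ℕ.!) ⌝ * (⌜ + suc i ⌝ * c w (suc i)) ≈⟨ *-congˡ (c-suc w i) ⟩
        ⌜ + (i ℕ.!) ⌝ * (⌜ w ⌝ * (c w i + history w i n)) ≈⟨ solve 4 (λ f w c h → f :* (w :* (c :+ h)) := w :* (f :* c :+ f :* h)) refl ⌜ + (i ℕ.!) ⌝ ⌜ w ⌝ (c w i) (history w i n) ⟩
        ⌜ w ⌝ * (⌜ + (i ℕ.!) ⌝ * c w i + ⌜ + (i ℕ.!) ⌝ * history w i n) ≈⟨ *-congˡ (+-cong (rec ℕP.≤-refl) (previous (n ℕ.≤? i))) ⟩
        ⌜ w ⌝ * (⌜ num i ⌝ + ⌜ falling (+ i) n ℤ.* num-history i n ⌝) ≈⟨ *-congˡ (sym (⌜⌝-+ (num i) (falling (+ i) n ℤ.* num-history i n))) ⟩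
        ⌜ w ⌝ * ⌜ num i ℤ.+ falling (+ i) n ℤ.* num-history i n ⌝ ≈⟨ sym (⌜⌝-* w (num i ℤ.+ falling (+ i) n ℤ.* num-history i n)) ⟩
        ⌜ num (suc i) ⌝ ∎
        where
        previous : Dec (n ℕ.≤ i) → ⌜ + (i ℕ.!) ⌝ * history w i n ≈ ⌜ falling (+ i) n ℤ.* num-history i n ⌝
        previous (no n≰i) = trans (*-congˡ (≡⇒≈ (history-0 w i n (ℕP.≰⇒> n≰i)))) (trans (zeroʳ _) (≡⇒≈ (≡.cong ⌜_⌝ (≡.sym
          (≡.trans (≡.cong (falling (+ i) n ℤ.*_) (numerator-history-0 i n (ℕP.≰⇒> n≰i))) (ℤP.*-zeroʳ (falling (+ i) n)))))))
        previous (yes n≤i) = begin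
          ⌜ + (i ℕ.!) ⌝ * history w i n ≈⟨ *-cong (trans (≡⇒≈ (≡.cong ⌜_⌝ (falling-! i n n≤i))) (⌜⌝-* (falling (+ i) n) (+ (d ℕ.!)))) (≡⇒≈ (≡.trans (≡.cong (λ z → history w z n) i≡) (history-c w n d))) ⟩
          (⌜ falling (+ i) n ⌝ * ⌜ + (d ℕ.!) ⌝) * c w d ≈⟨ *-assoc _ _ _ ⟩
          ⌜ falling (+ i) n ⌝ * (⌜ + (d ℕ.!) ⌝ * c w d) ≈⟨ *-congˡ (rec (s≤s (ℕP.m∸n≤m i n))) ⟩
          ⌜ falling (+ i) n ⌝ * ⌜ num d ⌝ ≈⟨ sym (⌜⌝-* (falling (+ i) n) (num d)) ⟩
          ⌜ falling (+ i) n ℤ.* num d ⌝ ≡⟨ ≡.cong (λ z → ⌜ falling (+ i) n ℤ.* z ⌝) (≡.sym (≡.trans (≡.cong (λ z → num-history z n) i≡) (numerator-history-value n d))) ⟩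
          ⌜ falling (+ i) n ℤ.* num-history i n ⌝ ∎
          where
          d : ℕ
          d = i ℕ.∸ n
          i≡ : i ≡ n ℕ.+ d
          i≡ = ≡.sym (ℕP.m+[n∸m]≡n n≤i)

    -- The factorial costs m + e with e ≤ m/4, and the numerator returns ⌈m/2⌉. What remains is at
    -- least M - 3m/4 ≥ M/4 ≥ q, which is the origin of the bound 4k.
    c-valuation : ∀ m a q M → a ℕ.≤ n → m ℕ.≤ M → 4 ℕ.* q ℕ.≤ M → Val q (⌜ + (p ℕ.^ M) ⌝ * c w (p ℕ.* m ℕ.+ a))
    c-valuation m a q M a≤n m≤M 4q≤M = combine (factorial-form 4≤n m) (factorial-split m a a≤n) (Divisibility.divisible (divisibility m) a a≤n)
      where
      i : ℕ
      i = p ℕ.* m ℕ.+ a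
      combine : FactorialForm m → (∃ λ u → p∤ u × + (i ℕ.!) ≡ u ℤ.* (+ (p ℕ.^ m) ℤ.* + (m ℕ.!))) → num i ≅ + 0 [mod p ℕ.^ ℕ.⌈ m /2⌉ ] →
        Val q (⌜ + (p ℕ.^ M) ⌝ * c w i)
      combine (form u e p∤u m! 4e≤m) (u′ , p∤u′ , i!) (by-quotient y N≡) = Val-weaken q≤t (val (u′ ℤ.* u) y (∤-* p∤u′ p∤u)
        (unit-cancel (proj₂ inv) (begin
          A * (⌜ u′ ℤ.* u ⌝ * (B * C)) ≈⟨ solve 4 (λ a u b c → a :* (u :* (b :* c)) := b :* ((u :* a) :* c)) refl A ⌜ u′ ℤ.* u ⌝ B C ⟩
          B * ((⌜ u′ ℤ.* u ⌝ * A) * C) ≈⟨ *-congˡ (*-congʳ (trans (sym (⌜⌝-* (u′ ℤ.* u) (+ (p ℕ.^ (m ℕ.+ e))))) (≡⇒≈ (≡.cong ⌜_⌝ (≡.sym i!′))))) ⟩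
          B * (⌜ + (i ℕ.!) ⌝ * C) ≈⟨ *-congˡ (c-numerator i) ⟩
          B * ⌜ num i ⌝ ≈⟨ trans (sym (⌜⌝-* (+ (p ℕ.^ M)) (num i))) (≡⇒≈ (≡.cong ⌜_⌝ powers)) ⟩
          ⌜ + (p ℕ.^ (m ℕ.+ e)) ℤ.* (y ℤ.* + (p ℕ.^ t)) ⌝ ≈⟨ trans (⌜⌝-* (+ (p ℕ.^ (m ℕ.+ e))) (y ℤ.* + (p ℕ.^ t))) (*-congˡ (⌜⌝-* y (+ (p ℕ.^ t)))) ⟩
          A * (⌜ y ⌝ * ⌜ + (p ℕ.^ t) ⌝) ∎)))
        where
        t : ℕ
        t = M ℕ.+ ℕ.⌈ m /2⌉ ℕ.∸ (m ℕ.+ e)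
        A B C : Carrier
        A = ⌜ + (p ℕ.^ (m ℕ.+ e)) ⌝
        B = ⌜ + (p ℕ.^ M) ⌝
        C = c w i
        inv : ∃ λ u → u * A ≈ 1#
        inv = inverse-of (+ (p ℕ.^ (m ℕ.+ e))) (p^≢0 (m ℕ.+ e))
        i!′ : + (i ℕ.!) ≡ (u′ ℤ.* u) ℤ.* + (p ℕ.^ (m ℕ.+ e))
        i!′ = ≡.trans i! (≡.trans (≡.cong (λ z → u′ ℤ.* (+ (p ℕ.^ m) ℤ.* z)) m!) (≡.trans (lem u′ (+ (p ℕ.^ m)) u (+ (p ℕ.^ e)))
          (≡.cong ((u′ ℤ.* u) ℤ.*_) (≡.trans (≡.sym (ℤP.pos-* (p ℕ.^ m) (p ℕ.^ e))) (≡.cong +_ (≡.sym (ℕP.^-distribˡ-+-* p m e)))))))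
          where
          lem : ∀ u a v b → u ℤ.* (a ℤ.* (v ℤ.* b)) ≡ (u ℤ.* v) ℤ.* (a ℤ.* b)
          lem = solve-∀
        m≤2⌈m/2⌉ : m ℕ.≤ 2 ℕ.* ℕ.⌈ m /2⌉
        m≤2⌈m/2⌉ = go m
          where
          go : ∀ m → m ℕ.≤ 2 ℕ.* ℕ.⌈ m /2⌉
          go zero = z≤n
          go (suc zero) = s≤s z≤n
          go (suc (suc m)) = ℕP.≤-trans (s≤s (s≤s (go m))) (ℕP.≤-reflexive (≡.sym (ℕP.*-suc 2 ℕ.⌈ m /2⌉)))
        exponents : q ℕ.+ (m ℕ.+ e) ℕ.≤ M ℕ.+ ℕ.⌈ m /2⌉
        exponents = ℕP.*-cancelˡ-≤ 4 (≤R.begin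
          4 ℕ.* (q ℕ.+ (m ℕ.+ e)) ≤R.≡⟨ lem q m e ⟩
          4 ℕ.* q ℕ.+ (4 ℕ.* m ℕ.+ 4 ℕ.* e) ≤R.≤⟨ ℕP.+-mono-≤ 4q≤M (ℕP.+-monoʳ-≤ (4 ℕ.* m) 4e≤m) ⟩
          M ℕ.+ (4 ℕ.* m ℕ.+ m) ≤R.≡⟨ lem₂ M m ⟩
          M ℕ.+ 3 ℕ.* m ℕ.+ 2 ℕ.* m ≤R.≤⟨ ℕP.+-mono-≤ (ℕP.+-monoʳ-≤ M (ℕP.*-monoʳ-≤ 3 m≤M)) (ℕP.*-monoʳ-≤ 2 m≤2⌈m/2⌉) ⟩
          M ℕ.+ 3 ℕ.* M ℕ.+ 2 ℕ.* (2 ℕ.* ℕ.⌈ m /2⌉) ≤R.≡⟨ lem₃ M ℕ.⌈ m /2⌉ ⟩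
          4 ℕ.* (M ℕ.+ ℕ.⌈ m /2⌉) ≤R.∎)
          where
          module ≤R = ℕP.≤-Reasoning
          lem : ∀ q m e → 4 ℕ.* (q ℕ.+ (m ℕ.+ e)) ≡ 4 ℕ.* q ℕ.+ (4 ℕ.* m ℕ.+ 4 ℕ.* e)
          lem = ℕSolver.solve-∀
          lem₂ : ∀ M m → M ℕ.+ (4 ℕ.* m ℕ.+ m) ≡ M ℕ.+ 3 ℕ.* m ℕ.+ 2 ℕ.* m
          lem₂ = ℕSolver.solve-∀
          lem₃ : ∀ M c → M ℕ.+ 3 ℕ.* M ℕ.+ 2 ℕ.* (2 ℕ.* c) ≡ 4 ℕ.* (M ℕ.+ c)
          lem₃ = ℕSolver.solve-∀
        q≤t : q ℕ.≤ t
        q≤t = ℕP.m+n≤o⇒m≤o∸n q exponents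
        powers : + (p ℕ.^ M) ℤ.* num i ≡ + (p ℕ.^ (m ℕ.+ e)) ℤ.* (y ℤ.* + (p ℕ.^ t))
        powers = ≡.trans (≡.cong (+ (p ℕ.^ M) ℤ.*_) (≡.trans N≡ (ℤP.+-identityˡ _))) (≡.trans (lem (+ (p ℕ.^ M)) y (+ (p ℕ.^ ℕ.⌈ m /2⌉)))
          (≡.trans (≡.cong (y ℤ.*_) (≡.trans (≡.sym (ℤP.pos-* (p ℕ.^ M) (p ℕ.^ ℕ.⌈ m /2⌉))) (≡.trans (≡.cong +_ (≡.trans (≡.sym (ℕP.^-distribˡ-+-* p M ℕ.⌈ m /2⌉))
            (≡.trans (≡.cong (p ℕ.^_) (≡.sym (ℕP.m+[n∸m]≡n (ℕP.≤-trans (ℕP.m≤n+m (m ℕ.+ e) q) exponents)))) (ℕP.^-distribˡ-+-* p (m ℕ.+ e) t)))) (ℤP.pos-* (p ℕ.^ (m ℕ.+ e)) (p ℕ.^ t)))))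
          (lem₂ y (+ (p ℕ.^ (m ℕ.+ e))) (+ (p ℕ.^ t)))))
          where
          lem : ∀ a y b → a ℤ.* (y ℤ.* b) ≡ y ℤ.* (a ℤ.* b)
          lem = solve-∀
          lem₂ : ∀ y a b → y ℤ.* (a ℤ.* b) ≡ a ℤ.* (y ℤ.* b)
          lem₂ = solve-∀

-- The Gross–Koblitz formula

module GrossKoblitz (K : RationalAlgebra) (n : ℕ) (pp : Prime (suc n)) (h : ℕ) (n≡2h : n ≡ h ℕ.+ h) (4≤n : 4 ℕ.≤ n) (k : ℕ) where
  open RationalAlgebra K
  open ≈-Reasoning
  open Solver using (solve; _:+_; _:*_; _:-_; :-_; _:=_)
  open Valuation K n pp
  open DworkSeries K n
  open GammaValues n pp h n≡2h k
  open SuffixProduct n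
  private module Q = Mod M

  -p^ : ℕ → ℤ
  -p^ m = (ℤ.- + p) ℤ.^ m

  -p^-split : ∀ m → -p^ m ≡ (ℤ.- + 1) ℤ.^ m ℤ.* + (p ℕ.^ m)
  -p^-split m = ≡.trans (≡.cong (ℤ._^ m) (lem (+ p))) (≡.trans (^-distrib (ℤ.- + 1) (+ p) m) (≡.cong ((ℤ.- + 1) ℤ.^ m ℤ.*_) (≡.sym (pos-^ p m))))
    where
    lem : ∀ p → ℤ.- p ≡ ℤ.- + 1 ℤ.* p
    lem = solve-∀

  scaled-valuation : ∀ w i q m → i ℕDM./ p ℕ.≤ m → 4 ℕ.* q ℕ.≤ m → Val q (⌜ -p^ m ⌝ * c w i)
  scaled-valuation w i q m i/p≤m 4q≤m = Val-cong (begin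
      ⌜ (ℤ.- + 1) ℤ.^ m ⌝ * (⌜ + (p ℕ.^ m) ⌝ * c w i) ≈⟨ sym (*-assoc _ _ _) ⟩
      (⌜ (ℤ.- + 1) ℤ.^ m ⌝ * ⌜ + (p ℕ.^ m) ⌝) * c w i ≈⟨ *-congʳ (trans (sym (⌜⌝-* ((ℤ.- + 1) ℤ.^ m) (+ (p ℕ.^ m)))) (≡⇒≈ (≡.cong ⌜_⌝ (≡.sym (-p^-split m))))) ⟩
      ⌜ -p^ m ⌝ * c w i ∎)
    (Val-*ˡ (Val-int ((ℤ.- + 1) ℤ.^ m)) (≡.subst (λ z → Val q (⌜ + (p ℕ.^ m) ⌝ * c w z)) i≡
      (Coefficients.c-valuation 4≤n w (i ℕDM./ p) (i ℕDM.% p) q m (ℕP.≤-pred (ℕDM.m%n<n i p)) i/p≤m 4q≤m)))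
    where
    i≡ : p ℕ.* (i ℕDM./ p) ℕ.+ i ℕDM.% p ≡ i
    i≡ = ≡.sym (≡.trans (ℕDM.m≡m%n+[m/n]*n i p) (≡.trans (ℕP.+-comm (i ℕDM.% p) _) (≡.cong (ℕ._+ i ℕDM.% p) (ℕP.*-comm (i ℕDM./ p) p))))

  quotient-≤ : ∀ i m → i ℕ.< p ℕ.* suc m → i ℕDM./ p ℕ.≤ m
  quotient-≤ i m i< = ℕP.≤-pred (ℕDM.m<n*o⇒m/o<n (≡.subst (i ℕ.<_) (ℕP.*-comm p (suc m)) i<))

  below : ∀ m a l → a ℕ.≤ n → p ℕ.* m ℕ.+ a ℕ.∸ l ℕ.< p ℕ.* suc m
  below m a l a≤n = ℕP.≤-<-trans (ℕP.m∸n≤m (p ℕ.* m ℕ.+ a) l) (≡.subst (p ℕ.* m ℕ.+ a ℕ.<_) (≡.trans (ℕP.+-comm (p ℕ.* m) p) (≡.sym (ℕP.*-suc p m))) (ℕP.+-monoʳ-< (p ℕ.* m) (s≤s a≤n)))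

  k≤repunit : k ℕ.≤ repunit k
  k≤repunit = go k
    where
    go : ∀ j → j ℕ.≤ repunit j
    go zero = z≤n
    go (suc j) = ℕP.≤-trans (s≤s (ℕP.≤-trans (go j) (ℕP.m≤n*m (repunit j) p))) (ℕP.≤-reflexive (ℕP.+-comm 1 _))

  -- In `trace` at N = `twistLength a`, the factor ε = (a + n) p^k kills its integral cofactor, and
  -- e N N and all terms beyond 4k are multiples of p^k because N ≥ 4k. What remains is `lam a N`,
  -- where w^(nN+a) = w^((a+n)M) ≡ w^(aM) and the product of integers prime to p is inverted by γ a
  -- up to sign.
  gross-koblitz : ∀ w a → p∤ w → a ℕ.≤ n →
    Val k ((1# - ⌜ + p ⌝) * ∑ (suc (4 ℕ.* k)) (λ m → ⌜ -p^ m ⌝ * c w (n ℕ.* m ℕ.+ a)) - ⌜ γ a ℤ.* w ℤ.^ (M ℕ.* a) ⌝)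
  gross-koblitz w a p∤w a≤n = Val-cong assemble (Val-- (Val-+ (Val-+ lam-close (Val-neg (Val-*ˡ (Val-int (+ p)) e-small))) (Val-*ʳ ε-small Y-integral)) (Val-*ˡ (Val-- (Val-int (+ 1)) (Val-int (+ p))) tail-small))
    where
    inv : ∃ λ v → v * ⌜ w ⌝ ≈ 1#
    inv = inverse-of w (∤⇒≢0 p∤w)
    v u : Carrier
    v = proj₁ inv
    u = - (⌜ + p ⌝ * v)
    wu : ⌜ w ⌝ * u ≈ - ⌜ + p ⌝
    wu = begin
      ⌜ w ⌝ * - (⌜ + p ⌝ * v) ≈⟨ solve 3 (λ w p v → w :* (:- (p :* v)) := :- (p :* (v :* w))) refl ⌜ w ⌝ ⌜ + p ⌝ v ⟩
      - (⌜ + p ⌝ * (v * ⌜ w ⌝)) ≈⟨ -‿cong (trans (*-congˡ (proj₂ inv)) (*-identityʳ _)) ⟩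
      - ⌜ + p ⌝ ∎
    N : ℕ
    N = twistLength a
    open Twist w u wu
    open Trace a N
    nN+a : n ℕ.* N ℕ.+ a ≡ (a ℕ.+ n) ℕ.* M
    nN+a = ≡.trans (lem n a (repunit k)) (≡.cong ((a ℕ.+ n) ℕ.*_) (n*repunit k))
      where
      lem : ∀ n a r → n ℕ.* ((a ℕ.+ n) ℕ.* r ℕ.+ 1) ℕ.+ a ≡ (a ℕ.+ n) ℕ.* (n ℕ.* r ℕ.+ 1)
      lem = ℕSolver.solve-∀
    4k≤N : 4 ℕ.* k ℕ.≤ N
    4k≤N = ℕP.≤-trans (ℕP.*-mono-≤ (ℕP.≤-trans 4≤n (ℕP.m≤n+m n a)) k≤repunit) (ℕP.m≤m+n _ 1)
    T : ℕ
    T = suc (4 ℕ.* k)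
    r : ℕ
    r = suc N ℕ.∸ T
    diag : ℕ → Carrier
    diag m = ⌜ -p^ m ⌝ * c w (n ℕ.* m ℕ.+ a)
    e-diag : ∀ m → e m m ≈ diag m
    e-diag m = begin
      c w (p ℕ.* m ℕ.+ a ℕ.∸ m) * ⌜ w ⌝ ^ m * u ^ m ≈⟨ trans (*-assoc _ _ _) (*-cong (≡⇒≈ (≡.cong (c w) index)) (sym (^-distrib-* ⌜ w ⌝ u m))) ⟩
      c w (n ℕ.* m ℕ.+ a) * (⌜ w ⌝ * u) ^ m ≈⟨ *-congˡ (trans (^-congˡ m (trans wu (sym (⌜⌝-neg (+ p))))) (sym (⌜⌝-^ (ℤ.- + p) m))) ⟩
      c w (n ℕ.* m ℕ.+ a) * ⌜ -p^ m ⌝ ≈⟨ *-comm _ _ ⟩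
      diag m ∎
      where
      index : p ℕ.* m ℕ.+ a ℕ.∸ m ≡ n ℕ.* m ℕ.+ a
      index = ≡.trans (≡.cong (ℕ._∸ m) (ℕP.+-assoc m (n ℕ.* m) a)) (ℕP.m+n∸m≡n m (n ℕ.* m ℕ.+ a))
    diag-small : ∀ m → 4 ℕ.* k ℕ.≤ m → Val k (diag m)
    diag-small m 4k≤m = scaled-valuation w (n ℕ.* m ℕ.+ a) k m
      (quotient-≤ _ m (≡.subst (ℕ._< p ℕ.* suc m) (≡.trans (≡.cong (ℕ._∸ m) (ℕP.+-assoc m (n ℕ.* m) a)) (ℕP.m+n∸m≡n m (n ℕ.* m ℕ.+ a))) (below m a m a≤n))) 4k≤m
    e-small : Val k (e N N)
    e-small = Val-cong (sym (e-diag N)) (diag-small N 4k≤N)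
    ε-small : Val k ⌜ ε ⌝
    ε-small = Val-≅0 (Q.trans (Q.≡⇒≈ (≡.trans (≡.cong +_ nN+a) (ℤP.pos-* (a ℕ.+ n) M))) (Q.multiple (+ (a ℕ.+ n))))
    v-integral : Val 0 v
    v-integral = Val-inverse p∤w (proj₂ inv)
    e-integral : ∀ l m → Val 0 (e l m)
    e-integral l m = Val-cong (begin
        (⌜ -p^ m ⌝ * C) * (⌜ w ⌝ ^ l * v ^ m) ≈⟨ *-congʳ (*-congʳ (⌜⌝-^ (ℤ.- + p) m)) ⟩
        (⌜ ℤ.- + p ⌝ ^ m * C) * (⌜ w ⌝ ^ l * v ^ m) ≈⟨ solve 4 (λ q c w v → (q :* c) :* (w :* v) := c :* w :* (q :* v)) refl _ C _ _ ⟩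
        C * ⌜ w ⌝ ^ l * (⌜ ℤ.- + p ⌝ ^ m * v ^ m) ≈⟨ *-congˡ (sym (^-distrib-* ⌜ ℤ.- + p ⌝ v m)) ⟩
        C * ⌜ w ⌝ ^ l * (⌜ ℤ.- + p ⌝ * v) ^ m ≈⟨ *-congˡ (^-congˡ m (sym (-‿distribˡ-* ⌜ + p ⌝ v))) ⟩
        C * ⌜ w ⌝ ^ l * u ^ m ∎)
      (Val-*ʳ (scaled-valuation w (p ℕ.* m ℕ.+ a ℕ.∸ l) 0 m (quotient-≤ _ m (below m a l a≤n)) z≤n) (Val-*ˡ (Val-^ l (Val-int w)) (Val-^ m v-integral)))
      where
      C : Carrier
      C = c w (p ℕ.* m ℕ.+ a ℕ.∸ l)
    Y-integral : Val 0 (∑ (suc N) Y)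
    Y-integral = Val-∑ (suc N) Y (λ m _ → Val-∑ m _ (λ l _ → Val-*ˡ (Val-int (weight m (suc l))) (e-integral l m)))
    S : ℤ
    S = suffixProduct N a
    p∤S : p∤ S
    p∤S d = Γ-unit (p ℕ.* N ℕ.+ suc a) (Mod.trans p (Mod.≡⇒≈ p (Γ-suffixProduct N a a≤n)) (Mod.trans p (Mod.*ˡ p ((ℤ.- + 1) ℤ.^ (p ℕ.* N ℕ.+ suc a)) d) (Mod.≡⇒≈ p (ℤP.*-zeroʳ ((ℤ.- + 1) ℤ.^ (p ℕ.* N ℕ.+ suc a))))))
    target : ℤ
    target = γ a ℤ.* w ℤ.^ (M ℕ.* a)
    lam-close : Val k (lam a N - ⌜ target ⌝)
    lam-close = Val-unit-cancel S p∤S (Val-cong (begin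
        ⌜ (ℤ.- + 1) ℤ.^ N ℤ.* W ℤ.- S ℤ.* target ⌝ ≈⟨ trans (⌜⌝-- ((ℤ.- + 1) ℤ.^ N ℤ.* W) (S ℤ.* target)) (+-cong (sym (lam-value N a a≤n)) (-‿cong (⌜⌝-* S target))) ⟩
        ⌜ S ⌝ * lam a N - ⌜ S ⌝ * ⌜ target ⌝ ≈⟨ solve 3 (λ s l t → s :* l :- s :* t := s :* (l :- t)) refl ⌜ S ⌝ (lam a N) ⌜ target ⌝ ⟩
        ⌜ S ⌝ * (lam a N - ⌜ target ⌝) ∎)
      (Val-≅0 (Q.x≈y⇒x-y≈0 congruence)))
      where
      W : ℤ
      W = w ℤ.^ (n ℕ.* N ℕ.+ a)
      W≅ : W Q.≅ w ℤ.^ (M ℕ.* a)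
      W≅ = Q.trans (Q.≡⇒≈ (≡.trans (≡.cong (w ℤ.^_) (≡.trans nN+a (≡.trans (ℕP.*-distribʳ-+ M a n) (≡.cong (ℕ._+ n ℕ.* M) (ℕP.*-comm a M))))) (ℤP.^-distribˡ-+-* w (M ℕ.* a) (n ℕ.* M))))
        (Q.trans (Q.*ˡ (w ℤ.^ (M ℕ.* a)) (ω-order p∤w)) (Q.≡⇒≈ (ℤP.*-identityʳ _)))
      congruence : (ℤ.- + 1) ℤ.^ N ℤ.* W Q.≅ S ℤ.* target
      congruence = Q.trans (Q.*-cong (Q.sym (suffixProduct-γ a a≤n)) W≅) (Q.≡⇒≈ (ℤP.*-assoc S (γ a) (w ℤ.^ (M ℕ.* a))))
    tail : Carrier
    tail = ∑ r (λ i → diag (T ℕ.+ i))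
    tail-small : Val k tail
    tail-small = Val-∑ r _ (λ i _ → diag-small (T ℕ.+ i) (ℕP.≤-trans (ℕP.n≤1+n (4 ℕ.* k)) (ℕP.m≤m+n T i)))
    D≈ : ∑ (suc N) (λ m → e m m) ≈ ∑ T diag + tail
    D≈ = begin
      ∑ (suc N) (λ m → e m m) ≈⟨ ∑-cong′ (suc N) e-diag ⟩
      ∑ (suc N) diag ≡⟨ ≡.cong (λ z → ∑ z diag) (≡.sym (ℕP.m+[n∸m]≡n (s≤s 4k≤N))) ⟩
      ∑ (T ℕ.+ r) diag ≈⟨ ∑-append T r diag ⟩
      ∑ T diag + tail ∎
    assemble : (((lam a N - ⌜ target ⌝) + - (⌜ + p ⌝ * e N N)) + ⌜ ε ⌝ * ∑ (suc N) Y) - (1# - ⌜ + p ⌝) * tail ≈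
      (1# - ⌜ + p ⌝) * ∑ T diag - ⌜ target ⌝
    assemble = begin
      (((lam a N - ⌜ target ⌝) + - (⌜ + p ⌝ * e N N)) + ⌜ ε ⌝ * ∑ (suc N) Y) - (1# - ⌜ + p ⌝) * tail
        ≈⟨ solve 5 (λ l t x y z → (((l :- t) :+ :- x) :+ y) :- z := ((l :- x) :+ y) :- z :- t) refl (lam a N) ⌜ target ⌝ (⌜ + p ⌝ * e N N) (⌜ ε ⌝ * ∑ (suc N) Y) ((1# - ⌜ + p ⌝) * tail) ⟩
      ((lam a N - ⌜ + p ⌝ * e N N) + ⌜ ε ⌝ * ∑ (suc N) Y) - (1# - ⌜ + p ⌝) * tail - ⌜ target ⌝
        ≈⟨ +-congʳ (+-congʳ (sym trace)) ⟩
      (1# - ⌜ + p ⌝) * ∑ (suc N) (λ m → e m m) - (1# - ⌜ + p ⌝) * tail - ⌜ target ⌝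
        ≈⟨ +-congʳ (+-congʳ (*-congˡ D≈)) ⟩
      (1# - ⌜ + p ⌝) * (∑ T diag + tail) - (1# - ⌜ + p ⌝) * tail - ⌜ target ⌝
        ≈⟨ solve 4 (λ q d x t → q :* (d :+ x) :- q :* x :- t := q :* d :- t) refl (1# - ⌜ + p ⌝) (∑ T diag) tail ⌜ target ⌝ ⟩
      (1# - ⌜ + p ⌝) * ∑ T diag - ⌜ target ⌝ ∎

-- Additivity of Dwork's exponential

module Convolution (K : RationalAlgebra) (n : ℕ) (w w′ : ℤ) where
  open RationalAlgebra K
  open ≈-Reasoning
  open Solver using (solve; _:+_; _:*_; _:=_)
  open DworkSeries K n

  private
    -- Convolutions with one factor delayed by j; the recursion for c calls for the delays 0 and n.
    convˡ convʳ : ℕ → ℕ → Carrier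
    convˡ j s = ∑ (suc s) (λ i → history w i j * c w′ (s ℕ.∸ i))
    convʳ j s = ∑ (suc s) (λ i → c w i * history w′ (s ℕ.∸ i) j)

    convˡ-suc : ∀ j s → convˡ (suc j) (suc s) ≈ convˡ j s
    convˡ-suc j s = trans (∑-front (suc s) _) (trans (+-congʳ (zeroˡ _)) (+-identityˡ _))

    convʳ-suc : ∀ j s → convʳ (suc j) (suc s) ≈ convʳ j s
    convʳ-suc j s = trans (+-cong
        (∑-cong (suc s) (λ i i<1+s → *-congˡ (≡⇒≈ (≡.cong (λ z → history w′ z (suc j)) (ℕP.+-∸-assoc 1 (ℕP.≤-pred i<1+s))))))
        (trans (*-congˡ (≡⇒≈ (≡.cong (λ z → history w′ z (suc j)) (ℕP.n∸n≡0 s)))) (zeroʳ _)))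
      (+-identityʳ _)

    Claim : ℕ → Set
    Claim s = convˡ 0 s ≈ c (w ℤ.+ w′) s

    convˡ-history : ∀ s → (∀ {t} → t ℕ.≤ s → Claim t) → ∀ j → convˡ j s ≈ history (w ℤ.+ w′) s j
    convˡ-history s claim zero = claim ℕP.≤-refl
    convˡ-history zero claim (suc j) = trans (+-identityˡ _) (zeroˡ _)
    convˡ-history (suc s) claim (suc j) = trans (convˡ-suc j s) (convˡ-history s (λ t≤s → claim (ℕP.≤-trans t≤s (ℕP.n≤1+n s))) j)

    convʳ-history : ∀ s → (∀ {t} → t ℕ.≤ s → Claim t) → ∀ j → convʳ j s ≈ history (w ℤ.+ w′) s j
    convʳ-history s claim zero = claim ℕP.≤-refl
    convʳ-history zero claim (suc j) = trans (+-identityˡ _) (zeroʳ _)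
    convʳ-history (suc s) claim (suc j) = trans (convʳ-suc j s) (convʳ-history s (λ t≤s → claim (ℕP.≤-trans t≤s (ℕP.n≤1+n s))) j)

    weightedˡ : ∀ s → ∑ (suc (suc s)) (λ i → ⌜ + i ⌝ * (c w i * c w′ (suc s ℕ.∸ i))) ≈ ⌜ w ⌝ * (convˡ 0 s + convˡ n s)
    weightedˡ s = begin
      ∑ (suc (suc s)) (λ i → ⌜ + i ⌝ * (c w i * c w′ (suc s ℕ.∸ i)))
        ≈⟨ trans (∑-front (suc s) (λ i → ⌜ + i ⌝ * (c w i * c w′ (suc s ℕ.∸ i)))) (trans (+-congʳ (zeroˡ _)) (+-identityˡ _)) ⟩
      ∑ (suc s) (λ i → ⌜ + suc i ⌝ * (c w (suc i) * c w′ (s ℕ.∸ i)))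
        ≈⟨ ∑-cong′ (suc s) (λ i → begin
          ⌜ + suc i ⌝ * (c w (suc i) * c w′ (s ℕ.∸ i)) ≈⟨ sym (*-assoc _ _ _) ⟩
          (⌜ + suc i ⌝ * c w (suc i)) * c w′ (s ℕ.∸ i) ≈⟨ *-congʳ (c-suc w i) ⟩
          ⌜ w ⌝ * (c w i + history w i n) * c w′ (s ℕ.∸ i) ≈⟨ solve 4 (λ w c h d → w :* (c :+ h) :* d := w :* (c :* d :+ h :* d)) refl _ _ _ _ ⟩
          ⌜ w ⌝ * (c w i * c w′ (s ℕ.∸ i) + history w i n * c w′ (s ℕ.∸ i)) ∎) ⟩
      ∑ (suc s) (λ i → ⌜ w ⌝ * (c w i * c w′ (s ℕ.∸ i) + history w i n * c w′ (s ℕ.∸ i)))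
        ≈⟨ trans (∑-*ˡ (suc s) ⌜ w ⌝ _) (*-congˡ (∑-+ (suc s) _ _)) ⟩
      ⌜ w ⌝ * (convˡ 0 s + convˡ n s) ∎

    weightedʳ : ∀ s → ∑ (suc (suc s)) (λ i → ⌜ + (suc s ℕ.∸ i) ⌝ * (c w i * c w′ (suc s ℕ.∸ i))) ≈ ⌜ w′ ⌝ * (convʳ 0 s + convʳ n s)
    weightedʳ s = begin
      ∑ (suc s) t + t (suc s)
        ≈⟨ +-cong (∑-cong (suc s) term) (trans (*-congʳ (≡⇒≈ (≡.cong (λ z → ⌜ + z ⌝) (ℕP.n∸n≡0 s)))) (zeroˡ _)) ⟩
      ∑ (suc s) (λ i → ⌜ w′ ⌝ * (c w i * c w′ (s ℕ.∸ i) + c w i * history w′ (s ℕ.∸ i) n)) + 0#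
        ≈⟨ trans (+-identityʳ _) (trans (∑-*ˡ (suc s) ⌜ w′ ⌝ _) (*-congˡ (∑-+ (suc s) _ _))) ⟩
      ⌜ w′ ⌝ * (convʳ 0 s + convʳ n s) ∎
      where
      t : ℕ → Carrier
      t i = ⌜ + (suc s ℕ.∸ i) ⌝ * (c w i * c w′ (suc s ℕ.∸ i))
      term : ∀ i → i ℕ.< suc s → t i ≈ ⌜ w′ ⌝ * (c w i * c w′ (s ℕ.∸ i) + c w i * history w′ (s ℕ.∸ i) n)
      term i i<1+s = begin
        ⌜ + (suc s ℕ.∸ i) ⌝ * (c w i * c w′ (suc s ℕ.∸ i)) ≡⟨ ≡.cong (λ z → ⌜ + z ⌝ * (c w i * c w′ z)) (ℕP.+-∸-assoc 1 (ℕP.≤-pred i<1+s)) ⟩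
        ⌜ + suc m ⌝ * (c w i * c w′ (suc m)) ≈⟨ solve 3 (λ a b c → a :* (b :* c) := b :* (a :* c)) refl _ _ _ ⟩
        c w i * (⌜ + suc m ⌝ * c w′ (suc m)) ≈⟨ *-congˡ (c-suc w′ m) ⟩
        c w i * (⌜ w′ ⌝ * (c w′ m + history w′ m n)) ≈⟨ solve 4 (λ c w d h → c :* (w :* (d :+ h)) := w :* (c :* d :+ c :* h)) refl _ _ _ _ ⟩
        ⌜ w′ ⌝ * (c w i * c w′ m + c w i * history w′ m n) ∎
        where
        m : ℕ
        m = s ℕ.∸ i

  -- The product rule for derivatives: multiply by s = i + (s - i) and apply the recursion to the
  -- first or the second factor. The result satisfies the recursion for w + w′, whose delayed terms
  -- are known by induction.
  c-convolution : ∀ s → ∑ (suc s) (λ i → c w i * c w′ (s ℕ.∸ i)) ≈ c (w ℤ.+ w′) s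
  c-convolution = <-rec Claim step
    where
    step : ∀ s → (∀ {t} → t ℕ.< s → Claim t) → Claim s
    step zero _ = trans (+-identityˡ _) (*-identityˡ 1#)
    step (suc s) rec = unit-cancel (recip-inverse s) (begin
      ⌜ + suc s ⌝ * convˡ 0 (suc s)
        ≈⟨ sym (∑-*ˡ (suc (suc s)) _ _) ⟩
      ∑ (suc (suc s)) (λ i → ⌜ + suc s ⌝ * (c w i * c w′ (suc s ℕ.∸ i)))
        ≈⟨ ∑-cong (suc (suc s)) (λ i i< → trans (*-congʳ (trans (≡⇒≈ (≡.cong (λ z → ⌜ + z ⌝) (≡.sym (ℕP.m+[n∸m]≡n (ℕP.≤-pred i<))))) (⌜⌝-+ (+ i) (+ (suc s ℕ.∸ i))))) (distribʳ _ _ _)) ⟩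
      ∑ (suc (suc s)) (λ i → ⌜ + i ⌝ * (c w i * c w′ (suc s ℕ.∸ i)) + ⌜ + (suc s ℕ.∸ i) ⌝ * (c w i * c w′ (suc s ℕ.∸ i)))
        ≈⟨ trans (∑-+ (suc (suc s)) _ _) (+-cong (weightedˡ s) (weightedʳ s)) ⟩
      ⌜ w ⌝ * (convˡ 0 s + convˡ n s) + ⌜ w′ ⌝ * (convʳ 0 s + convʳ n s)
        ≈⟨ +-cong (*-congˡ (+-cong (claim ℕP.≤-refl) (convˡ-history s claim n))) (*-congˡ (+-cong (claim ℕP.≤-refl) (convʳ-history s claim n))) ⟩
      ⌜ w ⌝ * (c W s + history W s n) + ⌜ w′ ⌝ * (c W s + history W s n)
        ≈⟨ trans (sym (distribʳ _ _ _)) (*-congʳ (sym (⌜⌝-+ w w′))) ⟩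
      ⌜ W ⌝ * (c W s + history W s n)
        ≈⟨ sym (c-suc W s) ⟩
      ⌜ + suc s ⌝ * c W (suc s) ∎)
      where
      W : ℤ
      W = w ℤ.+ w′
      claim : ∀ {t} → t ℕ.≤ s → Claim t
      claim t≤s = rec (s≤s t≤s)

-- Gauss sums in L[Y]/(Y^n + p)

module RingHom (R S : CommutativeRing 0ℓ 0ℓ) where
  private
    module R = RingTheory R
    module S = RingTheory S

  ⌜⌝-natural : (φ : R.Carrier → S.Carrier) → (∀ {x y} → x R.≈ y → φ x S.≈ φ y) → (∀ x y → φ (x R.+ y) S.≈ φ x S.+ φ y) →
    φ R.0# S.≈ S.0# → φ R.1# S.≈ S.1# → (∀ x → φ (R.- x) S.≈ S.- φ x) → ∀ z → φ R.⌜ z ⌝ S.≈ S.⌜ z ⌝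
  ⌜⌝-natural φ φ-cong φ-+ φ-0 φ-1 φ-neg (+ m) = pos m
    where
    pos : ∀ m → φ R.⌜ + m ⌝ S.≈ S.⌜ + m ⌝
    pos zero = φ-0
    pos (suc m) = S.trans (φ-cong (R.⌜⌝-+ (+ 1) (+ m))) (S.trans (φ-+ R.1# R.⌜ + m ⌝) (S.trans (S.+-cong φ-1 (pos m)) (S.sym (S.⌜⌝-+ (+ 1) (+ m)))))
  ⌜⌝-natural φ φ-cong φ-+ φ-0 φ-1 φ-neg -[1+ m ] = S.trans (φ-neg R.⌜ + suc m ⌝) (S.-‿cong (⌜⌝-natural φ φ-cong φ-+ φ-0 φ-1 φ-neg (+ suc m)))

-- L[Y]/(Y^n - ϖ). Elements are formal sums of terms c Y^e; equality is tested on the L-linear functionals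
-- of L[Y] vanishing on the ideal, which are the sequences f = (f(Y^i)) with f (i + n) = ϖ f i.
module Ramified (L : CommutativeRing 0ℓ 0ℓ) (n : ℕ) (ϖ : CommutativeRing.Carrier L) where
  private module L = RingTheory L
  open L using (_+_; _*_; -_; 0#; 1#) renaming (_≈_ to _≈ᴸ_)
  open L.Solver using (solve; _:+_; _:*_; _:-_; :-_; _:=_; con)

  Terms : Set
  Terms = List (L.Carrier × ℕ)

  Functional : (ℕ → L.Carrier) → Set
  Functional f = ∀ i → f (i ℕ.+ n) ≈ᴸ ϖ * f i

  ⟪_,_⟫ : Terms → (ℕ → L.Carrier) → L.Carrier
  ⟪ [] , f ⟫ = 0#
  ⟪ (c , e) ∷ x , f ⟫ = c * f e + ⟪ x , f ⟫

  ⟪⟫-cong : ∀ x {f g : ℕ → L.Carrier} → (∀ i → f i ≈ᴸ g i) → ⟪ x , f ⟫ ≈ᴸ ⟪ x , g ⟫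
  ⟪⟫-cong [] h = L.refl
  ⟪⟫-cong ((c , e) ∷ x) h = L.+-cong (L.*-congˡ (h e)) (⟪⟫-cong x h)

  ⟪⟫-++ : ∀ x y f → ⟪ x List.++ y , f ⟫ ≈ᴸ ⟪ x , f ⟫ + ⟪ y , f ⟫
  ⟪⟫-++ [] y f = L.sym (L.+-identityˡ _)
  ⟪⟫-++ ((c , e) ∷ x) y f = L.trans (L.+-congˡ (⟪⟫-++ x y f)) (L.sym (L.+-assoc _ _ _))

  ⟪⟫-+ : ∀ x f g → ⟪ x , (λ i → f i + g i) ⟫ ≈ᴸ ⟪ x , f ⟫ + ⟪ x , g ⟫
  ⟪⟫-+ [] f g = L.sym (L.+-identityˡ 0#)
  ⟪⟫-+ ((c , e) ∷ x) f g = L.trans (L.+-congˡ (⟪⟫-+ x f g))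
    (solve 5 (λ c a b x y → c :* (a :+ b) :+ (x :+ y) := (c :* a :+ x) :+ (c :* b :+ y)) L.refl c (f e) (g e) ⟪ x , f ⟫ ⟪ x , g ⟫)

  ⟪⟫-* : ∀ x a f → ⟪ x , (λ i → a * f i) ⟫ ≈ᴸ a * ⟪ x , f ⟫
  ⟪⟫-* [] a f = L.sym (L.zeroʳ a)
  ⟪⟫-* ((c , e) ∷ x) a f = L.trans (L.+-congˡ (⟪⟫-* x a f)) (solve 4 (λ c a f x → c :* (a :* f) :+ a :* x := a :* (c :* f :+ x)) L.refl c a (f e) ⟪ x , f ⟫)

  ⟪⟫-zero : ∀ x → ⟪ x , (λ _ → 0#) ⟫ ≈ᴸ 0#
  ⟪⟫-zero [] = L.refl
  ⟪⟫-zero ((c , e) ∷ x) = L.trans (L.+-cong (L.zeroʳ c) (⟪⟫-zero x)) (L.+-identityˡ 0#)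

  ⟪⟫-swap : ∀ x y (g : ℕ → ℕ → L.Carrier) → ⟪ x , (λ i → ⟪ y , g i ⟫) ⟫ ≈ᴸ ⟪ y , (λ j → ⟪ x , (λ i → g i j) ⟫) ⟫
  ⟪⟫-swap [] y g = L.sym (⟪⟫-zero y)
  ⟪⟫-swap ((c , e) ∷ x) y g = L.trans (L.+-cong (L.sym (⟪⟫-* y c (g e))) (⟪⟫-swap x y g)) (L.sym (⟪⟫-+ y _ _))

  negate : Terms → Terms
  negate = List.map (λ { (c , e) → - c , e })

  ⟪⟫-negate : ∀ x f → ⟪ negate x , f ⟫ ≈ᴸ - ⟪ x , f ⟫
  ⟪⟫-negate [] f = L.sym L.-0#≈0#
  ⟪⟫-negate ((c , e) ∷ x) f = L.trans (L.+-congˡ (⟪⟫-negate x f)) (solve 3 (λ c f x → (:- c) :* f :+ :- x := :- (c :* f :+ x)) L.refl c (f e) ⟪ x , f ⟫)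

  infixl 7 _⊛_
  _⊛_ : Terms → Terms → Terms
  [] ⊛ y = []
  ((c , e) ∷ x) ⊛ y = List.map (λ { (d , j) → c * d , e ℕ.+ j }) y List.++ x ⊛ y

  ⟪⟫-scale : ∀ c e y f → ⟪ List.map (λ { (d , j) → c * d , e ℕ.+ j }) y , f ⟫ ≈ᴸ c * ⟪ y , (λ j → f (e ℕ.+ j)) ⟫
  ⟪⟫-scale c e [] f = L.sym (L.zeroʳ c)
  ⟪⟫-scale c e ((d , j) ∷ y) f = L.trans (L.+-congˡ (⟪⟫-scale c e y f)) (solve 4 (λ c d f y → c :* d :* f :+ c :* y := c :* (d :* f :+ y)) L.refl c d (f (e ℕ.+ j)) ⟪ y , (λ j → f (e ℕ.+ j)) ⟫)

  ⟪⟫-⊛ : ∀ x y f → ⟪ x ⊛ y , f ⟫ ≈ᴸ ⟪ x , (λ e → ⟪ y , (λ j → f (e ℕ.+ j)) ⟫) ⟫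
  ⟪⟫-⊛ [] y f = L.refl
  ⟪⟫-⊛ ((c , e) ∷ x) y f = L.trans (⟪⟫-++ (List.map _ y) (x ⊛ y) f) (L.+-cong (⟪⟫-scale c e y f) (⟪⟫-⊛ x y f))

  infix 4 _≈ᴬ_
  record _≈ᴬ_ (x y : Terms) : Set where
    constructor tested
    field
      test : ∀ f → Functional f → ⟪ x , f ⟫ ≈ᴸ ⟪ y , f ⟫

  open _≈ᴬ_ public

  shift-functional : ∀ {f} e → Functional f → Functional (λ j → f (e ℕ.+ j))
  shift-functional {f} e F i = L.trans (L.≡⇒≈ (≡.cong f (≡.sym (ℕP.+-assoc e i n)))) (F (e ℕ.+ i))

  partial-functional : ∀ {f} y → Functional f → Functional (λ e → ⟪ y , (λ j → f (e ℕ.+ j)) ⟫)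
  partial-functional {f} y F i = L.trans (⟪⟫-cong y (λ j → L.trans (L.≡⇒≈ (≡.cong f (≡.trans (ℕP.+-assoc i n j) (≡.trans (≡.cong (i ℕ.+_) (ℕP.+-comm n j)) (≡.sym (ℕP.+-assoc i j n)))))) (F (i ℕ.+ j)))) (⟪⟫-* y ϖ _)

  ⊛-comm : ∀ x y → (x ⊛ y) ≈ᴬ (y ⊛ x)
  ⊛-comm x y = tested λ f F → L.trans (⟪⟫-⊛ x y f) (L.trans (⟪⟫-swap x y _)
    (L.trans (⟪⟫-cong y (λ j → ⟪⟫-cong x (λ i → L.≡⇒≈ (≡.cong f (ℕP.+-comm i j))))) (L.sym (⟪⟫-⊛ y x f))))

  ⊛-distribʳ : ∀ x y z → ((y List.++ z) ⊛ x) ≈ᴬ (y ⊛ x List.++ z ⊛ x)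
  ⊛-distribʳ x y z = tested λ f F → L.trans (⟪⟫-⊛ (y List.++ z) x f) (L.trans (⟪⟫-++ y z _) (L.sym (L.trans (⟪⟫-++ (y ⊛ x) (z ⊛ x) f) (L.+-cong (⟪⟫-⊛ y x f) (⟪⟫-⊛ z x f)))))

  ++-congᴬ : ∀ {x y u v} → x ≈ᴬ y → u ≈ᴬ v → (x List.++ u) ≈ᴬ (y List.++ v)
  ++-congᴬ {x} {y} {u} {v} a b = tested λ f F → L.trans (⟪⟫-++ x u f) (L.trans (L.+-cong (test a f F) (test b f F)) (L.sym (⟪⟫-++ y v f)))

  ++-commᴬ : ∀ x y → (x List.++ y) ≈ᴬ (y List.++ x)
  ++-commᴬ x y = tested λ f F → L.trans (⟪⟫-++ x y f) (L.trans (L.+-comm _ _) (L.sym (⟪⟫-++ y x f)))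

  transᴬ : ∀ {x y z} → x ≈ᴬ y → y ≈ᴬ z → x ≈ᴬ z
  transᴬ a b = tested λ f F → L.trans (test a f F) (test b f F)

  ⊛-identityˡ : ∀ x → (((1# , 0) ∷ []) ⊛ x) ≈ᴬ x
  ⊛-identityˡ x = tested λ f F → L.trans (⟪⟫-⊛ ((1# , 0) ∷ []) x f) (L.trans (L.+-identityʳ _) (L.*-identityˡ _))

  negate-inverseʳ : ∀ x → (x List.++ negate x) ≈ᴬ []
  negate-inverseʳ x = tested λ f F → L.trans (⟪⟫-++ x (negate x) f) (L.trans (L.+-congˡ (⟪⟫-negate x f)) (L.-‿inverseʳ _))

  ramifiedRing : CommutativeRing 0ℓ 0ℓ
  ramifiedRing = record
    { Carrier = Terms ; _≈_ = _≈ᴬ_ ; _+_ = List._++_ ; _*_ = _⊛_ ; -_ = negate ; 0# = [] ; 1# = (1# , 0) ∷ []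
    ; isCommutativeRing = record
      { isRing = record
        { +-isAbelianGroup = record
          { isGroup = record
            { isMonoid = record
              { isSemigroup = record
                { isMagma = record
                  { isEquivalence = record
                    { refl = tested λ f F → L.refl
                    ; sym = λ a → tested λ f F → L.sym (test a f F)
                    ; trans = transᴬ }
                  ; ∙-cong = ++-congᴬ }
                ; assoc = λ x y z → tested λ f F → L.trans (⟪⟫-++ (x List.++ y) z f) (L.trans (L.+-congʳ (⟪⟫-++ x y f)) (L.trans (L.+-assoc _ _ _) (L.sym (L.trans (⟪⟫-++ x (y List.++ z) f) (L.+-congˡ (⟪⟫-++ y z f)))))) }
              ; identity = (λ x → tested λ f F → L.refl) , (λ x → tested λ f F → L.trans (⟪⟫-++ x [] f) (L.+-identityʳ _)) }
            ; inverse = (λ x → transᴬ (++-commᴬ (negate x) x) (negate-inverseʳ x)) , negate-inverseʳ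
            ; ⁻¹-cong = λ {x} {y} a → tested λ f F → L.trans (⟪⟫-negate x f) (L.trans (L.-‿cong (test a f F)) (L.sym (⟪⟫-negate y f))) }
          ; comm = ++-commᴬ }
        ; *-cong = λ {x} {y} {u} {v} a b → tested λ f F → L.trans (⟪⟫-⊛ x u f) (L.trans (test a _ (partial-functional u F))
            (L.trans (⟪⟫-cong y (λ e → test b _ (shift-functional e F))) (L.sym (⟪⟫-⊛ y v f))))
        ; *-assoc = λ x y z → tested λ f F → L.trans (⟪⟫-⊛ (x ⊛ y) z f) (L.trans (⟪⟫-⊛ x y _) (L.sym (L.trans (⟪⟫-⊛ x (y ⊛ z) f)
            (⟪⟫-cong x (λ e → L.trans (⟪⟫-⊛ y z _) (⟪⟫-cong y (λ j → ⟪⟫-cong z (λ l → L.≡⇒≈ (≡.cong f (≡.sym (ℕP.+-assoc e j l)))))))))))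
        ; *-identity = ⊛-identityˡ , (λ x → transᴬ (⊛-comm x ((1# , 0) ∷ [])) (⊛-identityˡ x))
        ; distrib = (λ x y z → transᴬ (⊛-comm x (y List.++ z)) (transᴬ (⊛-distribʳ x y z) (++-congᴬ (⊛-comm y x) (⊛-comm z x)))) , ⊛-distribʳ }
      ; *-comm = ⊛-comm } }

  module A = RingTheory ramifiedRing

  mono : L.Carrier → ℕ → Terms
  mono c e = (c , e) ∷ []

  mono-cong : ∀ {c d} e → c ≈ᴸ d → mono c e ≈ᴬ mono d e
  mono-cong e c≈d = tested λ f F → L.+-congʳ (L.*-congʳ c≈d)

  mono-* : ∀ c e d j → mono c e ⊛ mono d j ≈ᴬ mono (c * d) (e ℕ.+ j)
  mono-* c e d j = tested λ f F → L.refl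

  mono-+ : ∀ c d e → (mono c e List.++ mono d e) ≈ᴬ mono (c + d) e
  mono-+ c d e = tested λ f F → solve 3 (λ c d f → c :* f :+ (d :* f :+ con (+ 0)) := (c :+ d) :* f :+ con (+ 0)) L.refl c d (f e)

  mono-0 : ∀ e → mono 0# e ≈ᴬ []
  mono-0 e = tested λ f F → L.trans (L.+-identityʳ _) (L.zeroˡ _)

  mono-∑ : ∀ m (f : ℕ → L.Carrier) e → A.∑ m (λ i → mono (f i) e) ≈ᴬ mono (L.∑ m f) e
  mono-∑ zero f e = A.sym (mono-0 e)
  mono-∑ (suc m) f e = A.trans (A.+-congʳ (mono-∑ m f e)) (mono-+ (L.∑ m f) (f m) e)

  mono-wrap : ∀ c e → mono c (e ℕ.+ n) ≈ᴬ mono (ϖ * c) e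
  mono-wrap c e = tested λ f F → L.+-congʳ (L.trans (L.*-congˡ (F e)) (solve 3 (λ c p f → c :* (p :* f) := p :* c :* f) L.refl c ϖ (f e)))

  mono-wraps : ∀ c e t → mono c (e ℕ.+ t ℕ.* n) ≈ᴬ mono (ϖ L.^ t * c) e
  mono-wraps c e zero = A.trans (A.≡⇒≈ (≡.cong (mono c) (ℕP.+-identityʳ e))) (mono-cong e (L.sym (L.*-identityˡ c)))
  mono-wraps c e (suc t) = A.trans (A.≡⇒≈ (≡.cong (mono c) (≡.trans (≡.cong (e ℕ.+_) (ℕP.+-comm n (t ℕ.* n))) (≡.sym (ℕP.+-assoc e (t ℕ.* n) n)))))
    (A.trans (mono-wrap c (e ℕ.+ t ℕ.* n)) (A.trans (mono-wraps (ϖ * c) e t) (mono-cong e (solve 3 (λ q p c → q :* (p :* c) := p :* q :* c) L.refl (ϖ L.^ t) ϖ c))))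

  ⌜⌝-mono : ∀ z → mono L.⌜ z ⌝ 0 ≈ᴬ A.⌜ z ⌝
  ⌜⌝-mono = RingHom.⌜⌝-natural L ramifiedRing (λ c → mono c 0) (mono-cong 0) (λ x y → A.sym (mono-+ x y 0)) (mono-0 0) A.refl
    (λ x → A.refl)

  mono-injective : .⦃ _ : ℕ.NonZero n ⦄ → ∀ e c d → e ℕ.< n → mono c e ≈ᴬ mono d e → c ≈ᴸ d
  mono-injective e c d e<n eq = L.trans (L.sym (at c)) (L.trans (test eq f F) (at d))
    where
    f : ℕ → L.Carrier
    -- The functional that reads off the coefficient of Y^e after every Y^n has been replaced by ϖ.
    f i = L.δ (i ℕDM.% n) e * ϖ L.^ (i ℕDM./ n)
    F : Functional f
    F i = L.trans (L.*-cong (L.≡⇒≈ (≡.cong (λ z → L.δ z e) (ℕDM.[m+n]%n≡m%n i n))) (L.≡⇒≈ (≡.cong (ϖ L.^_) quotient)))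
      (solve 3 (λ d p q → d :* (p :* q) := p :* (d :* q)) L.refl (L.δ (i ℕDM.% n) e) ϖ (ϖ L.^ (i ℕDM./ n)))
      where
      quotient : (i ℕ.+ n) ℕDM./ n ≡ suc (i ℕDM./ n)
      quotient = ≡.trans (ℕDM.+-distrib-/-∣ʳ i (ℕD.∣-refl {n})) (≡.trans (≡.cong (i ℕDM./ n ℕ.+_) (ℕDM.n/n≡1 n)) (ℕP.+-comm _ 1))
    at : ∀ c → ⟪ mono c e , f ⟫ ≈ᴸ c
    at c = L.trans (L.+-identityʳ _) (L.trans (L.*-congˡ (L.trans (L.*-cong
        (L.trans (L.≡⇒≈ (≡.cong (λ z → L.δ z e) (ℕDM.m<n⇒m%n≡m e<n))) (L.δ-refl e)) (L.≡⇒≈ (≡.cong (ϖ L.^_) (ℕDM.m<n⇒m/n≡0 e<n))))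
        (L.*-identityˡ 1#))) (L.*-identityʳ c))

-- All that the character sums use of F. Periodicity modulo p is not listed, since it follows from
-- `F-expansion`. `Y-injective` brings an identity in the ring back to a congruence of integers.
record GaussRing (n : ℕ) (pp : Prime (suc n)) (h : ℕ) (n≡2h : n ≡ h ℕ.+ h) (k : ℕ) : Set (Level.suc 0ℓ) where
  open GammaValues n pp h n≡2h k using (M; γ; p∤_)
  field
    ring : CommutativeRing 0ℓ 0ℓ
  open RingTheory ring
  field
    ⌜⌝-mod : ∀ {x y} → x ≅ y [mod M ] → ⌜ x ⌝ ≈ ⌜ y ⌝
    Y : Carrier
    Y^n : Y ^ n ≈ ⌜ ℤ.- + suc n ⌝
    Y-injective : ∀ e x y → e ℕ.< n → ⌜ x ⌝ * Y ^ e ≈ ⌜ y ⌝ * Y ^ e → x ≅ y [mod M ]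
    -- F w = exp(w(Y + Y^p/p))
    F : ℤ → Carrier
    F-0 : F (+ 0) ≈ 1#
    F-+ : ∀ w w′ → F w * F w′ ≈ F (w ℤ.+ w′)
    F-expansion : ∀ w → p∤ w → ⌜ + 1 ℤ.- + suc n ⌝ * F w ≈ ∑ n (λ a → ⌜ γ a ℤ.* w ℤ.^ (M ℕ.* a) ⌝ * Y ^ a)

module CarryLemmas (n : ℕ) .⦃ n-nonZero : ℕ.NonZero n ⦄ where
  -- The power (-p)^⌊i/n⌋ is multiplicative in i only up to (-p)^carry. This is the factor that Y^n
  -- = -p produces when two reduced exponents are added.
  carry : ℕ → ℕ → ℕ
  carry i j = (i ℕDM.% n ℕ.+ j ℕDM.% n) ℕDM./ n

  residues-+ : ∀ i j → i ℕDM.% n ℕ.+ j ℕDM.% n ≡ (i ℕ.+ j) ℕDM.% n ℕ.+ carry i j ℕ.* n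
  residues-+ i j = ≡.trans (ℕDM.m≡m%n+[m/n]*n (i ℕDM.% n ℕ.+ j ℕDM.% n) n) (≡.cong (ℕ._+ carry i j ℕ.* n) (≡.sym (ℕDM.%-distribˡ-+ i j n)))

  quotients-+ : ∀ i j → (i ℕ.+ j) ℕDM./ n ≡ carry i j ℕ.+ (i ℕDM./ n ℕ.+ j ℕDM./ n)
  quotients-+ i j = ≡.trans (≡.cong (ℕDM._/ n) decompose) (≡.trans (ℕDM.+-distrib-/-∣ˡ (i ℕDM.% n ℕ.+ j ℕDM.% n) (ℕD.n∣m*n (i ℕDM./ n ℕ.+ j ℕDM./ n) {n}))
    (≡.trans (≡.cong (ℕ._+ carry i j) (ℕDM.m*n/n≡m (i ℕDM./ n ℕ.+ j ℕDM./ n) n)) (ℕP.+-comm _ (carry i j))))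
    where
    decompose : i ℕ.+ j ≡ (i ℕDM./ n ℕ.+ j ℕDM./ n) ℕ.* n ℕ.+ (i ℕDM.% n ℕ.+ j ℕDM.% n)
    decompose = ≡.trans (≡.cong₂ ℕ._+_ (ℕDM.m≡m%n+[m/n]*n i n) (ℕDM.m≡m%n+[m/n]*n j n)) (lem (i ℕDM.% n) (i ℕDM./ n) (j ℕDM.% n) (j ℕDM./ n) n)
      where
      lem : ∀ a q b r n → (a ℕ.+ q ℕ.* n) ℕ.+ (b ℕ.+ r ℕ.* n) ≡ (q ℕ.+ r) ℕ.* n ℕ.+ (a ℕ.+ b)
      lem = ℕSolver.solve-∀

-- The ring L plays the role of ℤ₍ₚ₎/p^k, and term w i that of (-p)^(i/n) c w i.
record ScaledCoefficients (n : ℕ) (pp : Prime (suc n)) (h : ℕ) (n≡2h : n ≡ h ℕ.+ h) (k : ℕ) .⦃ n-nonZero : ℕ.NonZero n ⦄ : Set (Level.suc 0ℓ) where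
  open GammaValues n pp h n≡2h k using (p; M; γ; p∤_)
  open CarryLemmas n using (carry)
  field
    L : CommutativeRing 0ℓ 0ℓ
  module L = RingTheory L
  field
    ⌜⌝-modᴸ : ∀ {x y} → x ≅ y [mod M ] → L.⌜ x ⌝ L.≈ L.⌜ y ⌝
    ⌜⌝-injectiveᴸ : ∀ x y → L.⌜ x ⌝ L.≈ L.⌜ y ⌝ → x ≅ y [mod M ]
    T : ℕ
    T>0 : 0 ℕ.< T
    term : ℤ → ℕ → L.Carrier
    term-vanishes : ∀ w i → T ℕ.* n ℕ.≤ i → term w i L.≈ L.0#
    term-convolution : ∀ w w′ s →
      L.∑ (suc s) (λ i → L.⌜ ℤ.- + p ⌝ L.^ carry i (s ℕ.∸ i) L.* (term w i L.* term w′ (s ℕ.∸ i))) L.≈ term (w ℤ.+ w′) s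
    term-0-0 : term (+ 0) 0 L.≈ L.1#
    term-0-suc : ∀ i → term (+ 0) (suc i) L.≈ L.0#
    term-sum : ∀ w a → p∤ w → a ℕ.< n → L.⌜ + 1 ℤ.- + p ⌝ L.* L.∑ T (λ m → term w (m ℕ.* n ℕ.+ a)) L.≈ L.⌜ γ a ℤ.* w ℤ.^ (M ℕ.* a) ⌝

module AdditiveRing (n : ℕ) (pp : Prime (suc n)) (h : ℕ) (n≡2h : n ≡ h ℕ.+ h) (k : ℕ) .⦃ n-nonZero : ℕ.NonZero n ⦄ (S : ScaledCoefficients n pp h n≡2h k) where
  open GammaValues n pp h n≡2h k
  open CarryLemmas n
  open ScaledCoefficients S
  open Ramified L n L.⌜ ℤ.- + p ⌝
  open A using () renaming (_≈_ to _≋_; _*_ to _⊗_)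

  -- c_i Y^i with Y^i already reduced: c_i itself need not be p-integral and becomes so with the
  -- factor (-p)^⌊i/n⌋ contained in `term`.
  E : ℤ → ℕ → Terms
  E w i = mono (term w i) (i ℕDM.% n)

  E-vanishes : ∀ w i → T ℕ.* n ℕ.≤ i → E w i ≋ A.0#
  E-vanishes w i Tn≤i = A.trans (mono-cong (i ℕDM.% n) (term-vanishes w i Tn≤i)) (mono-0 (i ℕDM.% n))

  F : ℤ → Terms
  F w = A.∑ (T ℕ.* n) (E w)

  product : ℤ → ℤ → ℕ → ℕ → L.Carrier
  product w w′ i j = L.⌜ ℤ.- + p ⌝ L.^ carry i j L.* (term w i L.* term w′ j)

  E-* : ∀ w w′ i j → E w i ⊗ E w′ j ≋ mono (product w w′ i j) ((i ℕ.+ j) ℕDM.% n)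
  E-* w w′ i j = A.trans (mono-* (term w i) (i ℕDM.% n) (term w′ j) (j ℕDM.% n))
    (A.trans (A.≡⇒≈ (≡.cong (mono (term w i L.* term w′ j)) (residues-+ i j))) (mono-wraps (term w i L.* term w′ j) ((i ℕ.+ j) ℕDM.% n) (carry i j)))

  E-convolution : ∀ w w′ s → A.∑ (suc s) (λ i → E w i ⊗ E w′ (s ℕ.∸ i)) ≋ E (w ℤ.+ w′) s
  E-convolution w w′ s = A.trans (A.∑-cong (suc s) (λ i i<1+s → A.trans (E-* w w′ i (s ℕ.∸ i))
      (A.≡⇒≈ (≡.cong (λ z → mono (product w w′ i (s ℕ.∸ i)) (z ℕDM.% n)) (ℕP.m+[n∸m]≡n (ℕP.≤-pred i<1+s))))))
    (A.trans (mono-∑ (suc s) (λ i → product w w′ i (s ℕ.∸ i)) (s ℕDM.% n)) (mono-cong (s ℕDM.% n) (term-convolution w w′ s)))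

  -- The truncated series multiply like full ones because all terms from Tn on are zero at this
  -- level, for w, for w′ and for their sum.
  F-+ : ∀ w w′ → F w ⊗ F w′ ≋ F (w ℤ.+ w′)
  F-+ w w′ = A.trans (A.sym (A.∑-cauchy B (E w) (E w′) (E-vanishes w) (E-vanishes w′)))
    (A.trans (A.∑-cong′ (B ℕ.+ B) (E-convolution w w′)) (A.∑-extend (E (w ℤ.+ w′)) (ℕP.m≤m+n B B) (λ i B≤i _ → E-vanishes (w ℤ.+ w′) i B≤i)))
    where
    B : ℕ
    B = T ℕ.* n

  n>0 : 0 ℕ.< n
  n>0 = ℕP.n≢0⇒n>0 n≢0

  F-0 : F (+ 0) ≋ A.1#
  F-0 = A.trans (A.∑-extend (E (+ 0)) (ℕP.*-mono-≤ {1} {T} {1} {n} T>0 n>0) (λ { (suc i) _ _ → E-0-suc i }))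
    (A.trans (A.+-identityˡ (E (+ 0) 0)) E-0-0)
    where
    E-0-suc : ∀ i → E (+ 0) (suc i) ≋ A.0#
    E-0-suc i = A.trans (mono-cong (suc i ℕDM.% n) (term-0-suc i)) (mono-0 (suc i ℕDM.% n))
    E-0-0 : E (+ 0) 0 ≋ A.1#
    E-0-0 = A.trans (A.≡⇒≈ (≡.cong (mono (term (+ 0) 0)) (ℕDM.m<n⇒m%n≡m n>0))) (mono-cong 0 term-0-0)

  Y : Terms
  Y = mono L.1# 1

  Y^ : ∀ e → Y A.^ e ≋ mono L.1# e
  Y^ zero = A.refl
  Y^ (suc e) = A.trans (A.*-congˡ {Y} (Y^ e)) (A.trans (mono-* L.1# 1 L.1# e) (mono-cong (suc e) (L.*-identityˡ L.1#)))

  ⌜⌝Y^ : ∀ z e → A.⌜ z ⌝ ⊗ Y A.^ e ≋ mono L.⌜ z ⌝ e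
  ⌜⌝Y^ z e = A.trans (A.*-cong (A.sym (⌜⌝-mono z)) (Y^ e)) (A.trans (mono-* L.⌜ z ⌝ 0 L.1# e) (mono-cong e (L.*-identityʳ L.⌜ z ⌝)))

  F-expansion : ∀ w → p∤ w → A.⌜ + 1 ℤ.- + p ⌝ ⊗ F w ≋ A.∑ n (λ a → A.⌜ γ a ℤ.* w ℤ.^ (M ℕ.* a) ⌝ ⊗ Y A.^ a)
  F-expansion w p∤w = A.trans (A.*-congˡ {A.⌜ + 1 ℤ.- + p ⌝} (A.trans (A.∑-blocks T n (E w)) (A.∑-swap T n (λ m a → E w (m ℕ.* n ℕ.+ a)))))
    (A.trans (A.sym (A.∑-*ˡ n A.⌜ + 1 ℤ.- + p ⌝ _)) (A.∑-cong n coefficient))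
    where
    coefficient : ∀ a → a ℕ.< n → A.⌜ + 1 ℤ.- + p ⌝ ⊗ A.∑ T (λ m → E w (m ℕ.* n ℕ.+ a)) ≋ A.⌜ γ a ℤ.* w ℤ.^ (M ℕ.* a) ⌝ ⊗ Y A.^ a
    coefficient a a<n = A.trans (A.*-cong (A.sym (⌜⌝-mono (+ 1 ℤ.- + p)))
        (A.trans (A.∑-cong′ T (λ m → A.≡⇒≈ (≡.cong (mono (term w (m ℕ.* n ℕ.+ a))) (remainder m)))) (mono-∑ T _ a)))
      (A.trans (mono-* L.⌜ + 1 ℤ.- + p ⌝ 0 _ a) (A.trans (mono-cong a (term-sum w a p∤w a<n)) (A.sym (⌜⌝Y^ (γ a ℤ.* w ℤ.^ (M ℕ.* a)) a))))
      where
      remainder : ∀ m → (m ℕ.* n ℕ.+ a) ℕDM.% n ≡ a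
      remainder m = ≡.trans (≡.cong (ℕDM._% n) (ℕP.+-comm (m ℕ.* n) a)) (≡.trans (ℕDM.[m+kn]%n≡m%n a m n) (ℕDM.m<n⇒m%n≡m a<n))

  gaussRing : GaussRing n pp h n≡2h k
  gaussRing = record
    { ring = ramifiedRing
    ; ⌜⌝-mod = λ {x} {y} x≅y → A.trans (A.sym (⌜⌝-mono x)) (A.trans (mono-cong 0 (⌜⌝-modᴸ x≅y)) (⌜⌝-mono y))
    ; Y = Y
    ; Y^n = A.trans (Y^ n) (A.trans (mono-wrap L.1# 0) (A.trans (mono-cong 0 (L.*-identityʳ L.⌜ ℤ.- + p ⌝)) (⌜⌝-mono (ℤ.- + p))))
    ; Y-injective = λ e x y e<n eq → ⌜⌝-injectiveᴸ x y (mono-injective e L.⌜ x ⌝ L.⌜ y ⌝ e<n (A.trans (A.sym (⌜⌝Y^ x e)) (A.trans eq (⌜⌝Y^ y e))))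
    ; F = F
    ; F-0 = F-0
    ; F-+ = F-+
    ; F-expansion = F-expansion }

module Additive (K : RationalAlgebra) (n : ℕ) (pp : Prime (suc n)) (h : ℕ) (n≡2h : n ≡ h ℕ.+ h) (4≤n : 4 ℕ.≤ n) (k : ℕ) where
  open RationalAlgebra K
  open ≈-Reasoning
  open Solver using (solve; _:*_; _:-_; :-_; _:=_; con)
  open Valuation K n pp
  open DworkSeries K n
  open GammaValues n pp h n≡2h k
  open GrossKoblitz K n pp h n≡2h 4≤n k
  private
    module Q = Mod M
    instance
      n-nonZero : ℕ.NonZero n
      n-nonZero = ℕ.≢-nonZero n≢0

  L : CommutativeRing 0ℓ 0ℓ
  L = ℤ₍ₚ₎/ k

  private module L = RingTheory L

  proj₁-⌜⌝ : ∀ z → proj₁ L.⌜ z ⌝ ≡ ⌜ z ⌝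
  proj₁-⌜⌝ (+ m) = pos m
    where
    pos : ∀ m → proj₁ L.⌜ + m ⌝ ≡ ⌜ + m ⌝
    pos zero = ≡.refl
    pos (suc zero) = ≡.refl
    pos (suc (suc m)) = ≡.cong (_+ 1#) (pos (suc m))
  proj₁-⌜⌝ -[1+ m ] = ≡.cong -_ (proj₁-⌜⌝ (+ suc m))

  proj₁-∑ : ∀ m f → proj₁ (L.∑ m f) ≡ ∑ m (λ i → proj₁ (f i))
  proj₁-∑ zero f = ≡.refl
  proj₁-∑ (suc m) f = ≡.cong (_+ proj₁ (f m)) (proj₁-∑ m f)

  proj₁-^ : ∀ x m → proj₁ (x L.^ m) ≡ proj₁ x ^ m
  proj₁-^ x zero = ≡.refl
  proj₁-^ x (suc m) = ≡.cong (proj₁ x *_) (proj₁-^ x m)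

  L-eq : ∀ {x y : L.Carrier} → proj₁ x ≈ proj₁ y → x L.≈ y
  L-eq {x} {y} e = Val-cong (sym (trans (+-congʳ e) (-‿inverseʳ (proj₁ y)))) Val-0

  L-zero : ∀ {x : L.Carrier} → Val k (proj₁ x) → x L.≈ L.0#
  L-zero v = Val-cong (solve 1 (λ x → x := x :- con (+ 0)) refl _) v

  open CarryLemmas n

  -- For i ≥ Tn the quotient i/n exceeds 4k, and `scaled-valuation` then makes the i-th term a
  -- multiple of p^k.
  T : ℕ
  T = suc (4 ℕ.* k)

  scaled : ℤ → ℕ → Carrier
  scaled w i = ⌜ -p^ (i ℕDM./ n) ⌝ * c w i

  i/p≤i/n : ∀ i → i ℕDM./ p ℕ.≤ i ℕDM./ n
  i/p≤i/n i = ℕDM./-monoʳ-≤ i {p} {n} (ℕP.n≤1+n n)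

  term : ℤ → ℕ → L.Carrier
  term w i = scaled w i , scaled-valuation w i 0 (i ℕDM./ n) (i/p≤i/n i) z≤n

  term-vanishes : ∀ w i → T ℕ.* n ℕ.≤ i → term w i L.≈ L.0#
  term-vanishes w i Tn≤i = L-zero {term w i} (scaled-valuation w i k (i ℕDM./ n) (i/p≤i/n i)
    (ℕP.≤-trans (ℕP.n≤1+n (4 ℕ.* k)) (ℕP.≤-trans (ℕP.≤-reflexive (≡.sym (ℕDM.m*n/n≡m T n))) (ℕDM./-monoˡ-≤ n Tn≤i))))

  -p^-+ : ∀ a b → -p^ (a ℕ.+ b) ≡ -p^ a ℤ.* -p^ b
  -p^-+ a b = ℤP.^-distribˡ-+-* (ℤ.- + p) a b

  product : ℤ → ℤ → ℕ → ℕ → L.Carrier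
  product w w′ i j = L.⌜ ℤ.- + p ⌝ L.^ carry i j L.* (term w i L.* term w′ j)

  product-value : ∀ w w′ i j → proj₁ (product w w′ i j) ≈ ⌜ -p^ ((i ℕ.+ j) ℕDM./ n) ⌝ * (c w i * c w′ j)
  product-value w w′ i j = begin
    proj₁ (L.⌜ ℤ.- + p ⌝ L.^ carry i j) * (scaled w i * scaled w′ j)
      ≈⟨ *-congʳ (trans (≡⇒≈ (≡.trans (proj₁-^ L.⌜ ℤ.- + p ⌝ (carry i j)) (≡.cong (_^ carry i j) (proj₁-⌜⌝ (ℤ.- + p))))) (sym (⌜⌝-^ (ℤ.- + p) (carry i j)))) ⟩
    ⌜ -p^ (carry i j) ⌝ * ((⌜ -p^ (i ℕDM./ n) ⌝ * c w i) * (⌜ -p^ (j ℕDM./ n) ⌝ * c w′ j))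
      ≈⟨ solve 5 (λ q a x b y → q :* ((a :* x) :* (b :* y)) := (q :* (a :* b)) :* (x :* y)) refl _ _ _ _ _ ⟩
    (⌜ -p^ (carry i j) ⌝ * (⌜ -p^ (i ℕDM./ n) ⌝ * ⌜ -p^ (j ℕDM./ n) ⌝)) * (c w i * c w′ j)
      ≈⟨ *-congʳ (trans (*-congˡ (sym (⌜⌝-* (-p^ (i ℕDM./ n)) (-p^ (j ℕDM./ n))))) (trans (sym (⌜⌝-* (-p^ (carry i j)) (-p^ (i ℕDM./ n) ℤ.* -p^ (j ℕDM./ n))))
          (≡⇒≈ (≡.cong ⌜_⌝ (≡.sym (≡.trans (≡.cong -p^ (quotients-+ i j)) (≡.trans (-p^-+ (carry i j) _) (≡.cong (-p^ (carry i j) ℤ.*_) (-p^-+ (i ℕDM./ n) (j ℕDM./ n)))))))))) ⟩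
    ⌜ -p^ ((i ℕ.+ j) ℕDM./ n) ⌝ * (c w i * c w′ j) ∎

  convolution-value : ∀ w w′ s → proj₁ (L.∑ (suc s) (λ i → product w w′ i (s ℕ.∸ i))) ≈ scaled (w ℤ.+ w′) s
  convolution-value w w′ s = begin
    proj₁ (L.∑ (suc s) (λ i → product w w′ i (s ℕ.∸ i))) ≡⟨ proj₁-∑ (suc s) (λ i → product w w′ i (s ℕ.∸ i)) ⟩
    ∑ (suc s) (λ i → proj₁ (product w w′ i (s ℕ.∸ i))) ≈⟨ ∑-cong (suc s) (λ i i<1+s → trans (product-value w w′ i (s ℕ.∸ i))
                                                                     (*-congʳ (≡⇒≈ (≡.cong (λ z → ⌜ -p^ (z ℕDM./ n) ⌝) (ℕP.m+[n∸m]≡n (ℕP.≤-pred i<1+s)))))) ⟩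
    ∑ (suc s) (λ i → ⌜ -p^ (s ℕDM./ n) ⌝ * (c w i * c w′ (s ℕ.∸ i))) ≈⟨ ∑-*ˡ (suc s) _ _ ⟩
    ⌜ -p^ (s ℕDM./ n) ⌝ * ∑ (suc s) (λ i → c w i * c w′ (s ℕ.∸ i)) ≈⟨ *-congˡ (Convolution.c-convolution K n w w′ s) ⟩
    scaled (w ℤ.+ w′) s ∎

  c-0 : ∀ i → c (+ 0) (suc i) ≈ 0#
  c-0 i = unit-cancel (recip-inverse i) (trans (c-suc (+ 0) i) (trans (zeroˡ _) (sym (zeroʳ _))))

  sum-value : ∀ w a → a ℕ.< n →
    (1# - ⌜ + p ⌝) * ∑ T (λ m → ⌜ -p^ m ⌝ * c w (n ℕ.* m ℕ.+ a)) - ⌜ γ a ℤ.* w ℤ.^ (M ℕ.* a) ⌝ ≈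
    proj₁ L.⌜ + 1 ℤ.- + p ⌝ * proj₁ (L.∑ T (λ m → term w (m ℕ.* n ℕ.+ a))) - proj₁ L.⌜ γ a ℤ.* w ℤ.^ (M ℕ.* a) ⌝
  sum-value w a a<n = +-cong (*-cong (sym (trans (≡⇒≈ (proj₁-⌜⌝ (+ 1 ℤ.- + p))) (⌜⌝-- (+ 1) (+ p))))
      (sym (trans (≡⇒≈ (proj₁-∑ T _)) (∑-cong′ T (λ m → *-cong (≡⇒≈ (≡.cong (λ z → ⌜ -p^ z ⌝) (block-quotient m))) (≡⇒≈ (≡.cong (λ z → c w (z ℕ.+ a)) (ℕP.*-comm m n))))))))
    (-‿cong (≡⇒≈ (≡.sym (proj₁-⌜⌝ (γ a ℤ.* w ℤ.^ (M ℕ.* a))))))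
    where
    block-quotient : ∀ m → (m ℕ.* n ℕ.+ a) ℕDM./ n ≡ m
    block-quotient m = ≡.trans (ℕDM.+-distrib-/-∣ˡ a (ℕD.n∣m*n m {n})) (≡.trans (≡.cong₂ ℕ._+_ (ℕDM.m*n/n≡m m n) (ℕDM.m<n⇒m/n≡0 a<n)) (ℕP.+-identityʳ m))

  ⌜⌝-difference : ∀ x y → ⌜ x ℤ.- y ⌝ ≈ proj₁ L.⌜ x ⌝ - proj₁ L.⌜ y ⌝
  ⌜⌝-difference x y = trans (⌜⌝-- x y) (+-cong (≡⇒≈ (≡.sym (proj₁-⌜⌝ x))) (-‿cong (≡⇒≈ (≡.sym (proj₁-⌜⌝ y)))))

  term-convolution : ∀ w w′ s → L.∑ (suc s) (λ i → product w w′ i (s ℕ.∸ i)) L.≈ term (w ℤ.+ w′) s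
  term-convolution w w′ s = L-eq {L.∑ (suc s) (λ i → product w w′ i (s ℕ.∸ i))} {term (w ℤ.+ w′) s} (convolution-value w w′ s)

  term-0-0 : term (+ 0) 0 L.≈ L.1#
  term-0-0 = L-eq {term (+ 0) 0} {L.1#} (trans (*-identityʳ _) (≡⇒≈ (≡.cong (λ z → ⌜ -p^ z ⌝) (ℕDM.m<n⇒m/n≡0 (ℕP.n≢0⇒n>0 n≢0)))))

  L-mod : ∀ {x y} → x ≅ y [mod M ] → L.⌜ x ⌝ L.≈ L.⌜ y ⌝
  L-mod {x} {y} x≅y = Val-cong (⌜⌝-difference x y) (Val-≅0 (Q.x≈y⇒x-y≈0 x≅y))

  L-injective : ∀ x y → L.⌜ x ⌝ L.≈ L.⌜ y ⌝ → x ≅ y [mod M ]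
  L-injective x y e = Q.x-y≈0⇒x≈y (Val⇒≅0 (x ℤ.- y) (Val-cong (sym (⌜⌝-difference x y)) e))

  term-0-suc : ∀ i → term (+ 0) (suc i) L.≈ L.0#
  term-0-suc i = L-eq {term (+ 0) (suc i)} {L.0#} (trans (*-congˡ (c-0 i)) (zeroʳ _))

  term-sum : ∀ w a → p∤ w → a ℕ.< n → L.⌜ + 1 ℤ.- + p ⌝ L.* L.∑ T (λ m → term w (m ℕ.* n ℕ.+ a)) L.≈ L.⌜ γ a ℤ.* w ℤ.^ (M ℕ.* a) ⌝
  term-sum w a p∤w a<n = Val-cong (sum-value w a a<n) (gross-koblitz w a p∤w (ℕP.<⇒≤ a<n))

  scaledCoefficients : ScaledCoefficients n pp h n≡2h k
  scaledCoefficients = record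
    { L = L
    ; ⌜⌝-modᴸ = L-mod
    ; ⌜⌝-injectiveᴸ = L-injective
    ; T = T
    ; T>0 = s≤s z≤n
    ; term = term
    ; term-vanishes = term-vanishes
    ; term-convolution = term-convolution
    ; term-0-0 = term-0-0
    ; term-0-suc = term-0-suc
    ; term-sum = term-sum }

  gaussRing : GaussRing n pp h n≡2h k
  gaussRing = AdditiveRing.gaussRing n pp h n≡2h k scaledCoefficients

module RationalField where
  open RingTheory ℚᵘP.+-*-commutativeRing

  ⌜⌝-ℚ : ∀ z → ⌜ z ⌝ ≈ mkℚᵘ z 0
  ⌜⌝-ℚ (+ m) = pos m
    where
    pos : ∀ m → ⌜ + m ⌝ ≈ mkℚᵘ (+ m) 0
    pos zero = refl
    pos (suc m) = trans (⌜⌝-+ (+ 1) (+ m)) (trans (+-congˡ {1#} (pos m)) (*≡* (≡.cong (ℤ._* + 1) (≡.cong₂ ℤ._+_ (ℤP.*-identityʳ (+ 1)) (ℤP.*-identityʳ (+ m))))))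
  ⌜⌝-ℚ -[1+ m ] = -‿cong (⌜⌝-ℚ (+ suc m))

  ⌜⌝-injective : ∀ x y → ⌜ x ⌝ ≈ ⌜ y ⌝ → x ≡ y
  ⌜⌝-injective x y e with trans (sym (⌜⌝-ℚ x)) (trans e (⌜⌝-ℚ y))
  ... | *≡* eq = ≡.trans (≡.sym (ℤP.*-identityʳ x)) (≡.trans eq (ℤP.*-identityʳ y))

  recip : ℕ → Carrier
  recip i = mkℚᵘ (+ 1) i

  recip-inverse : ∀ i → recip i * ⌜ + suc i ⌝ ≈ 1#
  recip-inverse i = trans (*-congˡ {recip i} (⌜⌝-ℚ (+ suc i))) (*≡* (≡.trans (ℤP.*-identityʳ (+ 1 ℤ.* + suc i)) (≡.cong (λ z → + 1 ℤ.* + suc z) (≡.sym (ℕP.*-identityʳ i)))))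

rationals : RationalAlgebra
rationals = record
  { algebra = ℚᵘP.+-*-commutativeRing
  ; recip = RationalField.recip
  ; recip-inverse = RationalField.recip-inverse
  ; ⌜⌝-injective = RationalField.⌜⌝-injective }

gaussRing : (n : ℕ) (pp : Prime (suc n)) (h : ℕ) (n≡2h : n ≡ h ℕ.+ h) → 4 ℕ.≤ n → (k : ℕ) → GaussRing n pp h n≡2h k
gaussRing n pp h n≡2h 4≤n k = Additive.gaussRing rationals n pp h n≡2h 4≤n k

-- Character sums

module Characters (n : ℕ) (pp : Prime (suc n)) (h : ℕ) (n≡2h : n ≡ h ℕ.+ h) (k : ℕ) where
  open GammaValues n pp h n≡2h k public
  private module P = Mod p
  open Mod M

  instance
    n-nonZero : ℕ.NonZero n
    n-nonZero = ℕ.≢-nonZero n≢0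

  h≢0 : h ≢ 0
  h≢0 e = n≢0 (≡.trans n≡2h (≡.cong (λ z → z ℕ.+ z) e))

  h<n : h ℕ.< n
  h<n = ≡.subst (h ℕ.<_) (≡.sym n≡2h) (ℕP.m<m+n h (ℕP.n≢0⇒n>0 h≢0))

  -- χ e = ω^e on units
  χ : ℕ → ℤ → ℤ
  χ e z = z ℤ.^ (M ℕ.* e)

  χ-* : ∀ e x y → χ e (x ℤ.* y) ≡ χ e x ℤ.* χ e y
  χ-* e x y = ^-distrib x y (M ℕ.* e)

  χ-+ : ∀ e f x → χ (e ℕ.+ f) x ≡ χ e x ℤ.* χ f x
  χ-+ e f x = ≡.trans (≡.cong (x ℤ.^_) (ℕP.*-distribˡ-+ M e f)) (ℤP.^-distribˡ-+-* x (M ℕ.* e) (M ℕ.* f))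

  -- The condition is on e as a number, not modulo n: χ n is the trivial character extended by 0,
  -- while χ 0 is constantly 1. Exponents whose value at 0 matters are therefore left unreduced
  -- below.
  χ-zero : ∀ e {x} → e ≢ 0 → x P.≅ + 0 → χ e x ≅ + 0
  χ-zero zero e≢0 _ = ⊥-elim (e≢0 ≡.refl)
  χ-zero (suc e) {x} _ x≅0 = trans (≡⇒≈ (≡.sym (ℤP.^-*-assoc x M (suc e)))) (trans (*ʳ ((x ℤ.^ M) ℤ.^ e) (p∣⇒ω≅0 x≅0)) (≡⇒≈ (ℤP.*-zeroˡ ((x ℤ.^ M) ℤ.^ e))))

  χ-unit : ∀ e {x} → p∤ x → p∤ χ e x
  χ-unit e p∤x = ∤-^ (M ℕ.* e) p∤x

  χ-periodic : ∀ e f {x} → p∤ x → n ℕD.∣ f → χ (e ℕ.+ f) x ≅ χ e x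
  χ-periodic e f {x} p∤x n∣f = trans (≡⇒≈ (χ-+ e f x)) (trans (*ˡ (χ e x) (ω-power-one f n∣f p∤x)) (≡⇒≈ (ℤP.*-identityʳ (χ e x))))

  χ-% : ∀ e {x} → p∤ x → χ (e ℕDM.% n) x ≅ χ e x
  χ-% e {x} p∤x = trans (sym (χ-periodic (e ℕDM.% n) (e ℕDM./ n ℕ.* n) p∤x (ℕD.n∣m*n (e ℕDM./ n)))) (≡⇒≈ (≡.cong (λ z → χ z x) (≡.sym (ℕDM.m≡m%n+[m/n]*n e n))))

  χ--1 : ∀ e → χ e (ℤ.- + 1) ≡ (ℤ.- + 1) ℤ.^ e
  χ--1 e = ≡.trans (≡.cong ((ℤ.- + 1) ℤ.^_) (ℕP.*-comm M e)) (-1^*M e)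

  χ-1 : ∀ e → χ e (+ 1) ≡ + 1
  χ-1 e = ℤP.^-zeroˡ (M ℕ.* e)

  -- The representative of -e in 0, ..., n - 1; by `∣-unique` it is the one index that survives
  -- orthogonality.
  compl : ℕ → ℕ
  compl e = (n ℕ.∸ e ℕDM.% n) ℕDM.% n

  compl<n : ∀ e → compl e ℕ.< n
  compl<n e = ℕDM.m%n<n (n ℕ.∸ e ℕDM.% n) n

  n∣+compl : ∀ e → n ℕD.∣ e ℕ.+ compl e
  n∣+compl e = ℕD.m%n≡0⇒n∣m (e ℕ.+ compl e) n (≡.trans (ℕDM.%-distribˡ-+ e (compl e) n)
    (≡.trans (≡.cong (λ z → (e ℕDM.% n ℕ.+ z) ℕDM.% n) (ℕDM.m%n%n≡m%n (n ℕ.∸ e ℕDM.% n) n))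
    (≡.trans (≡.cong (λ z → (z ℕ.+ (n ℕ.∸ e ℕDM.% n) ℕDM.% n) ℕDM.% n) (≡.sym (ℕDM.m%n%n≡m%n e n)))
    (≡.trans (≡.sym (ℕDM.%-distribˡ-+ (e ℕDM.% n) (n ℕ.∸ e ℕDM.% n) n)) (≡.trans (≡.cong (ℕDM._% n) (ℕP.m+[n∸m]≡n (ℕP.<⇒≤ (ℕDM.m%n<n e n)))) (ℕDM.n%n≡0 n))))))

  ∣-unique : ∀ e {a c} → a ℕ.< n → c ℕ.< n → n ℕD.∣ e ℕ.+ a → n ℕD.∣ e ℕ.+ c → a ≡ c
  ∣-unique e {a} {c} a<n c<n n∣a n∣c = go (ℕP.≤-total a c) a<n c<n n∣a n∣c
    where
    half : ∀ {a c} → a ℕ.≤ c → c ℕ.< n → n ℕD.∣ e ℕ.+ a → n ℕD.∣ e ℕ.+ c → a ≡ c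
    half {a} {c} a≤c c<n n∣a n∣c = ℕP.≤-antisym a≤c (ℕP.m∸n≡0⇒m≤n (small (ℕD.∣m+n∣m⇒∣n (≡.subst (n ℕD.∣_) (≡.sym (≡.trans (ℕP.+-assoc e a (c ℕ.∸ a)) (≡.cong (e ℕ.+_) (ℕP.m+[n∸m]≡n a≤c)))) n∣c) n∣a) (ℕP.≤-<-trans (ℕP.m∸n≤m c a) c<n)))
      where
      small : ∀ {d} → n ℕD.∣ d → d ℕ.< n → d ≡ 0
      small {zero} _ _ = ≡.refl
      small {suc d} n∣d d<n = ⊥-elim (ℕP.<⇒≱ d<n (ℕD.∣⇒≤ n∣d))
    go : ∀ {a c} → a ℕ.≤ c ⊎ c ℕ.≤ a → a ℕ.< n → c ℕ.< n → n ℕD.∣ e ℕ.+ a → n ℕD.∣ e ℕ.+ c → a ≡ c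
    go (inj₁ a≤c) _ c<n x y = half a≤c c<n x y
    go (inj₂ c≤a) a<n _ x y = ≡.sym (half c≤a a<n y x)

  n∣h+h : n ℕD.∣ h ℕ.+ h
  n∣h+h = ≡.subst (n ℕD.∣_) n≡2h ℕD.∣-refl

module GaussSums (n : ℕ) (pp : Prime (suc n)) (h : ℕ) (n≡2h : n ≡ h ℕ.+ h) (k : ℕ) (gaussRing : GaussRing n pp h n≡2h k) where
  open Characters n pp h n≡2h k public
  open GaussRing gaussRing
  open RingTheory ring
  open ≈-Reasoning
  open Solver using (solve; _:*_; _:=_; con)
  private
    module P = Mod p
    module Q = Mod M

  1-p : Carrier
  1-p = ⌜ + 1 ℤ.- + p ⌝

  p∤1-p : p∤ + 1 ℤ.- + p
  p∤1-p e = ∤-1 (P.trans (P.x-y≈0⇒x≈y e) P.modulus)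

  unit-cancelᴬ : ∀ u {x y} → p∤ u → ⌜ u ⌝ * x ≈ ⌜ u ⌝ * y → x ≈ y
  unit-cancelᴬ u p∤u = unit-cancel {⌜ u ⌝} {⌜ inverse u ⌝} (trans (sym (⌜⌝-* (inverse u) u)) (⌜⌝-mod (Q.trans (Q.≡⇒≈ (ℤP.*-comm (inverse u) u)) (inverseʳ p∤u))))

  Z : ℤ → Carrier
  Z z = 1-p * F z

  Z-expansion : ∀ z → p∤ z → Z z ≈ ∑ n (λ a → ⌜ γ a ℤ.* χ a z ⌝ * Y ^ a)
  Z-expansion = F-expansion

  -- Every term of the expansion is a character value, and ω(z) modulo p^k depends only on z modulo
  -- p.
  Z-cong-unit : ∀ {z z′} → p∤ z → z P.≅ z′ → Z z ≈ Z z′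
  Z-cong-unit {z} {z′} p∤z e = trans (Z-expansion z p∤z) (trans (∑-cong′ n (λ a → *-congʳ (⌜⌝-mod (Q.*ˡ (γ a) (ω-power-cong a e)))))
    (sym (Z-expansion z′ (λ d → p∤z (P.trans e d)))))

  -- The expansion says nothing at z ≡ 0. Periodicity is transported there from the unit 1: F z F 1
  -- = F (z + 1) = F 1, and F 1 has the inverse F (-1).
  F-zero : ∀ {z} → z P.≅ + 0 → F z ≈ 1#
  F-zero {z} z≅0 = begin
    F z ≈⟨ sym (*-identityʳ _) ⟩
    F z * 1# ≈⟨ *-congˡ (sym F1F-1) ⟩
    F z * (F (+ 1) * F (ℤ.- + 1)) ≈⟨ sym (*-assoc _ _ _) ⟩
    (F z * F (+ 1)) * F (ℤ.- + 1) ≈⟨ *-congʳ (trans (F-+ z (+ 1)) (unit-cancelᴬ (+ 1 ℤ.- + p) p∤1-p (sym (Z-cong-unit ∤-1 (P.sym (P.+ʳ (+ 1) z≅0)))))) ⟩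
    F (+ 1) * F (ℤ.- + 1) ≈⟨ F1F-1 ⟩
    1# ∎
    where
    F1F-1 : F (+ 1) * F (ℤ.- + 1) ≈ 1#
    F1F-1 = trans (F-+ (+ 1) (ℤ.- + 1)) F-0

  Z-zero : ∀ {z} → z P.≅ + 0 → Z z ≈ 1-p
  Z-zero z≅0 = trans (*-congˡ (F-zero z≅0)) (*-identityʳ _)

  Z-+ : ∀ z z′ → Z z * Z z′ ≈ 1-p * Z (z ℤ.+ z′)
  Z-+ z z′ = trans (solve 3 (λ q a b → (q :* a) :* (q :* b) := q :* (q :* (a :* b))) refl 1-p (F z) (F z′)) (*-congˡ (*-congˡ (F-+ z z′)))

  ⌜∑⌝ : ∀ m f → ⌜ Q.∑ m f ⌝ ≈ ∑ m (λ i → ⌜ f i ⌝)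
  ⌜∑⌝ zero f = refl
  ⌜∑⌝ (suc m) f = trans (⌜⌝-+ (Q.∑ m f) (f m)) (+-congʳ (⌜∑⌝ m f))

  characterSum-δ : ∀ e a c → a ℕ.< n → c ℕ.< n → n ℕD.∣ e ℕ.+ c → ∑ n (λ w → ⌜ χ (e ℕ.+ a) (+ suc w) ⌝) ≈ δ c a * ⌜ + n ⌝
  characterSum-δ e a c a<n c<n n∣e+c = trans (sym (⌜∑⌝ n (λ w → χ (e ℕ.+ a) (+ suc w)))) (split (c ℕ.≟ a))
    where
    split : Dec (c ≡ a) → ⌜ characterSum (e ℕ.+ a) ⌝ ≈ δ c a * ⌜ + n ⌝
    split (yes ≡.refl) = trans (⌜⌝-mod (characterSum-trivial (e ℕ.+ c) n∣e+c)) (sym (trans (*-congʳ (δ-refl c)) (*-identityˡ _)))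
    split (no c≢a) = trans (⌜⌝-mod (characterSum-nontrivial (e ℕ.+ a) (λ n∣e+a → c≢a (∣-unique e c<n a<n n∣e+c n∣e+a)))) (sym (trans (*-congʳ (δ-≢ c a c≢a)) (zeroˡ _)))

  -- Orthogonality selects the term c of the expansion. At z ≡ 0 and c ≠ 0 both sides vanish; at z ≡
  -- 0 and c = 0 they would be n(1 - p) and n, so that case is excluded.
  gaussSum : ∀ e c z → c ℕ.< n → n ℕD.∣ e ℕ.+ c → (p∤ z) ⊎ (c ≢ 0) →
    ∑ n (λ w → ⌜ χ e (+ suc w) ⌝ * Z (+ suc w ℤ.* z)) ≈ ⌜ + n ⌝ * (⌜ γ c ℤ.* χ c z ⌝ * Y ^ c)
  gaussSum e c z c<n n∣e+c hyp = split (≅0? z)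
    where
    unit-w : ∀ {w} → w ℕ.< n → p∤ + suc w
    unit-w w<n = ∤-small (s≤s z≤n) (s≤s w<n)
    split : Dec (z P.≅ + 0) → ∑ n (λ w → ⌜ χ e (+ suc w) ⌝ * Z (+ suc w ℤ.* z)) ≈ ⌜ + n ⌝ * (⌜ γ c ℤ.* χ c z ⌝ * Y ^ c)
    split (no p∤z) = begin
      ∑ n (λ w → ⌜ χ e (+ suc w) ⌝ * Z (+ suc w ℤ.* z))
        ≈⟨ ∑-cong n (λ w w<n → trans (*-congˡ (Z-expansion (+ suc w ℤ.* z) (∤-* (unit-w w<n) p∤z))) (sym (∑-*ˡ n _ _))) ⟩
      ∑ n (λ w → ∑ n (λ a → ⌜ χ e (+ suc w) ⌝ * (⌜ γ a ℤ.* χ a (+ suc w ℤ.* z) ⌝ * Y ^ a)))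
        ≈⟨ ∑-cong′ n (λ w → ∑-cong′ n (λ a → separate w a)) ⟩
      ∑ n (λ w → ∑ n (λ a → ⌜ χ (e ℕ.+ a) (+ suc w) ⌝ * (⌜ γ a ℤ.* χ a z ⌝ * Y ^ a)))
        ≈⟨ ∑-swap n n _ ⟩
      ∑ n (λ a → ∑ n (λ w → ⌜ χ (e ℕ.+ a) (+ suc w) ⌝ * (⌜ γ a ℤ.* χ a z ⌝ * Y ^ a)))
        ≈⟨ ∑-cong n (λ a a<n → trans (∑-*ʳ n _ _) (trans (*-congʳ (characterSum-δ e a c a<n c<n n∣e+c)) (*-assoc _ _ _))) ⟩
      ∑ n (λ a → δ c a * (⌜ + n ⌝ * (⌜ γ a ℤ.* χ a z ⌝ * Y ^ a)))
        ≈⟨ ∑-δ n c (λ a → ⌜ + n ⌝ * (⌜ γ a ℤ.* χ a z ⌝ * Y ^ a)) c<n ⟩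
      ⌜ + n ⌝ * (⌜ γ c ℤ.* χ c z ⌝ * Y ^ c) ∎
      where
      separate : ∀ w a → ⌜ χ e (+ suc w) ⌝ * (⌜ γ a ℤ.* χ a (+ suc w ℤ.* z) ⌝ * Y ^ a) ≈ ⌜ χ (e ℕ.+ a) (+ suc w) ⌝ * (⌜ γ a ℤ.* χ a z ⌝ * Y ^ a)
      separate w a = trans (sym (*-assoc _ _ _)) (trans (*-congʳ (begin
        ⌜ χ e W ⌝ * ⌜ γ a ℤ.* χ a (W ℤ.* z) ⌝ ≈⟨ sym (⌜⌝-* (χ e W) (γ a ℤ.* χ a (W ℤ.* z))) ⟩
        ⌜ χ e W ℤ.* (γ a ℤ.* χ a (W ℤ.* z)) ⌝ ≡⟨ ≡.cong ⌜_⌝ (≡.trans (≡.cong (λ v → χ e W ℤ.* (γ a ℤ.* v)) (χ-* a W z)) (≡.trans (lem (χ e W) (γ a) (χ a W) (χ a z)) (≡.cong (ℤ._* (γ a ℤ.* χ a z)) (≡.sym (χ-+ e a W))))) ⟩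
        ⌜ χ (e ℕ.+ a) W ℤ.* (γ a ℤ.* χ a z) ⌝ ≈⟨ ⌜⌝-* (χ (e ℕ.+ a) W) (γ a ℤ.* χ a z) ⟩
        ⌜ χ (e ℕ.+ a) W ⌝ * ⌜ γ a ℤ.* χ a z ⌝ ∎)) (*-assoc _ _ _))
        where
        W : ℤ
        W = + suc w
        lem : ∀ x g y z → x ℤ.* (g ℤ.* (y ℤ.* z)) ≡ (x ℤ.* y) ℤ.* (g ℤ.* z)
        lem = solve-∀
    split (yes z≅0) = degenerate hyp
      where
      degenerate : (p∤ z) ⊎ (c ≢ 0) → ∑ n (λ w → ⌜ χ e (+ suc w) ⌝ * Z (+ suc w ℤ.* z)) ≈ ⌜ + n ⌝ * (⌜ γ c ℤ.* χ c z ⌝ * Y ^ c)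
      degenerate (inj₁ p∤z) = ⊥-elim (p∤z z≅0)
      degenerate (inj₂ c≢0) = begin
        ∑ n (λ w → ⌜ χ e (+ suc w) ⌝ * Z (+ suc w ℤ.* z))
          ≈⟨ ∑-cong′ n (λ w → *-cong (≡⇒≈ (≡.cong (λ v → ⌜ χ v (+ suc w) ⌝) (≡.sym (ℕP.+-identityʳ e)))) (Z-zero (P.trans (P.*ˡ (+ suc w) z≅0) (P.≡⇒≈ (ℤP.*-zeroʳ (+ suc w)))))) ⟩
        ∑ n (λ w → ⌜ χ (e ℕ.+ 0) (+ suc w) ⌝ * 1-p)
          ≈⟨ trans (∑-*ʳ n _ _) (*-congʳ (trans (characterSum-δ e 0 c (ℕP.n≢0⇒n>0 n≢0) c<n n∣e+c) (trans (*-congʳ (δ-≢ c 0 c≢0)) (zeroˡ _)))) ⟩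
        0# * 1-p
          ≈⟨ solve 3 (λ q n y → con (+ 0) :* q := n :* (con (+ 0) :* y)) refl 1-p ⌜ + n ⌝ (Y ^ c) ⟩
        ⌜ + n ⌝ * (⌜ + 0 ⌝ * Y ^ c)
          ≈⟨ *-congˡ (*-congʳ (⌜⌝-mod (Q.sym (Q.trans (Q.*ˡ (γ c) (χ-zero c c≢0 z≅0)) (Q.≡⇒≈ (ℤP.*-zeroʳ (γ c))))))) ⟩
        ⌜ + n ⌝ * (⌜ γ c ℤ.* χ c z ⌝ * Y ^ c) ∎

  Y^-reduce : ∀ e d → Y ^ (e ℕ.+ n ℕ.* d) ≈ ⌜ (ℤ.- + p) ℤ.^ d ⌝ * Y ^ e
  Y^-reduce e d = begin
    Y ^ (e ℕ.+ n ℕ.* d) ≈⟨ ^-homo-* Y e (n ℕ.* d) ⟩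
    Y ^ e * Y ^ (n ℕ.* d) ≈⟨ *-congˡ (sym (^-assocʳ Y n d)) ⟩
    Y ^ e * (Y ^ n) ^ d ≈⟨ *-congˡ (trans (^-congˡ d Y^n) (sym (⌜⌝-^ (ℤ.- + p) d))) ⟩
    Y ^ e * ⌜ (ℤ.- + p) ℤ.^ d ⌝ ≈⟨ *-comm _ _ ⟩
    ⌜ (ℤ.- + p) ℤ.^ d ⌝ * Y ^ e ∎

module JacobiSums (n : ℕ) (pp : Prime (suc n)) (h : ℕ) (n≡2h : n ≡ h ℕ.+ h) (k : ℕ) (gaussRing : GaussRing n pp h n≡2h k) where
  open GaussSums n pp h n≡2h k gaussRing public
  open GaussRing gaussRing
  private
    module A = RingTheory ring
    module P = Mod p
  open Mod M
  open ≈-Reasoning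

  jacobi-term : ℕ → ℕ → ℤ
  jacobi-term r x = χ (n ℕ.∸ r) (+ suc x) ℤ.* χ (r ℕ.+ h) (+ 1 ℤ.- + suc x)

  jacobi : ℕ → ℤ
  jacobi r = ∑ n (jacobi-term r)

  coresidue : ℕ → ℕ
  coresidue r = compl (r ℕ.+ h)

  -- By `κ-value` this is the power of -p in the Jacobi sum: the number of full turns in r +
  -- `coresidue r` beyond h.
  κ : ℕ → ℕ
  κ r = (r ℕ.+ coresidue r) ℕDM./ n

  κ-value : ∀ r → r ℕ.+ coresidue r ≡ h ℕ.+ κ r ℕ.* n
  κ-value r = ≡.trans (ℕDM.m≡m%n+[m/n]*n (r ℕ.+ coresidue r) n) (≡.cong (ℕ._+ κ r ℕ.* n)
    (∣-unique h (ℕDM.m%n<n (r ℕ.+ coresidue r) n) h<n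
      (ℕD.∣m+n∣m⇒∣n {m = κ r ℕ.* n} (≡.subst (n ℕD.∣_) regroup (n∣+compl (r ℕ.+ h))) (ℕD.n∣m*n (κ r))) n∣h+h))
    where
    regroup : (r ℕ.+ h) ℕ.+ coresidue r ≡ κ r ℕ.* n ℕ.+ (h ℕ.+ (r ℕ.+ coresidue r) ℕDM.% n)
    regroup = ≡.trans (lem r h (coresidue r)) (≡.trans (≡.cong (h ℕ.+_) (ℕDM.m≡m%n+[m/n]*n (r ℕ.+ coresidue r) n)) (lem₂ h _ (κ r ℕ.* n)))
      where
      lem : ∀ r h c → (r ℕ.+ h) ℕ.+ c ≡ h ℕ.+ (r ℕ.+ c)
      lem = ℕSolver.solve-∀
      lem₂ : ∀ h a b → h ℕ.+ (a ℕ.+ b) ≡ b ℕ.+ (h ℕ.+ a)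
      lem₂ = ℕSolver.solve-∀

  -1^2 : ∀ e → (ℤ.- + 1) ℤ.^ e ℤ.* (ℤ.- + 1) ℤ.^ e ≡ + 1
  -1^2 e = ≡.trans (≡.sym (ℤP.^-distribˡ-+-* (ℤ.- + 1) e e)) (-1^double e)

  -- The case where the second character is trivial.
  jacobi-h : jacobi h ≅ (ℤ.- + 1) ℤ.^ h ℤ.* (ℤ.- + p) ℤ.^ κ h ℤ.* (γ h ℤ.* γ h ℤ.* γ (coresidue h))
  jacobi-h = trans value (sym (begin
      (ℤ.- + 1) ℤ.^ h ℤ.* (ℤ.- + p) ℤ.^ κ h ℤ.* (γ h ℤ.* γ h ℤ.* γ (coresidue h))
        ≡⟨ ≡.cong₂ (λ a b → (ℤ.- + 1) ℤ.^ h ℤ.* (ℤ.- + p) ℤ.^ a ℤ.* (γ h ℤ.* γ h ℤ.* γ b)) κ≡0 cores≡0 ⟩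
      (ℤ.- + 1) ℤ.^ h ℤ.* + 1 ℤ.* (γ h ℤ.* γ h ℤ.* γ 0)
        ≈⟨ *ˡ ((ℤ.- + 1) ℤ.^ h ℤ.* + 1) (*-cong γh² γ-0) ⟩
      (ℤ.- + 1) ℤ.^ h ℤ.* + 1 ℤ.* (ℤ.- (ℤ.- + 1) ℤ.^ h ℤ.* + 1)
        ≡⟨ ≡.trans (lem ((ℤ.- + 1) ℤ.^ h)) (≡.cong ℤ.-_ (-1^2 h)) ⟩
      ℤ.- + 1 ∎))
    where
    lem : ∀ s → s ℤ.* + 1 ℤ.* (ℤ.- s ℤ.* + 1) ≡ ℤ.- (s ℤ.* s)
    lem = solve-∀
    γh² : γ h ℤ.* γ h ≅ ℤ.- (ℤ.- + 1) ℤ.^ h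
    γh² = trans (≡⇒≈ (≡.cong (λ z → γ h ℤ.* γ z) (≡.sym (≡.trans (≡.cong (ℕ._∸ h) n≡2h) (ℕP.m+n∸n≡m h h))))) (γ-reflection h (ℕP.<⇒≤ h<n))
    cores≡0 : coresidue h ≡ 0
    cores≡0 = ∣-unique (h ℕ.+ h) (compl<n (h ℕ.+ h)) (ℕP.n≢0⇒n>0 n≢0) (n∣+compl (h ℕ.+ h)) (≡.subst (n ℕD.∣_) (≡.sym (ℕP.+-identityʳ (h ℕ.+ h))) n∣h+h)
    κ≡0 : κ h ≡ 0
    κ≡0 = ≡.trans (≡.cong (ℕDM._/ n) (≡.trans (≡.cong (h ℕ.+_) cores≡0) (ℕP.+-identityʳ h))) (ℕDM.m<n⇒m/n≡0 h<n)
    n∸h : n ℕ.∸ h ≡ h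
    n∸h = ≡.trans (≡.cong (ℕ._∸ h) n≡2h) (ℕP.m+n∸n≡m h h)
    full : characterSum h ≅ + 0
    full = characterSum-nontrivial h (λ n∣h → ℕP.<⇒≱ h<n (ℕD.∣⇒≤ ⦃ ℕ.≢-nonZero h≢0 ⦄ n∣h))
    value : jacobi h ≅ ℤ.- + 1
    value = go n ≡.refl
      where
      go : ∀ m → n ≡ m → jacobi h ≅ ℤ.- + 1
      go zero e = ⊥-elim (n≢0 e)
      go (suc m) e = begin
        ∑ n (jacobi-term h) ≡⟨ ≡.cong (λ z → ∑ z (jacobi-term h)) e ⟩
        ∑ (suc m) (jacobi-term h) ≈⟨ ∑-front m (jacobi-term h) ⟩
        jacobi-term h 0 ℤ.+ ∑ m (λ x → jacobi-term h (suc x)) ≈⟨ +-cong first (∑-cong m rest) ⟩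
        + 0 ℤ.+ ∑ m (λ x → χ h (+ suc (suc x))) ≡⟨ lem₂ (∑ m (λ x → χ h (+ suc (suc x)))) ⟩
        (+ 1 ℤ.+ ∑ m (λ x → χ h (+ suc (suc x)))) ℤ.- + 1 ≈⟨ +ʳ (ℤ.- + 1) (+ʳ (∑ m (λ x → χ h (+ suc (suc x)))) (≡⇒≈ (≡.sym (χ-1 h)))) ⟩
        (χ h (+ 1) ℤ.+ ∑ m (λ x → χ h (+ suc (suc x)))) ℤ.- + 1 ≈⟨ +ʳ (ℤ.- + 1) (sym (∑-front m (λ x → χ h (+ suc x)))) ⟩
        ∑ (suc m) (λ x → χ h (+ suc x)) ℤ.- + 1 ≈⟨ +ʳ (ℤ.- + 1) (trans (≡⇒≈ (≡.cong (λ z → ∑ z (λ x → χ h (+ suc x))) (≡.sym e))) full) ⟩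
        + 0 ℤ.- + 1 ∎
        where
        lem₂ : ∀ s → + 0 ℤ.+ s ≡ (+ 1 ℤ.+ s) ℤ.- + 1
        lem₂ = solve-∀
        first : jacobi-term h 0 ≅ + 0
        first = trans (*ˡ (χ (n ℕ.∸ h) (+ 1)) (χ-zero (h ℕ.+ h) (λ z → n≢0 (≡.trans n≡2h z)) P.refl)) (≡⇒≈ (ℤP.*-zeroʳ (χ (n ℕ.∸ h) (+ 1))))
        rest : ∀ x → x ℕ.< m → jacobi-term h (suc x) ≅ χ h (+ suc (suc x))
        rest x x<m = trans (*-cong (≡⇒≈ (≡.cong (λ z → χ z (+ suc (suc x))) n∸h)) (ω-power-one (h ℕ.+ h) n∣h+h unit)) (≡⇒≈ (ℤP.*-identityʳ _))
          where
          unit : p∤ + 1 ℤ.- + suc (suc x)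
          unit d = ∤-difference {1} {suc (suc x)} (s≤s (s≤s z≤n)) (s≤s (ℕP.≤-trans (s≤s x<m) (ℕP.≤-reflexive (≡.sym e)))) (P.x-y≈0⇒x≈y d)

  -- The classical relation between Jacobi and Gauss sums. It first yields the Jacobi sum times γ c
  -- with c ≡ r + h; reflection then replaces 1/γ c by γ (n - c), and n - c is `coresidue r`.
  jacobi-generic : ∀ r → 0 ℕ.< r → r ℕ.< n → r ≢ h → jacobi r ≅ (ℤ.- + 1) ℤ.^ h ℤ.* (ℤ.- + p) ℤ.^ κ r ℤ.* (γ h ℤ.* γ r ℤ.* γ (coresidue r))
  jacobi-generic r 0<r r<n r≢h = begin
    jacobi r
      ≡⟨ ≡.sym (≡.trans (≡.cong (ℤ._* jacobi r) (-1^2 c)) (ℤP.*-identityˡ (jacobi r))) ⟩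
    (σ c ℤ.* σ c) ℤ.* jacobi r
      ≡⟨ lem (σ c) (jacobi r) ⟩
    σ c ℤ.* ((ℤ.- σ c) ℤ.* (ℤ.- jacobi r))
      ≈⟨ *ˡ (σ c) (*ʳ (ℤ.- jacobi r) (sym (γ-reflection c (ℕP.<⇒≤ c<n)))) ⟩
    σ c ℤ.* ((γ c ℤ.* γ (n ℕ.∸ c)) ℤ.* (ℤ.- jacobi r))
      ≡⟨ lem₂ (σ c) (γ c) (γ (n ℕ.∸ c)) (jacobi r) ⟩
    σ c ℤ.* (γ (n ℕ.∸ c) ℤ.* (ℤ.- γ c ℤ.* jacobi r))
      ≈⟨ *ˡ (σ c) (*ˡ (γ (n ℕ.∸ c)) relation) ⟩
    σ c ℤ.* (γ (n ℕ.∸ c) ℤ.* ((ℤ.- + p) ℤ.^ d ℤ.* (σ r ℤ.* (γ r ℤ.* γ h))))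
      ≡⟨ ≡.trans (lem₃ (σ c) (γ (n ℕ.∸ c)) ((ℤ.- + p) ℤ.^ d) (σ r) (γ r) (γ h))
           (≡.cong₂ (λ s g → s ℤ.* (ℤ.- + p) ℤ.^ d ℤ.* (γ h ℤ.* γ r ℤ.* γ g)) sign (≡.sym cores)) ⟩
    σ h ℤ.* (ℤ.- + p) ℤ.^ d ℤ.* (γ h ℤ.* γ r ℤ.* γ (coresidue r))
      ≡⟨ ≡.cong (λ z → σ h ℤ.* (ℤ.- + p) ℤ.^ z ℤ.* (γ h ℤ.* γ r ℤ.* γ (coresidue r))) d≡κ ⟩
    σ h ℤ.* (ℤ.- + p) ℤ.^ κ r ℤ.* (γ h ℤ.* γ r ℤ.* γ (coresidue r)) ∎
    where
    σ : ℕ → ℤ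
    σ e = (ℤ.- + 1) ℤ.^ e
    c d e f : ℕ
    c = (r ℕ.+ h) ℕDM.% n
    d = (r ℕ.+ h) ℕDM./ n
    f = n ℕ.∸ r
    e = h ℕ.+ f
    lem : ∀ s j → (s ℤ.* s) ℤ.* j ≡ s ℤ.* ((ℤ.- s) ℤ.* (ℤ.- j))
    lem = solve-∀
    lem₂ : ∀ s g g′ j → s ℤ.* ((g ℤ.* g′) ℤ.* (ℤ.- j)) ≡ s ℤ.* (g′ ℤ.* (ℤ.- g ℤ.* j))
    lem₂ = solve-∀
    lem₃ : ∀ s g q t a b → s ℤ.* (g ℤ.* (q ℤ.* (t ℤ.* (a ℤ.* b)))) ≡ (s ℤ.* t) ℤ.* q ℤ.* (b ℤ.* a ℤ.* g)
    lem₃ = solve-∀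
    c<n : c ℕ.< n
    c<n = ℕDM.m%n<n (r ℕ.+ h) n
    r+f : f ℕ.+ r ≡ n
    r+f = ℕP.m∸n+n≡m (ℕP.<⇒≤ r<n)
    n∣f+r : n ℕD.∣ f ℕ.+ r
    n∣f+r = ≡.subst (n ℕD.∣_) (≡.sym r+f) ℕD.∣-refl
    decompose : r ℕ.+ h ≡ c ℕ.+ d ℕ.* n
    decompose = ℕDM.m≡m%n+[m/n]*n (r ℕ.+ h) n
    n∣e+c : n ℕD.∣ e ℕ.+ c
    n∣e+c = ℕD.∣m+n∣m⇒∣n {m = d ℕ.* n} (≡.subst (n ℕD.∣_) (≡.trans (≡.sym total) (ℕP.+-comm (e ℕ.+ c) (d ℕ.* n))) (ℕD.∣m∣n⇒∣m+n n∣h+h n∣f+r)) (ℕD.n∣m*n d)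
      where
      total : (e ℕ.+ c) ℕ.+ d ℕ.* n ≡ (h ℕ.+ h) ℕ.+ (f ℕ.+ r)
      total = ≡.trans (ℕP.+-assoc e c (d ℕ.* n)) (≡.trans (≡.cong (e ℕ.+_) (≡.sym decompose)) (lem₄ h f r))
        where
        lem₄ : ∀ h f r → (h ℕ.+ f) ℕ.+ (r ℕ.+ h) ≡ (h ℕ.+ h) ℕ.+ (f ℕ.+ r)
        lem₄ = ℕSolver.solve-∀
    c≢0 : c ≢ 0
    c≢0 c≡0 = r≢h (∣-unique h r<n h<n (≡.subst (n ℕD.∣_) (ℕP.+-comm r h) (ℕD.m%n≡0⇒n∣m (r ℕ.+ h) n c≡0)) n∣h+h)
    cores : coresidue r ≡ n ℕ.∸ c
    cores = ℕDM.m<n⇒m%n≡m (ℕP.∸-monoʳ-< (ℕP.n≢0⇒n>0 c≢0) (ℕP.<⇒≤ c<n))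
    d≡κ : d ≡ κ r
    d≡κ = ℕP.*-cancelʳ-≡ d (κ r) n (ℕP.+-cancelˡ-≡ n _ _ (≡.trans (≡.trans (≡.cong (ℕ._+ d ℕ.* n) (≡.sym (ℕP.m+[n∸m]≡n (ℕP.<⇒≤ c<n))))
      (≡.trans (lem₄ c (n ℕ.∸ c) (d ℕ.* n)) (≡.trans (≡.cong₂ (λ a b → a ℕ.+ b) (≡.sym decompose) (≡.sym cores)) (≡.trans (lem₅ r h (coresidue r)) (≡.cong (h ℕ.+_) (κ-value r))))))
      (≡.trans (≡.sym (ℕP.+-assoc h h (κ r ℕ.* n))) (≡.cong (ℕ._+ κ r ℕ.* n) (≡.sym n≡2h)))))
      where
      lem₄ : ∀ a b x → (a ℕ.+ b) ℕ.+ x ≡ (a ℕ.+ x) ℕ.+ b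
      lem₄ = ℕSolver.solve-∀
      lem₅ : ∀ r h x → (r ℕ.+ h) ℕ.+ x ≡ h ℕ.+ (r ℕ.+ x)
      lem₅ = ℕSolver.solve-∀
    sign : σ c ℤ.* σ r ≡ σ h
    sign = ≡.trans (≡.cong (ℤ._* σ r) (≡.sym c-sign)) (≡.trans (≡.sym (ℤP.^-distribˡ-+-* (ℤ.- + 1) (r ℕ.+ h) r)) (≡.trans (≡.cong σ (lem₄ r h)) (-1^+double h r)))
      where
      lem₄ : ∀ r h → (r ℕ.+ h) ℕ.+ r ≡ h ℕ.+ (r ℕ.+ r)
      lem₄ = ℕSolver.solve-∀
      c-sign : σ (r ℕ.+ h) ≡ σ c
      c-sign = ≡.trans (≡.cong σ (≡.trans decompose (≡.cong (c ℕ.+_) (≡.trans (≡.cong (d ℕ.*_) n≡2h) (ℕP.*-distribˡ-+ d h h))))) (-1^+double c (d ℕ.* h))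
    -- A double sum evaluated in both orders. Over w first it gives the Jacobi sum times the Gauss
    -- sum of index c, with the factor 1 - p = -n from `Z-+`. Over x first it gives the Gauss sum of
    -- index r, and the sum over w that is left has index h.
    double : A.Carrier
    double = A.∑ n (λ w → A.∑ n (λ x → A.⌜ χ e (+ suc w) ⌝ A.* (A.⌜ χ f (+ suc x) ⌝ A.* (Z (+ suc w) A.* Z (+ suc x ℤ.* ℤ.- + suc w)))))
    open A.Solver using (solve; _:*_; _:=_)
    module AR = A.≈-Reasoning
    side₁ : double A.≈ A.⌜ (+ 1 ℤ.- + p) ℤ.* (+ n ℤ.* (γ c ℤ.* jacobi r)) ⌝ A.* Y A.^ c
    side₁ = AR.begin
      double
        AR.≈⟨ A.∑-cong′ n (λ w → A.∑-cong′ n (λ x → A.trans (A.*-congˡ (A.*-congˡ (A.trans (Z-+ (+ suc w) (+ suc x ℤ.* ℤ.- + suc w)) (A.*-congˡ (A.≡⇒≈ (≡.cong Z (lem₆ (+ suc w) (+ suc x))))))))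
             (solve 4 (λ a b q z → a :* (b :* (q :* z)) := (q :* b) :* (a :* z)) A.refl _ _ _ _))) ⟩
      A.∑ n (λ w → A.∑ n (λ x → (1-p A.* A.⌜ χ f (+ suc x) ⌝) A.* (A.⌜ χ e (+ suc w) ⌝ A.* Z (+ suc w ℤ.* (+ 1 ℤ.- + suc x)))))
        AR.≈⟨ A.∑-swap n n _ ⟩
      A.∑ n (λ x → A.∑ n (λ w → (1-p A.* A.⌜ χ f (+ suc x) ⌝) A.* (A.⌜ χ e (+ suc w) ⌝ A.* Z (+ suc w ℤ.* (+ 1 ℤ.- + suc x)))))
        AR.≈⟨ A.∑-cong n (λ x x<n → A.trans (A.∑-*ˡ n _ _) (A.trans (A.*-congˡ (gaussSum e c (+ 1 ℤ.- + suc x) c<n n∣e+c (inj₂ c≢0))) (collect x x<n))) ⟩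
      A.∑ n (λ x → A.⌜ (+ 1 ℤ.- + p) ℤ.* (+ n ℤ.* γ c) ⌝ A.* A.⌜ jacobi-term r x ⌝ A.* Y A.^ c)
        AR.≈⟨ A.trans (A.∑-*ʳ n _ _) (A.*-congʳ (A.trans (A.∑-*ˡ n _ _) (A.*-congˡ (A.sym (⌜∑⌝ n (jacobi-term r)))))) ⟩
      (A.⌜ (+ 1 ℤ.- + p) ℤ.* (+ n ℤ.* γ c) ⌝ A.* A.⌜ jacobi r ⌝) A.* Y A.^ c
        AR.≈⟨ A.*-congʳ (A.trans (A.sym (A.⌜⌝-* ((+ 1 ℤ.- + p) ℤ.* (+ n ℤ.* γ c)) (jacobi r))) (A.≡⇒≈ (≡.cong A.⌜_⌝ (lem₇ (+ 1 ℤ.- + p) (+ n) (γ c) (jacobi r))))) ⟩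
      A.⌜ (+ 1 ℤ.- + p) ℤ.* (+ n ℤ.* (γ c ℤ.* jacobi r)) ⌝ A.* Y A.^ c AR.∎
      where
      lem₆ : ∀ w x → w ℤ.+ x ℤ.* ℤ.- w ≡ w ℤ.* (+ 1 ℤ.- x)
      lem₆ = solve-∀
      lem₇ : ∀ q n g j → (q ℤ.* (n ℤ.* g)) ℤ.* j ≡ q ℤ.* (n ℤ.* (g ℤ.* j))
      lem₇ = solve-∀
      χ-reduce : ∀ y → Dec (y P.≅ + 0) → χ c y ≅ χ (r ℕ.+ h) y
      χ-reduce y (no p∤y) = χ-% (r ℕ.+ h) p∤y
      χ-reduce y (yes y≅0) = trans (χ-zero c c≢0 y≅0) (sym (χ-zero (r ℕ.+ h) (λ z → ℕP.<-irrefl (≡.sym (ℕP.m+n≡0⇒m≡0 r z)) 0<r) y≅0))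
      collect : ∀ x → x ℕ.< n → (1-p A.* A.⌜ χ f (+ suc x) ⌝) A.* (A.⌜ + n ⌝ A.* (A.⌜ γ c ℤ.* χ c (+ 1 ℤ.- + suc x) ⌝ A.* Y A.^ c)) A.≈
        A.⌜ (+ 1 ℤ.- + p) ℤ.* (+ n ℤ.* γ c) ⌝ A.* A.⌜ jacobi-term r x ⌝ A.* Y A.^ c
      collect x x<n = A.trans (A.*-congˡ (A.*-congˡ (A.*-congʳ (A.trans (⌜⌝-mod (*ˡ (γ c) (χ-reduce (+ 1 ℤ.- + suc x) (≅0? _)))) (A.⌜⌝-* (γ c) (χ (r ℕ.+ h) (+ 1 ℤ.- + suc x)))))))
        (A.trans (solve 6 (λ q a n g b y → (q :* a) :* (n :* ((g :* b) :* y)) := (q :* (n :* g)) :* (a :* b) :* y) A.refl 1-p A.⌜ χ f (+ suc x) ⌝ A.⌜ + n ⌝ A.⌜ γ c ⌝ A.⌜ χ (r ℕ.+ h) (+ 1 ℤ.- + suc x) ⌝ (Y A.^ c))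
        (A.*-congʳ (A.*-cong (A.sym (A.trans (A.⌜⌝-* (+ 1 ℤ.- + p) (+ n ℤ.* γ c)) (A.*-congˡ (A.⌜⌝-* (+ n) (γ c))))) (A.sym (A.⌜⌝-* (χ f (+ suc x)) (χ (r ℕ.+ h) (+ 1 ℤ.- + suc x)))))))
    side₂ : double A.≈ A.⌜ + n ℤ.* (+ n ℤ.* ((ℤ.- + p) ℤ.^ d ℤ.* (σ r ℤ.* (γ r ℤ.* γ h)))) ⌝ A.* Y A.^ c
    side₂ = AR.begin
      double
        AR.≈⟨ A.∑-cong n (λ w w<n → A.trans (A.∑-cong′ n (λ x → solve 4 (λ a b y z → a :* (b :* (y :* z)) := (a :* y) :* (b :* z)) A.refl _ _ _ _))
             (A.trans (A.∑-*ˡ n _ _) (A.trans (A.*-congˡ (gaussSum f r (ℤ.- + suc w) r<n n∣f+r (inj₁ (unit-neg w<n)))) (regroup w)))) ⟩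
      A.∑ n (λ w → (A.⌜ + n ⌝ A.* A.⌜ σ r ℤ.* γ r ⌝ A.* Y A.^ r) A.* (A.⌜ χ (e ℕ.+ r) (+ suc w) ⌝ A.* Z (+ suc w ℤ.* + 1)))
        AR.≈⟨ A.trans (A.∑-*ˡ n _ _) (A.*-congˡ (gaussSum (e ℕ.+ r) h (+ 1) h<n n∣e+r+h (inj₁ ∤-1))) ⟩
      (A.⌜ + n ⌝ A.* A.⌜ σ r ℤ.* γ r ⌝ A.* Y A.^ r) A.* (A.⌜ + n ⌝ A.* (A.⌜ γ h ℤ.* χ h (+ 1) ⌝ A.* Y A.^ h))
        AR.≈⟨ solve 5 (λ n g y g′ y′ → (n :* g :* y) :* (n :* (g′ :* y′)) := (n :* (n :* (g :* g′))) :* (y :* y′)) A.refl A.⌜ + n ⌝ A.⌜ σ r ℤ.* γ r ⌝ (Y A.^ r) A.⌜ γ h ℤ.* χ h (+ 1) ⌝ (Y A.^ h) ⟩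
      (A.⌜ + n ⌝ A.* (A.⌜ + n ⌝ A.* (A.⌜ σ r ℤ.* γ r ⌝ A.* A.⌜ γ h ℤ.* χ h (+ 1) ⌝))) A.* (Y A.^ r A.* Y A.^ h)
        AR.≈⟨ A.*-cong (A.*-congˡ (A.*-congˡ (A.sym (A.⌜⌝-* (σ r ℤ.* γ r) (γ h ℤ.* χ h (+ 1))))))
               (A.trans (A.sym (A.^-homo-* Y r h)) (A.trans (A.≡⇒≈ (≡.cong (Y A.^_) (≡.trans decompose (≡.cong (c ℕ.+_) (ℕP.*-comm d n))))) (Y^-reduce c d))) ⟩
      (A.⌜ + n ⌝ A.* (A.⌜ + n ⌝ A.* A.⌜ (σ r ℤ.* γ r) ℤ.* (γ h ℤ.* χ h (+ 1)) ⌝)) A.* (A.⌜ (ℤ.- + p) ℤ.^ d ⌝ A.* Y A.^ c)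
        AR.≈⟨ solve 4 (λ n g q y → (n :* (n :* g)) :* (q :* y) := (n :* (n :* (q :* g))) :* y) A.refl A.⌜ + n ⌝ A.⌜ (σ r ℤ.* γ r) ℤ.* (γ h ℤ.* χ h (+ 1)) ⌝ A.⌜ (ℤ.- + p) ℤ.^ d ⌝ (Y A.^ c) ⟩
      (A.⌜ + n ⌝ A.* (A.⌜ + n ⌝ A.* (A.⌜ (ℤ.- + p) ℤ.^ d ⌝ A.* A.⌜ (σ r ℤ.* γ r) ℤ.* (γ h ℤ.* χ h (+ 1)) ⌝))) A.* Y A.^ c
        AR.≈⟨ A.*-congʳ (A.trans (A.*-congˡ (A.trans (A.*-congˡ (A.sym (A.⌜⌝-* ((ℤ.- + p) ℤ.^ d) ((σ r ℤ.* γ r) ℤ.* (γ h ℤ.* χ h (+ 1)))))) (A.sym (A.⌜⌝-* (+ n) _)))) (A.sym (A.⌜⌝-* (+ n) _))) ⟩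
      A.⌜ + n ℤ.* (+ n ℤ.* ((ℤ.- + p) ℤ.^ d ℤ.* ((σ r ℤ.* γ r) ℤ.* (γ h ℤ.* χ h (+ 1))))) ⌝ A.* Y A.^ c
        AR.≈⟨ A.*-congʳ (A.≡⇒≈ (≡.cong (λ z → A.⌜ + n ℤ.* (+ n ℤ.* ((ℤ.- + p) ℤ.^ d ℤ.* z)) ⌝) (≡.trans (≡.cong (λ v → (σ r ℤ.* γ r) ℤ.* (γ h ℤ.* v)) (χ-1 h)) (lem₈ (σ r) (γ r) (γ h))))) ⟩
      A.⌜ + n ℤ.* (+ n ℤ.* ((ℤ.- + p) ℤ.^ d ℤ.* (σ r ℤ.* (γ r ℤ.* γ h)))) ⌝ A.* Y A.^ c AR.∎
      where
      lem₈ : ∀ s a b → (s ℤ.* a) ℤ.* (b ℤ.* + 1) ≡ s ℤ.* (a ℤ.* b)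
      lem₈ = solve-∀
      unit-neg : ∀ {w} → w ℕ.< n → p∤ ℤ.- + suc w
      unit-neg {w} w<n u = ∤-small (s≤s z≤n) (s≤s w<n) (P.trans (P.≡⇒≈ (≡.sym (ℤP.neg-involutive (+ suc w)))) (P.-‿cong u))
      n∣e+r+h : n ℕD.∣ (e ℕ.+ r) ℕ.+ h
      n∣e+r+h = ≡.subst (n ℕD.∣_) (lem₉ h f r) (ℕD.∣m∣n⇒∣m+n n∣h+h n∣f+r)
        where
        lem₉ : ∀ h f r → (h ℕ.+ h) ℕ.+ (f ℕ.+ r) ≡ ((h ℕ.+ f) ℕ.+ r) ℕ.+ h
        lem₉ = ℕSolver.solve-∀
      χ-neg : ∀ w → χ r (ℤ.- + suc w) ≡ σ r ℤ.* χ r (+ suc w)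
      χ-neg w = ≡.trans (≡.cong (χ r) (≡.sym (ℤP.-1*i≡-i (+ suc w)))) (≡.trans (χ-* r (ℤ.- + 1) (+ suc w)) (≡.cong (ℤ._* χ r (+ suc w)) (χ--1 r)))
      regroup : ∀ w → (A.⌜ χ e (+ suc w) ⌝ A.* Z (+ suc w)) A.* (A.⌜ + n ⌝ A.* (A.⌜ γ r ℤ.* χ r (ℤ.- + suc w) ⌝ A.* Y A.^ r)) A.≈
        (A.⌜ + n ⌝ A.* A.⌜ σ r ℤ.* γ r ⌝ A.* Y A.^ r) A.* (A.⌜ χ (e ℕ.+ r) (+ suc w) ⌝ A.* Z (+ suc w ℤ.* + 1))
      regroup w = A.trans (A.*-congˡ (A.*-congˡ (A.*-congʳ (A.trans (A.≡⇒≈ (≡.cong A.⌜_⌝ (≡.trans (≡.cong (γ r ℤ.*_) (χ-neg w)) (lem₁₀ (γ r) (σ r) (χ r (+ suc w)))))) (A.⌜⌝-* (σ r ℤ.* γ r) (χ r (+ suc w)))))))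
        (A.trans (solve 6 (λ a z n g b y → (a :* z) :* (n :* ((g :* b) :* y)) := (n :* g :* y) :* ((a :* b) :* z)) A.refl A.⌜ χ e (+ suc w) ⌝ (Z (+ suc w)) A.⌜ + n ⌝ A.⌜ σ r ℤ.* γ r ⌝ A.⌜ χ r (+ suc w) ⌝ (Y A.^ r))
        (A.*-congˡ (A.*-cong (A.trans (A.sym (A.⌜⌝-* (χ e (+ suc w)) (χ r (+ suc w)))) (A.≡⇒≈ (≡.cong A.⌜_⌝ (≡.sym (χ-+ e r (+ suc w)))))) (A.≡⇒≈ (≡.cong Z (≡.sym (ℤP.*-identityʳ (+ suc w))))))))
        where
        lem₁₀ : ∀ g s x → g ℤ.* (s ℤ.* x) ≡ (s ℤ.* g) ℤ.* x
        lem₁₀ = solve-∀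
    relation : ℤ.- γ c ℤ.* jacobi r ≅ (ℤ.- + p) ℤ.^ d ℤ.* (σ r ℤ.* (γ r ℤ.* γ h))
    relation = cancelᴹ (+ n) p∤n (cancelᴹ (+ n) p∤n (trans (≡⇒≈ (lem₁₁ (+ n) (γ c) (jacobi r))) (Y-injective c _ _ c<n (A.trans (A.sym side₁) side₂))))
      where
      lem₁₁ : ∀ n g j → n ℤ.* (n ℤ.* (ℤ.- g ℤ.* j)) ≡ (+ 1 ℤ.- (+ 1 ℤ.+ n)) ℤ.* (n ℤ.* (g ℤ.* j))
      lem₁₁ = solve-∀

  jacobi-value : ∀ r → 0 ℕ.< r → r ℕ.< n → jacobi r ≅ (ℤ.- + 1) ℤ.^ h ℤ.* (ℤ.- + p) ℤ.^ κ r ℤ.* (γ h ℤ.* γ r ℤ.* γ (coresidue r))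
  jacobi-value r 0<r r<n with r ℕ.≟ h
  ... | yes ≡.refl = jacobi-h
  ... | no r≢h = jacobi-generic r 0<r r<n r≢h

-- The double sum attached to the cubic

module MainSum (n : ℕ) (pp : Prime (suc n)) (h : ℕ) (n≡2h : n ≡ h ℕ.+ h) (k : ℕ) (gaussRing : GaussRing n pp h n≡2h k)
  (α β : ℤ) (p∤α : PrimeMod.p∤_ n pp α) (p∤β : PrimeMod.p∤_ n pp β) (β≡2α : β ≡ α ℤ.+ α) where
  open GaussSums n pp h n≡2h k gaussRing
  open GaussRing gaussRing
  open RingTheory ring
  open ≈-Reasoning
  open Solver using (solve; _:+_; _:*_; _:-_; :-_; _:=_)
  private
    module P = Mod p
    module Q = Mod M

  private
    U : ℕ → ℤ
    U w = + suc w

    unit : ∀ {w} → w ℕ.< n → p∤ U w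
    unit w<n = ∤-small (s≤s z≤n) (s≤s w<n)

  cubic : ℤ → ℤ
  cubic t = α ℤ.+ β ℤ.* t ℤ.+ α ℤ.* (t ℤ.* t) ℤ.+ t ℤ.* t ℤ.* t

  Φ : ℤ
  Φ = Q.∑ n (λ t → χ h (cubic (U t)))

  -- The exponents forced by orthogonality modulo n: the sum over t requires 3D + 2C + B ≡ 0, and
  -- the sum over y requires h + A + B + C + D ≡ 0. The second condition makes the total power of Y
  -- equal to Y^h up to powers of -p.
  B-index A-index : ℕ → ℕ → ℕ
  B-index C D = compl (D ℕ.+ D ℕ.+ D ℕ.+ (C ℕ.+ C))
  A-index C D = compl (h ℕ.+ D ℕ.+ C ℕ.+ B-index C D)

  total : ℕ → ℕ → ℕ
  total C D = A-index C D ℕ.+ B-index C D ℕ.+ C ℕ.+ D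

  wraps : ℕ → ℕ → ℕ
  wraps C D = total C D ℕDM./ n

  total-value : ∀ C D → total C D ≡ h ℕ.+ n ℕ.* wraps C D
  total-value C D = ≡.trans (ℕDM.m≡m%n+[m/n]*n (total C D) n) (≡.cong₂ ℕ._+_ residue-h (ℕP.*-comm (wraps C D) n))
    where
    residue-h : total C D ℕDM.% n ≡ h
    residue-h = ∣-unique h (ℕDM.m%n<n (total C D) n) h<n
      (ℕD.∣m+n∣m⇒∣n {m = wraps C D ℕ.* n} (≡.subst (n ℕD.∣_) regroup (n∣+compl (h ℕ.+ D ℕ.+ C ℕ.+ B-index C D))) (ℕD.n∣m*n (wraps C D))) n∣h+h
      where
      lem : ∀ h a b c d → h ℕ.+ d ℕ.+ c ℕ.+ b ℕ.+ a ≡ h ℕ.+ (a ℕ.+ b ℕ.+ c ℕ.+ d)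
      lem = ℕSolver.solve-∀
      lem₂ : ∀ h a b → h ℕ.+ (a ℕ.+ b) ≡ b ℕ.+ (h ℕ.+ a)
      lem₂ = ℕSolver.solve-∀
      regroup : h ℕ.+ D ℕ.+ C ℕ.+ B-index C D ℕ.+ A-index C D ≡ wraps C D ℕ.* n ℕ.+ (h ℕ.+ total C D ℕDM.% n)
      regroup = ≡.trans (lem h (A-index C D) (B-index C D) C D) (≡.trans (≡.cong (h ℕ.+_) (ℕDM.m≡m%n+[m/n]*n (total C D) n)) (lem₂ h (total C D ℕDM.% n) (wraps C D ℕ.* n)))

  coefficient : ℕ → ℕ → ℤ
  coefficient C D = γ D ℤ.* ((γ C ℤ.* χ C α) ℤ.* ((γ (B-index C D) ℤ.* χ (B-index C D) β) ℤ.* (γ (A-index C D) ℤ.* χ (A-index C D) α)))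

  product₃ : ℤ → ℤ → Carrier
  product₃ y t = Z (y ℤ.* α) * Z (t ℤ.* (β ℤ.* y)) * Z (y ℤ.* (α ℤ.* (t ℤ.* t)))

  row : ℕ → Carrier
  row D = ∑ n (λ y → ∑ n (λ t → ⌜ χ (h ℕ.+ D) (U y) ⌝ * ⌜ χ (D ℕ.+ D ℕ.+ D) (U t) ⌝ * product₃ (U y) (U t)))

  -- The last factor Z (y t³) is expanded in full-rows; the row D = 0 belongs to the quadratic α(1 + t)².
  full : Carrier
  full = ∑ n (λ y → ∑ n (λ t → ⌜ χ h (U y) ⌝ * (product₃ (U y) (U t) * Z (U y ℤ.* (U t ℤ.* U t ℤ.* U t)))))

  full-rows : full ≈ ∑ n (λ D → ⌜ γ D ⌝ * Y ^ D * row D)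
  full-rows = begin
    full
      ≈⟨ ∑-cong n (λ y y<n → ∑-cong n (λ t t<n → expand y t y<n t<n)) ⟩
    ∑ n (λ y → ∑ n (λ t → ∑ n (λ D → ⌜ γ D ⌝ * Y ^ D * entry D y t)))
      ≈⟨ ∑-cong′ n (λ y → ∑-swap n n _) ⟩
    ∑ n (λ y → ∑ n (λ D → ∑ n (λ t → ⌜ γ D ⌝ * Y ^ D * entry D y t)))
      ≈⟨ ∑-swap n n _ ⟩
    ∑ n (λ D → ∑ n (λ y → ∑ n (λ t → ⌜ γ D ⌝ * Y ^ D * entry D y t)))
      ≈⟨ ∑-cong′ n (λ D → trans (∑-cong′ n (λ y → ∑-*ˡ n _ _)) (∑-*ˡ n _ _)) ⟩
    ∑ n (λ D → ⌜ γ D ⌝ * Y ^ D * row D) ∎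
    where
    entry : ℕ → ℕ → ℕ → Carrier
    entry D y t = ⌜ χ (h ℕ.+ D) (U y) ⌝ * ⌜ χ (D ℕ.+ D ℕ.+ D) (U t) ⌝ * product₃ (U y) (U t)
    χ-cube : ∀ D y t → χ D (y ℤ.* (t ℤ.* t ℤ.* t)) ≡ χ D y ℤ.* χ (D ℕ.+ D ℕ.+ D) t
    χ-cube D y t = ≡.trans (χ-* D y (t ℤ.* t ℤ.* t)) (≡.cong (χ D y ℤ.*_) (≡.trans (χ-* D (t ℤ.* t) t) (≡.trans (≡.cong (ℤ._* χ D t) (≡.trans (χ-* D t t) (≡.sym (χ-+ D D t)))) (≡.sym (χ-+ (D ℕ.+ D) D t)))))
    expand : ∀ y t → y ℕ.< n → t ℕ.< n → ⌜ χ h (U y) ⌝ * (product₃ (U y) (U t) * Z (U y ℤ.* (U t ℤ.* U t ℤ.* U t))) ≈ ∑ n (λ D → ⌜ γ D ⌝ * Y ^ D * entry D y t)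
    expand y t y<n t<n = begin
      ⌜ χ h (U y) ⌝ * (product₃ (U y) (U t) * Z (U y ℤ.* (U t ℤ.* U t ℤ.* U t)))
        ≈⟨ *-congˡ (*-congˡ (Z-expansion _ (∤-* (unit y<n) (∤-* (∤-* (unit t<n) (unit t<n)) (unit t<n))))) ⟩
      ⌜ χ h (U y) ⌝ * (product₃ (U y) (U t) * ∑ n (λ D → ⌜ γ D ℤ.* χ D (U y ℤ.* (U t ℤ.* U t ℤ.* U t)) ⌝ * Y ^ D))
        ≈⟨ trans (sym (*-assoc _ _ _)) (sym (∑-*ˡ n _ _)) ⟩
      ∑ n (λ D → (⌜ χ h (U y) ⌝ * product₃ (U y) (U t)) * (⌜ γ D ℤ.* χ D (U y ℤ.* (U t ℤ.* U t ℤ.* U t)) ⌝ * Y ^ D))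
        ≈⟨ ∑-cong′ n (λ D → trans (*-congˡ (*-congʳ (trans (≡⇒≈ (≡.cong (λ z → ⌜ γ D ℤ.* z ⌝) (χ-cube D (U y) (U t)))) (trans (⌜⌝-* (γ D) (χ D (U y) ℤ.* χ (D ℕ.+ D ℕ.+ D) (U t))) (*-congˡ (⌜⌝-* (χ D (U y)) (χ (D ℕ.+ D ℕ.+ D) (U t))))))))
             (trans (solve 6 (λ a q g b c y → (a :* q) :* ((g :* (b :* c)) :* y) := g :* y :* ((a :* b) :* c :* q)) refl ⌜ χ h (U y) ⌝ (product₃ (U y) (U t)) ⌜ γ D ⌝ ⌜ χ D (U y) ⌝ ⌜ χ (D ℕ.+ D ℕ.+ D) (U t) ⌝ (Y ^ D))
               (*-congˡ (*-congʳ (*-congʳ (trans (sym (⌜⌝-* (χ h (U y)) (χ D (U y)))) (≡⇒≈ (≡.cong ⌜_⌝ (≡.sym (χ-+ h D (U y)))))))))) ) ⟩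
      ∑ n (λ D → ⌜ γ D ⌝ * Y ^ D * entry D y t) ∎

  -- Only the factor with αyt² is expanded explicitly. For the two linear factors `gaussSum`
  -- performs expansion and orthogonality at once, over t with index B and then over y with index A.
  row-value : ∀ D → ⌜ γ D ⌝ * Y ^ D * row D ≈ ⌜ + n ℤ.* (+ n ℤ.* Q.∑ n (λ C → coefficient C D ℤ.* (ℤ.- + p) ℤ.^ wraps C D)) ⌝ * Y ^ h
  row-value D = begin
    ⌜ γ D ⌝ * Y ^ D * row D
      ≈⟨ *-congˡ (∑-cong n (λ y y<n → ∑-cong n (λ t t<n → expand y t y<n t<n))) ⟩
    ⌜ γ D ⌝ * Y ^ D * ∑ n (λ y → ∑ n (λ t → ∑ n (λ C → entry C y t)))
      ≈⟨ *-congˡ (trans (∑-cong′ n (λ y → ∑-swap n n _)) (∑-swap n n _)) ⟩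
    ⌜ γ D ⌝ * Y ^ D * ∑ n (λ C → ∑ n (λ y → ∑ n (λ t → entry C y t)))
      ≈⟨ *-congˡ (∑-cong′ n columns) ⟩
    ⌜ γ D ⌝ * Y ^ D * ∑ n (λ C → ⌜ γ C ℤ.* χ C α ⌝ * Y ^ C * (⌜ + n ⌝ * (⌜ γB C ⌝ * Y ^ B-index C D) * (⌜ + n ⌝ * (⌜ γA C ⌝ * Y ^ A-index C D))))
      ≈⟨ sym (∑-*ˡ n _ _) ⟩
    ∑ n (λ C → ⌜ γ D ⌝ * Y ^ D * (⌜ γ C ℤ.* χ C α ⌝ * Y ^ C * (⌜ + n ⌝ * (⌜ γB C ⌝ * Y ^ B-index C D) * (⌜ + n ⌝ * (⌜ γA C ⌝ * Y ^ A-index C D)))))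
      ≈⟨ ∑-cong′ n collect ⟩
    ∑ n (λ C → (⌜ + n ⌝ * ⌜ + n ⌝) * ⌜ coefficient C D ℤ.* (ℤ.- + p) ℤ.^ wraps C D ⌝ * Y ^ h)
      ≈⟨ trans (∑-*ʳ n _ _) (*-congʳ (trans (∑-*ˡ n _ _) (*-congˡ (sym (⌜∑⌝ n _))))) ⟩
    (⌜ + n ⌝ * ⌜ + n ⌝) * ⌜ S ⌝ * Y ^ h
      ≈⟨ *-congʳ (trans (*-assoc _ _ _) (trans (*-congˡ (sym (⌜⌝-* (+ n) S))) (sym (⌜⌝-* (+ n) (+ n ℤ.* S))))) ⟩
    ⌜ + n ℤ.* (+ n ℤ.* S) ⌝ * Y ^ h ∎
    where
    S : ℤ
    S = Q.∑ n (λ C → coefficient C D ℤ.* (ℤ.- + p) ℤ.^ wraps C D)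
    γB γA : ℕ → ℤ
    γB C = γ (B-index C D) ℤ.* χ (B-index C D) β
    γA C = γ (A-index C D) ℤ.* χ (A-index C D) α
    tExp yExp : ℕ → ℕ
    tExp C = D ℕ.+ D ℕ.+ D ℕ.+ (C ℕ.+ C)
    yExp C = h ℕ.+ D ℕ.+ C
    entry : ℕ → ℕ → ℕ → Carrier
    entry C y t = (⌜ γ C ℤ.* χ C α ⌝ * Y ^ C) * (⌜ χ (yExp C) (U y) ⌝ * Z (U y ℤ.* α)) * (⌜ χ (tExp C) (U t) ⌝ * Z (U t ℤ.* (β ℤ.* U y)))
    χ-square : ∀ C y t → χ C (y ℤ.* (α ℤ.* (t ℤ.* t))) ≡ χ C α ℤ.* (χ C y ℤ.* χ (C ℕ.+ C) t)
    χ-square C y t = ≡.trans (χ-* C y (α ℤ.* (t ℤ.* t))) (≡.trans (≡.cong (χ C y ℤ.*_) (≡.trans (χ-* C α (t ℤ.* t)) (≡.cong (χ C α ℤ.*_) (≡.trans (χ-* C t t) (≡.sym (χ-+ C C t)))))) (lem (χ C y) (χ C α) (χ (C ℕ.+ C) t)))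
      where
      lem : ∀ y a t → y ℤ.* (a ℤ.* t) ≡ a ℤ.* (y ℤ.* t)
      lem = solve-∀
    expand : ∀ y t → y ℕ.< n → t ℕ.< n → ⌜ χ (h ℕ.+ D) (U y) ⌝ * ⌜ χ (D ℕ.+ D ℕ.+ D) (U t) ⌝ * product₃ (U y) (U t) ≈ ∑ n (λ C → entry C y t)
    expand y t y<n t<n = begin
      a * b * (z₁ * z₂ * Z (U y ℤ.* (α ℤ.* (U t ℤ.* U t))))
        ≈⟨ *-congˡ (*-congˡ (Z-expansion _ (∤-* (unit y<n) (∤-* p∤α (∤-* (unit t<n) (unit t<n)))))) ⟩
      a * b * (z₁ * z₂ * ∑ n (λ C → ⌜ γ C ℤ.* χ C (U y ℤ.* (α ℤ.* (U t ℤ.* U t))) ⌝ * Y ^ C))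
        ≈⟨ trans (sym (*-assoc _ _ _)) (sym (∑-*ˡ n _ _)) ⟩
      ∑ n (λ C → (a * b * (z₁ * z₂)) * (⌜ γ C ℤ.* χ C (U y ℤ.* (α ℤ.* (U t ℤ.* U t))) ⌝ * Y ^ C))
        ≈⟨ ∑-cong′ n (λ C → trans (*-congˡ (*-congʳ (split C)))
             (trans (solve 8 (λ a b z w g y t Y → (a :* b :* (z :* w)) :* ((g :* (y :* t)) :* Y) := (g :* Y) :* ((a :* y) :* z) :* ((b :* t) :* w)) refl a b z₁ z₂ ⌜ γ C ℤ.* χ C α ⌝ ⌜ χ C (U y) ⌝ ⌜ χ (C ℕ.+ C) (U t) ⌝ (Y ^ C))
               (*-cong (*-congˡ (*-congʳ (merge (h ℕ.+ D) C (U y)))) (*-congʳ (merge (D ℕ.+ D ℕ.+ D) (C ℕ.+ C) (U t)))))) ⟩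
      ∑ n (λ C → entry C y t) ∎
      where
      a b z₁ z₂ : Carrier
      a = ⌜ χ (h ℕ.+ D) (U y) ⌝
      b = ⌜ χ (D ℕ.+ D ℕ.+ D) (U t) ⌝
      z₁ = Z (U y ℤ.* α)
      z₂ = Z (U t ℤ.* (β ℤ.* U y))
      merge : ∀ e f z → ⌜ χ e z ⌝ * ⌜ χ f z ⌝ ≈ ⌜ χ (e ℕ.+ f) z ⌝
      merge e f z = trans (sym (⌜⌝-* (χ e z) (χ f z))) (≡⇒≈ (≡.cong ⌜_⌝ (≡.sym (χ-+ e f z))))
      split : ∀ C → ⌜ γ C ℤ.* χ C (U y ℤ.* (α ℤ.* (U t ℤ.* U t))) ⌝ ≈ ⌜ γ C ℤ.* χ C α ⌝ * (⌜ χ C (U y) ⌝ * ⌜ χ (C ℕ.+ C) (U t) ⌝)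
      split C = trans (≡⇒≈ (≡.cong ⌜_⌝ (≡.trans (≡.cong (γ C ℤ.*_) (χ-square C (U y) (U t))) (≡.sym (ℤP.*-assoc (γ C) (χ C α) _)))))
        (trans (⌜⌝-* (γ C ℤ.* χ C α) (χ C (U y) ℤ.* χ (C ℕ.+ C) (U t))) (*-congˡ (⌜⌝-* (χ C (U y)) (χ (C ℕ.+ C) (U t)))))
    columns : ∀ C → ∑ n (λ y → ∑ n (λ t → entry C y t)) ≈ ⌜ γ C ℤ.* χ C α ⌝ * Y ^ C * (⌜ + n ⌝ * (⌜ γB C ⌝ * Y ^ B-index C D) * (⌜ + n ⌝ * (⌜ γA C ⌝ * Y ^ A-index C D)))
    columns C = begin
      ∑ n (λ y → ∑ n (λ t → entry C y t))
        ≈⟨ ∑-cong n (λ y y<n → trans (∑-*ˡ n _ _) (*-congˡ (gaussSum (tExp C) B (β ℤ.* U y) (compl<n (tExp C)) (n∣+compl (tExp C)) (inj₁ (∤-* p∤β (unit y<n)))))) ⟩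
      ∑ n (λ y → g * (⌜ χ (yExp C) (U y) ⌝ * Z (U y ℤ.* α)) * (⌜ + n ⌝ * (⌜ γ B ℤ.* χ B (β ℤ.* U y) ⌝ * Y ^ B)))
        ≈⟨ ∑-cong′ n (λ y → trans (*-congˡ (*-congˡ (*-congʳ (trans (≡⇒≈ (≡.cong ⌜_⌝ (≡.trans (≡.cong (γ B ℤ.*_) (χ-* B β (U y))) (≡.sym (ℤP.*-assoc (γ B) (χ B β) (χ B (U y))))))) (⌜⌝-* (γB C) (χ B (U y)))))))
             (trans (solve 7 (λ g x z n b c Y → g :* (x :* z) :* (n :* ((b :* c) :* Y)) := (g :* (n :* (b :* Y))) :* ((x :* c) :* z)) refl g ⌜ χ (yExp C) (U y) ⌝ (Z (U y ℤ.* α)) ⌜ + n ⌝ ⌜ γB C ⌝ ⌜ χ B (U y) ⌝ (Y ^ B))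
               (*-congˡ (*-congʳ (trans (sym (⌜⌝-* (χ (yExp C) (U y)) (χ B (U y)))) (≡⇒≈ (≡.cong ⌜_⌝ (≡.sym (χ-+ (yExp C) B (U y)))))))))) ⟩
      ∑ n (λ y → (g * (⌜ + n ⌝ * (⌜ γB C ⌝ * Y ^ B))) * (⌜ χ (yExp C ℕ.+ B) (U y) ⌝ * Z (U y ℤ.* α)))
        ≈⟨ trans (∑-*ˡ n _ _) (*-congˡ (gaussSum (yExp C ℕ.+ B) (A-index C D) α (compl<n (yExp C ℕ.+ B)) (n∣+compl (yExp C ℕ.+ B)) (inj₁ p∤α))) ⟩
      (g * (⌜ + n ⌝ * (⌜ γB C ⌝ * Y ^ B))) * (⌜ + n ⌝ * (⌜ γA C ⌝ * Y ^ A-index C D))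
        ≈⟨ *-assoc _ _ _ ⟩
      g * (⌜ + n ⌝ * (⌜ γB C ⌝ * Y ^ B) * (⌜ + n ⌝ * (⌜ γA C ⌝ * Y ^ A-index C D))) ∎
      where
      B : ℕ
      B = B-index C D
      g : Carrier
      g = ⌜ γ C ℤ.* χ C α ⌝ * Y ^ C
    collect : ∀ C → ⌜ γ D ⌝ * Y ^ D * (⌜ γ C ℤ.* χ C α ⌝ * Y ^ C * (⌜ + n ⌝ * (⌜ γB C ⌝ * Y ^ B-index C D) * (⌜ + n ⌝ * (⌜ γA C ⌝ * Y ^ A-index C D)))) ≈
      (⌜ + n ⌝ * ⌜ + n ⌝) * ⌜ coefficient C D ℤ.* (ℤ.- + p) ℤ.^ wraps C D ⌝ * Y ^ h
    collect C = begin
      ⌜ γ D ⌝ * Y ^ D * (⌜ γC ⌝ * Y ^ C * (⌜ + n ⌝ * (⌜ γB C ⌝ * Y ^ B) * (⌜ + n ⌝ * (⌜ γA C ⌝ * Y ^ A))))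
        ≈⟨ solve 9 (λ d D c C n b B a A → d :* D :* (c :* C :* (n :* (b :* B) :* (n :* (a :* A)))) := (n :* n) :* (d :* (c :* (b :* a))) :* (((A :* B) :* C) :* D)) refl
             ⌜ γ D ⌝ (Y ^ D) ⌜ γC ⌝ (Y ^ C) ⌜ + n ⌝ ⌜ γB C ⌝ (Y ^ B) ⌜ γA C ⌝ (Y ^ A) ⟩
      (⌜ + n ⌝ * ⌜ + n ⌝) * (⌜ γ D ⌝ * (⌜ γC ⌝ * (⌜ γB C ⌝ * ⌜ γA C ⌝))) * (((Y ^ A * Y ^ B) * Y ^ C) * Y ^ D)
        ≈⟨ *-cong (*-congˡ (sym (trans (⌜⌝-* (γ D) _) (*-congˡ (trans (⌜⌝-* γC (γB C ℤ.* γA C)) (*-congˡ (⌜⌝-* (γB C) (γA C)))))))) powers ⟩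
      (⌜ + n ⌝ * ⌜ + n ⌝) * ⌜ coefficient C D ⌝ * (⌜ (ℤ.- + p) ℤ.^ wraps C D ⌝ * Y ^ h)
        ≈⟨ solve 4 (λ n c q y → n :* c :* (q :* y) := n :* (c :* q) :* y) refl (⌜ + n ⌝ * ⌜ + n ⌝) ⌜ coefficient C D ⌝ ⌜ (ℤ.- + p) ℤ.^ wraps C D ⌝ (Y ^ h) ⟩
      (⌜ + n ⌝ * ⌜ + n ⌝) * (⌜ coefficient C D ⌝ * ⌜ (ℤ.- + p) ℤ.^ wraps C D ⌝) * Y ^ h
        ≈⟨ *-congʳ (*-congˡ (sym (⌜⌝-* (coefficient C D) ((ℤ.- + p) ℤ.^ wraps C D)))) ⟩
      (⌜ + n ⌝ * ⌜ + n ⌝) * ⌜ coefficient C D ℤ.* (ℤ.- + p) ℤ.^ wraps C D ⌝ * Y ^ h ∎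
      where
      A B : ℕ
      A = A-index C D
      B = B-index C D
      γC : ℤ
      γC = γ C ℤ.* χ C α
      powers : ((Y ^ A * Y ^ B) * Y ^ C) * Y ^ D ≈ ⌜ (ℤ.- + p) ℤ.^ wraps C D ⌝ * Y ^ h
      powers = trans (*-congʳ (trans (*-congʳ (sym (^-homo-* Y A B))) (sym (^-homo-* Y (A ℕ.+ B) C)))) (trans (sym (^-homo-* Y (A ℕ.+ B ℕ.+ C) D))
        (trans (≡⇒≈ (≡.cong (Y ^_) (total-value C D))) (Y^-reduce h (wraps C D))))

  product₃-value : ∀ y t → product₃ y t ≈ 1-p * 1-p * Z (y ℤ.* (α ℤ.+ β ℤ.* t ℤ.+ α ℤ.* (t ℤ.* t)))
  product₃-value y t = begin
    Z (y ℤ.* α) * Z (t ℤ.* (β ℤ.* y)) * Z (y ℤ.* (α ℤ.* (t ℤ.* t))) ≈⟨ *-congʳ (Z-+ (y ℤ.* α) (t ℤ.* (β ℤ.* y))) ⟩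
    1-p * Z (y ℤ.* α ℤ.+ t ℤ.* (β ℤ.* y)) * Z (y ℤ.* (α ℤ.* (t ℤ.* t))) ≈⟨ trans (*-assoc _ _ _) (*-congˡ (Z-+ (y ℤ.* α ℤ.+ t ℤ.* (β ℤ.* y)) (y ℤ.* (α ℤ.* (t ℤ.* t))))) ⟩
    1-p * (1-p * Z (y ℤ.* α ℤ.+ t ℤ.* (β ℤ.* y) ℤ.+ y ℤ.* (α ℤ.* (t ℤ.* t)))) ≈⟨ trans (sym (*-assoc _ _ _)) (*-congˡ (≡⇒≈ (≡.cong Z (lem y t α β)))) ⟩
    1-p * 1-p * Z (y ℤ.* (α ℤ.+ β ℤ.* t ℤ.+ α ℤ.* (t ℤ.* t))) ∎
    where
    lem : ∀ y t α β → y ℤ.* α ℤ.+ t ℤ.* (β ℤ.* y) ℤ.+ y ℤ.* (α ℤ.* (t ℤ.* t)) ≡ y ℤ.* (α ℤ.+ β ℤ.* t ℤ.+ α ℤ.* (t ℤ.* t))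
    lem = solve-∀

  -- Zeros of f cause no exception: the index h is not 0, so `gaussSum` holds at f t ≡ 0 as well.
  quadratic-sum : ∀ (q : Carrier) (f : ℕ → ℤ) →
    ∑ n (λ y → ∑ n (λ t → ⌜ χ h (U y) ⌝ * (q * Z (U y ℤ.* f t)))) ≈ q * ⌜ + n ℤ.* (γ h ℤ.* Q.∑ n (λ t → χ h (f t))) ⌝ * Y ^ h
  quadratic-sum q f = begin
    ∑ n (λ y → ∑ n (λ t → ⌜ χ h (U y) ⌝ * (q * Z (U y ℤ.* f t))))
      ≈⟨ trans (∑-swap n n _) (∑-cong′ n (λ t → trans (∑-cong′ n (λ y → solve 3 (λ a q z → a :* (q :* z) := q :* (a :* z)) refl _ _ _)) (∑-*ˡ n _ _))) ⟩
    ∑ n (λ t → q * ∑ n (λ y → ⌜ χ h (U y) ⌝ * Z (U y ℤ.* f t)))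
      ≈⟨ ∑-cong′ n (λ t → *-congˡ (gaussSum h h (f t) h<n n∣h+h (inj₂ h≢0))) ⟩
    ∑ n (λ t → q * (⌜ + n ⌝ * (⌜ γ h ℤ.* χ h (f t) ⌝ * Y ^ h)))
      ≈⟨ ∑-cong′ n (λ t → trans (*-congˡ (*-congˡ (*-congʳ (⌜⌝-* (γ h) (χ h (f t)))))) (solve 5 (λ q n g x y → q :* (n :* ((g :* x) :* y)) := (q :* (n :* g)) :* x :* y) refl q ⌜ + n ⌝ ⌜ γ h ⌝ ⌜ χ h (f t) ⌝ (Y ^ h))) ⟩
    ∑ n (λ t → (q * (⌜ + n ⌝ * ⌜ γ h ⌝)) * ⌜ χ h (f t) ⌝ * Y ^ h)
      ≈⟨ trans (∑-*ʳ n _ _) (*-congʳ (trans (∑-*ˡ n _ _) (*-congˡ (sym (⌜∑⌝ n (λ t → χ h (f t))))))) ⟩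
    (q * (⌜ + n ⌝ * ⌜ γ h ⌝)) * ⌜ Σχ ⌝ * Y ^ h
      ≈⟨ *-congʳ (trans (solve 4 (λ q n g x → (q :* (n :* g)) :* x := q :* (n :* (g :* x))) refl q ⌜ + n ⌝ ⌜ γ h ⌝ ⌜ Σχ ⌝) (*-congˡ (trans (*-congˡ (sym (⌜⌝-* (γ h) Σχ))) (sym (⌜⌝-* (+ n) (γ h ℤ.* Σχ)))))) ⟩
    q * ⌜ + n ℤ.* (γ h ℤ.* Σχ) ⌝ * Y ^ h ∎
    where
    Σχ : ℤ
    Σχ = Q.∑ n (λ t → χ h (f t))

  full-value : full ≈ 1-p * 1-p * 1-p * ⌜ + n ℤ.* (γ h ℤ.* Φ) ⌝ * Y ^ h
  full-value = trans (∑-cong′ n (λ y → ∑-cong′ n (λ t → *-congˡ (begin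
      product₃ (U y) (U t) * Z (U y ℤ.* cube (U t)) ≈⟨ *-congʳ (product₃-value (U y) (U t)) ⟩
      1-p * 1-p * Z (U y ℤ.* q (U t)) * Z (U y ℤ.* cube (U t)) ≈⟨ trans (*-assoc _ _ _) (*-congˡ (Z-+ (U y ℤ.* q (U t)) (U y ℤ.* cube (U t)))) ⟩
      1-p * 1-p * (1-p * Z (U y ℤ.* q (U t) ℤ.+ U y ℤ.* cube (U t))) ≈⟨ trans (sym (*-assoc _ _ _)) (*-congˡ (≡⇒≈ (≡.cong Z (≡.sym (ℤP.*-distribˡ-+ (U y) (q (U t)) (cube (U t))))))) ⟩
      1-p * 1-p * 1-p * Z (U y ℤ.* cubic (U t)) ∎))))
    (quadratic-sum (1-p * 1-p * 1-p) (λ t → cubic (U t)))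
    where
    q cube : ℤ → ℤ
    q t = α ℤ.+ β ℤ.* t ℤ.+ α ℤ.* (t ℤ.* t)
    cube t = t ℤ.* t ℤ.* t

  -- The quadratic is α(1 + t)², so every term is χ h α except the one at t = -1, the last of the
  -- sum, which is 0.
  quadratic-values : Q.∑ n (λ t → χ h (α ℤ.+ β ℤ.* U t ℤ.+ α ℤ.* (U t ℤ.* U t))) Q.≅ (+ n ℤ.- + 1) ℤ.* χ h α
  quadratic-values = go n ≡.refl
    where
    value : ∀ t → χ h (α ℤ.+ β ℤ.* U t ℤ.+ α ℤ.* (U t ℤ.* U t)) ≡ χ h α ℤ.* χ (h ℕ.+ h) (+ 1 ℤ.+ U t)
    value t = ≡.trans (≡.cong (χ h) (≡.trans (≡.cong (λ b → α ℤ.+ b ℤ.* U t ℤ.+ α ℤ.* (U t ℤ.* U t)) β≡2α) (lem α (U t)))) (≡.trans (χ-* h α _) (≡.cong (χ h α ℤ.*_) (≡.trans (χ-* h (+ 1 ℤ.+ U t) (+ 1 ℤ.+ U t)) (≡.sym (χ-+ h h (+ 1 ℤ.+ U t))))))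
      where
      lem : ∀ α t → α ℤ.+ (α ℤ.+ α) ℤ.* t ℤ.+ α ℤ.* (t ℤ.* t) ≡ α ℤ.* ((+ 1 ℤ.+ t) ℤ.* (+ 1 ℤ.+ t))
      lem = solve-∀
    go : ∀ m → n ≡ m → Q.∑ n (λ t → χ h (α ℤ.+ β ℤ.* U t ℤ.+ α ℤ.* (U t ℤ.* U t))) Q.≅ (+ n ℤ.- + 1) ℤ.* χ h α
    go zero e = ⊥-elim (n≢0 e)
    go (suc m) e = Q.trans (Q.∑-cong′ n (λ t → Q.≡⇒≈ (value t))) (Q.trans (Q.≡⇒≈ (≡.cong (λ z → Q.∑ z term) e))
      (Q.trans (Q.+-cong (Q.trans (Q.∑-cong m generic) (Q.trans (Q.∑-const m (χ h α)) (Q.≡⇒≈ (≡.cong (ℤ._* χ h α) (Q.⌜⌝-is (+ m)))))) last)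
      (Q.≡⇒≈ (≡.trans (lem (+ m) (χ h α)) (≡.cong (λ z → (+ z ℤ.- + 1) ℤ.* χ h α) (≡.sym e))))))
      where
      term : ℕ → ℤ
      term t = χ h α ℤ.* χ (h ℕ.+ h) (+ 1 ℤ.+ U t)
      lem : ∀ m c → m ℤ.* c ℤ.+ + 0 ≡ ((+ 1 ℤ.+ m) ℤ.- + 1) ℤ.* c
      lem = solve-∀
      generic : ∀ t → t ℕ.< m → term t Q.≅ χ h α
      generic t t<m = Q.trans (Q.*ˡ (χ h α) (ω-power-one (h ℕ.+ h) n∣h+h (∤-small (s≤s z≤n) (s≤s (≡.subst (suc (suc t) ℕ.≤_) (≡.sym e) (s≤s t<m)))))) (Q.≡⇒≈ (ℤP.*-identityʳ (χ h α)))
      last : term m Q.≅ + 0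
      last = Q.trans (Q.*ˡ (χ h α) (χ-zero (h ℕ.+ h) (λ z → n≢0 (≡.trans n≡2h z)) (P.trans (P.≡⇒≈ (≡.cong (λ z → + suc z) (≡.sym e))) P.modulus))) (Q.≡⇒≈ (ℤP.*-zeroʳ (χ h α)))

  row-0 : row 0 ≈ 1-p * 1-p * ⌜ + n ℤ.* (γ h ℤ.* ((+ n ℤ.- + 1) ℤ.* χ h α)) ⌝ * Y ^ h
  row-0 = trans (∑-cong′ n (λ y → ∑-cong′ n (λ t → *-cong (trans (*-cong (≡⇒≈ (≡.cong (λ e → ⌜ χ e (U y) ⌝) (ℕP.+-identityʳ h))) (≡⇒≈ (≡.cong (λ e → ⌜ U t ℤ.^ e ⌝) (ℕP.*-zeroʳ M)))) (*-identityʳ _)) (product₃-value (U y) (U t)))))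
    (trans (quadratic-sum (1-p * 1-p) (λ t → α ℤ.+ β ℤ.* U t ℤ.+ α ℤ.* (U t ℤ.* U t)))
    (*-congʳ (*-congˡ (⌜⌝-mod (Q.*ˡ (+ n) (Q.*ˡ (γ h) quadratic-values))))))

  -- Summing over y first turns full into a multiple of Φ, and row 0 into a multiple of Σ χ_h(α(1+t)²) = (n - 1) χ_h(α).
  main-sum : ∀ m → n ≡ suc m → Q.∑ m (λ D → Q.∑ n (λ C → coefficient C (suc D) ℤ.* (ℤ.- + p) ℤ.^ wraps C (suc D))) Q.≅
    + n ℤ.* (γ h ℤ.* (ℤ.- (+ n ℤ.* Φ) ℤ.- (+ n ℤ.- + 1) ℤ.* χ h α))
  main-sum m n≡1+m = cancelᴹ (+ n) p∤n (cancelᴹ (+ n) p∤n (Y-injective h _ _ h<n (begin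
    ⌜ + n ℤ.* (+ n ℤ.* Q.∑ m S′) ⌝ * Y ^ h
      ≈⟨ *-congʳ (trans (⌜⌝-* (+ n) (+ n ℤ.* Q.∑ m S′)) (*-congˡ (trans (⌜⌝-* (+ n) (Q.∑ m S′)) (*-congˡ (⌜∑⌝ m S′))))) ⟩
    ⌜ + n ⌝ * (⌜ + n ⌝ * ∑ m (λ D → ⌜ S′ D ⌝)) * Y ^ h
      ≈⟨ trans (*-congʳ (trans (*-congˡ (sym (∑-*ˡ m _ _))) (sym (∑-*ˡ m _ _)))) (sym (∑-*ʳ m _ _)) ⟩
    ∑ m (λ D → ⌜ + n ⌝ * (⌜ + n ⌝ * ⌜ S′ D ⌝) * Y ^ h)
      ≈⟨ ∑-cong′ m (λ D → trans (*-congʳ (trans (*-congˡ (sym (⌜⌝-* (+ n) (S′ D)))) (sym (⌜⌝-* (+ n) (+ n ℤ.* S′ D))))) (sym (row-value (suc D)))) ⟩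
    ∑ m (λ D → T (suc D))
      ≈⟨ solve 2 (λ x s → s := (x :+ s) :- x) refl (T 0) (∑ m (λ D → T (suc D))) ⟩
    (T 0 + ∑ m (λ D → T (suc D))) - T 0
      ≈⟨ +-cong (trans (sym (∑-front m T)) (trans (≡⇒≈ (≡.cong (λ z → ∑ z T) (≡.sym n≡1+m))) (trans (sym full-rows) full-value))) (-‿cong T-0) ⟩
    1-p * 1-p * 1-p * ⌜ X₁ ⌝ * Y ^ h - 1-p * 1-p * ⌜ X₂ ⌝ * Y ^ h
      ≈⟨ solve 4 (λ q a b y → q :* q :* q :* a :* y :- q :* q :* b :* y := (q :* (q :* (q :* a :- b))) :* y) refl 1-p ⌜ X₁ ⌝ ⌜ X₂ ⌝ (Y ^ h) ⟩
    (1-p * (1-p * (1-p * ⌜ X₁ ⌝ - ⌜ X₂ ⌝))) * Y ^ h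
      ≈⟨ *-congʳ (trans (*-congˡ (trans (*-congˡ (trans (+-congʳ (sym (⌜⌝-* E X₁))) (sym (⌜⌝-- (E ℤ.* X₁) X₂)))) (sym (⌜⌝-* E _)))) (sym (⌜⌝-* E _))) ⟩
    ⌜ E ℤ.* (E ℤ.* (E ℤ.* X₁ ℤ.- X₂)) ⌝ * Y ^ h
      ≡⟨ ≡.cong (λ z → ⌜ z ⌝ * Y ^ h) (lem (+ n) (γ h) Φ (χ h α)) ⟩
    ⌜ + n ℤ.* (+ n ℤ.* (+ n ℤ.* (γ h ℤ.* (ℤ.- (+ n ℤ.* Φ) ℤ.- (+ n ℤ.- + 1) ℤ.* χ h α)))) ⌝ * Y ^ h ∎)))
    where
    S′ : ℕ → ℤ
    S′ D = Q.∑ n (λ C → coefficient C (suc D) ℤ.* (ℤ.- + p) ℤ.^ wraps C (suc D))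
    T : ℕ → Carrier
    T D = ⌜ γ D ⌝ * Y ^ D * row D
    E X₁ X₂ : ℤ
    E = + 1 ℤ.- + p
    X₁ = + n ℤ.* (γ h ℤ.* Φ)
    X₂ = + n ℤ.* (γ h ℤ.* ((+ n ℤ.- + 1) ℤ.* χ h α))
    T-0 : T 0 ≈ 1-p * 1-p * ⌜ X₂ ⌝ * Y ^ h
    T-0 = trans (*-cong (trans (*-congʳ (⌜⌝-mod γ-0)) (*-identityˡ 1#)) row-0) (*-identityˡ _)
    lem : ∀ n g f x → (+ 1 ℤ.- (+ 1 ℤ.+ n)) ℤ.* ((+ 1 ℤ.- (+ 1 ℤ.+ n)) ℤ.* ((+ 1 ℤ.- (+ 1 ℤ.+ n)) ℤ.* (n ℤ.* (g ℤ.* f)) ℤ.- n ℤ.* (g ℤ.* ((n ℤ.- + 1) ℤ.* x)))) ≡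
      n ℤ.* (n ℤ.* (n ℤ.* (g ℤ.* (ℤ.- (n ℤ.* f) ℤ.- (n ℤ.- + 1) ℤ.* x))))
    lem = solve-∀

-- Arguments of the gamma function

unique-quotient : ∀ m r r′ g g′ → r ℕ.< m → r′ ℕ.< m → + r ℤ.+ g ℤ.* + m ≡ + r′ ℤ.+ g′ ℤ.* + m → g ≡ g′
unique-quotient m r r′ g g′ r<m r′<m e = go (g′ ℤ.- g) ≡.refl
  where
  large : ∀ t {x y} → x ≡ y ℕ.+ suc t ℕ.* m → ¬ x ℕ.< m
  large t {x} {y} x≡ x<m = ℕP.<⇒≱ x<m (ℕP.≤-trans (ℕP.m≤m+n m (t ℕ.* m)) (ℕP.≤-trans (ℕP.m≤n+m (suc t ℕ.* m) y) (ℕP.≤-reflexive (≡.sym x≡))))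
  difference : + r ≡ + r′ ℤ.+ (g′ ℤ.- g) ℤ.* + m
  difference = ≡.trans (lem (+ r) g (+ m)) (≡.trans (≡.cong (ℤ._- g ℤ.* + m) e) (lem₂ (+ r′) g g′ (+ m)))
    where
    lem : ∀ r g m → r ≡ (r ℤ.+ g ℤ.* m) ℤ.- g ℤ.* m
    lem = solve-∀
    lem₂ : ∀ r g g′ m → (r ℤ.+ g′ ℤ.* m) ℤ.- g ℤ.* m ≡ r ℤ.+ (g′ ℤ.- g) ℤ.* m
    lem₂ = solve-∀
  go : ∀ d → g′ ℤ.- g ≡ d → g ≡ g′
  go (+ zero) d≡ = ≡.sym (ℤP.i-j≡0⇒i≡j g′ g d≡)
  go (+ suc t) d≡ = ⊥-elim (large t {r} {r′} (ℤP.+-injective (≡.trans difference (≡.trans (≡.cong (λ z → + r′ ℤ.+ z ℤ.* + m) d≡) (≡.cong (λ z → + r′ ℤ.+ z) (≡.sym (ℤP.pos-* (suc t) m)))))) r<m)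
  go -[1+ t ] d≡ = ⊥-elim (large t {r′} {r} (ℤP.+-injective (≡.trans (lem (+ r′) -[1+ t ] (+ m)) (≡.trans (≡.cong (λ z → z ℤ.+ + suc t ℤ.* + m) (≡.sym (≡.trans difference (≡.cong (λ z → + r′ ℤ.+ z ℤ.* + m) d≡))))
    (≡.cong (λ z → + r ℤ.+ z) (≡.sym (ℤP.pos-* (suc t) m)))))) r′<m)
    where
    lem : ∀ r d m → r ≡ (r ℤ.+ d ℤ.* m) ℤ.+ (ℤ.- d) ℤ.* m
    lem = solve-∀

-- Frac x c says x = c/N, where N = suc N-1.
module Fractions (N-1 : ℕ) where
  N : ℕ
  N = suc N-1

  Frac : ℚ → ℤ → Set
  Frac x c = ℚ.toℚᵘ x ℚᵘ.≃ mkℚᵘ c N-1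

  frac-cast : ∀ {x c c′} → c ≡ c′ → Frac x c → Frac x c′
  frac-cast ≡.refl f = f

  frac-+ : ∀ {x y c d} → Frac x c → Frac y d → Frac (x ℚ.+ y) (c ℤ.+ d)
  frac-+ {x} {y} {c} {d} fx fy = ℚᵘP.≃-trans (ℚP.toℚᵘ-homo-+ x y) (ℚᵘP.≃-trans (ℚᵘP.+-cong fx fy) (*≡* (lem c d (+ N))))
    where
    lem : ∀ c d N → (c ℤ.* N ℤ.+ d ℤ.* N) ℤ.* N ≡ (c ℤ.+ d) ℤ.* (N ℤ.* N)
    lem = solve-∀

  frac-neg : ∀ {x c} → Frac x c → Frac (ℚ.- x) (ℤ.- c)
  frac-neg {x} {c} fx = ℚᵘP.≃-trans (ℚP.toℚᵘ-homo‿- x) (ℚᵘP.-‿cong fx)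

  frac-- : ∀ {x y c d} → Frac x c → Frac y d → Frac (x ℚ.- y) (c ℤ.- d)
  frac-- fx fy = frac-+ fx (frac-neg fy)

  frac-/ : ∀ z i c → z ℤ.* + N ≡ c ℤ.* + suc i → Frac (z ℚ./ suc i) c
  frac-/ z i c e = ℚᵘP.≃-trans (ℚP.toℚᵘ-fromℚᵘ (mkℚᵘ z i)) (*≡* e)

  -- `floor` divides the reduced numerator by the reduced denominator b. After cross-multiplication
  -- both divisions have the divisor bN, where the quotient is unique.
  frac-floor : ∀ {x c} f d → Frac x c → c ≡ + d ℤ.+ f ℤ.* + N → d ℕ.< N → floor x ≡ f
  frac-floor {mkℚ a b-1 _} {c} f d (*≡* aN≡cb) c≡ d<N = ≡.trans (ℤDM.div-pos-is-/ℕ a (suc b-1))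
    (unique-quotient (suc b-1 ℕ.* N) (r ℕ.* N) (d ℕ.* suc b-1) g f (ℕP.*-monoˡ-< N (ℤDM.n%ℕd<d a (suc b-1)))
      (≡.subst (d ℕ.* suc b-1 ℕ.<_) (ℕP.*-comm N (suc b-1)) (ℕP.*-monoˡ-< (suc b-1) d<N)) (begin
        + (r ℕ.* N) ℤ.+ g ℤ.* + (suc b-1 ℕ.* N) ≡⟨ ≡.cong₂ (λ x y → x ℤ.+ g ℤ.* y) (ℤP.pos-* r N) (ℤP.pos-* (suc b-1) N) ⟩
        + r ℤ.* + N ℤ.+ g ℤ.* (+ suc b-1 ℤ.* + N) ≡⟨ lem (+ r) (+ N) g (+ suc b-1) ⟩
        (+ r ℤ.+ g ℤ.* + suc b-1) ℤ.* + N ≡⟨ ≡.cong (ℤ._* + N) (≡.sym (ℤDM.a≡a%ℕn+[a/ℕn]*n a (suc b-1))) ⟩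
        a ℤ.* + N ≡⟨ aN≡cb ⟩
        c ℤ.* + suc b-1 ≡⟨ ≡.cong (ℤ._* + suc b-1) c≡ ⟩
        (+ d ℤ.+ f ℤ.* + N) ℤ.* + suc b-1 ≡⟨ lem₂ (+ d) f (+ N) (+ suc b-1) ⟩
        + d ℤ.* + suc b-1 ℤ.+ f ℤ.* (+ suc b-1 ℤ.* + N) ≡⟨ ≡.sym (≡.cong₂ (λ x y → x ℤ.+ f ℤ.* y) (ℤP.pos-* d (suc b-1)) (ℤP.pos-* (suc b-1) N)) ⟩
        + (d ℕ.* suc b-1) ℤ.+ f ℤ.* + (suc b-1 ℕ.* N) ∎))
    where
    open ≡.≡-Reasoning
    r : ℕ
    r = a ℤDM.%ℕ suc b-1
    g : ℤ
    g = a ℤDM./ℕ suc b-1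
    lem : ∀ r N g b → r ℤ.* N ℤ.+ g ℤ.* (b ℤ.* N) ≡ (r ℤ.+ g ℤ.* b) ℤ.* N
    lem = solve-∀
    lem₂ : ∀ d f N b → (d ℤ.+ f ℤ.* N) ℤ.* b ≡ d ℤ.* b ℤ.+ f ℤ.* (b ℤ.* N)
    lem₂ = solve-∀

  frac-⟨⟩ : ∀ {x c} f d → Frac x c → c ≡ + d ℤ.+ f ℤ.* + N → d ℕ.< N → Frac ⟨ x ⟩ (+ d)
  frac-⟨⟩ {x} {c} f d fx c≡ d<N = frac-cast (≡.trans (≡.cong (ℤ._- f ℤ.* + N) c≡) (lem (+ d) f (+ N)))
    (≡.subst (λ z → Frac (x ℚ.- (z ℚ./ 1)) (c ℤ.- f ℤ.* + N)) (≡.sym (frac-floor f d fx c≡ d<N)) (frac-- fx (frac-/ f 0 (f ℤ.* + N) (≡.sym (ℤP.*-identityʳ (f ℤ.* + N))))))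
    where
    lem : ∀ d f N → (d ℤ.+ f ℤ.* N) ℤ.- f ℤ.* N ≡ d
    lem = solve-∀

mod′-≅ : ∀ z q → 0 ℕ.< q → + (z mod' q) ≅ z [mod q ]
mod′-≅ z q@(suc _) _ = Mod.sym q (by-quotient (z ℤDM./ℕ q) (ℤDM.a≡a%ℕn+[a/ℕn]*n z q))

module GammaArguments (n : ℕ) (pp : Prime (suc n)) (h : ℕ) (n≡2h : n ≡ h ℕ.+ h) (k : ℕ) (N-1 : ℕ) where
  open GammaValues n pp h n≡2h k
  open Fractions N-1
  private module P = Mod p
  open Mod M
  open ≈-Reasoning

  -- The reduced denominator b is prime to p: by aN = cb, a prime dividing b but not N would also
  -- divide a, contrary to lowest terms. This makes the power in `repQ` a true inverse.
  rep-frac : ∀ x c → Frac x c → p∤ + N → + N ℤ.* + (repQ p x k) ≅ c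
  rep-frac x@(mkℚ a b-1 cop) c (*≡* aN≡cb) p∤N = cancelᴹ b p∤b (begin
    b ℤ.* (+ N ℤ.* + (repQ p x k)) ≈⟨ *ˡ b (*ˡ (+ N) (mod′-≅ (a ℤ.* inverse b) M M>0)) ⟩
    b ℤ.* (+ N ℤ.* (a ℤ.* inverse b)) ≡⟨ lem b (+ N) a (inverse b) ⟩
    (a ℤ.* + N) ℤ.* (b ℤ.* inverse b) ≈⟨ *ˡ (a ℤ.* + N) (inverseʳ p∤b) ⟩
    (a ℤ.* + N) ℤ.* + 1 ≡⟨ ≡.trans (ℤP.*-identityʳ _) (≡.trans aN≡cb (ℤP.*-comm c b)) ⟩
    b ℤ.* c ∎)
    where
    b : ℤ
    b = + suc b-1
    lem : ∀ b N a i → b ℤ.* (N ℤ.* (a ℤ.* i)) ≡ (a ℤ.* N) ℤ.* (b ℤ.* i)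
    lem = solve-∀
    p∤b : p∤ b
    p∤b p∣b = ⊥-elim-irr (ℕP.<⇒≢ p>1 (≡.sym (cop (divides-∣∣ a p∣a , divides-∣∣ b p∣b))))
      where
      p∣a : a P.≅ + 0
      p∣a = cancel (+ N) p∤N (P.trans (P.≡⇒≈ (≡.trans (ℤP.*-comm (+ N) a) aN≡cb)) (P.trans (P.*ˡ c p∣b) (P.≡⇒≈ (≡.trans (ℤP.*-zeroʳ c) (≡.sym (ℤP.*-zeroʳ (+ N)))))))

-- Characters, point counts and hypergeometric values at level k

foldSum : {A : Set} → (A → ℤ) → List A → ℤ
foldSum f = List.foldr (λ x s → f x ℤ.+ s) (+ 0)

foldSum-++ : ∀ {A : Set} (f : A → ℤ) xs ys → foldSum f (xs List.++ ys) ≡ foldSum f xs ℤ.+ foldSum f ys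
foldSum-++ f [] ys = ≡.sym (ℤP.+-identityˡ _)
foldSum-++ f (x ∷ xs) ys = ≡.trans (≡.cong (λ z → f x ℤ.+ z) (foldSum-++ f xs ys)) (≡.sym (ℤP.+-assoc (f x) _ _))

foldSum-upTo : ∀ q m f → foldSum f (List.upTo m) ≡ Mod.∑ q m f
foldSum-upTo q zero f = ≡.refl
foldSum-upTo q (suc m) f = ≡.trans (≡.cong (foldSum f) (≡.sym (ListP.upTo-∷ʳ m)))
  (≡.trans (foldSum-++ f (List.upTo m) (m ∷ [])) (≡.cong₂ ℤ._+_ (foldSum-upTo q m f) (ℤP.+-identityʳ (f m))))

foldSum-map : ∀ {A B : Set} (f : B → ℤ) (g : A → B) xs → foldSum f (List.map g xs) ≡ foldSum (λ x → f (g x)) xs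
foldSum-map f g [] = ≡.refl
foldSum-map f g (x ∷ xs) = ≡.cong (λ z → f (g x) ℤ.+ z) (foldSum-map f g xs)

foldSum-concatMap : ∀ {A B : Set} (f : B → ℤ) (g : A → List B) xs → foldSum f (List.concatMap g xs) ≡ foldSum (λ x → foldSum f (g x)) xs
foldSum-concatMap f g [] = ≡.refl
foldSum-concatMap f g (x ∷ xs) = ≡.trans (foldSum-++ f (g x) (List.concatMap g xs)) (≡.cong (λ z → foldSum f (g x) ℤ.+ z) (foldSum-concatMap f g xs))

indicator : Bool → ℤ
indicator b = if b then + 1 else + 0

length-filter : ∀ {A : Set} (b : A → Bool) xs → + List.length (List.filter (λ x → T? (b x)) xs) ≡ foldSum (λ x → indicator (b x)) xs
length-filter b [] = ≡.refl
length-filter b (x ∷ xs) with b x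
... | true = ≡.cong (λ z → + 1 ℤ.+ z) (length-filter b xs)
... | false = ≡.trans (length-filter b xs) (≡.sym (ℤP.+-identityˡ _))

any-true : ∀ {A : Set} (b : A → Bool) {x} xs → x ∈ xs → b x ≡ true → any b xs ≡ true
any-true b (y ∷ xs) (here ≡.refl) e = ≡.cong (λ z → z Data.Bool.∨ List.foldr Data.Bool._∨_ false (List.map b xs)) e
any-true b (y ∷ xs) (there x∈xs) e with b y
... | true = ≡.refl
... | false = any-true b xs x∈xs e

any-true⇒ : ∀ {A : Set} (b : A → Bool) xs → any b xs ≡ true → ∃ λ x → x ∈ xs × b x ≡ true
any-true⇒ b (y ∷ xs) e with b y in eq
... | true = y , here ≡.refl , eq
... | false with any-true⇒ b xs e
... | x , x∈xs , e′ = x , there x∈xs , e′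

module DefsValues (n : ℕ) (pp : Prime (suc n)) (h : ℕ) (n≡2h : n ≡ h ℕ.+ h) (k : ℕ) where
  open Characters n pp h n≡2h k
  private module P = Mod p
  open Mod M

  ≡ᵇ-≅ : ∀ x y → ((+ x) mod' p) ≡ ((+ y) mod' p) → + x P.≅ + y
  ≡ᵇ-≅ x y e = P.trans (residue (+ x)) (P.trans (P.≡⇒≈ (≡.cong +_ e)) (P.sym (residue (+ y))))

  residue-small : ∀ {i j} → i ℕ.< p → j ℕ.< p → + i P.≅ + j → i ≡ j
  residue-small {i} {j} i<p j<p i≅j with i ℕ.<? j | j ℕ.<? i
  ... | yes i<j | _ = ⊥-elim (∤-difference i<j j<p i≅j)
  ... | no _ | yes j<i = ⊥-elim (∤-difference j<i i<p (P.sym i≅j))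
  ... | no i≮j | no j≮i = ℕP.≤-antisym (ℕP.≮⇒≥ j≮i) (ℕP.≮⇒≥ i≮j)

  ≅-mod' : ∀ x y → + x P.≅ + y → ((+ x) mod' p) ≡ ((+ y) mod' p)
  ≅-mod' x y e = residue-small (ℤDM.n%ℕd<d (+ x) p) (ℤDM.n%ℕd<d (+ y) p) (P.trans (P.sym (residue (+ x))) (P.trans e (residue (+ y))))

  test-true : ∀ x y → + x P.≅ + y → (((+ x) mod' p) ℕ.≡ᵇ ((+ y) mod' p)) ≡ true
  test-true x y e = Equivalence.to T-≡ (ℕP.≡⇒≡ᵇ _ _ (≅-mod' x y e))

  test-true⇒ : ∀ x y → (((+ x) mod' p) ℕ.≡ᵇ ((+ y) mod' p)) ≡ true → + x P.≅ + y
  test-true⇒ x y e = ≡ᵇ-≅ x y (ℕP.≡ᵇ⇒≡ _ _ (Equivalence.from T-≡ e))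

  test-false : ∀ x y → ¬ + x P.≅ + y → (((+ x) mod' p) ℕ.≡ᵇ ((+ y) mod' p)) ≡ false
  test-false x y ne with ((+ x) mod' p) ℕ.≡ᵇ ((+ y) mod' p) in eq
  ... | true = ⊥-elim (ne (test-true⇒ x y eq))
  ... | false = ≡.refl

  isZero-unit : ∀ x → p∤ + x → isZeroFp p x ≡ false
  isZero-unit x = test-false x 0

  isZero-zero : ∀ x → + x P.≅ + 0 → isZeroFp p x ≡ true
  isZero-zero x = test-true x 0

  ω-value : ∀ x → ω p x k ≅ χ 1 (+ x)
  ω-value x = trans (≡⇒≈ (pos-^ ((+ x) mod' p) M)) (trans (ω-cong (P.sym (residue (+ x)))) (≡⇒≈ (≡.cong ((+ x) ℤ.^_) (≡.sym (ℕP.*-identityʳ M)))))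

  χ-^ : ∀ e r x → χ e x ℤ.^ r ≡ χ (e ℕ.* r) x
  χ-^ e r x = ≡.trans (ℤP.^-*-assoc x (M ℕ.* e) r) (≡.cong (x ℤ.^_) (ℕP.*-assoc M e r))

  inverse-cong : ∀ {u v} → u ≅ v → inverse u ≅ inverse v
  inverse-cong = ^-cong (M ℕ.* n ℕ.∸ 1)

  inverse-unique : ∀ {u v} → p∤ u → u ℤ.* v ≅ + 1 → inverse u ≅ v
  inverse-unique {u} {v} p∤u e = cancelᴹ u p∤u (trans (inverseʳ p∤u) (sym e))

  inverse-χ : ∀ e f {x} → p∤ x → n ℕD.∣ e ℕ.+ f → inverse (χ e x) ≅ χ f x
  inverse-χ e f {x} p∤x n∣ = inverse-unique (χ-unit e p∤x) (trans (≡⇒≈ (≡.sym (χ-+ e f x))) (ω-power-one (e ℕ.+ f) n∣ p∤x))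

  charPow-ω : ∀ r x → p∤ + x → charPow p (ω p) r x k ≅ χ r (+ x)
  charPow-ω r x p∤x = trans (≡⇒≈ (≡.cong (λ b → (if b then cZ p (+ 0) else (_^Z_ p (ω p x) r)) k) (isZero-unit x p∤x)))
    (trans (^-cong r (ω-value x)) (≡⇒≈ (≡.trans (χ-^ 1 r (+ x)) (≡.cong (λ z → χ z (+ x)) (ℕP.*-identityˡ r)))))

  ω̄-unit : ∀ x → p∤ + x → ω̄ p x k ≅ χ (n ℕ.∸ 1) (+ x)
  ω̄-unit x p∤x = trans (≡⇒≈ (≡.cong (λ b → (if b then cZ p (+ 0) else invZ p (ω p x)) k) (isZero-unit x p∤x)))
    (trans (inverse-cong (ω-value x)) (inverse-χ 1 (n ℕ.∸ 1) p∤x (≡.subst (n ℕD.∣_) (≡.sym (ℕP.m+[n∸m]≡n (ℕP.n≢0⇒n>0 n≢0))) ℕD.∣-refl)))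

  charPow-ω̄ : ∀ r x → r ℕ.≤ n → p∤ + x → charPow p (ω̄ p) r x k ≅ χ (n ℕ.∸ r) (+ x)
  charPow-ω̄ r x r≤n p∤x = trans (≡⇒≈ (≡.cong (λ b → (if b then cZ p (+ 0) else (_^Z_ p (ω̄ p x) r)) k) (isZero-unit x p∤x)))
    (trans (^-cong r (ω̄-unit x p∤x)) (trans (≡⇒≈ (χ-^ (n ℕ.∸ 1) r (+ x))) (cancelᴹ (χ r (+ x)) (χ-unit r p∤x)
      (trans (trans (≡⇒≈ (≡.sym (χ-+ r ((n ℕ.∸ 1) ℕ.* r) (+ x)))) (ω-power-one _ n∣₁ p∤x)) (sym (trans (≡⇒≈ (≡.sym (χ-+ r (n ℕ.∸ r) (+ x)))) (ω-power-one _ n∣₂ p∤x)))))))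
    where
    n∣₁ : n ℕD.∣ r ℕ.+ (n ℕ.∸ 1) ℕ.* r
    n∣₁ = ≡.subst (n ℕD.∣_) (≡.sym (≡.cong (ℕ._* r) (ℕP.m+[n∸m]≡n (ℕP.n≢0⇒n>0 n≢0)))) (ℕD.m∣m*n r)
    n∣₂ : n ℕD.∣ r ℕ.+ (n ℕ.∸ r)
    n∣₂ = ≡.subst (n ℕD.∣_) (≡.sym (ℕP.m+[n∸m]≡n r≤n)) ℕD.∣-refl

  charPow-zero : ∀ ψ r x → + x P.≅ + 0 → charPow p ψ r x k ≡ + 0
  charPow-zero ψ r x e = ≡.cong (λ b → (if b then cZ p (+ 0) else (_^Z_ p (ψ x) r)) k) (isZero-zero x e)

  open Quadratic h n≡2h

  χ-h : ∀ {x s} → x ℤ.^ h P.≅ s → χ h x ≅ s ℤ.^ M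
  χ-h {x} e = trans (≡⇒≈ (≡.trans (≡.cong (x ℤ.^_) (ℕP.*-comm M h)) (≡.sym (ℤP.^-*-assoc x h M)))) (ω-cong e)

  -1^M : (ℤ.- + 1) ℤ.^ M ≡ ℤ.- + 1
  -1^M = ≡.trans (≡.cong ((ℤ.- + 1) ℤ.^_) (≡.sym (ℕP.*-identityˡ M))) (-1^*M 1)

  square-test : ℕ → ℕ → Bool
  square-test x y = ((+ (y ℕ.* y)) mod' p) ℕ.≡ᵇ ((+ x) mod' p)

  square-test⇒ : ∀ x y → square-test x y ≡ true → + y ℤ.* + y P.≅ + x
  square-test⇒ x y e = P.trans (P.≡⇒≈ (≡.sym (ℤP.pos-* y y))) (test-true⇒ (y ℕ.* y) x e)

  ⇒square-test : ∀ x y → + y ℤ.* + y P.≅ + x → square-test x y ≡ true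
  ⇒square-test x y e = test-true (y ℕ.* y) x (P.trans (P.≡⇒≈ (ℤP.pos-* y y)) e)

  φ-unit : ∀ x → p∤ + x → φ p x k ≅ χ h (+ x)
  φ-unit x p∤x = trans (≡⇒≈ (≡.cong (λ b → (if b then cZ p (+ 0) else (if isSquareFp p x then cZ p (+ 1) else cZ p (ℤ.- (+ 1)))) k) (isZero-unit x p∤x))) (split (half-power p∤x))
    where
    value : ∀ b → isSquareFp p x ≡ b → (if isSquareFp p x then cZ p (+ 1) else cZ p (ℤ.- (+ 1))) k ≡ (if b then cZ p (+ 1) else cZ p (ℤ.- (+ 1))) k
    value b ≡.refl = ≡.refl
    split : ((+ x) ℤ.^ h P.≅ + 1) ⊎ ((+ x) ℤ.^ h P.≅ ℤ.- + 1) → (if isSquareFp p x then cZ p (+ 1) else cZ p (ℤ.- (+ 1))) k ≅ χ h (+ x)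
    split (inj₁ e) = trans (≡⇒≈ (value true square)) (sym (trans (χ-h e) (≡⇒≈ (ℤP.^-zeroˡ M))))
      where
      root : ∃ λ y → y ℕ.< p × (+ y ℤ.* + y P.≅ + x)
      root = ⇒square p∤x e
      square : isSquareFp p x ≡ true
      square = any-true (square-test x) (List.upTo p) (∈-upTo⁺ (proj₁ (proj₂ root))) (⇒square-test x (proj₁ root) (proj₂ (proj₂ root)))
    split (inj₂ e) = trans (≡⇒≈ (value false nonsquare)) (sym (trans (χ-h e) (≡⇒≈ -1^M)))
      where
      nonsquare : isSquareFp p x ≡ false
      nonsquare with isSquareFp p x in eq
      ... | false = ≡.refl
      ... | true with any-true⇒ (square-test x) (List.upTo p) eq
      ... | y , _ , t = ⊥-elim (p∤2 (P.+ˡ (+ 1) (P.trans (P.sym (square⇒ (+ y) p∤x (square-test⇒ x y t))) e)))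

  φ-value : ∀ x → φ p x k ≅ χ h (+ x)
  φ-value x with ≅0? (+ x)
  ... | no p∤x = φ-unit x p∤x
  ... | yes x≅0 = trans (≡⇒≈ (≡.cong (λ b → (if b then cZ p (+ 0) else (if isSquareFp p x then cZ p (+ 1) else cZ p (ℤ.- (+ 1)))) k) (isZero-zero x x≅0))) (sym (χ-zero h h≢0 x≅0))

  δ : ℕ → ℕ → ℤ
  δ = RingTheory.δ (ℤ/ M)

  -- For a nonzero square the indicator of the roots is the sum of two `δ`, at r and p - r, which
  -- are distinct because p is odd.
  count-roots : ∀ v → ∑ p (λ y → indicator (square-test v y)) ≅ + 1 ℤ.+ χ h (+ v)
  count-roots v = split (≅0? (+ v))
    where
    open RingTheory (ℤ/ M) using (∑-δ; δ-refl; δ-≢)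
    ind-true : ∀ y → + y ℤ.* + y P.≅ + v → indicator (square-test v y) ≡ + 1
    ind-true y e = ≡.cong indicator (⇒square-test v y e)
    ind-false : ∀ y → ¬ + y ℤ.* + y P.≅ + v → indicator (square-test v y) ≡ + 0
    ind-false y ne = ≡.cong indicator (test-false (y ℕ.* y) v (λ e → ne (P.trans (P.≡⇒≈ (≡.sym (ℤP.pos-* y y))) e)))
    ∑δ : ∀ i → i ℕ.< p → ∑ p (λ y → δ i y) ≅ + 1
    ∑δ i i<p = trans (∑-cong′ p (λ y → ≡⇒≈ (≡.sym (ℤP.*-identityʳ (δ i y))))) (∑-δ p i (λ _ → + 1) i<p)
    split : Dec (+ v P.≅ + 0) → ∑ p (λ y → indicator (square-test v y)) ≅ + 1 ℤ.+ χ h (+ v)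
    split (yes v≅0) = trans (∑-cong p pointwise) (trans (∑δ 0 (s≤s z≤n)) (sym (trans (+ˡ (+ 1) (χ-zero h h≢0 v≅0)) refl)))
      where
      pointwise : ∀ y → y ℕ.< p → indicator (square-test v y) ≅ δ 0 y
      pointwise zero _ = ≡⇒≈ (ind-true 0 (P.sym v≅0))
      pointwise (suc y) y<p = trans (≡⇒≈ (ind-false (suc y) (λ e → ∤-* (∤-small (s≤s z≤n) y<p) (∤-small (s≤s z≤n) y<p) (P.trans e v≅0)))) (sym (δ-≢ 0 (suc y) (λ ())))
    split (no p∤v) = by-sign (half-power p∤v)
      where
      by-sign : ((+ v) ℤ.^ h P.≅ + 1) ⊎ ((+ v) ℤ.^ h P.≅ ℤ.- + 1) → ∑ p (λ y → indicator (square-test v y)) ≅ + 1 ℤ.+ χ h (+ v)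
      by-sign (inj₂ e) = trans (∑-zero p (λ y _ → ≡⇒≈ (ind-false y (λ y² → p∤2 (P.+ˡ (+ 1) (P.trans (P.sym (square⇒ (+ y) p∤v y²)) e))))))
        (sym (trans (+ˡ (+ 1) (trans (χ-h e) (≡⇒≈ -1^M))) refl))
      by-sign (inj₁ e) = two-roots (⇒square p∤v e)
        where
        two-roots : (∃ λ y → y ℕ.< p × (+ y ℤ.* + y P.≅ + v)) → ∑ p (λ y → indicator (square-test v y)) ≅ + 1 ℤ.+ χ h (+ v)
        two-roots (r , r<p , r²) = trans (∑-cong p (λ y y<p → pointwise y y<p (r ℕ.≟ y) (r′ ℕ.≟ y))) (trans (∑-+ p (λ y → δ r y) (λ y → δ r′ y))
          (trans (+-cong (∑δ r r<p) (∑δ r′ r′<p)) (sym (trans (+ˡ (+ 1) (trans (χ-h e) (≡⇒≈ (ℤP.^-zeroˡ M)))) refl))))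
          where
          p∤r : p∤ + r
          p∤r r≅0 = p∤v (P.trans (P.sym r²) (P.trans (P.*ˡ (+ r) r≅0) (P.≡⇒≈ (ℤP.*-zeroʳ (+ r)))))
          r>0 : 0 ℕ.< r
          r>0 = ℕP.n≢0⇒n>0 (λ z → p∤r (P.≡⇒≈ (≡.cong +_ z)))
          r′ : ℕ
          r′ = p ℕ.∸ r
          r′<p : r′ ℕ.< p
          r′<p = ℕP.∸-monoʳ-< r>0 (ℕP.<⇒≤ r<p)
          r+r′ : + r ℤ.+ + r′ P.≅ + 0
          r+r′ = P.trans (P.≡⇒≈ (≡.cong +_ (ℕP.m+[n∸m]≡n (ℕP.<⇒≤ r<p)))) P.modulus
          r′≅-r : + r′ P.≅ ℤ.- + r
          r′≅-r = P.trans (P.≡⇒≈ (lem (+ r) (+ r′))) (P.trans (P.+ʳ (ℤ.- + r) r+r′) (P.≡⇒≈ (ℤP.+-identityˡ (ℤ.- + r))))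
            where
            lem : ∀ r s → s ≡ (r ℤ.+ s) ℤ.+ ℤ.- r
            lem = solve-∀
          r′² : + r′ ℤ.* + r′ P.≅ + v
          r′² = P.trans (P.*-cong r′≅-r r′≅-r) (P.trans (P.≡⇒≈ (lem (+ r))) r²)
            where
            lem : ∀ r → (ℤ.- r) ℤ.* (ℤ.- r) ≡ r ℤ.* r
            lem = solve-∀
          r≢r′ : r ≢ r′
          r≢r′ e′ = ∤-* p∤2 p∤r (P.trans (P.≡⇒≈ (≡.trans (lem (+ r)) (≡.cong (λ z → + r ℤ.+ + z) e′))) r+r′)
            where
            lem : ∀ r → + 2 ℤ.* r ≡ r ℤ.+ r
            lem = solve-∀
          pointwise : ∀ y → y ℕ.< p → Dec (r ≡ y) → Dec (r′ ≡ y) → indicator (square-test v y) ≅ δ r y ℤ.+ δ r′ y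
          pointwise y y<p (yes ≡.refl) _ = trans (≡⇒≈ (ind-true r r²)) (sym (+-cong (δ-refl r) (δ-≢ r′ r (λ z → r≢r′ (≡.sym z)))))
          pointwise y y<p (no r≢y) (yes ≡.refl) = trans (≡⇒≈ (ind-true r′ r′²)) (sym (+-cong (δ-≢ r r′ r≢r′) (δ-refl r′)))
          pointwise y y<p (no r≢y) (no r′≢y) = trans (≡⇒≈ (ind-false y not-root)) (sym (+-cong (δ-≢ r y r≢y) (δ-≢ r′ y r′≢y)))
            where
            not-root : ¬ + y ℤ.* + y P.≅ + v
            not-root y² with euclid (+ y ℤ.- + r) (+ y ℤ.- + r′) (P.trans (P.*ˡ (+ y ℤ.- + r) (P.+ˡ (+ y) (P.-‿cong r′≅-r))) (P.trans (P.≡⇒≈ (lem (+ y) (+ r))) (P.x≈y⇒x-y≈0 (P.trans y² (P.sym r²)))))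
              where
              lem : ∀ y r → (y ℤ.- r) ℤ.* (y ℤ.- (ℤ.- r)) ≡ y ℤ.* y ℤ.- r ℤ.* r
              lem = solve-∀
            ... | inj₁ d = r≢y (≡.sym (residue-small y<p r<p (P.x-y≈0⇒x≈y d)))
            ... | inj₂ d = r′≢y (≡.sym (residue-small y<p r′<p (P.x-y≈0⇒x≈y d)))

module DefsSums (n : ℕ) (pp : Prime (suc n)) (h : ℕ) (n≡2h : n ≡ h ℕ.+ h) (k : ℕ) (gaussRing : GaussRing n pp h n≡2h k) where
  open JacobiSums n pp h n≡2h k gaussRing using (jacobi; jacobi-term)
  open Characters n pp h n≡2h k
  open DefsValues n pp h n≡2h k
  private module P = Mod p
  open Mod M
  open ≈-Reasoning

  sumZ-value : ∀ {A : Set} (F : A → Zp) xs → sumZ p (List.map F xs) k ≡ foldSum (λ x → F x k) xs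
  sumZ-value F [] = ≡.refl
  sumZ-value F (x ∷ xs) = ≡.cong (λ z → F x k ℤ.+ z) (sumZ-value F xs)

  toFp-≅ : ∀ z → + toFp p z P.≅ z
  toFp-≅ z = mod′-≅ z p (s≤s z≤n)

  -- The exponent r + h is kept unreduced. It is positive, so the value at 0 is 0 even for r = h,
  -- where the character is trivial.
  J-factor : ∀ r → r ℕ.≤ n → ∀ y → conj p (charMul p (charPow p (ω̄ p) r) (φ p)) y k ≅ χ (r ℕ.+ h) (+ y)
  J-factor r r≤n y = split (≅0? (+ y))
    where
    split : Dec (+ y P.≅ + 0) → conj p (charMul p (charPow p (ω̄ p) r) (φ p)) y k ≅ χ (r ℕ.+ h) (+ y)
    split (yes y≅0) = trans (≡⇒≈ (≡.cong (λ b → (if b then cZ p (+ 0) else invZ p (charMul p (charPow p (ω̄ p) r) (φ p) y)) k) (isZero-zero y y≅0)))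
      (sym (χ-zero (r ℕ.+ h) (λ z → h≢0 (ℕP.m+n≡0⇒n≡0 r z)) y≅0))
    split (no p∤y) = trans (≡⇒≈ (≡.cong (λ b → (if b then cZ p (+ 0) else invZ p (charMul p (charPow p (ω̄ p) r) (φ p) y)) k) (isZero-unit y p∤y)))
      (trans (inverse-cong (trans (*-cong (charPow-ω̄ r y r≤n p∤y) (φ-unit y p∤y)) (≡⇒≈ (≡.sym (χ-+ (n ℕ.∸ r) h (+ y))))))
        (inverse-χ ((n ℕ.∸ r) ℕ.+ h) (r ℕ.+ h) p∤y (≡.subst (n ℕD.∣_) (≡.sym (≡.trans (lem (n ℕ.∸ r) h r) (≡.cong (ℕ._+ (h ℕ.+ h)) (ℕP.m∸n+n≡m r≤n)))) (ℕD.∣m∣n⇒∣m+n ℕD.∣-refl n∣h+h))))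
      where
      lem : ∀ d h r → (d ℕ.+ h) ℕ.+ (r ℕ.+ h) ≡ (d ℕ.+ r) ℕ.+ (h ℕ.+ h)
      lem = ℕSolver.solve-∀

  J-value : ∀ r → 0 ℕ.< r → r ℕ.< n → J p (charPow p (ω̄ p) r) (conj p (charMul p (charPow p (ω̄ p) r) (φ p))) k ≅ jacobi r
  J-value r 0<r r<n = begin
    J p (charPow p (ω̄ p) r) (conj p (charMul p (charPow p (ω̄ p) r) (φ p))) k
      ≡⟨ ≡.trans (sumZ-value F (List.upTo p)) (foldSum-upTo M p (λ x → F x k)) ⟩
    ∑ p (λ x → F x k) ≈⟨ ∑-front n (λ x → F x k) ⟩
    F 0 k ℤ.+ ∑ n (λ x → F (suc x) k) ≈⟨ +-cong first (∑-cong n rest) ⟩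
    + 0 ℤ.+ jacobi r ≡⟨ ℤP.+-identityˡ (jacobi r) ⟩
    jacobi r ∎
    where
    F : ℕ → Zp
    F x = _*Z_ p (charPow p (ω̄ p) r x) (conj p (charMul p (charPow p (ω̄ p) r) (φ p)) (toFp p (+ 1 ℤ.- + x)))
    first : F 0 k ≅ + 0
    first = ≡⇒≈ (≡.trans (≡.cong (ℤ._* conj p (charMul p (charPow p (ω̄ p) r) (φ p)) (toFp p (+ 1 ℤ.- + 0)) k) (charPow-zero (ω̄ p) r 0 P.refl)) (ℤP.*-zeroˡ (conj p (charMul p (charPow p (ω̄ p) r) (φ p)) (toFp p (+ 1 ℤ.- + 0)) k)))
    rest : ∀ x → x ℕ.< n → F (suc x) k ≅ jacobi-term r x
    rest x x<n = *-cong (charPow-ω̄ r (suc x) (ℕP.<⇒≤ r<n) (∤-small (s≤s z≤n) (s≤s x<n)))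
      (trans (J-factor r (ℕP.<⇒≤ r<n) (toFp p (+ 1 ℤ.- + suc x))) (ω-power-cong (r ℕ.+ h) (toFp-≅ (+ 1 ℤ.- + suc x))))

  module Curve (l : ℕ) (p∤α : p∤ + (3 ℕ.* l)) (p∤β : p∤ + (6 ℕ.* l)) where
    α β : ℤ
    α = + (3 ℕ.* l)
    β = + (6 ℕ.* l)

    β≡2α : β ≡ α ℤ.+ α
    β≡2α = ≡.cong +_ (lem l)
      where
      lem : ∀ l → 6 ℕ.* l ≡ 3 ℕ.* l ℕ.+ 3 ℕ.* l
      lem = ℕSolver.solve-∀

    open MainSum n pp h n≡2h k gaussRing α β p∤α p∤β β≡2α using (Φ; cubic)

    rhs : ℕ → ℕ
    rhs x = x ℕ.* x ℕ.* x ℕ.+ 3 ℕ.* l ℕ.* ((x ℕ.+ 1) ℕ.* (x ℕ.+ 1))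

    points : + numPoints p l ≡ + 1 ℤ.+ ∑ p (λ x → ∑ p (λ y → indicator (square-test (rhs x) y)))
    points = ≡.cong (λ z → + 1 ℤ.+ z) (≡.trans (length-filter onCurve′ (List.concatMap row (List.upTo p)))
      (≡.trans (foldSum-concatMap (λ xy → indicator (onCurve′ xy)) row (List.upTo p))
      (≡.trans (foldSum-upTo M p (λ x → foldSum (λ xy → indicator (onCurve′ xy)) (row x)))
        (∑-≡ p (λ x → ≡.trans (foldSum-map (λ xy → indicator (onCurve′ xy)) (x ,_) (List.upTo p)) (foldSum-upTo M p (λ y → indicator (square-test (rhs x) y))))))))
      where
      onCurve′ : ℕ × ℕ → Bool
      onCurve′ xy = onCurve p l (proj₁ xy) (proj₂ xy)
      row : ℕ → List (ℕ × ℕ)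
      row x = List.map (x ,_) (List.upTo p)
      ∑-≡ : ∀ m {f g : ℕ → ℤ} → (∀ x → f x ≡ g x) → ∑ m f ≡ ∑ m g
      ∑-≡ zero e = ≡.refl
      ∑-≡ (suc m) e = ≡.cong₂ ℤ._+_ (∑-≡ m e) (e m)

    cubic-rhs : ∀ t → + rhs (suc t) ≡ cubic (+ suc t)
    cubic-rhs t = ≡.trans (≡.cong₂ ℤ._+_ (≡.trans (ℤP.pos-* (x ℕ.* x) x) (≡.cong (ℤ._* + x) (ℤP.pos-* x x))) (≡.trans (ℤP.pos-* (3 ℕ.* l) ((x ℕ.+ 1) ℕ.* (x ℕ.+ 1))) (≡.cong (α ℤ.*_) (ℤP.pos-* (x ℕ.+ 1) (x ℕ.+ 1)))))
      (≡.trans (lem (+ x) α) (≡.cong (λ b → α ℤ.+ b ℤ.* + x ℤ.+ α ℤ.* (+ x ℤ.* + x) ℤ.+ + x ℤ.* + x ℤ.* + x) (≡.sym β≡2α)))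
      where
      x : ℕ
      x = suc t
      lem : ∀ x a → x ℤ.* x ℤ.* x ℤ.+ a ℤ.* ((x ℤ.+ + 1) ℤ.* (x ℤ.+ + 1)) ≡ a ℤ.+ (a ℤ.+ a) ℤ.* x ℤ.+ a ℤ.* (x ℤ.* x) ℤ.+ x ℤ.* x ℤ.* x
      lem = solve-∀

    rhs-0 : + rhs 0 ≡ α
    rhs-0 = ≡.cong +_ (ℕP.*-identityʳ (3 ℕ.* l))

    -- The constant 1 in each root count adds up to p and cancels; x = 0 contributes χ h α, and the
    -- units contribute Φ.
    ap-value : ap p l ≅ ℤ.- (χ h α ℤ.+ Φ)
    ap-value = begin
      + (p ℕ.+ 1) ℤ.- + numPoints p l
        ≡⟨ ≡.cong (λ z → + (p ℕ.+ 1) ℤ.- z) points ⟩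
      + (p ℕ.+ 1) ℤ.- (+ 1 ℤ.+ ∑ p (λ x → ∑ p (λ y → indicator (square-test (rhs x) y))))
        ≈⟨ +ˡ (+ (p ℕ.+ 1)) (-‿cong (+ˡ (+ 1) (trans (∑-cong′ p (λ x → count-roots (rhs x))) (∑-+ p (λ _ → + 1) (λ x → χ h (+ rhs x)))))) ⟩
      + (p ℕ.+ 1) ℤ.- (+ 1 ℤ.+ (∑ p (λ _ → + 1) ℤ.+ ∑ p (λ x → χ h (+ rhs x))))
        ≈⟨ +ˡ (+ (p ℕ.+ 1)) (-‿cong (+ˡ (+ 1) (+-cong (trans (∑-const p (+ 1)) (≡⇒≈ (≡.trans (ℤP.*-identityʳ _) (⌜⌝-is (+ p)))))
             (trans (∑-front n (λ x → χ h (+ rhs x))) (+-cong (≡⇒≈ (≡.cong (χ h) rhs-0)) (∑-cong′ n (λ t → ≡⇒≈ (≡.cong (χ h) (cubic-rhs t))))))))) ⟩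
      + (p ℕ.+ 1) ℤ.- (+ 1 ℤ.+ (+ p ℤ.+ (χ h α ℤ.+ Φ)))
        ≡⟨ lem (+ p) (χ h α ℤ.+ Φ) ⟩
      ℤ.- (χ h α ℤ.+ Φ) ∎
      where
      lem : ∀ p s → (p ℤ.+ + 1) ℤ.- (+ 1 ℤ.+ (p ℤ.+ s)) ≡ ℤ.- s
      lem = solve-∀

-- Value x v e: at level k the element x of Qp is v/p^e.
module Values (p k : ℕ) where
  record Value (x : Qp p) (v : ℤ) (e : ℕ) : Set where
    constructor value
    field
      clears : Qp.num x k ℤ.* + (p ℕ.^ e) ≡ v ℤ.* + (p ℕ.^ Qp.den x)

  p^-+ : ∀ a b → + (p ℕ.^ (a ℕ.+ b)) ≡ + (p ℕ.^ a) ℤ.* + (p ℕ.^ b)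
  p^-+ a b = ≡.trans (≡.cong +_ (ℕP.^-distribˡ-+-* p a b)) (ℤP.pos-* (p ℕ.^ a) (p ℕ.^ b))

  value-cast : ∀ {x v w e} → v ≡ w → Value x v e → Value x w e
  value-cast ≡.refl u = u

  value-ι : ∀ z → Value (ι p z) (z k) 0
  value-ι z = value ≡.refl

  value-* : ∀ {x y v w e f} → Value x v e → Value y w f → Value (_*Q_ p x y) (v ℤ.* w) (e ℕ.+ f)
  value-* {x} {y} {v} {w} {e} {f} (value vx) (value vy) = value (≡.trans (≡.cong ((Qp.num x k ℤ.* Qp.num y k) ℤ.*_) (p^-+ e f))
    (≡.trans (lem (Qp.num x k) (Qp.num y k) _ _) (≡.trans (≡.cong₂ ℤ._*_ vx vy)
      (≡.trans (lem v _ w _) (≡.cong ((v ℤ.* w) ℤ.*_) (≡.sym (p^-+ (Qp.den x) (Qp.den y))))))))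
    where
    lem : ∀ a b c d → (a ℤ.* b) ℤ.* (c ℤ.* d) ≡ (a ℤ.* c) ℤ.* (b ℤ.* d)
    lem = solve-∀

  value-+ : ∀ {x y v w e} → Value x v e → Value y w e → Value (_+Q_ p x y) (v ℤ.+ w) e
  value-+ {x} {y} {v} {w} {e} (value vx) (value vy) = value (≡.trans (lem (Qp.num x k) (Qp.num y k) (+ (p ℕ.^ Qp.den y)) (+ (p ℕ.^ Qp.den x)) (+ (p ℕ.^ e)))
    (≡.trans (≡.cong₂ (λ a b → a ℤ.* + (p ℕ.^ Qp.den y) ℤ.+ b ℤ.* + (p ℕ.^ Qp.den x)) vx vy)
      (≡.trans (lem₂ v w (+ (p ℕ.^ Qp.den x)) (+ (p ℕ.^ Qp.den y))) (≡.cong ((v ℤ.+ w) ℤ.*_) (≡.sym (p^-+ (Qp.den x) (Qp.den y)))))))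
    where
    lem : ∀ a b f e q → (a ℤ.* f ℤ.+ b ℤ.* e) ℤ.* q ≡ (a ℤ.* q) ℤ.* f ℤ.+ (b ℤ.* q) ℤ.* e
    lem = solve-∀
    lem₂ : ∀ v w e f → (v ℤ.* e) ℤ.* f ℤ.+ (w ℤ.* f) ℤ.* e ≡ (v ℤ.+ w) ℤ.* (e ℤ.* f)
    lem₂ = solve-∀

  value-sum : ∀ {A : Set} (f : A → Qp p) (v : A → ℤ) e xs → ListAll.All (λ x → Value (f x) (v x) e) xs → Value (sumQ p (List.map f xs)) (foldSum v xs) e
  value-sum f v e [] [] = value ≡.refl
  value-sum f v e (x ∷ xs) (h ∷ hs) = value-+ h (value-sum f v e xs hs)

  value-neg : ∀ {x v e} → Value x v e → Value (-Q_ p x) (ℤ.- v) e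
  value-neg {x} {v} {e} (value vx) = value (≡.trans (≡.sym (ℤP.neg-distribˡ-* (Qp.num x k) (+ (p ℕ.^ e)))) (≡.trans (≡.cong ℤ.-_ vx) (ℤP.neg-distribˡ-* v (+ (p ℕ.^ Qp.den x)))))

  -- (-p)^(f-1)
  value-negpPow : ∀ e f → e ≡ + f ℤ.- + 1 → Value (negpPow p e) (ℤ.- (ℤ.- + p) ℤ.^ f) 1
  value-negpPow _ zero ≡.refl = value ≡.refl
  value-negpPow _ (suc f) ≡.refl = value (≡.trans (≡.cong₂ (λ a b → sgnPow f ℤ.* a ℤ.* + b) (pos-^ p f) (ℕP.*-identityʳ p)) (≡.trans (lem (sgnPow f) ((+ p) ℤ.^ f) (+ p))
    (≡.cong (λ z → ℤ.- ((ℤ.- + p) ℤ.* z) ℤ.* + 1) (split f))))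
    where
    lem : ∀ s q p → s ℤ.* q ℤ.* p ≡ ℤ.- ((ℤ.- p) ℤ.* (s ℤ.* q)) ℤ.* + 1
    lem = solve-∀
    lem₂ : ∀ s q p → ((ℤ.- + 1) ℤ.* s) ℤ.* (p ℤ.* q) ≡ (ℤ.- p) ℤ.* (s ℤ.* q)
    lem₂ = solve-∀
    split : ∀ m → sgnPow m ℤ.* (+ p) ℤ.^ m ≡ (ℤ.- + p) ℤ.^ m
    split zero = ≡.refl
    split (suc m) = ≡.trans (lem₂ (sgnPow m) ((+ p) ℤ.^ m) (+ p)) (≡.cong ((ℤ.- + p) ℤ.*_) (split m))

-- With n = suc m the denominators p - 1 and 2(p - 1) of Defs are visibly nonzero.
module GTerms (m : ℕ) (pp : Prime (suc (suc m))) (h : ℕ) (n≡2h : suc m ≡ h ℕ.+ h) (k : ℕ) where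
  n : ℕ
  n = suc m
  open Characters n pp h n≡2h k
  -- With this argument N is the normal form of 2n, a common denominator of all the gamma arguments.
  open Fractions (m ℕ.+ suc (m ℕ.+ 0))
  open GammaArguments n pp h n≡2h k (m ℕ.+ suc (m ℕ.+ 0))
  open Values p k
  private module P = Mod p
  open Mod M
  open ≈-Reasoning

  p∤N : p∤ + N
  p∤N e = ∤-* p∤2 p∤n (P.trans (P.≡⇒≈ (≡.sym (ℤP.pos-* 2 n))) e)

  jq : ℕ → ℚ
  jq j = (+ j) // n

  frac-jq : ∀ j → Frac (jq j) (+ (2 ℕ.* j))
  frac-jq j = frac-/ (+ j) m (+ (2 ℕ.* j)) (≡.trans (≡.sym (ℤP.pos-* j N)) (≡.trans (≡.cong +_ (lem j n)) (ℤP.pos-* (2 ℕ.* j) n)))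
    where
    lem : ∀ j n → j ℕ.* (n ℕ.+ (n ℕ.+ 0)) ≡ 2 ℕ.* j ℕ.* n
    lem = ℕSolver.solve-∀

  Γ-even : ∀ x c → c ℕ.≤ n → Frac x (+ (2 ℕ.* c)) → Γp p x k ≅ γ c
  Γ-even x c c≤n fx = Γ-at c (repQ p x k) c≤n (cancelᴹ (+ 2) p∤2 (begin
    + 2 ℤ.* (+ n ℤ.* + repQ p x k) ≡⟨ ≡.trans (≡.sym (ℤP.*-assoc (+ 2) (+ n) (+ repQ p x k))) (≡.cong (ℤ._* + repQ p x k) (≡.sym (ℤP.pos-* 2 n))) ⟩
    + N ℤ.* + repQ p x k ≈⟨ rep-frac x (+ (2 ℕ.* c)) fx p∤N ⟩
    + (2 ℕ.* c) ≡⟨ ℤP.pos-* 2 c ⟩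
    + 2 ℤ.* + c ∎))

  gammaQuotient : ℕ → ℚ → ℚ → ℤ
  gammaQuotient j a b = ((Γp p ⟨ a ℚ.- jq j ⟩ k ℤ.* inverse (Γp p ⟨ a ⟩ k)) ℤ.* Γp p ⟨ ℚ.- b ℚ.+ jq j ⟩ k) ℤ.* inverse (Γp p ⟨ ℚ.- b ⟩ k)

  Γp-unit : ∀ x → p∤ Γp p x k
  Γp-unit x = Γ-unit (repQ p x k)

  gammaQuotient-clear : ∀ j a b → gammaQuotient j a b ℤ.* (Γp p ⟨ a ⟩ k ℤ.* Γp p ⟨ ℚ.- b ⟩ k) ≅ Γp p ⟨ a ℚ.- jq j ⟩ k ℤ.* Γp p ⟨ ℚ.- b ℚ.+ jq j ⟩ k
  gammaQuotient-clear j a b = begin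
    (((x ℤ.* inverse y) ℤ.* z) ℤ.* inverse w) ℤ.* (y ℤ.* w) ≡⟨ lem x (inverse y) z (inverse w) y w ⟩
    (x ℤ.* z) ℤ.* ((y ℤ.* inverse y) ℤ.* (w ℤ.* inverse w)) ≈⟨ *ˡ (x ℤ.* z) (*-cong (inverseʳ (Γp-unit ⟨ a ⟩)) (inverseʳ (Γp-unit ⟨ ℚ.- b ⟩))) ⟩
    (x ℤ.* z) ℤ.* (+ 1 ℤ.* + 1) ≡⟨ ℤP.*-identityʳ (x ℤ.* z) ⟩
    x ℤ.* z ∎
    where
    x y z w : ℤ
    x = Γp p ⟨ a ℚ.- jq j ⟩ k
    y = Γp p ⟨ a ⟩ k
    z = Γp p ⟨ ℚ.- b ℚ.+ jq j ⟩ k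
    w = Γp p ⟨ ℚ.- b ⟩ k
    lem : ∀ x i z j y w → (((x ℤ.* i) ℤ.* z) ℤ.* j) ℤ.* (y ℤ.* w) ≡ (x ℤ.* z) ℤ.* ((y ℤ.* i) ℤ.* (w ℤ.* j))
    lem = solve-∀

  -- a ≡ da/N, -b ≡ db/N modulo ℤ; subtracting and adding j/n borrows g and carries t.
  record Shifted (j : ℕ) (a b : ℚ) : Set where
    field
      da db dc dd g t f : ℕ
      fa fb : ℤ
      frac-a : Frac a (+ da ℤ.+ fa ℤ.* + N)
      frac-b : Frac (ℚ.- b) (+ db ℤ.+ fb ℤ.* + N)
      da<N : da ℕ.< N
      db<N : db ℕ.< N
      dc<N : dc ℕ.< N
      dd<N : dd ℕ.< N
      borrow : da ℕ.+ g ℕ.* N ≡ dc ℕ.+ 2 ℕ.* j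
      carry : db ℕ.+ 2 ℕ.* j ≡ dd ℕ.+ t ℕ.* N
      f-value : f ℕ.+ t ≡ 1 ℕ.+ g

    frac-⟨a⟩ : Frac ⟨ a ⟩ (+ da)
    frac-⟨a⟩ = frac-⟨⟩ fa da frac-a ≡.refl da<N
    frac-⟨-b⟩ : Frac ⟨ ℚ.- b ⟩ (+ db)
    frac-⟨-b⟩ = frac-⟨⟩ fb db frac-b ≡.refl db<N
    borrowℤ : ∀ z → (+ da ℤ.+ z ℤ.* + N) ℤ.- + (2 ℕ.* j) ≡ + dc ℤ.+ (z ℤ.- + g) ℤ.* + N
    borrowℤ z = ≡.trans (lem (+ da) z (+ N) (+ (2 ℕ.* j)) (+ g)) (≡.trans (≡.cong (λ s → s ℤ.- + (2 ℕ.* j) ℤ.+ (z ℤ.- + g) ℤ.* + N) (≡.trans (≡.cong (λ s → + da ℤ.+ s) (≡.sym (ℤP.pos-* g N))) (≡.cong +_ borrow)))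
      (lem₂ (+ dc) (+ (2 ℕ.* j)) (z ℤ.- + g) (+ N)))
      where
      lem : ∀ a z N j g → (a ℤ.+ z ℤ.* N) ℤ.- j ≡ (a ℤ.+ g ℤ.* N) ℤ.- j ℤ.+ (z ℤ.- g) ℤ.* N
      lem = solve-∀
      lem₂ : ∀ c j z N → (c ℤ.+ j) ℤ.- j ℤ.+ z ℤ.* N ≡ c ℤ.+ z ℤ.* N
      lem₂ = solve-∀
    carryℤ : ∀ z → (+ db ℤ.+ z ℤ.* + N) ℤ.+ + (2 ℕ.* j) ≡ + dd ℤ.+ (z ℤ.+ + t) ℤ.* + N
    carryℤ z = ≡.trans (lem (+ db) z (+ N) (+ (2 ℕ.* j))) (≡.trans (≡.cong (ℤ._+ z ℤ.* + N) (≡.trans (≡.cong +_ carry) (≡.cong (λ s → + dd ℤ.+ s) (ℤP.pos-* t N)))) (lem₂ (+ dd) (+ t) (+ N) z))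
      where
      lem : ∀ b z N j → (b ℤ.+ z ℤ.* N) ℤ.+ j ≡ (b ℤ.+ j) ℤ.+ z ℤ.* N
      lem = solve-∀
      lem₂ : ∀ d t N z → (d ℤ.+ t ℤ.* N) ℤ.+ z ℤ.* N ≡ d ℤ.+ (z ℤ.+ t) ℤ.* N
      lem₂ = solve-∀
    frac-⟨a-j⟩ : Frac ⟨ a ℚ.- jq j ⟩ (+ dc)
    frac-⟨a-j⟩ = frac-⟨⟩ (fa ℤ.- + g) dc (frac-- frac-a (frac-jq j)) (borrowℤ fa) dc<N
    frac-⟨-b+j⟩ : Frac ⟨ ℚ.- b ℚ.+ jq j ⟩ (+ dd)
    frac-⟨-b+j⟩ = frac-⟨⟩ (fb ℤ.+ + t) dd (frac-+ frac-b (frac-jq j)) (carryℤ fb) dd<N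
    -- The floors are -g and t, so the exponent is g - t. It can be -1, and the natural number f is
    -- therefore shifted by one.
    exponent : ℤ.- floor (⟨ a ⟩ ℚ.- jq j) ℤ.- floor (⟨ ℚ.- b ⟩ ℚ.+ jq j) ≡ + f ℤ.- + 1
    exponent = ≡.trans (≡.cong₂ (λ x y → ℤ.- x ℤ.- y)
        (frac-floor (+ 0 ℤ.- + g) dc (frac-- frac-⟨a⟩ (frac-jq j)) (≡.trans (≡.cong (ℤ._- + (2 ℕ.* j)) (lem₀ (+ da) (+ N))) (borrowℤ (+ 0))) dc<N)
        (frac-floor (+ 0 ℤ.+ + t) dd (frac-+ frac-⟨-b⟩ (frac-jq j)) (≡.trans (≡.cong (ℤ._+ + (2 ℕ.* j)) (lem₀ (+ db) (+ N))) (carryℤ (+ 0))) dd<N))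
      (≡.trans (lem (+ g) (+ t)) (≡.trans (≡.cong (λ s → s ℤ.- + t ℤ.- + 1) (≡.cong +_ (≡.sym f-value))) (lem₂ (+ f) (+ t))))
      where
      lem₀ : ∀ a N → a ≡ a ℤ.+ + 0 ℤ.* N
      lem₀ = solve-∀
      lem : ∀ g t → ℤ.- (+ 0 ℤ.- g) ℤ.- (+ 0 ℤ.+ t) ≡ (+ 1 ℤ.+ g) ℤ.- t ℤ.- + 1
      lem = solve-∀
      lem₂ : ∀ f t → (f ℤ.+ t) ℤ.- t ℤ.- + 1 ≡ f ℤ.- + 1
      lem₂ = solve-∀
    value-Gterm : Value (Gterm p j a b) (ℤ.- (ℤ.- + p) ℤ.^ f ℤ.* gammaQuotient j a b) 1
    value-Gterm = value-* (value-negpPow _ f exponent) (value-ι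
      (_*Z_ p (_*Z_ p (_*Z_ p (Γp p ⟨ a ℚ.- jq j ⟩) (invZ p (Γp p ⟨ a ⟩))) (Γp p ⟨ ℚ.- b ℚ.+ jq j ⟩)) (invZ p (Γp p ⟨ ℚ.- b ⟩))))

a₁ b₁ a₂ b₂ : ℕ → ℕ → ℚ
a₁ n r = (+ r) // n
b₁ n r = ℚ.- ((+ r) // (2 ℕ.* n))
a₂ n r = ℚ.- ℚ.½ ℚ.- a₁ n r
b₂ n r = b₁ n r ℚ.- ℚ.½

-- Here p is a variable: for p a successor the fractions (+ r) // (p ∸ 1) would get normalised during conversion checking.
module Evaluation (p k l : ℕ) where
  open Values p k

  gTerm : ℕ → ℕ → ℕ → Qp p
  gTerm n r j = _*Q_ p (ι p (_*Z_ p (cZ p (sgnPow (j ℕ.* 2))) (charPow p (ω̄ p) j 1)))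
    (prodQ p (termsList p j (a₁ n r ∷ a₂ n r ∷ []) (b₁ n r ∷ b₂ n r ∷ [])))

  value-gTerm : ∀ n r j {v w} → Value (Gterm p j (a₁ n r) (b₁ n r)) v 1 → Value (Gterm p j (a₂ n r) (b₂ n r)) w 1 →
    Value (gTerm n r j) ((sgnPow (j ℕ.* 2) ℤ.* charPow p (ω̄ p) j 1 k) ℤ.* (v ℤ.* (w ℤ.* + 1))) 2
  value-gTerm n r j {v} {w} x y = value-* {f = 2} (value-ι (_*Z_ p (cZ p (sgnPow (j ℕ.* 2))) (charPow p (ω̄ p) j 1)))
    (value-* {f = 1} x (value-* {f = 0} y (value-ι (cZ p (+ 1)))))

  inv : ℕ → ℤ
  inv n = invZ p (cZ p (+ n)) k

  value-G22 : ∀ n r {v} → n ≡ p ℕ.∸ 1 → Value (sumQ p (List.map (gTerm n r) (List.upTo n))) v 2 → Value (G22 p r 1) (ℤ.- inv n ℤ.* v) 2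
  value-G22 _ r ≡.refl x = value-* (value-neg (value-ι (invZ p (cZ p (+ (p ℕ.∸ 1)))))) x

  ψ : ℕ → Char p
  ψ r = charMul p (charPow p (ω̄ p) r) (φ p)

  φ₋ : ℤ
  φ₋ = φ p (toFp p (ℤ.- (+ (3 ℕ.* l)))) k

  ωβ ψ₋ J′ : ℕ → ℤ
  ωβ r = charPow p (ω p) r (toFp p (+ (6 ℕ.* l))) k
  ψ₋ r = ψ r (toFp p (ℤ.- (+ 1))) k
  J′ r = J p (charPow p (ω̄ p) r) (conj p (ψ r)) k

  rowTerm : ℕ → Qp p
  rowTerm r = _*Q_ p (_*Q_ p (ι p (charPow p (ω p) r (toFp p (+ (6 ℕ.* l))))) (binom p (charPow p (ω̄ p) r) (ψ r))) (G22 p r 1)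

  value-rowTerm : ∀ r {v} → Value (G22 p r 1) v 2 → Value (rowTerm r) ((ωβ r ℤ.* ((ψ₋ r ℤ.* + 1) ℤ.* J′ r)) ℤ.* v) 3
  value-rowTerm r x = value-* {e = 1} (value-* {e = 0} (value-ι (charPow p (ω p) r (toFp p (+ (6 ℕ.* l)))))
    (value-* {e = 1} {f = 0} (value-* {e = 0} (value-ι (ψ r (toFp p (ℤ.- (+ 1))))) (value {e = 1} ≡.refl)) (value-ι (J p (charPow p (ω̄ p) r) (conj p (ψ r)))))) x

  value-LHS : ∀ n {v} → n ≡ p ℕ.∸ 1 → Value (sumQ p (List.map rowTerm (List.map suc (List.upTo (p ℕ.∸ 2))))) v 3 →
    Value (LHS p l) (((+ (p ℕ.^ 2) ℤ.* φ₋) ℤ.* inv n) ℤ.* v) 3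
  value-LHS _ ≡.refl x = value-* (value-* {e = 0} (value-* {e = 0} (value-ι (cZ p (+ (p ℕ.^ 2)))) (value-ι (φ p (toFp p (ℤ.- (+ (3 ℕ.* l))))))) (value-ι (invZ p (cZ p (+ (p ℕ.∸ 1)))))) x

  -- Each row contains the 1/p of its binomial coefficient. A single row thus makes the exponent of
  -- the denominator a visible successor, whatever the other denominators are.
  LHS-den : ∀ {x xs} → List.map suc (List.upTo (p ℕ.∸ 2)) ≡ x ∷ xs → ∃ λ d → Qp.den (LHS p l) ≡ suc d
  LHS-den e = _ , ≡.cong (λ xs → Qp.den (sumQ p (List.map rowTerm xs))) e

  φ₊ : ℤ
  φ₊ = φ p (toFp p (+ (3 ℕ.* l))) k

  -- The p² in front of the sum and one p of the denominator make up the p³ of the value, which is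
  -- cancelled in ℤ itself; no precision is lost.
  LHS-num : .⦃ _ : ℕ.NonZero p ⦄ → ∀ {n W d} → Value (LHS p l) (((+ (p ℕ.^ 2) ℤ.* φ₋) ℤ.* inv n) ℤ.* W) 3 → Qp.den (LHS p l) ≡ suc d →
    Qp.num (LHS p l) k ≡ ((φ₋ ℤ.* inv n) ℤ.* W) ℤ.* + (p ℕ.^ d)
  LHS-num {n} {W} {d} (value clears) e = ℤP.*-cancelʳ-≡ _ _ (+ (p ℕ.^ 3)) ⦃ ℕP.m^n≢0 p 3 ⦄ (≡.trans clears (≡.trans (≡.cong (λ z → ((+ (p ℕ.^ 2) ℤ.* φ₋) ℤ.* inv n) ℤ.* W ℤ.* + (p ℕ.^ z)) e)
    (≡.trans (≡.cong (((+ (p ℕ.^ 2) ℤ.* φ₋) ℤ.* inv n) ℤ.* W ℤ.*_) (ℤP.pos-* p (p ℕ.^ d))) (≡.trans (lem (+ (p ℕ.^ 2)) φ₋ (inv n) W (+ p) (+ (p ℕ.^ d)))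
      (≡.cong ((((φ₋ ℤ.* inv n) ℤ.* W) ℤ.* + (p ℕ.^ d)) ℤ.*_) (≡.sym (ℤP.pos-* p (p ℕ.^ 2))))))))
    where
    lem : ∀ s f i w p d → ((s ℤ.* f) ℤ.* i) ℤ.* w ℤ.* (p ℤ.* d) ≡ (((f ℤ.* i) ℤ.* w) ℤ.* d) ℤ.* (p ℤ.* s)
    lem = solve-∀

  conclusion : ∀ n Y d → n ≡ p ℕ.∸ 1 → Qp.den (LHS p l) ≡ suc d → Qp.num (LHS p l) k ≡ Y ℤ.* + (p ℕ.^ d) → Y ≅ + p ℤ.* (φ₊ ℤ.* inv n ℤ.+ ap p l) [mod p ℕ.^ k ] →
    + (p ℕ.^ k) ℤDiv.∣ (Qp.num (LHS p l) k ℤ.* + (p ℕ.^ Qp.den (RHS p l)) ℤ.- Qp.num (RHS p l) k ℤ.* + (p ℕ.^ Qp.den (LHS p l)))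
  conclusion _ Y d ≡.refl den≡ num≡ Y≅ = Mod.≅⇒∣ (p ℕ.^ k) (begin
    Qp.num (LHS p l) k ℤ.* + 1 ≡⟨ ≡.trans (ℤP.*-identityʳ (Qp.num (LHS p l) k)) num≡ ⟩
    Y ℤ.* + (p ℕ.^ d) ≈⟨ *ʳ (+ (p ℕ.^ d)) Y≅ ⟩
    + p ℤ.* (φ₊ ℤ.* i ℤ.+ ap p l) ℤ.* + (p ℕ.^ d) ≡⟨ lem φ₊ i (ap p l) (+ p) (+ (p ℕ.^ d)) ⟩
    (φ₊ ℤ.* i ℤ.* + 1 ℤ.+ ap p l ℤ.* + 1) ℤ.* (+ p ℤ.* + (p ℕ.^ d))
      ≡⟨ ≡.cong ((φ₊ ℤ.* i ℤ.* + 1 ℤ.+ ap p l ℤ.* + 1) ℤ.*_) (≡.trans (≡.sym (ℤP.pos-* p (p ℕ.^ d))) (≡.cong (λ z → + (p ℕ.^ z)) (≡.sym den≡))) ⟩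
    Qp.num (RHS p l) k ℤ.* + (p ℕ.^ Qp.den (LHS p l)) ∎)
    where
    open Mod (p ℕ.^ k)
    open ≈-Reasoning
    i : ℤ
    i = inv (p ℕ.∸ 1)
    lem : ∀ f i a p d → p ℤ.* (f ℤ.* i ℤ.+ a) ℤ.* d ≡ (f ℤ.* i ℤ.* + 1 ℤ.+ a ℤ.* + 1) ℤ.* (p ℤ.* d)
    lem = solve-∀

-- Matching the hypergeometric terms with the double sum

module Subtraction (n : ℕ) .⦃ n-nonZero : ℕ.NonZero n ⦄ where
  sub : ℕ → ℕ → ℕ
  sub x j = (x ℕ.+ (n ℕ.∸ j)) ℕDM.% n

  borrowed : ℕ → ℕ → ℕ
  borrowed x j = 1 ℕ.∸ (x ℕ.+ (n ℕ.∸ j)) ℕDM./ n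

  sub<n : ∀ x j → sub x j ℕ.< n
  sub<n x j = ℕDM.m%n<n (x ℕ.+ (n ℕ.∸ j)) n

  sub-value : ∀ x j → x ℕ.< n → j ℕ.≤ n → x ℕ.+ borrowed x j ℕ.* n ≡ sub x j ℕ.+ j
  sub-value x j x<n j≤n = go ((x ℕ.+ (n ℕ.∸ j)) ℕDM./ n) ≡.refl q≤1
    where
    q≤1 : (x ℕ.+ (n ℕ.∸ j)) ℕDM./ n ℕ.≤ 1
    q≤1 = ℕP.≤-pred (ℕDM.m<n*o⇒m/o<n (≡.subst (x ℕ.+ (n ℕ.∸ j) ℕ.<_) (≡.cong (n ℕ.+_) (≡.sym (ℕP.+-identityʳ n))) (ℕP.+-mono-<-≤ x<n (ℕP.m∸n≤m n j))))
    whole : ∀ q → (x ℕ.+ (n ℕ.∸ j)) ℕDM./ n ≡ q → x ℕ.+ n ≡ (sub x j ℕ.+ j) ℕ.+ q ℕ.* n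
    whole q e = ≡.trans (≡.cong (x ℕ.+_) (≡.sym (ℕP.m∸n+n≡m j≤n))) (≡.trans (≡.sym (ℕP.+-assoc x (n ℕ.∸ j) j))
      (≡.trans (≡.cong (ℕ._+ j) (≡.trans (ℕDM.m≡m%n+[m/n]*n (x ℕ.+ (n ℕ.∸ j)) n) (≡.cong (λ z → sub x j ℕ.+ z ℕ.* n) e))) (lem (sub x j) j (q ℕ.* n))))
      where
      lem : ∀ s j q → (s ℕ.+ q) ℕ.+ j ≡ (s ℕ.+ j) ℕ.+ q
      lem = ℕSolver.solve-∀
    go : ∀ q → (x ℕ.+ (n ℕ.∸ j)) ℕDM./ n ≡ q → q ℕ.≤ 1 → x ℕ.+ (1 ℕ.∸ (x ℕ.+ (n ℕ.∸ j)) ℕDM./ n) ℕ.* n ≡ sub x j ℕ.+ j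
    go zero e _ = ≡.trans (≡.cong (λ z → x ℕ.+ (1 ℕ.∸ z) ℕ.* n) e) (≡.trans (≡.cong (x ℕ.+_) (ℕP.+-identityʳ n)) (≡.trans (whole 0 e) (ℕP.+-identityʳ _)))
    go (suc zero) e _ = ≡.trans (≡.cong (λ z → x ℕ.+ (1 ℕ.∸ z) ℕ.* n) e) (≡.trans (ℕP.+-identityʳ x)
      (ℕP.+-cancelʳ-≡ n x (sub x j ℕ.+ j) (≡.trans (whole 1 e) (≡.cong ((sub x j ℕ.+ j) ℕ.+_) (ℕP.+-identityʳ n)))))
    go (suc (suc q)) e (s≤s ())

  -- The arguments (r + 2j)/2n and (r + n + 2j)/2n differ by 1/2. Modulo 1 they are B/2n and B/2n +
  -- 1/2 in some order, B being the residue of r + 2j modulo n, and this is the pair that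
  -- duplication needs.
  record Doubling (r j : ℕ) : Set where
    field
      c₁ c₂ t₁ t₂ : ℕ
      c₁<2n : c₁ ℕ.< 2 ℕ.* n
      c₂<2n : c₂ ℕ.< 2 ℕ.* n
      t₁≤1 : t₁ ℕ.≤ 1
      t₂≤1 : t₂ ℕ.≤ 1
      value₁ : r ℕ.+ 2 ℕ.* j ≡ c₁ ℕ.+ t₁ ℕ.* (2 ℕ.* n)
      value₂ : r ℕ.+ n ℕ.+ 2 ℕ.* j ≡ c₂ ℕ.+ t₂ ℕ.* (2 ℕ.* n)
      total : t₁ ℕ.+ t₂ ≡ (r ℕ.+ 2 ℕ.* j) ℕDM./ n
      halves : (c₁ ≡ (r ℕ.+ 2 ℕ.* j) ℕDM.% n × c₂ ≡ (r ℕ.+ 2 ℕ.* j) ℕDM.% n ℕ.+ n) ⊎ (c₁ ≡ (r ℕ.+ 2 ℕ.* j) ℕDM.% n ℕ.+ n × c₂ ≡ (r ℕ.+ 2 ℕ.* j) ℕDM.% n)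

  doubling : ∀ r j → r ℕ.< n → j ℕ.< n → Doubling r j
  doubling r j r<n j<n = go ((r ℕ.+ 2 ℕ.* j) ℕDM./ n) ≡.refl q≤2
    where
    B : ℕ
    B = (r ℕ.+ 2 ℕ.* j) ℕDM.% n
    B<n : B ℕ.< n
    B<n = ℕDM.m%n<n (r ℕ.+ 2 ℕ.* j) n
    B<2n : B ℕ.< 2 ℕ.* n
    B<2n = ℕP.<-≤-trans B<n (ℕP.m≤m+n n (n ℕ.+ 0))
    B+n<2n : B ℕ.+ n ℕ.< 2 ℕ.* n
    B+n<2n = ≡.subst (B ℕ.+ n ℕ.<_) (≡.cong (n ℕ.+_) (≡.sym (ℕP.+-identityʳ n))) (ℕP.+-monoˡ-< n B<n)
    q≤2 : (r ℕ.+ 2 ℕ.* j) ℕDM./ n ℕ.≤ 2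
    q≤2 = ℕP.≤-pred (ℕDM.m<n*o⇒m/o<n (ℕP.+-mono-<-≤ r<n (ℕP.*-monoʳ-≤ 2 (ℕP.<⇒≤ j<n))))
    whole : ∀ q → (r ℕ.+ 2 ℕ.* j) ℕDM./ n ≡ q → r ℕ.+ 2 ℕ.* j ≡ B ℕ.+ q ℕ.* n
    whole q e = ≡.trans (ℕDM.m≡m%n+[m/n]*n (r ℕ.+ 2 ℕ.* j) n) (≡.cong (λ z → B ℕ.+ z ℕ.* n) e)
    whole′ : ∀ q → (r ℕ.+ 2 ℕ.* j) ℕDM./ n ≡ q → r ℕ.+ n ℕ.+ 2 ℕ.* j ≡ B ℕ.+ suc q ℕ.* n
    whole′ q e = ≡.trans (lem r n (2 ℕ.* j)) (≡.trans (≡.cong (ℕ._+ n) (whole q e)) (lem₂ B (q ℕ.* n) n))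
      where
      lem : ∀ r n d → r ℕ.+ n ℕ.+ d ≡ (r ℕ.+ d) ℕ.+ n
      lem = ℕSolver.solve-∀
      lem₂ : ∀ b q n → (b ℕ.+ q) ℕ.+ n ≡ b ℕ.+ (n ℕ.+ q)
      lem₂ = ℕSolver.solve-∀
    move₁ : ∀ B n → B ℕ.+ 1 ℕ.* n ≡ (B ℕ.+ n) ℕ.+ 0 ℕ.* (2 ℕ.* n)
    move₁ = ℕSolver.solve-∀
    move₀ : ∀ B n → B ℕ.+ 0 ℕ.* n ≡ B ℕ.+ 0 ℕ.* (2 ℕ.* n)
    move₀ = ℕSolver.solve-∀
    move₂ : ∀ B n → B ℕ.+ 2 ℕ.* n ≡ B ℕ.+ 1 ℕ.* (2 ℕ.* n)
    move₂ = ℕSolver.solve-∀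
    move₃ : ∀ B n → B ℕ.+ 3 ℕ.* n ≡ (B ℕ.+ n) ℕ.+ 1 ℕ.* (2 ℕ.* n)
    move₃ = ℕSolver.solve-∀
    go : ∀ q → (r ℕ.+ 2 ℕ.* j) ℕDM./ n ≡ q → q ℕ.≤ 2 → Doubling r j
    go 0 e _ = record { c₁ = B ; c₂ = B ℕ.+ n ; t₁ = 0 ; t₂ = 0 ; c₁<2n = B<2n ; c₂<2n = B+n<2n ; t₁≤1 = z≤n ; t₂≤1 = z≤n
      ; value₁ = ≡.trans (whole 0 e) (move₀ B n) ; value₂ = ≡.trans (whole′ 0 e) (move₁ B n) ; total = ≡.sym e ; halves = inj₁ (≡.refl , ≡.refl) }
    go 1 e _ = record { c₁ = B ℕ.+ n ; c₂ = B ; t₁ = 0 ; t₂ = 1 ; c₁<2n = B+n<2n ; c₂<2n = B<2n ; t₁≤1 = z≤n ; t₂≤1 = s≤s z≤n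
      ; value₁ = ≡.trans (whole 1 e) (move₁ B n) ; value₂ = ≡.trans (whole′ 1 e) (move₂ B n) ; total = ≡.sym e ; halves = inj₂ (≡.refl , ≡.refl) }
    go 2 e _ = record { c₁ = B ; c₂ = B ℕ.+ n ; t₁ = 1 ; t₂ = 1 ; c₁<2n = B<2n ; c₂<2n = B+n<2n ; t₁≤1 = s≤s z≤n ; t₂≤1 = s≤s z≤n
      ; value₁ = ≡.trans (whole 2 e) (move₂ B n) ; value₂ = ≡.trans (whole′ 2 e) (move₃ B n) ; total = ≡.sym e ; halves = inj₁ (≡.refl , ≡.refl) }
    go (suc (suc (suc _))) e (s≤s (s≤s ()))

module GValues (m : ℕ) (pp : Prime (suc (suc m))) (h : ℕ) (n≡2h : suc m ≡ h ℕ.+ h) (k : ℕ) (gaussRing : GaussRing (suc m) pp h n≡2h k) where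
  open GTerms m pp h n≡2h k
  open JacobiSums n pp h n≡2h k gaussRing using (coresidue; κ; κ-value)
  open Characters n pp h n≡2h k
  open Fractions (m ℕ.+ suc (m ℕ.+ 0))
  open GammaArguments n pp h n≡2h k (m ℕ.+ suc (m ℕ.+ 0))
  open Values p k
  open Subtraction n
  open Mod M
  open ≈-Reasoning

  frac-r2q : ∀ r → Frac ((+ r) // (2 ℕ.* n)) (+ r)
  frac-r2q r = frac-/ (+ r) (m ℕ.+ suc (m ℕ.+ 0)) (+ r) ≡.refl

  frac-½ : Frac ℚ.½ (+ n)
  frac-½ = frac-/ (+ 1) 1 (+ n) (≡.trans (ℤP.*-identityˡ (+ N)) (≡.trans (≡.cong +_ (ℕP.*-comm 2 n)) (ℤP.pos-* n 2)))

  double-< : ∀ {c} → c ℕ.< n → 2 ℕ.* c ℕ.< N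
  double-< c<n = ℕP.*-monoʳ-< 2 c<n

  module At (r j : ℕ) (r<n : r ℕ.< n) (j<n : j ℕ.< n) where
    open Doubling (doubling r j r<n j<n)
    C A B s₀ : ℕ
    s₀ = coresidue r
    C = sub r j
    A = sub s₀ j
    B = (r ℕ.+ 2 ℕ.* j) ℕDM.% n

    s₀<n : s₀ ℕ.< n
    s₀<n = compl<n (r ℕ.+ h)

    double-borrow : ∀ {x g c} → x ℕ.+ g ℕ.* n ≡ c ℕ.+ j → 2 ℕ.* x ℕ.+ g ℕ.* N ≡ 2 ℕ.* c ℕ.+ 2 ℕ.* j
    double-borrow {x} {g} {c} e = ≡.trans (lem x g n) (≡.trans (≡.cong (2 ℕ.*_) e) (ℕP.*-distribˡ-+ 2 c j))
      where
      lem : ∀ x g n → 2 ℕ.* x ℕ.+ g ℕ.* (2 ℕ.* n) ≡ 2 ℕ.* (x ℕ.+ g ℕ.* n)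
      lem = ℕSolver.solve-∀

    f₁ f₂ : ℕ
    f₁ = 1 ℕ.+ borrowed r j ℕ.∸ t₁
    f₂ = 1 ℕ.+ borrowed s₀ j ℕ.∸ t₂

    f₁+t₁ : f₁ ℕ.+ t₁ ≡ 1 ℕ.+ borrowed r j
    f₁+t₁ = ℕP.m∸n+n≡m (ℕP.≤-trans t₁≤1 (s≤s z≤n))

    f₂+t₂ : f₂ ℕ.+ t₂ ≡ 1 ℕ.+ borrowed s₀ j
    f₂+t₂ = ℕP.m∸n+n≡m (ℕP.≤-trans t₂≤1 (s≤s z≤n))

    shifted₁ : Shifted j (a₁ n r) (b₁ n r)
    shifted₁ = record { da = 2 ℕ.* r ; db = r ; dc = 2 ℕ.* C ; dd = c₁ ; g = borrowed r j ; t = t₁ ; f = f₁ ; fa = + 0 ; fb = + 0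
      ; frac-a = frac-cast (≡.sym (ℤP.+-identityʳ (+ (2 ℕ.* r)))) (frac-jq r)
      ; frac-b = frac-cast (≡.trans (ℤP.neg-involutive (+ r)) (≡.sym (ℤP.+-identityʳ (+ r)))) (frac-neg (frac-neg (frac-r2q r)))
      ; da<N = double-< r<n ; db<N = ℕP.<-≤-trans r<n (ℕP.m≤m+n n (n ℕ.+ 0)) ; dc<N = double-< (sub<n r j) ; dd<N = c₁<2n
      ; borrow = double-borrow {r} {borrowed r j} {C} (sub-value r j r<n (ℕP.<⇒≤ j<n)) ; carry = value₁ ; f-value = f₁+t₁ }

    shifted₂ : Shifted j (a₂ n r) (b₂ n r)
    -- Since r + s₀ = h + κ r · n, the parameter -1/2 - r/n equals s₀/n - (1 + κ r); its fractional
    -- part is that of the Jacobi index.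
    shifted₂ = record { da = 2 ℕ.* s₀ ; db = r ℕ.+ n ; dc = 2 ℕ.* A ; dd = c₂ ; g = borrowed s₀ j ; t = t₂ ; f = f₂ ; fa = ℤ.- + suc (κ r) ; fb = + 0
      ; frac-a = frac-cast numerator-a (frac-- {ℚ.- ℚ.½} {a₁ n r} (frac-neg {ℚ.½} frac-½) (frac-jq r))
      ; frac-b = frac-cast (lem (+ r) (+ n) (+ N)) (frac-neg (frac-- (frac-neg (frac-r2q r)) frac-½))
      ; da<N = double-< s₀<n ; db<N = ≡.subst (r ℕ.+ n ℕ.<_) (≡.cong (n ℕ.+_) (≡.sym (ℕP.+-identityʳ n))) (ℕP.+-monoˡ-< n r<n) ; dc<N = double-< (sub<n s₀ j) ; dd<N = c₂<2n
      ; borrow = double-borrow {s₀} {borrowed s₀ j} {A} (sub-value s₀ j s₀<n (ℕP.<⇒≤ j<n)) ; carry = value₂ ; f-value = f₂+t₂ }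
      where
      lem : ∀ r n N → ℤ.- (ℤ.- r ℤ.- n) ≡ (r ℤ.+ n) ℤ.+ + 0 ℤ.* N
      lem = solve-∀
      doubled : 2 ℕ.* r ℕ.+ 2 ℕ.* s₀ ≡ n ℕ.+ κ r ℕ.* N
      doubled = ≡.trans (≡.sym (ℕP.*-distribˡ-+ 2 r s₀)) (≡.trans (≡.cong (2 ℕ.*_) (κ-value r)) (≡.trans (lem₂ h (κ r) n) (≡.cong (λ z → z ℕ.+ κ r ℕ.* N) (≡.sym n≡2h))))
        where
        lem₂ : ∀ h κ n → 2 ℕ.* (h ℕ.+ κ ℕ.* n) ≡ (h ℕ.+ h) ℕ.+ κ ℕ.* (2 ℕ.* n)
        lem₂ = ℕSolver.solve-∀
      numerator-a : ℤ.- + n ℤ.- + (2 ℕ.* r) ≡ + (2 ℕ.* s₀) ℤ.+ (ℤ.- + suc (κ r)) ℤ.* + N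
      numerator-a = ≡.trans (lem₃ (+ n) (+ (2 ℕ.* r)) (+ (2 ℕ.* s₀))) (≡.trans (≡.cong (λ z → + (2 ℕ.* s₀) ℤ.- + n ℤ.- z) (≡.trans (≡.cong +_ doubled) (≡.cong (λ z → + n ℤ.+ z) (ℤP.pos-* (κ r) N))))
        (≡.trans (lem₄ (+ n) (+ (2 ℕ.* s₀)) (+ κ r) (+ N)) (≡.trans (≡.cong (λ z → + (2 ℕ.* s₀) ℤ.- z ℤ.- + κ r ℤ.* + N) (≡.cong (λ z → + (n ℕ.+ z)) (≡.sym (ℕP.+-identityʳ n)))) (lem₅ (+ (2 ℕ.* s₀)) (+ N) (+ κ r)))))
        where
        lem₃ : ∀ n r s → ℤ.- n ℤ.- r ≡ s ℤ.- n ℤ.- (r ℤ.+ s)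
        lem₃ = solve-∀
        lem₄ : ∀ n s κ N → s ℤ.- n ℤ.- (n ℤ.+ κ ℤ.* N) ≡ s ℤ.- (n ℤ.+ n) ℤ.- κ ℤ.* N
        lem₄ = solve-∀
        lem₅ : ∀ s N κ → s ℤ.- N ℤ.- κ ℤ.* N ≡ s ℤ.+ (ℤ.- (+ 1 ℤ.+ κ)) ℤ.* N
        lem₅ = solve-∀

    module S₁ = Shifted shifted₁
    module S₂ = Shifted shifted₂

    gammas : ℤ
    gammas = gammaQuotient j (a₁ n r) (b₁ n r) ℤ.* gammaQuotient j (a₂ n r) (b₂ n r)

    private
      X₀ X₀′ X₁ X₂ : ℕ
      X₀ = repQ p ⟨ ℚ.- b₁ n r ⟩ k
      X₀′ = repQ p ⟨ ℚ.- b₂ n r ⟩ k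
      X₁ = repQ p ⟨ ℚ.- b₁ n r ℚ.+ jq j ⟩ k
      X₂ = repQ p ⟨ ℚ.- b₂ n r ℚ.+ jq j ⟩ k

    duplication₀ : χ (n ℕ.∸ r) (+ 2) ℤ.* (Γ X₀ ℤ.* Γ X₀′) ≅ γ r ℤ.* γ h
    duplication₀ = γ-duplication r X₀ X₀′ (ℕP.<⇒≤ r<n) (rep-frac _ (+ r) S₁.frac-⟨-b⟩ p∤N) (rep-frac _ (+ (r ℕ.+ n)) S₂.frac-⟨-b⟩ p∤N)

    duplication₁ : χ (n ℕ.∸ B) (+ 2) ℤ.* (Γ X₁ ℤ.* Γ X₂) ≅ γ B ℤ.* γ h
    duplication₁ = split halves
      where
      B≤n : B ℕ.≤ n
      B≤n = ℕP.<⇒≤ (ℕDM.m%n<n (r ℕ.+ 2 ℕ.* j) n)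
      X₁≅ : + N ℤ.* + X₁ ≅ + c₁
      X₁≅ = rep-frac _ (+ c₁) S₁.frac-⟨-b+j⟩ p∤N
      X₂≅ : + N ℤ.* + X₂ ≅ + c₂
      X₂≅ = rep-frac _ (+ c₂) S₂.frac-⟨-b+j⟩ p∤N
      split : (c₁ ≡ B × c₂ ≡ B ℕ.+ n) ⊎ (c₁ ≡ B ℕ.+ n × c₂ ≡ B) → χ (n ℕ.∸ B) (+ 2) ℤ.* (Γ X₁ ℤ.* Γ X₂) ≅ γ B ℤ.* γ h
      split (inj₁ (e₁ , e₂)) = γ-duplication B X₁ X₂ B≤n (trans X₁≅ (≡⇒≈ (≡.cong +_ e₁))) (trans X₂≅ (≡⇒≈ (≡.cong +_ e₂)))
      split (inj₂ (e₁ , e₂)) = trans (*ˡ (χ (n ℕ.∸ B) (+ 2)) (≡⇒≈ (ℤP.*-comm (Γ X₁) (Γ X₂)))) (γ-duplication B X₂ X₁ B≤n (trans X₂≅ (≡⇒≈ (≡.cong +_ e₂))) (trans X₁≅ (≡⇒≈ (≡.cong +_ e₁))))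

    -- Duplication is applied twice: the numerator values at B/2n and B/2n + 1/2 combine to γ B, and
    -- the denominator values at r/2n and r/2n + 1/2 to γ r. Both produce γ h, which cancels.
    gammas-value : gammas ℤ.* (γ r ℤ.* γ s₀ ℤ.* γ r) ℤ.* χ (n ℕ.∸ B) (+ 2) ≅ γ C ℤ.* γ A ℤ.* γ B ℤ.* χ (n ℕ.∸ r) (+ 2)
    gammas-value = cancelᴹ (γ h) (γ-unit h) (begin
      γ h ℤ.* (G₁ ℤ.* G₂ ℤ.* (γ r ℤ.* γ s₀ ℤ.* γ r) ℤ.* u)
        ≡⟨ lem₁ (γ h) G₁ G₂ (γ r) (γ s₀) u ⟩
      (G₁ ℤ.* G₂ ℤ.* (γ r ℤ.* γ s₀) ℤ.* u) ℤ.* (γ r ℤ.* γ h)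
        ≈⟨ *ˡ (G₁ ℤ.* G₂ ℤ.* (γ r ℤ.* γ s₀) ℤ.* u) (sym duplication₀) ⟩
      (G₁ ℤ.* G₂ ℤ.* (γ r ℤ.* γ s₀) ℤ.* u) ℤ.* (v ℤ.* (Γ X₀ ℤ.* Γ X₀′))
        ≡⟨ lem₂ G₁ G₂ (γ r) (γ s₀) u v (Γ X₀) (Γ X₀′) ⟩
      (u ℤ.* v) ℤ.* ((G₁ ℤ.* (γ r ℤ.* Γ X₀)) ℤ.* (G₂ ℤ.* (γ s₀ ℤ.* Γ X₀′)))
        ≈⟨ *ˡ (u ℤ.* v) (*-cong
             (trans (*ˡ G₁ (*ʳ (Γ X₀) (sym (Γ-even ⟨ a₁ n r ⟩ r (ℕP.<⇒≤ r<n) S₁.frac-⟨a⟩)))) (trans (gammaQuotient-clear j (a₁ n r) (b₁ n r)) (*ʳ (Γ X₁) (Γ-even ⟨ a₁ n r ℚ.- jq j ⟩ C (ℕP.<⇒≤ (sub<n r j)) S₁.frac-⟨a-j⟩))))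
             (trans (*ˡ G₂ (*ʳ (Γ X₀′) (sym (Γ-even ⟨ a₂ n r ⟩ s₀ (ℕP.<⇒≤ s₀<n) S₂.frac-⟨a⟩)))) (trans (gammaQuotient-clear j (a₂ n r) (b₂ n r)) (*ʳ (Γ X₂) (Γ-even ⟨ a₂ n r ℚ.- jq j ⟩ A (ℕP.<⇒≤ (sub<n s₀ j)) S₂.frac-⟨a-j⟩))))) ⟩
      (u ℤ.* v) ℤ.* ((γ C ℤ.* Γ X₁) ℤ.* (γ A ℤ.* Γ X₂))
        ≡⟨ lem₃ u v (γ C) (Γ X₁) (γ A) (Γ X₂) ⟩
      (v ℤ.* (γ C ℤ.* γ A)) ℤ.* (u ℤ.* (Γ X₁ ℤ.* Γ X₂))
        ≈⟨ *ˡ (v ℤ.* (γ C ℤ.* γ A)) duplication₁ ⟩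
      (v ℤ.* (γ C ℤ.* γ A)) ℤ.* (γ B ℤ.* γ h)
        ≡⟨ lem₄ v (γ C) (γ A) (γ B) (γ h) ⟩
      γ h ℤ.* (γ C ℤ.* γ A ℤ.* γ B ℤ.* v) ∎)
      where
      G₁ G₂ u v : ℤ
      G₁ = gammaQuotient j (a₁ n r) (b₁ n r)
      G₂ = gammaQuotient j (a₂ n r) (b₂ n r)
      u = χ (n ℕ.∸ B) (+ 2)
      v = χ (n ℕ.∸ r) (+ 2)
      lem₁ : ∀ h a b r s u → h ℤ.* (a ℤ.* b ℤ.* (r ℤ.* s ℤ.* r) ℤ.* u) ≡ (a ℤ.* b ℤ.* (r ℤ.* s) ℤ.* u) ℤ.* (r ℤ.* h)
      lem₁ = solve-∀
      lem₂ : ∀ a b r s u v x y → (a ℤ.* b ℤ.* (r ℤ.* s) ℤ.* u) ℤ.* (v ℤ.* (x ℤ.* y)) ≡ (u ℤ.* v) ℤ.* ((a ℤ.* (r ℤ.* x)) ℤ.* (b ℤ.* (s ℤ.* y)))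
      lem₂ = solve-∀
      lem₃ : ∀ u v c x a y → (u ℤ.* v) ℤ.* ((c ℤ.* x) ℤ.* (a ℤ.* y)) ≡ (v ℤ.* (c ℤ.* a)) ℤ.* (u ℤ.* (x ℤ.* y))
      lem₃ = solve-∀
      lem₄ : ∀ v c a b h → (v ℤ.* (c ℤ.* a)) ℤ.* (b ℤ.* h) ≡ h ℤ.* (c ℤ.* a ℤ.* b ℤ.* v)
      lem₄ = solve-∀

    t₁+t₂ : t₁ ℕ.+ t₂ ≡ (r ℕ.+ 2 ℕ.* j) ℕDM./ n
    t₁+t₂ = total

module Terms (m : ℕ) (pp : Prime (suc (suc m))) (h : ℕ) (n≡2h : suc m ≡ h ℕ.+ h) (k : ℕ) (gaussRing : GaussRing (suc m) pp h n≡2h k)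
  (l : ℕ) (p∤α : PrimeMod.p∤_ (suc m) pp (+ (3 ℕ.* l))) (p∤β : PrimeMod.p∤_ (suc m) pp (+ (6 ℕ.* l))) where
  open GTerms m pp h n≡2h k using (n)
  open JacobiSums n pp h n≡2h k gaussRing using (κ; κ-value)
  open Characters n pp h n≡2h k
  open DefsValues n pp h n≡2h k
  open DefsSums n pp h n≡2h k gaussRing using (module Curve)
  open Curve l p∤α p∤β using (α; β; β≡2α)
  open MainSum n pp h n≡2h k gaussRing α β p∤α p∤β β≡2α using (A-index; B-index; wraps; total-value; coefficient)
  open Subtraction n
  module G = GValues m pp h n≡2h k gaussRing
  private module P = Mod p
  open Mod M
  open ≈-Reasoning

  q : ℤ
  q = ℤ.- + p

  σ : ℕ → ℤ
  σ e = (ℤ.- + 1) ℤ.^ e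

  module Entry (r j : ℕ) (0<r : 0 ℕ.< r) (r<n : r ℕ.< n) (j<n : j ℕ.< n) where
    open G.At r j r<n j<n
    D g₁ g₃ d : ℕ
    D = n ℕ.∸ r
    g₁ = borrowed r j
    g₃ = borrowed s₀ j
    d = (r ℕ.+ 2 ℕ.* j) ℕDM./ n

    D+r : D ℕ.+ r ≡ n
    D+r = ℕP.m∸n+n≡m (ℕP.<⇒≤ r<n)

    B-value : r ℕ.+ 2 ℕ.* j ≡ B ℕ.+ d ℕ.* n
    B-value = ℕDM.m≡m%n+[m/n]*n (r ℕ.+ 2 ℕ.* j) n

    C-value : r ℕ.+ g₁ ℕ.* n ≡ C ℕ.+ j
    C-value = sub-value r j r<n (ℕP.<⇒≤ j<n)

    A-value : s₀ ℕ.+ g₃ ℕ.* n ≡ A ℕ.+ j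
    A-value = sub-value s₀ j s₀<n (ℕP.<⇒≤ j<n)

    index-sum : (C ℕ.+ A ℕ.+ B) ℕ.+ d ℕ.* n ≡ (r ℕ.+ h) ℕ.+ (κ r ℕ.+ g₁ ℕ.+ g₃) ℕ.* n
    index-sum = ℕP.+-cancelʳ-≡ (2 ℕ.* j) _ _ (≡.trans (lem₁ C A B (d ℕ.* n) j)
      (≡.trans (≡.cong₂ ℕ._+_ (≡.cong₂ ℕ._+_ (≡.sym C-value) (≡.sym A-value)) (≡.sym B-value))
      (≡.trans (lem₂ r (g₁ ℕ.* n) s₀ (g₃ ℕ.* n) j)
      (≡.trans (≡.cong (λ z → z ℕ.+ (r ℕ.+ g₁ ℕ.* n ℕ.+ g₃ ℕ.* n ℕ.+ 2 ℕ.* j)) (κ-value r)) (lem₃ h (κ r) n r g₁ g₃ j)))))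
      where
      lem₁ : ∀ C A B d j → (C ℕ.+ A ℕ.+ B) ℕ.+ d ℕ.+ 2 ℕ.* j ≡ ((C ℕ.+ j) ℕ.+ (A ℕ.+ j)) ℕ.+ (B ℕ.+ d)
      lem₁ = ℕSolver.solve-∀
      lem₂ : ∀ r g s e j → ((r ℕ.+ g) ℕ.+ (s ℕ.+ e)) ℕ.+ (r ℕ.+ 2 ℕ.* j) ≡ (r ℕ.+ s) ℕ.+ (r ℕ.+ g ℕ.+ e ℕ.+ 2 ℕ.* j)
      lem₂ = ℕSolver.solve-∀
      lem₃ : ∀ h κ n r a b j → (h ℕ.+ κ ℕ.* n) ℕ.+ (r ℕ.+ a ℕ.* n ℕ.+ b ℕ.* n ℕ.+ 2 ℕ.* j) ≡ (r ℕ.+ h) ℕ.+ (κ ℕ.+ a ℕ.+ b) ℕ.* n ℕ.+ 2 ℕ.* j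
      lem₃ = ℕSolver.solve-∀

    n∣-from : ∀ {x} a b → x ℕ.+ a ℕ.* n ≡ b ℕ.* n → n ℕD.∣ x
    n∣-from {x} a b e = ℕD.∣m+n∣m⇒∣n {m = a ℕ.* n} (≡.subst (n ℕD.∣_) (≡.trans (≡.sym e) (ℕP.+-comm x (a ℕ.* n))) (ℕD.n∣m*n b)) (ℕD.n∣m*n a)

    -- Modulo n, 3D + 2C + B is -3r + 2(r - j) + (r + 2j) = 0.
    B≡ : B ≡ B-index C D
    B≡ = ∣-unique (D ℕ.+ D ℕ.+ D ℕ.+ (C ℕ.+ C)) (ℕDM.m%n<n (r ℕ.+ 2 ℕ.* j) n) (compl<n (D ℕ.+ D ℕ.+ D ℕ.+ (C ℕ.+ C)))
      (n∣-from d (3 ℕ.+ 2 ℕ.* g₁) (ℕP.+-cancelʳ-≡ (2 ℕ.* j) _ _ (≡.trans (lem₁ D C B (d ℕ.* n) j)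
        (≡.trans (≡.cong₂ (λ x y → D ℕ.+ D ℕ.+ D ℕ.+ (x ℕ.+ x) ℕ.+ y) (≡.sym C-value) (≡.sym B-value))
        (≡.trans (lem₂ D r (g₁ ℕ.* n) j) (≡.trans (≡.cong (λ z → 3 ℕ.* z ℕ.+ 2 ℕ.* (g₁ ℕ.* n) ℕ.+ 2 ℕ.* j) D+r) (lem₃ n g₁ j)))))))
      (n∣+compl (D ℕ.+ D ℕ.+ D ℕ.+ (C ℕ.+ C)))
      where
      lem₁ : ∀ D C B d j → (D ℕ.+ D ℕ.+ D ℕ.+ (C ℕ.+ C)) ℕ.+ B ℕ.+ d ℕ.+ 2 ℕ.* j ≡ D ℕ.+ D ℕ.+ D ℕ.+ ((C ℕ.+ j) ℕ.+ (C ℕ.+ j)) ℕ.+ (B ℕ.+ d)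
      lem₁ = ℕSolver.solve-∀
      lem₂ : ∀ D r g j → D ℕ.+ D ℕ.+ D ℕ.+ ((r ℕ.+ g) ℕ.+ (r ℕ.+ g)) ℕ.+ (r ℕ.+ 2 ℕ.* j) ≡ 3 ℕ.* (D ℕ.+ r) ℕ.+ 2 ℕ.* g ℕ.+ 2 ℕ.* j
      lem₂ = ℕSolver.solve-∀
      lem₃ : ∀ n g j → 3 ℕ.* n ℕ.+ 2 ℕ.* (g ℕ.* n) ℕ.+ 2 ℕ.* j ≡ (3 ℕ.+ 2 ℕ.* g) ℕ.* n ℕ.+ 2 ℕ.* j
      lem₃ = ℕSolver.solve-∀

    -- Modulo n, the indices C, A and B add up to r + h by `index-sum`, so h + D + C + B + A is h -
    -- r + r + h = 2h, that is 0.
    A≡ : A ≡ A-index C D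
    A≡ = ∣-unique (h ℕ.+ D ℕ.+ C ℕ.+ B-index C D) (sub<n s₀ j) (compl<n (h ℕ.+ D ℕ.+ C ℕ.+ B-index C D))
      (≡.subst (λ b → n ℕD.∣ h ℕ.+ D ℕ.+ C ℕ.+ b ℕ.+ A) B≡ (n∣-from d (2 ℕ.+ (κ r ℕ.+ g₁ ℕ.+ g₃))
        (≡.trans (lem₁ h D C B A (d ℕ.* n)) (≡.trans (≡.cong (λ z → h ℕ.+ D ℕ.+ z) index-sum)
          (≡.trans (lem₂ h D r ((κ r ℕ.+ g₁ ℕ.+ g₃) ℕ.* n)) (≡.cong₂ (λ x y → x ℕ.+ (y ℕ.+ (κ r ℕ.+ g₁ ℕ.+ g₃) ℕ.* n)) (≡.sym n≡2h) D+r))))))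
      (n∣+compl (h ℕ.+ D ℕ.+ C ℕ.+ B-index C D))
      where
      lem₁ : ∀ h D C B A d → h ℕ.+ D ℕ.+ C ℕ.+ B ℕ.+ A ℕ.+ d ≡ h ℕ.+ D ℕ.+ (C ℕ.+ A ℕ.+ B ℕ.+ d)
      lem₁ = ℕSolver.solve-∀
      lem₂ : ∀ h D r c → h ℕ.+ D ℕ.+ ((r ℕ.+ h) ℕ.+ c) ≡ (h ℕ.+ h) ℕ.+ ((D ℕ.+ r) ℕ.+ c)
      lem₂ = ℕSolver.solve-∀

    wraps+d : wraps C D ℕ.+ d ≡ 1 ℕ.+ (κ r ℕ.+ g₁ ℕ.+ g₃)
    wraps+d = ℕP.*-cancelʳ-≡ _ _ n (ℕP.+-cancelˡ-≡ h _ _ (≡.trans (lem₁ h (wraps C D) d n) (≡.trans (≡.cong (ℕ._+ d ℕ.* n) (≡.sym (total-value C D)))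
      (≡.trans (≡.cong₂ (λ a b → a ℕ.+ b ℕ.+ C ℕ.+ D ℕ.+ d ℕ.* n) (≡.sym A≡) (≡.sym B≡)) (≡.trans (lem₂ A B C D (d ℕ.* n)) (≡.trans (≡.cong (D ℕ.+_) index-sum)
        (≡.trans (lem₃ D r h ((κ r ℕ.+ g₁ ℕ.+ g₃) ℕ.* n)) (≡.cong (λ z → h ℕ.+ (z ℕ.+ (κ r ℕ.+ g₁ ℕ.+ g₃) ℕ.* n)) D+r))))))))
      where
      lem₁ : ∀ h w d n → h ℕ.+ (w ℕ.+ d) ℕ.* n ≡ (h ℕ.+ n ℕ.* w) ℕ.+ d ℕ.* n
      lem₁ = ℕSolver.solve-∀
      lem₂ : ∀ A B C D d → A ℕ.+ B ℕ.+ C ℕ.+ D ℕ.+ d ≡ D ℕ.+ (C ℕ.+ A ℕ.+ B ℕ.+ d)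
      lem₂ = ℕSolver.solve-∀
      lem₃ : ∀ D r h c → D ℕ.+ ((r ℕ.+ h) ℕ.+ c) ≡ h ℕ.+ ((D ℕ.+ r) ℕ.+ c)
      lem₃ = ℕSolver.solve-∀

    -- The powers of -p agree: κ comes from the Jacobi sum, f₁ and f₂ from the floors, and `wraps`
    -- from reducing the power of Y. The surplus 1 is the factor -p that ends up in K.
    exponents : κ r ℕ.+ (f₁ ℕ.+ f₂) ≡ suc (wraps C D)
    exponents = ℕP.+-cancelʳ-≡ d _ _ (≡.trans (≡.cong ((κ r ℕ.+ (f₁ ℕ.+ f₂)) ℕ.+_) (≡.sym t₁+t₂)) (≡.trans (lem (κ r) f₁ f₂ _ _)
      (≡.trans (≡.cong₂ (λ x y → κ r ℕ.+ (x ℕ.+ y)) f₁+t₁ f₂+t₂) (≡.trans (lem₂ (κ r) g₁ g₃) (≡.cong suc (≡.sym wraps+d))))))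
      where
      lem : ∀ κ f g t u → κ ℕ.+ (f ℕ.+ g) ℕ.+ (t ℕ.+ u) ≡ κ ℕ.+ ((f ℕ.+ t) ℕ.+ (g ℕ.+ u))
      lem = ℕSolver.solve-∀
      lem₂ : ∀ κ g e → κ ℕ.+ ((1 ℕ.+ g) ℕ.+ (1 ℕ.+ e)) ≡ suc (1 ℕ.+ (κ ℕ.+ g ℕ.+ e))
      lem₂ = ℕSolver.solve-∀

    u v : ℤ
    u = χ (n ℕ.∸ B) (+ 2)
    v = χ D (+ 2)

    χβ : ∀ e → χ e β ≡ χ e (+ 2) ℤ.* χ e α
    χβ e = ≡.trans (≡.cong (χ e) (≡.trans β≡2α (lem α))) (χ-* e (+ 2) α)
      where
      lem : ∀ a → a ℤ.+ a ≡ + 2 ℤ.* a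
      lem = solve-∀

    χ-n : ∀ e x → x ℕ.+ e ≡ n → χ e (+ 2) ℤ.* χ x (+ 2) ≅ + 1
    χ-n e x eq = trans (≡⇒≈ (≡.trans (≡.sym (χ-+ e x (+ 2))) (≡.cong (λ z → χ z (+ 2)) (≡.trans (ℕP.+-comm e x) eq)))) (ω-power-one n ℕD.∣-refl p∤2)

    -- Because β = 2α, the values χ r β and χ B β contain the powers of 2 that compensate those left
    -- by the two duplications. This is how 6λ fits beside 3λ.
    characters : χ h α ℤ.* χ r β ℤ.* v ≅ χ C α ℤ.* (χ B β ℤ.* χ A α) ℤ.* u
    characters = begin
      χ h α ℤ.* χ r β ℤ.* v ≡⟨ ≡.cong (λ z → χ h α ℤ.* z ℤ.* v) (χβ r) ⟩
      χ h α ℤ.* (χ r (+ 2) ℤ.* χ r α) ℤ.* v ≡⟨ lem₁ (χ h α) (χ r (+ 2)) (χ r α) v ⟩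
      (χ r α ℤ.* χ h α) ℤ.* (χ r (+ 2) ℤ.* v) ≈⟨ *-cong whole (trans (χ-n r D D+r) (sym (χ-n B (n ℕ.∸ B) (ℕP.m∸n+n≡m (ℕP.<⇒≤ (ℕDM.m%n<n (r ℕ.+ 2 ℕ.* j) n)))))) ⟩
      ((χ C α ℤ.* χ A α) ℤ.* χ B α) ℤ.* (χ B (+ 2) ℤ.* u) ≡⟨ lem₂ (χ C α) (χ A α) (χ B α) (χ B (+ 2)) u ⟩
      χ C α ℤ.* ((χ B (+ 2) ℤ.* χ B α) ℤ.* χ A α) ℤ.* u ≡⟨ ≡.cong (λ z → χ C α ℤ.* (z ℤ.* χ A α) ℤ.* u) (≡.sym (χβ B)) ⟩
      χ C α ℤ.* (χ B β ℤ.* χ A α) ℤ.* u ∎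
      where
      lem₁ : ∀ a b c v → a ℤ.* (b ℤ.* c) ℤ.* v ≡ (c ℤ.* a) ℤ.* (b ℤ.* v)
      lem₁ = solve-∀
      lem₂ : ∀ c a b e u → ((c ℤ.* a) ℤ.* b) ℤ.* (e ℤ.* u) ≡ c ℤ.* ((e ℤ.* b) ℤ.* a) ℤ.* u
      lem₂ = solve-∀
      whole : χ r α ℤ.* χ h α ≅ (χ C α ℤ.* χ A α) ℤ.* χ B α
      whole = begin
        χ r α ℤ.* χ h α ≡⟨ ≡.sym (χ-+ r h α) ⟩
        χ (r ℕ.+ h) α ≈⟨ sym (χ-periodic (r ℕ.+ h) _ p∤α (ℕD.n∣m*n (κ r ℕ.+ g₁ ℕ.+ g₃))) ⟩
        χ ((r ℕ.+ h) ℕ.+ (κ r ℕ.+ g₁ ℕ.+ g₃) ℕ.* n) α ≡⟨ ≡.cong (λ z → χ z α) (≡.sym index-sum) ⟩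
        χ ((C ℕ.+ A ℕ.+ B) ℕ.+ d ℕ.* n) α ≈⟨ χ-periodic (C ℕ.+ A ℕ.+ B) _ p∤α (ℕD.n∣m*n d) ⟩
        χ (C ℕ.+ A ℕ.+ B) α ≡⟨ ≡.trans (χ-+ (C ℕ.+ A) B α) (≡.cong (ℤ._* χ B α) (χ-+ C A α)) ⟩
        (χ C α ℤ.* χ A α) ℤ.* χ B α ∎

    coefficient-value : coefficient C D ≡ γ D ℤ.* ((γ C ℤ.* χ C α) ℤ.* ((γ B ℤ.* χ B β) ℤ.* (γ A ℤ.* χ A α)))
    coefficient-value = ≡.cong₂ (λ a b → γ D ℤ.* ((γ C ℤ.* χ C α) ℤ.* ((γ b ℤ.* χ b β) ℤ.* (γ a ℤ.* χ a α)))) (≡.sym A≡) (≡.sym B≡)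

    -- After clearing γ r and the power of 2, `γ-reflection` turns -(-1)^r into γ r · γ D; in this
    -- way the index D = n - r appears.
    core : ℤ.- (σ r ℤ.* (χ h α ℤ.* χ r β ℤ.* (γ r ℤ.* γ s₀) ℤ.* gammas)) ≅ coefficient C D
    core = cancelᴹ (γ r ℤ.* u) (∤-* (γ-unit r) (χ-unit (n ℕ.∸ B) p∤2)) (begin
      (γ r ℤ.* u) ℤ.* ℤ.- (σ r ℤ.* (χ h α ℤ.* χ r β ℤ.* (γ r ℤ.* γ s₀) ℤ.* gammas))
        ≡⟨ lem₁ (γ r) u (σ r) (χ h α ℤ.* χ r β) (γ s₀) gammas ⟩
      (ℤ.- σ r ℤ.* (χ h α ℤ.* χ r β)) ℤ.* (gammas ℤ.* (γ r ℤ.* γ s₀ ℤ.* γ r) ℤ.* u)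
        ≈⟨ *ˡ (ℤ.- σ r ℤ.* (χ h α ℤ.* χ r β)) gammas-value ⟩
      (ℤ.- σ r ℤ.* (χ h α ℤ.* χ r β)) ℤ.* (γ C ℤ.* γ A ℤ.* γ B ℤ.* v)
        ≡⟨ lem₂ (σ r) (χ h α ℤ.* χ r β) (γ C ℤ.* γ A ℤ.* γ B) v ⟩
      ℤ.- σ r ℤ.* (γ C ℤ.* γ A ℤ.* γ B) ℤ.* (χ h α ℤ.* χ r β ℤ.* v)
        ≈⟨ *-cong (*ʳ (γ C ℤ.* γ A ℤ.* γ B) (sym (γ-reflection r (ℕP.<⇒≤ r<n)))) characters ⟩
      γ r ℤ.* γ D ℤ.* (γ C ℤ.* γ A ℤ.* γ B) ℤ.* (χ C α ℤ.* (χ B β ℤ.* χ A α) ℤ.* u)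
        ≡⟨ lem₃ (γ r) (γ D) (γ C) (γ A) (γ B) (χ C α) (χ B β) (χ A α) u ⟩
      (γ r ℤ.* u) ℤ.* (γ D ℤ.* ((γ C ℤ.* χ C α) ℤ.* ((γ B ℤ.* χ B β) ℤ.* (γ A ℤ.* χ A α))))
        ≡⟨ ≡.cong ((γ r ℤ.* u) ℤ.*_) (≡.sym coefficient-value) ⟩
      (γ r ℤ.* u) ℤ.* coefficient C D ∎)
      where
      lem₁ : ∀ g u s x y w → (g ℤ.* u) ℤ.* ℤ.- (s ℤ.* (x ℤ.* (g ℤ.* y) ℤ.* w)) ≡ (ℤ.- s ℤ.* x) ℤ.* (w ℤ.* (g ℤ.* y ℤ.* g) ℤ.* u)
      lem₁ = solve-∀
      lem₂ : ∀ s x g v → (ℤ.- s ℤ.* x) ℤ.* (g ℤ.* v) ≡ ℤ.- s ℤ.* g ℤ.* (x ℤ.* v)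
      lem₂ = solve-∀
      lem₃ : ∀ r d c a b x y z u → r ℤ.* d ℤ.* (c ℤ.* a ℤ.* b) ℤ.* (x ℤ.* (y ℤ.* z) ℤ.* u) ≡ (r ℤ.* u) ℤ.* (d ℤ.* ((c ℤ.* x) ℤ.* ((b ℤ.* y) ℤ.* (a ℤ.* z))))
      lem₃ = solve-∀

-- The bookkeeping of one term over plain variables: s and t are (-1)^h and (-1)^r; x and y are χ h
-- α and χ r β; a, d, f, w are powers of q = -p; g, b, c are the γ of the Jacobi sum; e and o are
-- the gamma quotients; i is 1/(p-1).
collect : ∀ m s x y t a g b c d e f o q w φ₋ ωβ ψ₋ J′ i v co → φ₋ ≅ s ℤ.* x [mod m ] → ωβ ≅ y [mod m ] → ψ₋ ≅ t ℤ.* s [mod m ] → J′ ≅ s ℤ.* a ℤ.* (g ℤ.* b ℤ.* c) [mod m ] → v ≅ + 1 [mod m ] →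
  ℤ.- (t ℤ.* (x ℤ.* y ℤ.* (b ℤ.* c) ℤ.* (e ℤ.* o))) ≅ co [mod m ] → s ℤ.* s ≡ + 1 → a ℤ.* (d ℤ.* f) ≡ q ℤ.* w →
  ((φ₋ ℤ.* i) ℤ.* ((ωβ ℤ.* ((ψ₋ ℤ.* + 1) ℤ.* J′)) ℤ.* ℤ.- i)) ℤ.* (v ℤ.* ((ℤ.- d ℤ.* e) ℤ.* ((ℤ.- f ℤ.* o) ℤ.* + 1))) ≅ s ℤ.* g ℤ.* (i ℤ.* i) ℤ.* q ℤ.* (co ℤ.* w) [mod m ]
collect m s x y t a g b c d e f o q w φ₋ ωβ ψ₋ J′ i v co hφ hω hψ hJ hv hcore hs hq = begin
  ((φ₋ ℤ.* i) ℤ.* ((ωβ ℤ.* ((ψ₋ ℤ.* + 1) ℤ.* J′)) ℤ.* ℤ.- i)) ℤ.* (v ℤ.* z)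
    ≈⟨ *-cong (*-cong (*ʳ i hφ) (*ʳ (ℤ.- i) (*-cong hω (*-cong (*ʳ (+ 1) hψ) hJ)))) (*ʳ z hv) ⟩
  ((s ℤ.* x) ℤ.* i ℤ.* ((y ℤ.* ((t ℤ.* s) ℤ.* + 1 ℤ.* (s ℤ.* a ℤ.* (g ℤ.* b ℤ.* c)))) ℤ.* ℤ.- i)) ℤ.* (+ 1 ℤ.* z)
    ≡⟨ lem₁ s x i y t a g b c d e f o ⟩
  (s ℤ.* s) ℤ.* (s ℤ.* g ℤ.* (i ℤ.* i) ℤ.* (a ℤ.* (d ℤ.* f))) ℤ.* ℤ.- (t ℤ.* (x ℤ.* y ℤ.* (b ℤ.* c) ℤ.* (e ℤ.* o)))
    ≈⟨ *ˡ ((s ℤ.* s) ℤ.* (s ℤ.* g ℤ.* (i ℤ.* i) ℤ.* (a ℤ.* (d ℤ.* f)))) hcore ⟩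
  (s ℤ.* s) ℤ.* (s ℤ.* g ℤ.* (i ℤ.* i) ℤ.* (a ℤ.* (d ℤ.* f))) ℤ.* co
    ≡⟨ ≡.cong₂ (λ x y → x ℤ.* (s ℤ.* g ℤ.* (i ℤ.* i) ℤ.* y) ℤ.* co) hs hq ⟩
  + 1 ℤ.* (s ℤ.* g ℤ.* (i ℤ.* i) ℤ.* (q ℤ.* w)) ℤ.* co
    ≡⟨ lem₂ (s ℤ.* g ℤ.* (i ℤ.* i)) q w co ⟩
  s ℤ.* g ℤ.* (i ℤ.* i) ℤ.* q ℤ.* (co ℤ.* w) ∎
  where
  open Mod m
  open ≈-Reasoning
  z : ℤ
  z = (ℤ.- d ℤ.* e) ℤ.* ((ℤ.- f ℤ.* o) ℤ.* + 1)
  lem₁ : ∀ s x i y t a g b c d e f o → ((s ℤ.* x) ℤ.* i ℤ.* ((y ℤ.* ((t ℤ.* s) ℤ.* + 1 ℤ.* (s ℤ.* a ℤ.* (g ℤ.* b ℤ.* c)))) ℤ.* ℤ.- i)) ℤ.* (+ 1 ℤ.* ((ℤ.- d ℤ.* e) ℤ.* ((ℤ.- f ℤ.* o) ℤ.* + 1))) ≡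
    (s ℤ.* s) ℤ.* (s ℤ.* g ℤ.* (i ℤ.* i) ℤ.* (a ℤ.* (d ℤ.* f))) ℤ.* ℤ.- (t ℤ.* (x ℤ.* y ℤ.* (b ℤ.* c) ℤ.* (e ℤ.* o)))
  lem₁ = solve-∀
  lem₂ : ∀ a q w c → + 1 ℤ.* (a ℤ.* (q ℤ.* w)) ℤ.* c ≡ a ℤ.* q ℤ.* (c ℤ.* w)
  lem₂ = solve-∀

module Rows (m : ℕ) (pp : Prime (suc (suc m))) (h : ℕ) (n≡2h : suc m ≡ h ℕ.+ h) (k : ℕ) (gaussRing : GaussRing (suc m) pp h n≡2h k)
  (l : ℕ) (p∤α : PrimeMod.p∤_ (suc m) pp (+ (3 ℕ.* l))) (p∤β : PrimeMod.p∤_ (suc m) pp (+ (6 ℕ.* l))) where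
  open GTerms m pp h n≡2h k using (n; gammaQuotient)
  open JacobiSums n pp h n≡2h k gaussRing using (jacobi-value; coresidue; κ; -1^2)
  open Characters n pp h n≡2h k
  open DefsValues n pp h n≡2h k
  open DefsSums n pp h n≡2h k gaussRing using (toFp-≅; J-value; module Curve)
  open Terms m pp h n≡2h k gaussRing l p∤α p∤β using (q; σ; module Entry; module G) public
  open Curve l p∤α p∤β using (α; β; β≡2α) public
  open MainSum n pp h n≡2h k gaussRing α β p∤α p∤β β≡2α using (wraps; coefficient) public
  open Subtraction n
  private module P = Mod p
  open Mod M

  module V = Values (suc (suc m)) k

  -- The numerator of x over p^e, scaled by a, is congruent to b.
  Scaled : Qp (suc (suc m)) → ℕ → ℤ → ℤ → Set
  Scaled x e a b = ∃ λ v → V.Value x v e × a ℤ.* v ≅ b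

  scaled-sum : ∀ t (F : ℕ → Qp (suc (suc m))) e a b → (∀ j → j ℕ.< t → Scaled (F j) e a (b j)) → Scaled (sumQ (suc (suc m)) (List.map F (List.upTo t))) e a (∑ t b)
  scaled-sum t F e a b s = ∑ t numerator
    , V.value-cast (foldSum-upTo M t numerator) (V.value-sum F numerator e (List.upTo t) (AllP.applyUpTo⁺₁ (λ j → j) t (λ {j} j<t → proj₁ (at j j<t (j ℕ.<? t)))))
    , trans (sym (∑-*ˡ t a numerator)) (∑-cong t (λ j j<t → proj₂ (at j j<t (j ℕ.<? t))))
    where
    -- The numerators must form a function on all of ℕ, although they are given only below t; 0 is a
    -- filler elsewhere.
    choose : ∀ j → Dec (j ℕ.< t) → ℤ
    choose j (yes j<t) = proj₁ (s j j<t)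
    choose j (no _) = + 0
    numerator : ℕ → ℤ
    numerator j = choose j (j ℕ.<? t)
    at : ∀ j → j ℕ.< t → (j<?t : Dec (j ℕ.< t)) → V.Value (F j) (choose j j<?t) e × a ℤ.* choose j j<?t ≅ b j
    at j _ (yes j<t) = proj₂ (s j j<t)
    at j j<t (no j≮t) with () ← j≮t j<t

  φ₋ inv : ℤ
  φ₋ = Evaluation.φ₋ (suc (suc m)) k l
  inv = Evaluation.inv (suc (suc m)) k l (suc m)

  φ₋-value : φ₋ ≅ σ h ℤ.* χ h α
  φ₋-value = trans (φ-value (toFp p (ℤ.- α))) (trans (ω-power-cong h (toFp-≅ (ℤ.- α))) (≡⇒≈ (≡.trans (≡.cong (χ h) (lem α)) (≡.trans (χ-* h (ℤ.- + 1) α) (≡.cong (ℤ._* χ h α) (χ--1 h))))))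
    where
    lem : ∀ a → ℤ.- a ≡ (ℤ.- + 1) ℤ.* a
    lem = solve-∀

  module Row (r : ℕ) (0<r : 0 ℕ.< r) (r<n : r ℕ.< n) where
    r≤n : r ℕ.≤ n
    r≤n = ℕP.<⇒≤ r<n

    ωβ ψ₋ J′ : ℤ
    ωβ = Evaluation.ωβ (suc (suc m)) k l r
    ψ₋ = Evaluation.ψ₋ (suc (suc m)) k l r
    J′ = Evaluation.J′ (suc (suc m)) k l r

    ωβ-value : ωβ ≅ χ r β
    ωβ-value = trans (charPow-ω r (toFp p β) (λ e → p∤β (P.trans (P.sym (toFp-≅ β)) e))) (ω-power-cong r (toFp-≅ β))

    ψ₋-value : ψ₋ ≅ σ r ℤ.* σ h
    ψ₋-value = *-cong
      (trans (charPow-ω̄ r (toFp p (ℤ.- + 1)) r≤n (λ e → p∤-1 (P.trans (P.sym (toFp-≅ (ℤ.- + 1))) e))) (trans (ω-power-cong (n ℕ.∸ r) (toFp-≅ (ℤ.- + 1))) (≡⇒≈ (≡.trans (χ--1 (n ℕ.∸ r)) (-1^n∸ r r≤n)))))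
      (trans (φ-value (toFp p (ℤ.- + 1))) (trans (ω-power-cong h (toFp-≅ (ℤ.- + 1))) (≡⇒≈ (χ--1 h))))
      where
      p∤-1 : ¬ (ℤ.- + 1) P.≅ + 0
      p∤-1 e = ∤-1 (P.-‿cong e)

    J′-value : J′ ≅ σ h ℤ.* q ℤ.^ κ r ℤ.* (γ h ℤ.* γ r ℤ.* γ (coresidue r))
    J′-value = trans (J-value r 0<r r<n) (jacobi-value r 0<r r<n)

    scale K : ℤ
    scale = (φ₋ ℤ.* inv) ℤ.* ((ωβ ℤ.* ((ψ₋ ℤ.* + 1) ℤ.* J′)) ℤ.* ℤ.- inv)
    K = σ h ℤ.* γ h ℤ.* (inv ℤ.* inv) ℤ.* q

    entry : ℕ → ℤ
    entry j = coefficient (sub r j) (n ℕ.∸ r) ℤ.* q ℤ.^ wraps (sub r j) (n ℕ.∸ r)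

    module Column (j : ℕ) (j<n : j ℕ.< n) where
      open G.At r j r<n j<n public
      open Entry r j 0<r r<n j<n using (D; core; exponents) public
      G₁ G₂ : ℤ
      G₁ = gammaQuotient j (a₁ n r) (b₁ n r)
      G₂ = gammaQuotient j (a₂ n r) (b₂ n r)

      value₁ : V.Value (Gterm (suc (suc m)) j (a₁ (suc m) r) (b₁ (suc m) r)) (ℤ.- q ℤ.^ f₁ ℤ.* G₁) 1
      value₁ = S₁.value-Gterm

      value₂ : V.Value (Gterm (suc (suc m)) j (a₂ (suc m) r) (b₂ (suc m) r)) (ℤ.- q ℤ.^ f₂ ℤ.* G₂) 1
      value₂ = S₂.value-Gterm

      value-gValue : V.Value (Evaluation.gTerm (suc (suc m)) k l (suc m) r j) ((sgnPow (j ℕ.* 2) ℤ.* charPow (suc (suc m)) (ω̄ (suc (suc m))) j 1 k) ℤ.* ((ℤ.- q ℤ.^ f₁ ℤ.* G₁) ℤ.* ((ℤ.- q ℤ.^ f₂ ℤ.* G₂) ℤ.* + 1))) 2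
      value-gValue = Evaluation.value-gTerm (suc (suc m)) k l (suc m) r j {ℤ.- q ℤ.^ f₁ ℤ.* G₁} {ℤ.- q ℤ.^ f₂ ℤ.* G₂} value₁ value₂

      sign : sgnPow (j ℕ.* 2) ℤ.* charPow (suc (suc m)) (ω̄ (suc (suc m))) j 1 k ≅ + 1
      sign = trans (≡⇒≈ (≡.trans (≡.cong (ℤ._* charPow (suc (suc m)) (ω̄ (suc (suc m))) j 1 k) (≡.trans (≡.cong ((ℤ.- + 1) ℤ.^_) (lem j)) (-1^double j))) (ℤP.*-identityˡ (charPow (suc (suc m)) (ω̄ (suc (suc m))) j 1 k))))
        (trans (charPow-ω̄ j 1 (ℕP.<⇒≤ j<n) ∤-1) (≡⇒≈ (χ-1 (n ℕ.∸ j))))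
        where
        lem : ∀ j → j ℕ.* 2 ≡ j ℕ.+ j
        lem = ℕSolver.solve-∀

      powers : q ℤ.^ κ r ℤ.* (q ℤ.^ f₁ ℤ.* q ℤ.^ f₂) ≡ q ℤ.* q ℤ.^ wraps C D
      powers = ≡.trans (≡.cong (q ℤ.^ κ r ℤ.*_) (≡.sym (ℤP.^-distribˡ-+-* q f₁ f₂))) (≡.trans (≡.sym (ℤP.^-distribˡ-+-* q (κ r) (f₁ ℕ.+ f₂))) (≡.cong (q ℤ.^_) exponents))

      scaled-gValue : scale ℤ.* ((sgnPow (j ℕ.* 2) ℤ.* charPow (suc (suc m)) (ω̄ (suc (suc m))) j 1 k) ℤ.* ((ℤ.- q ℤ.^ f₁ ℤ.* G₁) ℤ.* ((ℤ.- q ℤ.^ f₂ ℤ.* G₂) ℤ.* + 1))) ≅ K ℤ.* entry j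
      scaled-gValue = collect M (σ h) (χ h α) (χ r β) (σ r) (q ℤ.^ κ r) (γ h) (γ r) (γ s₀) (q ℤ.^ f₁) G₁ (q ℤ.^ f₂) G₂ q (q ℤ.^ wraps C D) φ₋ ωβ ψ₋ J′ inv (sgnPow (j ℕ.* 2) ℤ.* charPow (suc (suc m)) (ω̄ (suc (suc m))) j 1 k) (coefficient C D)
        φ₋-value ωβ-value ψ₋-value J′-value sign core (-1^2 h) powers

    scaled-gTerm : ∀ j → j ℕ.< n → Scaled (Evaluation.gTerm (suc (suc m)) k l (suc m) r j) 2 scale (K ℤ.* entry j)
    scaled-gTerm j j<n = _ , Column.value-gValue j j<n , Column.scaled-gValue j j<n

    columnSum : Scaled (sumQ (suc (suc m)) (List.map (Evaluation.gTerm (suc (suc m)) k l (suc m) r) (List.upTo n))) 2 scale (∑ n (λ j → K ℤ.* entry j))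
    columnSum = scaled-sum n (Evaluation.gTerm (suc (suc m)) k l (suc m) r) 2 scale (λ j → K ℤ.* entry j) scaled-gTerm

    scaled-rowTerm : Scaled (Evaluation.rowTerm (suc (suc m)) k l r) 3 (φ₋ ℤ.* inv) (∑ n (λ j → K ℤ.* entry j))
    scaled-rowTerm = (ωβ ℤ.* ((ψ₋ ℤ.* + 1) ℤ.* J′)) ℤ.* (ℤ.- inv ℤ.* proj₁ columnSum) , Evaluation.value-rowTerm (suc (suc m)) k l r (Evaluation.value-G22 (suc (suc m)) k l (suc m) r ≡.refl (proj₁ (proj₂ columnSum)))
      , trans (≡⇒≈ (lem (φ₋ ℤ.* inv) (ωβ ℤ.* ((ψ₋ ℤ.* + 1) ℤ.* J′)) (ℤ.- inv) (proj₁ columnSum))) (proj₂ (proj₂ columnSum))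
      where
      lem : ∀ a b c w → a ℤ.* (b ℤ.* (c ℤ.* w)) ≡ (a ℤ.* (b ℤ.* c)) ℤ.* w
      lem = solve-∀

module Total (m : ℕ) (pp : Prime (suc (suc m))) (h : ℕ) (n≡2h : suc m ≡ h ℕ.+ h) (k : ℕ) (gaussRing : GaussRing (suc m) pp h n≡2h k)
  (l : ℕ) (p∤α : PrimeMod.p∤_ (suc m) pp (+ (3 ℕ.* l))) (p∤β : PrimeMod.p∤_ (suc m) pp (+ (6 ℕ.* l))) where
  open GTerms m pp h n≡2h k using (n)
  open JacobiSums n pp h n≡2h k gaussRing using (-1^2)
  open Characters n pp h n≡2h k
  open DefsValues n pp h n≡2h k
  open DefsSums n pp h n≡2h k gaussRing using (toFp-≅; module Curve)
  open Curve l p∤α p∤β using (ap-value)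
  open MainSum n pp h n≡2h k gaussRing (+ (3 ℕ.* l)) (+ (6 ℕ.* l)) p∤α p∤β (Curve.β≡2α l p∤α p∤β) using (Φ; main-sum)
  open Rows m pp h n≡2h k gaussRing l p∤α p∤β
  open Subtraction n
  open Mod M
  open ≈-Reasoning

  -- The map from j to r - j modulo n is its own inverse; `∣-unique` recognises j as the residue
  -- that completes `sub r j` to r.
  sub-involutive : ∀ r j → r ℕ.< n → j ℕ.< n → sub r (sub r j) ≡ j
  sub-involutive r j r<n j<n = ∣-unique (sub r j ℕ.+ (n ℕ.∸ r)) (sub<n r (sub r j)) j<n
    (divides (sub r (sub r j)) (borrowed r (sub r j)) (≡.trans (sub-value r (sub r j) r<n (ℕP.<⇒≤ (sub<n r j))) (ℕP.+-comm (sub r (sub r j)) (sub r j))))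
    (divides j (borrowed r j) (sub-value r j r<n (ℕP.<⇒≤ j<n)))
    where
    divides : ∀ x b → r ℕ.+ b ℕ.* n ≡ sub r j ℕ.+ x → n ℕD.∣ sub r j ℕ.+ (n ℕ.∸ r) ℕ.+ x
    divides x b e = ≡.subst (n ℕD.∣_) (≡.sym (≡.trans (lem (sub r j) (n ℕ.∸ r) x) (≡.trans (≡.cong ((n ℕ.∸ r) ℕ.+_) (≡.sym e))
      (≡.trans (≡.sym (ℕP.+-assoc (n ℕ.∸ r) r (b ℕ.* n))) (≡.cong (ℕ._+ b ℕ.* n) (ℕP.m∸n+n≡m (ℕP.<⇒≤ r<n))))))) (ℕD.n∣m*n (suc b))
      where
      lem : ∀ c d x → c ℕ.+ d ℕ.+ x ≡ d ℕ.+ (c ℕ.+ x)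
      lem = ℕSolver.solve-∀

  summand : ℕ → ℕ → ℤ
  summand C D = coefficient C D ℤ.* q ℤ.^ wraps C D

  K : ℤ
  K = σ h ℤ.* γ h ℤ.* (inv ℤ.* inv) ℤ.* q

  -- For fixed r the substitution C ≡ r - j permutes the columns, and D = n - r reverses the order
  -- of the rows 1, ..., n - 1.
  reindex : ∑ m (λ r → ∑ n (λ j → K ℤ.* summand (sub (suc r) j) (n ℕ.∸ suc r))) ≅ K ℤ.* ∑ m (λ D → ∑ n (λ C → summand C (suc D)))
  reindex = begin
    ∑ m (λ r → ∑ n (λ j → K ℤ.* summand (sub (suc r) j) (n ℕ.∸ suc r)))
      ≈⟨ ∑-cong m (λ r r<m → trans (∑-*ˡ n K (λ j → summand (sub (suc r) j) (n ℕ.∸ suc r))) (*ˡ K (∑-perm n (sub (suc r)) (sub (suc r)) (λ C → summand C (n ℕ.∸ suc r))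
           (λ j _ → sub<n (suc r) j) (λ j _ → sub<n (suc r) j) (λ j → sub-involutive (suc r) j (s≤s r<m)) (λ j → sub-involutive (suc r) j (s≤s r<m))))) ⟩
    ∑ m (λ r → K ℤ.* ∑ n (λ C → summand C (n ℕ.∸ suc r)))
      ≈⟨ ∑-*ˡ m K (λ r → ∑ n (λ C → summand C (n ℕ.∸ suc r))) ⟩
    K ℤ.* ∑ m (λ r → ∑ n (λ C → summand C (n ℕ.∸ suc r)))
      ≈⟨ *ˡ K (∑-cong m (λ r r<m → ≡⇒≈ (≡.cong (λ D → ∑ n (λ C → summand C D)) (ℕP.+-∸-assoc 1 r<m)))) ⟩
    K ℤ.* ∑ m (λ r → ∑ n (λ C → summand C (suc (m ℕ.∸ suc r))))
      ≈⟨ *ˡ K (∑-perm m (λ r → m ℕ.∸ suc r) (λ r → m ℕ.∸ suc r) (λ D → ∑ n (λ C → summand C (suc D))) reflected reflected reflect-twice reflect-twice) ⟩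
    K ℤ.* ∑ m (λ D → ∑ n (λ C → summand C (suc D))) ∎
    where
    reflected : ∀ r → r ℕ.< m → m ℕ.∸ suc r ℕ.< m
    reflected r r<m = ℕP.∸-monoʳ-< (s≤s z≤n) r<m
    reflect-twice : ∀ r → r ℕ.< m → m ℕ.∸ suc (m ℕ.∸ suc r) ≡ r
    reflect-twice r r<m = ≡.trans (≡.cong (m ℕ.∸_) (≡.sym (ℕP.+-∸-assoc 1 r<m))) (ℕP.m∸[m∸n]≡n (ℕP.<⇒≤ r<m))

  X : ℤ
  X = + p ℤ.* (Evaluation.φ₊ (suc (suc m)) k l ℤ.* inv ℤ.+ ap p l)

  -- Here (-1)^h (γ h)² ≡ -1, and -nΦ - (n-1)χ is χ - n(Φ + χ) for χ = χ h α. After division by n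
  -- the first part becomes φ(3λ)/(p-1), and the second is a_p because -(Φ + χ) ≡ a_p.
  K-value : K ℤ.* (+ n ℤ.* (γ h ℤ.* (ℤ.- (+ n ℤ.* Φ) ℤ.- (+ n ℤ.- + 1) ℤ.* χ h α))) ≅ X
  K-value = begin
    K ℤ.* (+ n ℤ.* (γ h ℤ.* (ℤ.- (+ n ℤ.* Φ) ℤ.- (+ n ℤ.- + 1) ℤ.* χ h α)))
      ≡⟨ lem₁ (σ h) (γ h) inv (+ p) (+ n) Φ (χ h α) ⟩
    (σ h ℤ.* (γ h ℤ.* γ h)) ℤ.* (+ p ℤ.* (+ n ℤ.* inv) ℤ.* ((+ n ℤ.* inv) ℤ.* (Φ ℤ.+ χ h α) ℤ.- χ h α ℤ.* inv))
      ≈⟨ *-cong (trans (*ˡ (σ h) γh²) (≡⇒≈ (≡.trans (≡.sym (ℤP.neg-distribʳ-* (σ h) (σ h))) (≡.cong ℤ.-_ (-1^2 h)))))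
           (*-cong (*ˡ (+ p) (inverseʳ p∤n)) (+ʳ (ℤ.- (χ h α ℤ.* inv)) (*ʳ (Φ ℤ.+ χ h α) (inverseʳ p∤n)))) ⟩
    (ℤ.- + 1) ℤ.* (+ p ℤ.* + 1 ℤ.* (+ 1 ℤ.* (Φ ℤ.+ χ h α) ℤ.- χ h α ℤ.* inv))
      ≡⟨ lem₂ inv (+ p) Φ (χ h α) ⟩
    + p ℤ.* (χ h α ℤ.* inv ℤ.+ ℤ.- (χ h α ℤ.+ Φ))
      ≈⟨ *ˡ (+ p) (+-cong (*ʳ inv (sym (trans (φ-value (toFp p α)) (ω-power-cong h (toFp-≅ α))))) (sym ap-value)) ⟩
    X ∎
    where
    γh² : γ h ℤ.* γ h ≅ ℤ.- σ h
    γh² = trans (≡⇒≈ (≡.cong (λ z → γ h ℤ.* γ z) (≡.sym (≡.trans (≡.cong (ℕ._∸ h) n≡2h) (ℕP.m+n∸n≡m h h))))) (γ-reflection h (ℕP.<⇒≤ h<n))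
    lem₁ : ∀ s g i p n f x → s ℤ.* g ℤ.* (i ℤ.* i) ℤ.* (ℤ.- p) ℤ.* (n ℤ.* (g ℤ.* (ℤ.- (n ℤ.* f) ℤ.- (n ℤ.- + 1) ℤ.* x))) ≡ (s ℤ.* (g ℤ.* g)) ℤ.* (p ℤ.* (n ℤ.* i) ℤ.* ((n ℤ.* i) ℤ.* (f ℤ.+ x) ℤ.- x ℤ.* i))
    lem₁ = solve-∀
    lem₂ : ∀ i p f x → (ℤ.- + 1) ℤ.* (p ℤ.* + 1 ℤ.* (+ 1 ℤ.* (f ℤ.+ x) ℤ.- x ℤ.* i)) ≡ p ℤ.* (x ℤ.* i ℤ.+ ℤ.- (x ℤ.+ f))
    lem₂ = solve-∀

  scaled-rows : Scaled (sumQ (suc (suc m)) (List.map (Evaluation.rowTerm (suc (suc m)) k l) (List.map suc (List.upTo m)))) 3 (φ₋ ℤ.* inv) X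
  scaled-rows = ≡.subst (λ xs → Scaled (sumQ (suc (suc m)) xs) 3 (φ₋ ℤ.* inv) X) (ListP.map-∘ (List.upTo m)) (proj₁ S , proj₁ (proj₂ S) , trans (proj₂ (proj₂ S)) (trans reindex (trans (*ˡ K (main-sum m ≡.refl)) K-value)))
    where
    S : Scaled (sumQ (suc (suc m)) (List.map (λ r → Evaluation.rowTerm (suc (suc m)) k l (suc r)) (List.upTo m))) 3 (φ₋ ℤ.* inv) (∑ m (λ r → ∑ n (λ j → K ℤ.* summand (sub (suc r) j) (n ℕ.∸ suc r))))
    S = scaled-sum m (λ r → Evaluation.rowTerm (suc (suc m)) k l (suc r)) 3 (φ₋ ℤ.* inv) (λ r → ∑ n (λ j → K ℤ.* summand (sub (suc r) j) (n ℕ.∸ suc r)))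
      (λ r r<m → Row.scaled-rowTerm (suc r) (s≤s z≤n) (s≤s r<m))

  divisible : ∀ {x xs} → List.map suc (List.upTo m) ≡ x ∷ xs →
    + (suc (suc m) ℕ.^ k) ℤDiv.∣ (Qp.num (LHS (suc (suc m)) l) k ℤ.* + (suc (suc m) ℕ.^ Qp.den (RHS (suc (suc m)) l)) ℤ.- Qp.num (RHS (suc (suc m)) l) k ℤ.* + (suc (suc m) ℕ.^ Qp.den (LHS (suc (suc m)) l)))
  divisible nonempty = Evaluation.conclusion (suc (suc m)) k l (suc m) ((φ₋ ℤ.* inv) ℤ.* proj₁ scaled-rows) (proj₁ den) ≡.refl (proj₂ den)
    (Evaluation.LHS-num (suc (suc m)) k l (Evaluation.value-LHS (suc (suc m)) k l (suc m) ≡.refl (proj₁ (proj₂ scaled-rows))) (proj₂ den)) (proj₂ (proj₂ scaled-rows))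
    where
    den : ∃ λ d → Qp.den (LHS (suc (suc m)) l) ≡ suc d
    den = Evaluation.LHS-den (suc (suc m)) k l nonempty

-- Specialisation to primes greater than 3

parity : ∀ n → ∃ λ h → n ≡ h ℕ.+ h ⊎ n ≡ suc (h ℕ.+ h)
parity zero = 0 , inj₁ ≡.refl
parity (suc n) with parity n
... | h , inj₁ e = h , inj₂ (≡.cong suc e)
... | h , inj₂ e = suc h , inj₁ (≡.cong suc (≡.trans e (≡.sym (ℕP.+-suc h h))))

prime-half : ∀ {p n} → Prime p → 3 ℕ.< p → p ≡ suc n → ∃ λ h → n ≡ h ℕ.+ h
prime-half {n = n} pp 3<p ≡.refl with parity n
... | h , inj₁ e = h , e
... | h , inj₂ e with prime⇒irreducible pp (ℕD.divides (suc h) (≡.trans (≡.cong suc e) (lem h)))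
  where
  lem : ∀ h → suc (suc (h ℕ.+ h)) ≡ suc h ℕ.* 2
  lem = ℕSolver.solve-∀
... | inj₁ ()
... | inj₂ 2≡p = ⊥-elim (ℕP.<⇒≱ 3<p (≡.subst (ℕ._≤ 3) 2≡p (s≤s (s≤s z≤n))))

-- Since p - 1 is even, p > 3 improves to the bound p - 1 ≥ 4 on which the valuation estimates rest.
double-≥4 : ∀ h → 3 ℕ.≤ h ℕ.+ h → 4 ℕ.≤ h ℕ.+ h
double-≥4 (suc (suc h)) _ = s≤s (s≤s (≡.subst (2 ℕ.≤_) (≡.sym (ℕP.+-suc h (suc h))) (s≤s (≡.subst (1 ℕ.≤_) (≡.sym (ℕP.+-suc h h)) (s≤s z≤n)))))
double-≥4 (suc zero) (s≤s (s≤s ()))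

formula : ∀ m (pp : Prime (suc (suc m))) → 3 ℕ.< suc (suc m) → ∀ l → l ℕ.< suc (suc m) → ¬ l ≡ 0 → _≈Q_ (suc (suc m)) (LHS (suc (suc m)) l) (RHS (suc (suc m)) l)
formula m pp 3<p l l<p l≢0 k = Total.divisible m pp (proj₁ half) (proj₂ half) k (gaussRing (suc m) pp (proj₁ half) (proj₂ half) 4≤n k) l p∤3l p∤6l (proj₂ (proj₂ (nonempty m (ℕP.≤-pred (ℕP.≤-pred 3<p)))))
  where
  open PrimeMod (suc m) pp
  half : ∃ λ h → suc m ≡ h ℕ.+ h
  half = prime-half pp 3<p ≡.refl
  4≤n : 4 ℕ.≤ suc m
  4≤n = ≡.subst (4 ℕ.≤_) (≡.sym (proj₂ half)) (double-≥4 (proj₁ half) (≡.subst (3 ℕ.≤_) (proj₂ half) (ℕP.≤-pred 3<p)))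
  -- Here p > 3 serves to make the coefficient 3 of the curve a unit.
  p∤3l : ¬ + (3 ℕ.* l) ≅ + 0 [mod suc (suc m) ]
  p∤3l = ≡.subst (λ z → ¬ z ≅ + 0 [mod suc (suc m) ]) (≡.sym (ℤP.pos-* 3 l)) (∤-* (∤-small (s≤s z≤n) 3<p) (∤-small (ℕP.n≢0⇒n>0 l≢0) l<p))
  p∤6l : ¬ + (6 ℕ.* l) ≅ + 0 [mod suc (suc m) ]
  p∤6l = ≡.subst (λ z → ¬ z ≅ + 0 [mod suc (suc m) ]) (≡.sym (≡.trans (≡.cong +_ (lem l)) (ℤP.pos-* 2 (3 ℕ.* l)))) (∤-* (∤-small (s≤s z≤n) (ℕP.<-trans (s≤s (s≤s (s≤s z≤n))) 3<p)) p∤3l)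
    where
    lem : ∀ l → 6 ℕ.* l ≡ 2 ℕ.* (3 ℕ.* l)
    lem = ℕSolver.solve-∀
  nonempty : ∀ m → 1 ℕ.< m → ∃ λ x → ∃ λ xs → List.map suc (List.upTo m) ≡ x ∷ xs
  nonempty (suc m) _ = _ , _ , ≡.refl

theorem1p2 : (p : ℕ) → Prime p → 3 < p →
    (l : ℕ) → l < p → ¬ (l ≡ 0) →
    ¬ (toFp p (+ (4 Data.Nat.* l)) ≡ toFp p (+ 9)) →
    _≈Q_ p (LHS p l) (RHS p l)
theorem1p2 (suc (suc m)) pp 3<p l l<p l≢0 _ = formula m pp 3<p l l<p l≢0
theorem1p2 (suc zero) pp (s≤s ())
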